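{- For all positive integers $\Delta$ and $k$ there exists a constant $C_{\Delta,k}$ such that the following holds. For any tree $T$ with maximum degree at most $\Delta$ and any positive integers $m_1\leq m_2\leq\dots\leq m_k$ with $|T|\geq C_{\Delta,k}\, m_k\log^4 m_k$, the tree $T$ is $K_{m_1,m_2,\dots,m_k}$-good, i.e. $R(T,K_{m_1,\dots,m_k})=(|T|-1)(k-1)+m_1$.
   Context: $K_{m_1,\dots,m_k}$ denotes the complete $k$-partite graph with parts of sizes $m_1,\dots,m_k$. For graphs $G,H$, the Ramsey number $R(G,H)$ is the smallest $N$ such that every red-blue coloring of the edges of $K_N$ contains a red copy of $G$ or a blue copy of $H$. A connected graph $G$ is $H$-good if $R(G,H)=(|G|-1)(\chi(H)-1)+\sigma(H)$, where $\chi(H)$ is the chromatic number and $\sigma(H)$ is the smallest possible size of a color class in a proper $\chi(H)$-coloring of $H$. -}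

module Defs where

open import Data.Nat using (ℕ; zero; suc; _+_; _*_; _∸_; _^_; _≤_)
open import Data.Nat.Logarithm using (⌊log₂_⌋)
open import Data.Bool using (Bool; true; false)
open import Data.Fin using (Fin; fromℕ) renaming (_≤_ to _≤ᶠ_)
open import Data.List using (List; []; _∷_; _∷ʳ_; length; filterᵇ; allFin)
open import Data.List.Relation.Unary.Linked using (Linked)
open import Data.List.Relation.Unary.Unique.Propositional using (Unique)
open import Data.Product using (Σ; _×_; proj₁)
open import Data.Sum using (_⊎_)
open import Relation.Binary.PropositionalEquality using (_≡_; _≢_)
open import Relation.Nullary using (¬_)
open import Function.Definitions using (Injective)

record SimpleGraph (n : ℕ) : Set where
  field
    adj    : Fin n → Fin n → Bool
    sym    : ∀ u v → adj u v ≡ adj v u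
    irrefl : ∀ v → adj v v ≡ false

module _ {n : ℕ} (G : SimpleGraph n) where
  open SimpleGraph G

  Adj : Fin n → Fin n → Set
  Adj u v = adj u v ≡ true

  data Walk : Fin n → Fin n → Set where
    here : ∀ {u} → Walk u u
    step : ∀ {u v w} → Adj u v → Walk v w → Walk u w

  Connected : Set
  Connected = ∀ u v → Walk u v

  HasCycle : Set
  HasCycle = Σ (Fin n) λ x → Σ (List (Fin n)) λ ys → Σ (Fin n) λ y →
    1 ≤ length ys × Unique (x ∷ (ys ∷ʳ y)) × Linked Adj (x ∷ (ys ∷ʳ y)) × Adj y x

  Acyclic : Set
  Acyclic = ¬ HasCycle

  IsTree : Set
  IsTree = 1 ≤ n × Connected × Acyclic

  degree : Fin n → ℕ
  degree v = length (filterᵇ (adj v) (allFin n))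

  MaxDegreeAtMost : ℕ → Set
  MaxDegreeAtMost Δ = ∀ v → degree v ≤ Δ

-- red/blue colourings of the edges of K_N: true = red, false = blue.
-- Only values at u ≢ v matter; colourings are required to be symmetric.
Coloring : ℕ → Set
Coloring N = Fin N → Fin N → Bool

SymmetricColoring : ∀ {N} → Coloring N → Set
SymmetricColoring c = ∀ u v → c u v ≡ c v u

MonoCopy : ∀ {N} (V : Set) (A : V → V → Set) → Coloring N → Bool → Set
MonoCopy {N} V A c b = Σ (V → Fin N) λ f → Injective _≡_ _≡_ f × (∀ x y → A x y → c (f x) (f y) ≡ b)

Arrows : ℕ → (V : Set) (A : V → V → Set) (W : Set) (B : W → W → Set) → Set
Arrows N V A W B = (c : Coloring N) → SymmetricColoring c → MonoCopy V A c true ⊎ MonoCopy W B c false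

IsRamseyNumber : (V : Set) (A : V → V → Set) (W : Set) (B : W → W → Set) → ℕ → Set
IsRamseyNumber V A W B r = Arrows r V A W B × (∀ N → Arrows N V A W B → r ≤ N)

KVert : (k : ℕ) → (Fin k → ℕ) → Set
KVert k m = Σ (Fin k) λ i → Fin (m i)

KAdj : (k : ℕ) (m : Fin k → ℕ) → KVert k m → KVert k m → Set
KAdj k m x y = proj₁ x ≢ proj₁ y

{-# OPTIONS --safe #-}

-- The lower bound is given by disjoint red cliques on |T| - 1 vertices. For the upper bound suppose that there is no red T;
-- by induction on k, every set of (|T| - 1)k + a vertices with a ≤ m contains k + 1 pairwise blue sets, one of size a and k
-- of size m. A maximal set with few red neighbours is small, for otherwise the induction hypothesis applies outside its
-- neighbourhood; removing it leaves a red graph in which small sets expand, so that trees grow by the Friedman–Pippenger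
-- method. If T has many leaves, then T without its leaves is grown and the leaves are added by Hall's theorem.
--
-- If T has few leaves, then it has many long bare paths. Here the graph splits into k nearly disjoint pieces in which any two
-- large sets are joined by a red edge, and by counting, one of the pieces together with the centres of large stars into it has
-- at least |T| vertices. Such a piece contains T even if it has no vertex to spare: the branch vertices are grown first, and
-- the long paths are routed through a Beneš network built from red paths. As the network realises every permutation,
-- the vertices left over at the end can be matched arbitrarily to both ends and still be absorbed by the long paths.

module Submission where

open import Defs
open import Data.Nat using (ℕ; zero; suc; _+_; _*_; _∸_; _^_; _≤_; _<_; z≤n; s≤s; _≤?_; _<?_; >-nonZero)
open import Data.Nat.Properties renaming (_≟_ to _≟ℕ_)
open import Data.Nat.DivMod using (_/_; _%_; m≡m%n+[m/n]*n; m%n<n; m<n*o⇒m/o<n)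
open import Data.Nat.Logarithm using (⌊log₂_⌋; ⌊log₂⌋-mono-≤; ⌊log₂[2^n]⌋≡n)
open import Data.Nat.Tactic.RingSolver using (solve; solve-∀)
open import Data.Bool using (Bool; true; false; _∧_; _∨_; not; if_then_else_; _xor_)
open import Data.Bool.Properties using () renaming (_≟_ to _≟ᵇ_)
open import Data.Fin using (Fin; toℕ; fromℕ; fromℕ<; punchOut; _↑ˡ_; _↑ʳ_; splitAt) renaming (zero to fzero; suc to fsuc; _≤_ to _≤ᶠ_)
open import Data.Fin.Properties using (_≟_; toℕ-injective; toℕ<n; toℕ-fromℕ; toℕ-fromℕ<; splitAt-↑ˡ; splitAt-↑ʳ; all?; injective⇒≤; any?; punchOut-injective)
open import Data.List using (List; []; _∷_; _++_; _∷ʳ_; length; map; replicate; filterᵇ; allFin; reverse; zip)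
open import Data.List.Properties using (length-++; length-map; ++-assoc; ++-identityʳ; map-++; length-reverse; unfold-reverse)
open import Data.List.Membership.Propositional using () renaming (_∈_ to _∈ˡ_; _∉_ to _∉ˡ_)
open import Data.List.Membership.Propositional.Properties using (∈-++⁺ˡ; ∈-++⁺ʳ; ∈-++⁻; ∈-map⁺; ∈-map⁻; ∈-allFin)
open import Data.List.Relation.Unary.Any using (here; there)
open import Data.List.Relation.Unary.All using (All; []; _∷_) renaming (lookup to All-lookup; map to All-map; tabulate to All-tabulate)
open import Data.List.Relation.Unary.All.Properties using () renaming (++⁺ to All-++⁺; ++⁻ˡ to All-++⁻ˡ; ++⁻ʳ to All-++⁻ʳ)
open import Data.List.Relation.Unary.AllPairs using ([]; _∷_)
open import Data.List.Relation.Unary.Linked using (Linked; []; [-]; _∷_)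
open import Data.List.Relation.Unary.Unique.Propositional using (Unique)
open import Data.List.Relation.Unary.Unique.Propositional.Properties using () renaming (allFin⁺ to Unique-allFin)
open import Data.List.Relation.Binary.Pointwise using (Pointwise; []; _∷_)
open import Data.List.Relation.Binary.Permutation.Propositional using (_↭_; ↭-refl; ↭-sym; ↭-trans; ↭-prep; ↭-swap; ↭-reflexive)
open import Data.List.Relation.Binary.Permutation.Propositional.Properties using (∈-resp-↭; All-resp-↭; ↭-length; ++⁺; ++⁺ˡ; ++⁺ʳ; ++-comm; shift; ↭-reverse; ++-commutativeMonoid)
open import Data.Product using (Σ; _×_; _,_; proj₁; proj₂)
open import Data.Sum using (_⊎_; inj₁; inj₂)
open import Data.Empty using (⊥; ⊥-elim)
open import Data.Unit using (⊤; tt)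
open import Function using (_∘_; id; case_of_)
open import Function.Definitions using (Injective)
open import Relation.Nullary using (¬_; Dec; yes; no)
open import Relation.Nullary.Decidable using (isYes; map′; _×-dec_; ¬?; _→-dec_)
open import Relation.Binary.PropositionalEquality using (_≡_; _≢_; refl; sym; trans; cong; cong₂; subst)
import Algebra.Solver.CommutativeMonoid

-- The number of vertices is exact, and this shapes everything: an extension argument needs a
-- surplus of order m_k and so cannot place the last vertices of T. If T has many leaves, these are
-- the surplus. This takes Q long paths whose routing is decided last, with lengths and total vertex
-- set independent of the decision. A connecting path has about 2 log M vertices, M of order m_k; a
-- switch zigzags over two such paths and the connections between them, so its wires have order
-- log^2 m_k, and a route through 2q layers of switches has order log^3 m_k, estimated by log^4. In
-- the case of few leaves the sets put aside lose vertices of order m_k, which does no harm while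
-- the pieces are being found; only the final count, of the pieces and the star centres, has to be
-- exact. For m_k = 1 the logarithm is 0 and gives no lower bound on |T|; that case is Chvátal's
-- theorem.

infixl 6 _⊞_
_⊞_ : ∀ {a b c d} → a ≤ b → c ≤ d → a + c ≤ b + d
_⊞_ = +-mono-≤

infixr 7 _·_
_·_ : ∀ k {a b} → a ≤ b → k * a ≤ k * b
k · h = *-monoʳ-≤ k h

≡⇒≥ : ∀ {a b} → a ≡ b → b ≤ a
≡⇒≥ e = ≤-reflexive (sym e)

-- An inequality is certified by a combination X ≤ Y of hypotheses, a slack s and a semiring identity.
lin : ∀ {X Y a b} s → X ≤ Y → a + Y + s ≡ b + X → a ≤ b
lin {X} {Y} {a} {b} s h e = +-cancelʳ-≤ X a b (begin
  a + X      ≤⟨ +-monoʳ-≤ a h ⟩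
  a + Y      ≤⟨ m≤m+n (a + Y) s ⟩
  a + Y + s  ≡⟨ e ⟩
  b + X      ∎)
  where open ≤-Reasoning

-- Classical reasoning in the double-negation monad

NN : Set → Set
NN A = ¬ ¬ A

pure : ∀ {A} → A → NN A
pure a k = k a

infixl 1 _>>=_
_>>=_ : ∀ {A B} → NN A → (A → NN B) → NN B
(m >>= f) k = m λ a → f a k

em : ∀ P → NN (P ⊎ ¬ P)
em P k = k (inj₂ λ p → k (inj₁ p))

counterexample : ∀ {A : Set} {P : A → Set} → (∀ x → NN (P x) → P x) → ¬ (∀ x → P x) → NN (Σ A λ x → ¬ P x)
counterexample st h k = h λ x → st x λ np → k (x , np)

≤-stable : ∀ {a b} → NN (a ≤ b) → a ≤ b
≤-stable {a} {b} h with a ≤? b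
... | yes p = p
... | no np = ⊥-elim (h np)

-- Finite sums

∑ : ∀ {n} → (Fin n → ℕ) → ℕ
∑ {zero} f = 0
∑ {suc n} f = f fzero + ∑ (f ∘ fsuc)

∑-mono : ∀ {n} {f g : Fin n → ℕ} → (∀ i → f i ≤ g i) → ∑ f ≤ ∑ g
∑-mono {zero} h = z≤n
∑-mono {suc n} h = h fzero ⊞ ∑-mono (h ∘ fsuc)

∑-cong : ∀ {n} {f g : Fin n → ℕ} → (∀ i → f i ≡ g i) → ∑ f ≡ ∑ g
∑-cong {zero} h = refl
∑-cong {suc n} h = cong₂ _+_ (h fzero) (∑-cong (h ∘ fsuc))

+-interchange : ∀ a b c d → (a + b) + (c + d) ≡ (a + c) + (b + d)
+-interchange = solve-∀

∑-+ : ∀ {n} (f g : Fin n → ℕ) → ∑ (λ i → f i + g i) ≡ ∑ f + ∑ g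
∑-+ {zero} f g = refl
∑-+ {suc n} f g = trans (cong (f fzero + g fzero +_) (∑-+ (f ∘ fsuc) (g ∘ fsuc))) (+-interchange (f fzero) _ _ _)

∑-* : ∀ {n} k (f : Fin n → ℕ) → ∑ (λ i → k * f i) ≡ k * ∑ f
∑-* {zero} k f = sym (*-zeroʳ k)
∑-* {suc n} k f = trans (cong (k * f fzero +_) (∑-* k (f ∘ fsuc))) (sym (*-distribˡ-+ k (f fzero) _))

∑-const : ∀ n k → ∑ {n} (λ _ → k) ≡ n * k
∑-const zero k = refl
∑-const (suc n) k = cong (k +_) (∑-const n k)

∑-swap : ∀ {m n} (f : Fin m → Fin n → ℕ) → ∑ (λ i → ∑ (f i)) ≡ ∑ (λ j → ∑ (λ i → f i j))
∑-swap {zero} {n} f = sym (trans (∑-const n 0) (*-zeroʳ n))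
∑-swap {suc m} f = trans (cong (∑ (f fzero) +_) (∑-swap (f ∘ fsuc))) (sym (∑-+ (f fzero) _))

term≤∑ : ∀ {n} (f : Fin n → ℕ) i → f i ≤ ∑ f
term≤∑ f fzero = m≤m+n _ _
term≤∑ f (fsuc i) = ≤-trans (term≤∑ (f ∘ fsuc) i) (m≤n+m _ _)

∑-positive : ∀ {n} {f : Fin n → ℕ} → 1 ≤ ∑ f → Σ (Fin n) λ i → 1 ≤ f i
∑-positive {suc n} {f} h with f fzero in eq
... | suc _ = fzero , subst (1 ≤_) (sym eq) (s≤s z≤n)
... | zero with ∑-positive {n} h
...   | i , p = fsuc i , p

∑-point : ∀ {n} {f g : Fin n → ℕ} x → (∀ i → i ≢ x → f i ≤ g i) → f x ≤ suc (g x) → ∑ f ≤ suc (∑ g)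
∑-point {suc n} fzero h p = ≤-trans (p ⊞ ∑-mono (λ i → h (fsuc i) λ ())) ≤-refl
∑-point {suc n} {f} {g} (fsuc x) h p = ≤-trans (h fzero (λ ()) ⊞ ∑-point x (λ i ne → h (fsuc i) λ { refl → ne refl }) p) (≤-reflexive (+-suc (g fzero) _))

infixr 8 _⊙_
_⊙_ : Bool → ℕ → ℕ
true ⊙ n = n
false ⊙ n = 0

⊙-≤ : ∀ b n → b ⊙ n ≤ n
⊙-≤ true n = ≤-refl
⊙-≤ false n = z≤n

-- Sets of vertices are Boolean functions on Fin N.

𝕊 : ℕ → Set
𝕊 N = Fin N → Bool

true≢false : ∀ {b : Bool} {A : Set} → b ≡ true → b ≡ false → A
true≢false refl ()

bool? : (b : Bool) → b ≡ true ⊎ b ≡ false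
bool? true = inj₁ refl
bool? false = inj₂ refl

∧⁺ : ∀ {a b} → a ≡ true → b ≡ true → a ∧ b ≡ true
∧⁺ refl refl = refl
∧⁻ : ∀ {a b} → a ∧ b ≡ true → a ≡ true × b ≡ true
∧⁻ {true} {true} _ = refl , refl
∨ˡ : ∀ {a b} → a ≡ true → a ∨ b ≡ true
∨ˡ refl = refl
∨ʳ : ∀ {a b} → b ≡ true → a ∨ b ≡ true
∨ʳ {true} _ = refl
∨ʳ {false} p = p
∨⁻ : ∀ {a b} → a ∨ b ≡ true → a ≡ true ⊎ b ≡ true
∨⁻ {true} _ = inj₁ refl
∨⁻ {false} p = inj₂ p
∨f : ∀ {a b} → a ≡ false → b ≡ false → a ∨ b ≡ false
∨f refl refl = refl
∨f⁻ : ∀ {a b} → a ∨ b ≡ false → a ≡ false × b ≡ false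
∨f⁻ {false} {false} _ = refl , refl
not⁺ : ∀ {a} → a ≡ false → not a ≡ true
not⁺ refl = refl
not⁻ : ∀ {a} → not a ≡ true → a ≡ false
not⁻ {false} _ = refl

module _ {N : ℕ} where

  infix 4 _∈_ _∉_ _⊆_
  infixl 6 _∪_ _∖_
  infixl 7 _∩_

  _∈_ _∉_ : Fin N → 𝕊 N → Set
  v ∈ X = X v ≡ true
  v ∉ X = X v ≡ false

  _⊆_ : 𝕊 N → 𝕊 N → Set
  X ⊆ Y = ∀ v → v ∈ X → v ∈ Y

  ∅ full : 𝕊 N
  ∅ v = false
  full v = true

  _∪_ _∩_ _∖_ : 𝕊 N → 𝕊 N → 𝕊 N
  (X ∪ Y) v = X v ∨ Y v
  (X ∩ Y) v = X v ∧ Y v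
  (X ∖ Y) v = X v ∧ not (Y v)

  ｛_｝ : Fin N → 𝕊 N
  ｛ x ｝ v = isYes (v ≟ x)

  sing-refl : ∀ x → x ∈ ｛ x ｝
  sing-refl x with x ≟ x
  ... | yes _ = refl
  ... | no ne = ⊥-elim (ne refl)

  sing⁻ : ∀ {v x} → v ∈ ｛ x ｝ → v ≡ x
  sing⁻ {v} {x} p with v ≟ x
  ... | yes e = e

  sing-∉ : ∀ {v x} → v ≢ x → v ∉ ｛ x ｝
  sing-∉ {v} {x} ne with v ≟ x
  ... | yes e = ⊥-elim (ne e)
  ... | no _ = refl

  opaque
    wt : 𝕊 N → (Fin N → ℕ) → ℕ
    wt X r = ∑ λ v → X v ⊙ r v

  card : 𝕊 N → ℕ
  card X = wt X λ _ → 1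

  opaque
    unfolding wt

    wt-∑ : ∀ X r → wt X r ≡ ∑ (λ v → X v ⊙ r v)
    wt-∑ X r = refl

    card-mono : ∀ {X Y} → X ⊆ Y → card X ≤ card Y
    card-mono {X} {Y} h = ∑-mono λ v → go (X v) (Y v) (h v)
      where
      go : ∀ a b → (a ≡ true → b ≡ true) → a ⊙ 1 ≤ b ⊙ 1
      go false b h = z≤n
      go true b h rewrite h refl = ≤-refl

    card-≗ : ∀ {X Y} → (∀ v → X v ≡ Y v) → card X ≡ card Y
    card-≗ h = ∑-cong λ v → cong (_⊙ 1) (h v)

    card-∪ : ∀ X Y → card (X ∪ Y) ≤ card X + card Y
    card-∪ X Y = ≤-trans (∑-mono λ v → go (X v) (Y v)) (≤-reflexive (∑-+ (λ v → X v ⊙ 1) _))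
      where
      go : ∀ a b → (a ∨ b) ⊙ 1 ≤ a ⊙ 1 + b ⊙ 1
      go true b = s≤s z≤n
      go false b = ≤-refl

    card-cover : ∀ {X} Y Z → (∀ v → v ∈ X → v ∈ Y ⊎ v ∈ Z) → card X ≤ card Y + card Z
    card-cover Y Z h = ≤-trans (card-mono λ v p → case h v p of λ { (inj₁ q) → ∨ˡ q ; (inj₂ q) → ∨ʳ q }) (card-∪ Y Z)

    card-disjoint : ∀ {X} Y Z → Y ⊆ X → Z ⊆ X → (∀ v → v ∈ Y → v ∈ Z → ⊥) → card Y + card Z ≤ card X
    card-disjoint {X} Y Z p q d = subst (_≤ _) (∑-+ (λ v → Y v ⊙ 1) _) (∑-mono λ v → go (X v) (Y v) (Z v) (p v) (q v) (d v))
      where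
      go : ∀ a b c → (b ≡ true → a ≡ true) → (c ≡ true → a ≡ true) → (b ≡ true → c ≡ true → ⊥) → b ⊙ 1 + c ⊙ 1 ≤ a ⊙ 1
      go a true true p q d = ⊥-elim (d refl refl)
      go a true false p q d rewrite p refl = ≤-refl
      go a false true p q d rewrite q refl = ≤-refl
      go a false false p q d = z≤n

    card-∅ : card ∅ ≡ 0
    card-∅ = trans (∑-const N 0) (*-zeroʳ N)

    card≤N : ∀ X → card X ≤ N
    card≤N X = ≤-trans (∑-mono λ v → ⊙-≤ (X v) 1) (≤-reflexive (trans (∑-const N 1) (*-identityʳ N)))

    card-full : card full ≡ N
    card-full = trans (∑-const N 1) (*-identityʳ N)

    card-sing : ∀ x → card ｛ x ｝ ≤ 1
    card-sing x = subst (λ z → card ｛ x ｝ ≤ suc z) card-∅ (∑-point x (λ i ne → ≤-reflexive (cong (_⊙ 1) (sing-∉ ne))) (⊙-≤ _ 1))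

    card-positive : ∀ {X} → 1 ≤ card X → Σ (Fin N) (_∈ X)
    card-positive {X} h with ∑-positive h
    ... | v , p with X v in eq
    ...   | true = v , eq

    ∈⇒card : ∀ {X x} → x ∈ X → 1 ≤ card X
    ∈⇒card {X} {x} p = subst (λ b → b ⊙ 1 ≤ card X) p (term≤∑ (λ v → X v ⊙ 1) x)

    card-insert : ∀ X x → card (X ∪ ｛ x ｝) ≤ suc (card X)
    card-insert X x = ≤-trans (card-∪ X ｛ x ｝) (≤-trans (+-monoʳ-≤ (card X) (card-sing x)) (≤-reflexive (+-comm (card X) 1)))

    card-insert-≥ : ∀ {X x} → x ∉ X → suc (card X) ≤ card (X ∪ ｛ x ｝)
    card-insert-≥ {X} {x} p = ≤-trans (+-monoˡ-≤ (card X) (∈⇒card (sing-refl x)))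
      (card-disjoint ｛ x ｝ X (λ v → ∨ʳ) (λ v → ∨ˡ) λ v q r → true≢false (subst (_∈ X) (sing⁻ q) r) p)

    wt-mono : ∀ X {r s} → (∀ v → r v ≤ s v) → wt X r ≤ wt X s
    wt-mono X h = ∑-mono λ v → go (X v) (h v)
      where
      go : ∀ b {m n} → m ≤ n → b ⊙ m ≤ b ⊙ n
      go true p = p
      go false p = z≤n

    wt-const : ∀ X k → wt X (λ _ → k) ≡ k * card X
    wt-const X k = trans (∑-cong λ v → go (X v)) (∑-* k λ v → X v ⊙ 1)
      where
      go : ∀ b → b ⊙ k ≡ k * (b ⊙ 1)
      go true = sym (*-identityʳ k)
      go false = sym (*-zeroʳ k)

    wt-modular : ∀ X Y r → wt (X ∪ Y) r + wt (X ∩ Y) r ≡ wt X r + wt Y r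
    wt-modular X Y r = trans (sym (∑-+ (λ v → (X v ∨ Y v) ⊙ r v) _)) (trans (∑-cong λ v → go (X v) (Y v)) (∑-+ (λ v → X v ⊙ r v) _))
      where
      go : ∀ a b {n} → (a ∨ b) ⊙ n + (a ∧ b) ⊙ n ≡ a ⊙ n + b ⊙ n
      go true true = refl
      go true false = refl
      go false b {n} = +-identityʳ _

  subset-of-size : ∀ X k → k ≤ card X → Σ (𝕊 N) λ Y → Y ⊆ X × card Y ≡ k
  subset-of-size X k h with m≤n⇒∃[o]m+o≡n h
  ... | o , e = shrink o X (trans (sym e) (+-comm k o))
    where
    shrink : ∀ o X → card X ≡ o + k → Σ (𝕊 N) λ Y → Y ⊆ X × card Y ≡ k
    shrink zero X e = X , (λ v p → p) , e
    shrink (suc o) X e with card-positive {X} (subst (1 ≤_) (sym e) (s≤s z≤n))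
    ... | x , x∈ with shrink o (X ∖ ｛ x ｝) (≤-antisym
                       (≤-pred (subst (suc (card (X ∖ ｛ x ｝)) ≤_) e (≤-trans (+-monoˡ-≤ _ (∈⇒card (sing-refl x)))
                          (card-disjoint ｛ x ｝ (X ∖ ｛ x ｝) (λ v p → subst (_∈ X) (sym (sing⁻ p)) x∈) (λ v → proj₁ ∘ ∧⁻) λ v p q → true≢false p (not⁻ (proj₂ (∧⁻ {X v} q)))))))
                       (≤-pred (subst (_≤ suc (card (X ∖ ｛ x ｝))) e (≤-trans (card-cover (X ∖ ｛ x ｝) ｛ x ｝ λ v p → case bool? (｛ x ｝ v) of λ { (inj₁ q) → inj₂ q ; (inj₂ q) → inj₁ (∧⁺ p (not⁺ q)) })
                          (≤-trans (+-monoʳ-≤ _ (card-sing x)) (≤-reflexive (+-comm _ 1)))))))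
    ...   | Y , s , c = Y , (λ v p → proj₁ (∧⁻ (s v p))) , c

  -- A witness can be replaced by a larger one at most N times; `f` bounds the replacements that are
  -- left.
  maximal : ∀ (P : 𝕊 N → Set) X₀ → P X₀ → NN (Σ (𝕊 N) λ X → P X × ∀ Y → P Y → card Y ≤ card X)
  maximal P X₀ p = go N X₀ p (m≤n+m N _)
    where
    go : ∀ f X → P X → N ≤ card X + f → NN (Σ (𝕊 N) λ X → P X × ∀ Y → P Y → card Y ≤ card X)
    go zero X p h = pure (X , p , λ Y _ → ≤-trans (card≤N Y) (subst (N ≤_) (+-identityʳ _) h))
    go (suc f) X p h = em (Σ (𝕊 N) λ Y → P Y × card X < card Y) >>= λ
      { (inj₁ (Y , q , lt)) → go f Y q (≤-trans h (≤-trans (≤-reflexive (+-suc (card X) f)) (+-monoˡ-≤ f lt)))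
      ; (inj₂ ne) → pure (X , p , λ Y q → ≮⇒≥ λ lt → ne (Y , q , lt)) }

-- Lists of vertices as sets and as multisets

module _ {N : ℕ} where

  ⟪_⟫ : List (Fin N) → 𝕊 N
  ⟪ [] ⟫ v = false
  ⟪ x ∷ xs ⟫ v = isYes (v ≟ x) ∨ ⟪ xs ⟫ v

  ∈⟪⟫⁺ : ∀ {v} {xs : List (Fin N)} → v ∈ˡ xs → v ∈ ⟪ xs ⟫
  ∈⟪⟫⁺ {v} (here refl) = ∨ˡ (sing-refl v)
  ∈⟪⟫⁺ (there p) = ∨ʳ (∈⟪⟫⁺ p)

  ∈⟪⟫⁻ : ∀ {v} (xs : List (Fin N)) → v ∈ ⟪ xs ⟫ → v ∈ˡ xs
  ∈⟪⟫⁻ {v} (x ∷ xs) p with ∨⁻ {isYes (v ≟ x)} p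
  ... | inj₁ q = here (sing⁻ q)
  ... | inj₂ q = there (∈⟪⟫⁻ xs q)

  ∉⟪⟫⁺ : ∀ {v} {xs : List (Fin N)} → v ∉ˡ xs → v ∉ ⟪ xs ⟫
  ∉⟪⟫⁺ {v} {xs} h with ⟪ xs ⟫ v in eq
  ... | false = refl
  ... | true = ⊥-elim (h (∈⟪⟫⁻ xs eq))

  ∉⟪⟫⁻ : ∀ {v} {xs : List (Fin N)} → v ∉ ⟪ xs ⟫ → v ∉ˡ xs
  ∉⟪⟫⁻ h p = true≢false (∈⟪⟫⁺ p) h

  ⟪⟫-↭ : ∀ {xs ys : List (Fin N)} → xs ↭ ys → ∀ v → ⟪ xs ⟫ v ≡ ⟪ ys ⟫ v
  ⟪⟫-↭ {xs} {ys} p v with ⟪ xs ⟫ v in e₁ | ⟪ ys ⟫ v in e₂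
  ... | true | true = refl
  ... | false | false = refl
  ... | true | false = ⊥-elim (∉⟪⟫⁻ e₂ (∈-resp-↭ p (∈⟪⟫⁻ xs e₁)))
  ... | false | true = ⊥-elim (∉⟪⟫⁻ e₁ (∈-resp-↭ (↭-sym p) (∈⟪⟫⁻ ys e₂)))

  card⟪⟫≤ : ∀ (xs : List (Fin N)) → card ⟪ xs ⟫ ≤ length xs
  card⟪⟫≤ [] = ≤-reflexive card-∅
  card⟪⟫≤ (x ∷ xs) = ≤-trans (card-∪ ｛ x ｝ ⟪ xs ⟫) (card-sing x ⊞ card⟪⟫≤ xs)

  card⟪⟫≥ : ∀ {xs : List (Fin N)} → Unique xs → length xs ≤ card ⟪ xs ⟫
  card⟪⟫≥ [] = z≤n
  card⟪⟫≥ {x ∷ xs} (h ∷ u) = ≤-trans (∈⇒card (sing-refl x) ⊞ card⟪⟫≥ u)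
    (card-disjoint ｛ x ｝ ⟪ xs ⟫ (λ v → ∨ˡ) (λ v → ∨ʳ) λ v p q → All-lookup h (∈⟪⟫⁻ xs q) (sym (sing⁻ p)))

anyF : ∀ {n} → (Fin n → Bool) → Bool
anyF {zero} f = false
anyF {suc n} f = f fzero ∨ anyF (f ∘ fsuc)

any⁺ : ∀ {n} (f : Fin n → Bool) i → f i ≡ true → anyF f ≡ true
any⁺ f fzero p = ∨ˡ p
any⁺ f (fsuc i) p = ∨ʳ (any⁺ (f ∘ fsuc) i p)

any⁻ : ∀ {n} (f : Fin n → Bool) → anyF f ≡ true → Σ (Fin n) λ i → f i ≡ true
any⁻ {suc n} f p with ∨⁻ {f fzero} p
... | inj₁ q = fzero , q
... | inj₂ q with any⁻ (f ∘ fsuc) q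
...   | i , r = fsuc i , r

∑-strict : ∀ {n} {f g : Fin n → ℕ} x → (∀ i → f i ≤ g i) → f x < g x → ∑ f < ∑ g
∑-strict fzero h p = p ⊞ ∑-mono (h ∘ fsuc)
∑-strict {suc n} {f} (fsuc x) h p = ≤-trans (≤-reflexive (sym (+-suc (f fzero) _))) (h fzero ⊞ ∑-strict x (h ∘ fsuc) p)

cnt-↭-comm₃ : ∀ a b c → a + (b + c) ≡ b + (a + c)
cnt-↭-comm₃ = solve-∀

module _ {N : ℕ} where

  infixl 6 _⊖_
  _⊖_ : (Fin N → ℕ) → Fin N → Fin N → ℕ
  (r ⊖ x) v = if ｛ x ｝ v then r v ∸ 1 else r v

  ⊖-same : ∀ r x → (r ⊖ x) x ≡ r x ∸ 1
  ⊖-same r x rewrite sing-refl x = refl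

  ⊖-≤ : ∀ r x v → (r ⊖ x) v ≤ r v
  ⊖-≤ r x v with ｛ x ｝ v
  ... | true = m∸n≤m (r v) 1
  ... | false = ≤-refl

  cnt : Fin N → List (Fin N) → ℕ
  cnt v [] = 0
  cnt v (x ∷ xs) = ｛ x ｝ v ⊙ 1 + cnt v xs

  cnt-++ : ∀ v xs ys → cnt v (xs ++ ys) ≡ cnt v xs + cnt v ys
  cnt-++ v [] ys = refl
  cnt-++ v (x ∷ xs) ys = trans (cong (｛ x ｝ v ⊙ 1 +_) (cnt-++ v xs ys)) (sym (+-assoc (｛ x ｝ v ⊙ 1) _ _))

  cnt-↭ : ∀ v {xs ys} → xs ↭ ys → cnt v xs ≡ cnt v ys
  cnt-↭ v _↭_.refl = refl
  cnt-↭ v (_↭_.prep x p) = cong (｛ x ｝ v ⊙ 1 +_) (cnt-↭ v p)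
  cnt-↭ v (_↭_.swap x y p) = trans (cong (λ z → ｛ x ｝ v ⊙ 1 + (｛ y ｝ v ⊙ 1 + z)) (cnt-↭ v p)) (cnt-↭-comm₃ (｛ x ｝ v ⊙ 1) (｛ y ｝ v ⊙ 1) _)
  cnt-↭ v (_↭_.trans p q) = trans (cnt-↭ v p) (cnt-↭ v q)

  cnt-∉ : ∀ {v xs} → v ∉ˡ xs → cnt v xs ≡ 0
  cnt-∉ {v} {[]} h = refl
  cnt-∉ {v} {x ∷ xs} h rewrite sing-∉ {v = v} {x} (h ∘ here) = cnt-∉ (h ∘ there)

  cnt-replicate : ∀ v k x → cnt v (replicate k x) ≡ ｛ x ｝ v ⊙ k
  cnt-replicate v zero x with ｛ x ｝ v
  ... | true = refl
  ... | false = refl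
  cnt-replicate v (suc k) x rewrite cnt-replicate v k x with ｛ x ｝ v
  ... | true = refl
  ... | false = refl

  opaque
    unfolding wt

    wt-strict : ∀ {X : 𝕊 N} {r s} x → (∀ v → r v ≤ s v) → x ∈ X → r x < s x → wt X r < wt X s
    wt-strict {X} {r} {s} x h p lt = ∑-strict x (λ v → go (X v) (h v)) (subst (λ b → b ⊙ r x < b ⊙ s x) (sym p) lt)
      where
      go : ∀ b {m n} → m ≤ n → b ⊙ m ≤ b ⊙ n
      go true p = p
      go false p = z≤n

    wt-agree : ∀ {X : 𝕊 N} {r s} → (∀ v → v ∈ X → r v ≤ s v) → wt X r ≤ wt X s
    wt-agree {X} h = ∑-mono λ v → go (X v) (h v)
      where
      go : ∀ b {m n} → (b ≡ true → m ≤ n) → b ⊙ m ≤ b ⊙ n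
      go true p = p refl
      go false p = z≤n

    wt-set : ∀ {X Y : 𝕊 N} r → (∀ v → v ∈ X → 1 ≤ r v → v ∈ Y) → wt X r ≤ wt Y r
    wt-set {X} {Y} r h = ∑-mono λ v → go (X v) (Y v) (r v) (h v)
      where
      go : ∀ a b n → (a ≡ true → 1 ≤ n → b ≡ true) → a ⊙ n ≤ b ⊙ n
      go false b n h = z≤n
      go true b zero h = z≤n
      go true b (suc n) h rewrite h refl (s≤s z≤n) = ≤-refl

    wt-≤-suc : ∀ (X : 𝕊 N) {r s} x → (∀ v → v ≢ x → r v ≤ s v) → r x ≤ suc (s x) → wt X r ≤ suc (wt X s)
    wt-≤-suc X {r} {s} x h p = ∑-point x (λ v ne → go (X v) (h v ne)) (go′ (X x) p)
      where
      go : ∀ b {m n} → m ≤ n → b ⊙ m ≤ b ⊙ n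
      go true p = p
      go false p = z≤n
      go′ : ∀ b {m n} → m ≤ suc n → b ⊙ m ≤ suc (b ⊙ n)
      go′ true p = p
      go′ false p = z≤n

  wt-⊖ : ∀ {X : 𝕊 N} {r x} → x ∈ X → 1 ≤ r x → suc (wt X (r ⊖ x)) ≤ wt X r
  wt-⊖ {X} {r} {x} p q = wt-strict x (⊖-≤ r x) p (subst (_< r x) (sym (⊖-same r x)) (pred< q))
    where
    pred< : ∀ {n} → 1 ≤ n → n ∸ 1 < n
    pred< {suc n} _ = ≤-refl

-- The Friedman–Pippenger extension step for a bipartite (not necessarily symmetric) relation: sets with equality in the
-- demand condition are closed under unions and stay small, so they cannot block every neighbour of x.

critical-∪-cancel : ∀ {a b c d e f w x} → a + b ≤ c + d → e + f ≡ w + x → c ≤ w → d ≤ x → f ≤ b → a ≤ e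
critical-∪-cancel {a} {b} {c} {d} {e} {f} {w} {x} h1 h2 h3 h4 h5 = lin 0 (h1 ⊞ ≡⇒≥ h2 ⊞ h3 ⊞ h4 ⊞ h5) (solve (a List.∷ b List.∷ c List.∷ d List.∷ e List.∷ f List.∷ w List.∷ x List.∷ List.[]))

module Extension {N : ℕ} (adj : Fin N → Fin N → Bool) where

  opaque
    nb : 𝕊 N → 𝕊 N
    nb X v = anyF λ x → X x ∧ adj x v

    nb⁺ : ∀ {X x v} → x ∈ X → adj x v ≡ true → v ∈ nb X
    nb⁺ {X} {x} {v} p q = any⁺ (λ x → X x ∧ adj x v) x (∧⁺ p q)

    nb⁻ : ∀ {X v} → v ∈ nb X → Σ (Fin N) λ x → x ∈ X × adj x v ≡ true
    nb⁻ {X} {v} p with any⁻ (λ x → X x ∧ adj x v) p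
    ... | x , q = x , ∧⁻ q

  nb-mono : ∀ {X Y} → X ⊆ Y → nb X ⊆ nb Y
  nb-mono h v p with nb⁻ p
  ... | x , q , a = nb⁺ (h x q) a

  nb-∪ : ∀ {X Y} v → v ∈ nb (X ∪ Y) → v ∈ nb X ⊎ v ∈ nb Y
  nb-∪ {X} v p with nb⁻ p
  ... | x , q , a with ∨⁻ {X x} q
  ...   | inj₁ r = inj₁ (nb⁺ r a)
  ...   | inj₂ r = inj₂ (nb⁺ r a)

  ρ : 𝕊 N → 𝕊 N → ℕ
  ρ X S = card (nb X ∖ S)

  -- Hall's condition with demands `r`, for subsets of `U` with at most `l` vertices, when the
  -- vertices of `S` are already taken.
  Good : 𝕊 N → ℕ → 𝕊 N → (Fin N → ℕ) → Set
  Good U l S r = ∀ X → X ⊆ U → card X ≤ l → wt X r ≤ ρ X S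

  ρ-insert : ∀ X S y → ρ X S ≤ suc (ρ X (S ∪ ｛ y ｝))
  ρ-insert X S y = ≤-trans (card-cover (nb X ∖ (S ∪ ｛ y ｝)) ｛ y ｝ λ v p → case bool? (｛ y ｝ v) of λ
    { (inj₁ q) → inj₂ q
    ; (inj₂ q) → inj₁ (∧⁺ (proj₁ (∧⁻ p)) (not⁺ (∨f (not⁻ (proj₂ (∧⁻ {nb X v} p))) q))) })
    (≤-trans (+-monoʳ-≤ _ (card-sing y)) (≤-reflexive (+-comm _ 1)))

  ρ-avoid : ∀ {X S y} → y ∉ nb X → ρ X S ≤ ρ X (S ∪ ｛ y ｝)
  ρ-avoid {X} {S} {y} h = card-mono λ v p → ∧⁺ (proj₁ (∧⁻ p)) (not⁺ (∨f (not⁻ (proj₂ (∧⁻ {nb X v} p)))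
    (sing-∉ λ { refl → true≢false (proj₁ (∧⁻ p)) h })))

  ρ-submodular : ∀ X Y S → ρ (X ∪ Y) S + ρ (X ∩ Y) S ≤ ρ X S + ρ Y S
  ρ-submodular X Y S = ≤-trans (card-mono (λ v p → sub v (∧⁻ p)) ⊞ card-mono λ v p → ∧⁺ (∧⁺ (nb-mono (λ w q → proj₁ (∧⁻ q)) v (proj₁ (∧⁻ p))) (proj₂ (∧⁻ {nb (X ∩ Y) v} p)))
      (∧⁺ (nb-mono (λ w q → proj₂ (∧⁻ {X w} q)) v (proj₁ (∧⁻ p))) (proj₂ (∧⁻ {nb (X ∩ Y) v} p))))
    (≤-reflexive (wt-modular (nb X ∖ S) (nb Y ∖ S) _))
    where
    sub : ∀ v → v ∈ nb (X ∪ Y) × not (S v) ≡ true → v ∈ ((nb X ∖ S) ∪ (nb Y ∖ S))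
    sub v (p , q) with nb-∪ {X} {Y} v p
    ... | inj₁ r = ∨ˡ (∧⁺ r q)
    ... | inj₂ r = ∨ʳ (∧⁺ r q)

  Good-mono : ∀ {U l S r s} → (∀ v → s v ≤ r v) → Good U l S r → Good U l S s
  Good-mono h g X p q = ≤-trans (wt-mono X h) (g X p q)

  Good-≗ : ∀ {U l S T r} → (∀ v → S v ≡ T v) → Good U l S r → Good U l T r
  Good-≗ {S = S} {T} h g X p q = ≤-trans (g X p q) (card-mono λ v r → subst (λ b → nb X v ∧ not b ≡ true) (h v) r)

  module _ {U : 𝕊 N} {M : ℕ} {S : 𝕊 N} {r : Fin N → ℕ} (1≤M : 1 ≤ M) (good : Good U (M + M) S r)
           (big : ∀ X → X ⊆ U → M < card X → card X ≤ M + M → wt X r < ρ X S) where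

    private
      Critical : 𝕊 N → Set
      Critical X = X ⊆ U × card X ≤ M × ρ X S ≤ wt X r

      critical-small : ∀ {X} → X ⊆ U → card X ≤ M + M → ρ X S ≤ wt X r → Critical X
      critical-small {X} s c t = s , ≮⇒≥ (λ lt → <-irrefl refl (<-≤-trans (big X s lt c) t)) , t

      -- `ρ` is submodular and `wt` is modular, so tightness passes to the union. Its size is at
      -- most 2M, and `big` excludes tight sets of sizes between M and 2M.
      critical-∪ : ∀ {X Y} → Critical X → Critical Y → Critical (X ∪ Y)
      critical-∪ {X} {Y} (sX , cX , tX) (sY , cY , tY) = critical-small sub (≤-trans (card-∪ X Y) (cX ⊞ cY))
        (critical-∪-cancel (ρ-submodular X Y S) (wt-modular X Y r) tX tY
          (good (X ∩ Y) (λ v p → sX v (proj₁ (∧⁻ p))) (≤-trans (card-mono λ v p → proj₁ (∧⁻ {X v} p)) (≤-trans cX (m≤m+n M M)))))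
        where
        sub : (X ∪ Y) ⊆ U
        sub v p with ∨⁻ {X v} p
        ... | inj₁ q = sX v q
        ... | inj₂ q = sY v q

    extend : ∀ {x} → x ∈ U → 1 ≤ r x → NN (Σ (Fin N) λ y → adj x y ≡ true × y ∉ S × Good U (M + M) (S ∪ ｛ y ｝) (r ⊖ x))
    extend {x} xU rx fail = (absorb-all (allFin N) >>= finish) id where

      blocking : ∀ y → adj x y ≡ true → y ∉ S → NN (Σ (𝕊 N) λ X → Critical X × x ∉ X × y ∈ nb X)
      blocking y a s = counterexample (λ X h p q → ≤-stable λ nh → h λ f → nh (f p q)) (λ g → fail (y , a , s , g)) >>= found
        where
        found : (Σ (𝕊 N) λ X → ¬ (X ⊆ U → card X ≤ M + M → wt X (r ⊖ x) ≤ ρ X (S ∪ ｛ y ｝))) → NN (Σ (𝕊 N) λ X → Critical X × x ∉ X × y ∈ nb X)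
        found (X , nh) = em (X ⊆ U × card X ≤ M + M × ρ X (S ∪ ｛ y ｝) < wt X (r ⊖ x)) >>= λ
          { (inj₂ n) → λ _ → nh λ p q → ≮⇒≥ λ lt → n (p , q , lt)
          ; (inj₁ (p , q , lt)) → case bool? (X x) of λ
            -- A set containing `x` loses one unit of demand and at most one neighbour, so it cannot
            -- have become deficient.
            { (inj₁ x∈X) → λ _ → <-irrefl refl (≤-trans (≤-trans (s≤s (≤-trans (good X p q) (ρ-insert X S y))) (s≤s lt)) (wt-⊖ x∈X rx))
            ; (inj₂ x∉X) → pure (X , critical-small p q (≤-trans (ρ-insert X S y) (≤-trans lt (wt-mono X (⊖-≤ r x)))) , x∉X , (case bool? (nb X y) of λ
               { (inj₁ z) → z
               ; (inj₂ z) → ⊥-elim (<-irrefl refl (<-≤-trans lt (≤-trans (wt-mono X (⊖-≤ r x)) (≤-trans (good X p q) (ρ-avoid {X} {S} z))))) })) } }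

      absorb-all : ∀ ys → NN (Σ (𝕊 N) λ X → Critical X × x ∉ X × (∀ y → y ∈ˡ ys → adj x y ≡ true → y ∉ S → y ∈ nb X))
      absorb-all [] = pure (∅ , ((λ v ()) , ≤-trans (≤-reflexive card-∅) z≤n , ≤-trans (≤-reflexive nb∅) z≤n) , refl , λ y ())
        where
        nb∅ : ρ ∅ S ≡ 0
        nb∅ = trans (card-≗ λ v → none v) card-∅
          where
          none : ∀ v → (nb ∅ ∖ S) v ≡ ∅ v
          none v with nb ∅ v in eq
          ... | false = refl
          ... | true with nb⁻ {∅} eq
          ...   | _ , () , _
      absorb-all (y ∷ ys) = absorb-all ys >>= λ { (X , cX , x∉ , h) → em (adj x y ≡ true × y ∉ S) >>= λ
        { (inj₂ n) → pure (X , cX , x∉ , λ { y′ (here refl) a s → ⊥-elim (n (a , s)) ; y′ (there p) a s → h y′ p a s })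
        ; (inj₁ (a , s)) → blocking y a s >>= λ { (Y , cY , x∉Y , y∈) → pure (X ∪ Y , critical-∪ cX cY , ∨f x∉ x∉Y ,
            λ { y′ (here refl) _ _ → nb-mono (λ _ → ∨ʳ) _ y∈ ; y′ (there p) a s → nb-mono (λ _ → ∨ˡ) _ (h y′ p a s) }) } } }

      finish : (Σ (𝕊 N) λ X → Critical X × x ∉ X × (∀ y → y ∈ˡ allFin N → adj x y ≡ true → y ∉ S → y ∈ nb X)) → NN ⊥
      -- All neighbours of `x` outside `S` already lie in the neighbourhood of `X`, so adding `x`
      -- raises the demand and leaves `ρ` as it is.
      finish (X , (s , c , t) , x∉ , h) _ = <-irrefl refl (begin-strict
        wt X r                          <⟨ +-mono-≤ rx ≤-refl ⟩
        r x + wt X r                    ≤⟨ wt-add ⟩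
        wt (X ∪ ｛ x ｝) r              ≤⟨ good (X ∪ ｛ x ｝) sub (≤-trans (card-insert X x) (≤-trans (s≤s c) (+-monoˡ-≤ M 1≤M))) ⟩
        ρ (X ∪ ｛ x ｝) S               ≤⟨ card-mono (λ v p → ∧⁺ (sub′ v (not⁻ (proj₂ (∧⁻ {nb (X ∪ ｛ x ｝) v} p))) (nb⁻ (proj₁ (∧⁻ p)))) (proj₂ (∧⁻ {nb (X ∪ ｛ x ｝) v} p))) ⟩
        ρ X S                           ≤⟨ t ⟩
        wt X r ∎)
        where
        open ≤-Reasoning
        sub : (X ∪ ｛ x ｝) ⊆ U
        sub v p with ∨⁻ {X v} p
        ... | inj₁ q = s v q
        ... | inj₂ q = subst (_∈ U) (sym (sing⁻ q)) xU
        sub′ : ∀ v → v ∉ S → Σ (Fin N) (λ u → u ∈ (X ∪ ｛ x ｝) × adj u v ≡ true) → v ∈ nb X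
        sub′ v vS (u , p , a) with ∨⁻ {X u} p
        ... | inj₁ q = nb⁺ q a
        ... | inj₂ q = h v (∈-allFin v) (subst (λ z → adj z v ≡ true) (sing⁻ q) a) vS
        wt-add : r x + wt X r ≤ wt (X ∪ ｛ x ｝) r
        wt-add = ≤-trans (+-monoˡ-≤ (wt X r) single) (≤-reflexive (trans (+-comm (wt ｛ x ｝ r) _) (trans (sym (wt-modular X ｛ x ｝ r)) (trans (cong (wt (X ∪ ｛ x ｝) r +_) disj) (+-identityʳ _)))))
          where
          opaque
            unfolding wt
            single : r x ≤ wt ｛ x ｝ r
            single = subst (λ b → b ⊙ r x ≤ wt ｛ x ｝ r) (sing-refl x) (term≤∑ (λ v → ｛ x ｝ v ⊙ r v) x)
            disj : wt (X ∩ ｛ x ｝) r ≡ 0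
            disj = trans (∑-cong {g = λ _ → 0} λ v → zero-at v) (trans (∑-const N 0) (*-zeroʳ N))
              where
              zero-at : ∀ v → (X v ∧ ｛ x ｝ v) ⊙ r v ≡ 0
              zero-at v with X v in e₁ | ｛ x ｝ v in e₂
              ... | false | _ = refl
              ... | true | false = refl
              ... | true | true = true≢false (subst (λ z → X z ≡ true) (sing⁻ e₂) e₁) x∉

  -- The extension step with `U` = `full` and M = N: no set has more than N vertices, so the
  -- hypothesis on big sets is vacuous, and the neighbours are chosen one at a time. A vertex
  -- repeated in `R` receives several neighbours.
  hall : ∀ R S → (∀ X → wt X (λ v → cnt v R) ≤ ρ X S) → NN (Σ (List (Fin N)) λ ys → Pointwise (λ x y → adj x y ≡ true) R ys × Unique ys × All (_∉ S) ys)
  hall [] S h = pure ([] , [] , [] , [])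
  hall (x ∷ R) S h = extend {full} {N} (≤-trans (s≤s z≤n) (toℕ<n x)) (λ X _ _ → h X) (λ X _ lt _ → ⊥-elim (<-irrefl refl (<-≤-trans lt (card≤N X)))) {x} refl has >>= next
    where
    has : 1 ≤ cnt x (x ∷ R)
    has rewrite sing-refl x = s≤s z≤n
    fewer : ∀ v → cnt v R ≤ ((λ v → cnt v (x ∷ R)) ⊖ x) v
    fewer v with ｛ x ｝ v
    ... | true = ≤-refl
    ... | false = ≤-refl
    next : (Σ (Fin N) λ y → adj x y ≡ true × y ∉ S × Good full (N + N) (S ∪ ｛ y ｝) ((λ v → cnt v (x ∷ R)) ⊖ x)) → _
    next (y , a , s , g) = hall R (S ∪ ｛ y ｝) (λ X → ≤-trans (wt-mono X fewer) (g X (λ _ _ → refl) (≤-trans (card≤N X) (m≤m+n N N)))) >>= λ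
      { (ys , pw , u , av) → pure (y ∷ ys , a ∷ pw , All-tabulate (λ {z} z∈ e → true≢false (subst (_∈ (S ∪ ｛ y ｝)) e (∨ʳ {S y} (sing-refl y))) (All-lookup av z∈)) ∷ u ,
          s ∷ All-map (λ p → proj₁ (∨f⁻ p)) av) }

-- Lists up to permutation, paths as lists, tokens

module ↭-Solver {N : ℕ} = Algebra.Solver.CommutativeMonoid (++-commutativeMonoid {A = Fin N})
open ↭-Solver using (_⊕_; _⊜_) renaming (solve to permute) public

module _ {A : Set} where

  Unique-++ˡ : ∀ (xs : List A) {ys} → Unique (xs ++ ys) → Unique xs
  Unique-++ˡ [] u = []
  Unique-++ˡ (x ∷ xs) (h ∷ u) = All-++⁻ˡ xs h ∷ Unique-++ˡ xs u

  Unique-++ʳ : ∀ (xs : List A) {ys} → Unique (xs ++ ys) → Unique ys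
  Unique-++ʳ [] u = u
  Unique-++ʳ (x ∷ xs) (h ∷ u) = Unique-++ʳ xs u

  Unique-disjoint : ∀ (xs : List A) {ys} → Unique (xs ++ ys) → ∀ {v} → v ∈ˡ xs → v ∈ˡ ys → ⊥
  Unique-disjoint (x ∷ xs) (h ∷ u) (here refl) q = All-lookup h (∈-++⁺ʳ xs q) refl
  Unique-disjoint (x ∷ xs) (h ∷ u) (there p) q = Unique-disjoint xs u p q

  Unique-++ : ∀ {xs ys : List A} → Unique xs → Unique ys → (∀ {v} → v ∈ˡ xs → v ∈ˡ ys → ⊥) → Unique (xs ++ ys)
  Unique-++ [] v d = v
  Unique-++ {x ∷ xs} (h ∷ u) v d = All-++⁺ h (All-tabulate λ q e → d (here refl) (subst (_∈ˡ _) (sym e) q)) ∷ Unique-++ u v λ p q → d (there p) q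

  Unique-↭ : ∀ {xs ys : List A} → xs ↭ ys → Unique xs → Unique ys
  Unique-↭ _↭_.refl u = u
  Unique-↭ (_↭_.prep x p) (h ∷ u) = All-resp-↭ p h ∷ Unique-↭ p u
  Unique-↭ (_↭_.swap x y p) ((xy ∷ hx) ∷ (hy ∷ u)) = ((λ e → xy (sym e)) ∷ All-resp-↭ p hy) ∷ (All-resp-↭ p hx ∷ Unique-↭ p u)
  Unique-↭ (_↭_.trans p q) u = Unique-↭ q (Unique-↭ p u)

module Paths {N : ℕ} (adj : Fin N → Fin N → Bool) where

  infixr 5 _◃_
  -- The list of a chain omits its first vertex and contains its last one.
  data Chain : Fin N → List (Fin N) → Fin N → Set where
    nil : ∀ {a} → Chain a [] a
    _◃_ : ∀ {a x xs b} → adj a x ≡ true → Chain x xs b → Chain a (x ∷ xs) b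

  chain-++ : ∀ {a xs b ys c} → Chain a xs b → Chain b ys c → Chain a (xs ++ ys) c
  chain-++ nil q = q
  chain-++ (e ◃ p) q = e ◃ chain-++ p q

  module _ (adj-sym : ∀ u v → adj u v ≡ adj v u) where

    turn : ∀ {p b zs q acc e} → adj p q ≡ true → Chain b zs q → Chain b acc e → Chain p (reverse zs ++ b ∷ acc) e
    turn a nil c = a ◃ c
    turn {b = b} {z ∷ zs} {acc = acc} a (e ◃ h) c = subst (λ l → Chain _ l _)
      (sym (trans (cong (_++ (b ∷ acc)) (unfold-reverse z zs)) (++-assoc (reverse zs) (z ∷ []) (b ∷ acc))))
      (turn a h (trans (adj-sym _ _) e ◃ c))

    bridge : ∀ {a xs p b zs q} → Chain a xs p → adj p q ≡ true → Chain b zs q → Chain a (xs ++ reverse zs ++ b ∷ []) b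
    bridge c e d = chain-++ c (turn e d nil)

-- Three tokens stay with every vertex of a new path, so that it can later be an end of further
-- links, an input of a switch, or take part in a matching.
tokens : ∀ {N} → List (Fin N) → List (Fin N)
tokens [] = []
tokens (x ∷ xs) = x ∷ x ∷ x ∷ tokens xs

tokens-++ : ∀ {N} (xs ys : List (Fin N)) → tokens (xs ++ ys) ≡ tokens xs ++ tokens ys
tokens-++ [] ys = refl
tokens-++ (x ∷ xs) ys = cong (λ l → x ∷ x ∷ x ∷ l) (tokens-++ xs ys)

tokens-↭ : ∀ {N} {xs ys : List (Fin N)} → xs ↭ ys → tokens xs ↭ tokens ys
tokens-↭ _↭_.refl = ↭-refl
tokens-↭ (_↭_.prep x p) = ↭-prep x (↭-prep x (↭-prep x (tokens-↭ p)))
tokens-↭ (_↭_.swap {xs} {ys} x y p) = ↭-trans (permute 3 (λ a b c → a ⊕ (a ⊕ (a ⊕ (b ⊕ (b ⊕ (b ⊕ c))))) ⊜ b ⊕ (b ⊕ (b ⊕ (a ⊕ (a ⊕ (a ⊕ c)))))) ↭-refl (x ∷ []) (y ∷ []) (tokens xs))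
  (↭-prep y (↭-prep y (↭-prep y (↭-prep x (↭-prep x (↭-prep x (tokens-↭ p)))))))
tokens-↭ (_↭_.trans p q) = ↭-trans (tokens-↭ p) (tokens-↭ q)

cnt-tokens : ∀ {N} (v : Fin N) {xs} → Unique xs → cnt v (tokens xs) ≤ ⟪ xs ⟫ v ⊙ 3
cnt-tokens v {[]} u = z≤n
cnt-tokens v {x ∷ xs} (h ∷ u) with v ≟ x
... | no _ = cnt-tokens v u
... | yes refl = ≤-reflexive (cong (λ z → 3 + z) (cnt-∉ λ p → All-lookup h (∈-tokens xs p) refl))
  where
  ∈-tokens : ∀ {v} ys → v ∈ˡ tokens ys → v ∈ˡ ys
  ∈-tokens (y ∷ ys) (here p) = here p
  ∈-tokens (y ∷ ys) (there (here p)) = here p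
  ∈-tokens (y ∷ ys) (there (there (here p))) = here p
  ∈-tokens (y ∷ ys) (there (there (there p))) = there (∈-tokens ys p)

-- The state of a greedy embedding: the list us of used vertices, and a multiset R of tokens. A token at x is a reserved
-- right to a new neighbour of x; each unused vertex implicitly holds w tokens.

record Host {N : ℕ} (adj : Fin N → Fin N → Bool) : Set where
  field
    irr        : ∀ x → adj x x ≡ false
    adj-sym    : ∀ u v → adj u v ≡ adj v u
    U          : 𝕊 N
    M w′ n̂    : ℕ
    1≤M        : 1 ≤ M
    robust     : ∀ X → X ⊆ U → card X ≤ M + M → (8 + w′) * card X ≤ card (Extension.nb adj X ∩ U)
    spread     : ∀ X → X ⊆ U → M ≤ card X → n̂ ≤ card ((X ∪ Extension.nb adj X) ∩ U)

-- The property that `U` is M-joined.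
Linking : ∀ {N} → (Fin N → Fin N → Bool) → 𝕊 N → ℕ → Set
Linking {N} adj U M = ∀ A B → A ⊆ U → B ⊆ U → (∀ v → v ∈ A → v ∈ B → ⊥) → M ≤ card A → M ≤ card B →
  NN (Σ (Fin N) λ p → Σ (Fin N) λ q → p ∈ A × q ∈ B × adj p q ≡ true)

big-arith : ∀ {d c r l n m} → d ≤ c * m → n ≤ m + (r + l) → l + (c + 1) * m < n → d < r
big-arith {d} {c} {r} {l} {n} {m} h1 h2 h3 = lin 0 (h1 ⊞ h2 ⊞ h3) (solve (d List.∷ c List.∷ r List.∷ l List.∷ n List.∷ m List.∷ List.[]))

more-arith : ∀ a b c → a + b + c ≡ a + (c + b + 0)
more-arith = solve-∀

module Tokens {N : ℕ} (adj : Fin N → Fin N → Bool) (host : Host adj) where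

  open Host host
  open Extension adj
  open Paths adj

  w wb : ℕ
  w = 5 + w′
  wb = 8 + w′

  outside : List (Fin N) → 𝕊 N
  outside us v = not (U v) ∨ ⟪ us ⟫ v

  demand : List (Fin N) → List (Fin N) → Fin N → ℕ
  demand us R v = cnt v R + not (⟪ us ⟫ v) ⊙ w

  record H (us R : List (Fin N)) : Set where
    constructor mkH
    field
      uniq : Unique us
      inU  : All (_∈ U) us
      tokU : All (_∈ U) R
      good : Good U (M + M) (outside us) (demand us R)
  open H public

  Bounded : List (Fin N) → List (Fin N) → Set
  Bounded us R = ∀ v → demand us R v ≤ wb

  G : List (Fin N) → List (Fin N) → Set
  G us R = H us R × Bounded us R

  demand-↭ : ∀ {us us′ R R′} → us ↭ us′ → R ↭ R′ → ∀ v → demand us R v ≡ demand us′ R′ v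
  demand-↭ p q v = cong₂ (λ a b → a + not b ⊙ w) (cnt-↭ v q) (⟪⟫-↭ p v)

  H-↭ : ∀ {us us′ R R′} → us ↭ us′ → R ↭ R′ → H us R → H us′ R′
  H-↭ p q (mkH u i t g) = mkH (Unique-↭ p u) (All-resp-↭ p i) (All-resp-↭ q t)
    (Good-mono (λ v → ≤-reflexive (sym (demand-↭ p q v))) (Good-≗ (λ v → cong (not (U v) ∨_) (⟪⟫-↭ p v)) g))

  G-↭ : ∀ {us us′ R R′} → us ↭ us′ → R ↭ R′ → G us R → G us′ R′
  G-↭ p q (h , b) = H-↭ p q h , λ v → subst (_≤ wb) (demand-↭ p q v) (b v)

  demand-drop : ∀ us T {R} v → demand us R v ≤ demand us (T ++ R) v
  demand-drop us T {R} v = +-monoˡ-≤ _ (subst (cnt v R ≤_) (sym (cnt-++ v T R)) (m≤n+m _ _))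

  H-drop : ∀ {us} T {R} → H us (T ++ R) → H us R
  H-drop {us} T (mkH u i t g) = mkH u i (All-++⁻ʳ T t) (Good-mono (demand-drop us T) g)

  G-drop : ∀ {us} T {R} → G us (T ++ R) → G us R
  G-drop {us} T (h , b) = H-drop T h , λ v → ≤-trans (demand-drop us T v) (b v)

  K : ℕ
  K = (wb + 1) * (M + M)

  -- A set of between M and 2M vertices sees `n̂` vertices of `U`, itself included. Without the set
  -- and the used vertices more than wb * 2M remain by the definition of `K`, and by `Bounded` the
  -- demand of the set is no larger than that; this is the strictness which the extension step asks
  -- of big sets.
  ext : ∀ {us x R} → G us (x ∷ R) → length us + K < n̂ → NN (Σ (Fin N) λ y → adj x y ≡ true × G (y ∷ us) (replicate w y ++ R))
  ext {us} {x} {R} (mkH u i (xU ∷ t) g , b) room = extend 1≤M g big xU has >>= λ { (y , a , y∉ , g′) → pure (y , a , new y a y∉ g′) }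
    where
    big : ∀ X → X ⊆ U → M < card X → card X ≤ M + M → wt X (demand us (x ∷ R)) < ρ X (outside us)
    big X s lt le = big-arith {c = wb} {l = length us} {m = M + M} (≤-trans (wt-mono X b) (≤-trans (≤-reflexive (wt-const X wb)) (wb · le)))
        (≤-trans (spread X s (<⇒≤ lt)) (≤-trans (card-cover X ((nb X ∖ outside us) ∪ ⟪ us ⟫) split) (le ⊞ (≤-trans (card-∪ (nb X ∖ outside us) ⟪ us ⟫) (≤-refl {ρ X (outside us)} ⊞ card⟪⟫≤ us))))) room
      where
      split : ∀ v → v ∈ ((X ∪ nb X) ∩ U) → v ∈ X ⊎ v ∈ ((nb X ∖ outside us) ∪ ⟪ us ⟫)
      split v p with ∧⁻ {X v ∨ nb X v} p
      ... | q , vU with ∨⁻ {X v} q | bool? (⟪ us ⟫ v)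
      ...   | inj₁ r | _ = inj₁ r
      ...   | inj₂ r | inj₁ z = inj₂ (∨ʳ z)
      ...   | inj₂ r | inj₂ z = inj₂ (∨ˡ (∧⁺ r (not⁺ (∨f (cong not vU) z))))
    has : 1 ≤ demand us (x ∷ R) x
    has rewrite sing-refl x = s≤s z≤n
    new : ∀ y → adj x y ≡ true → y ∉ outside us → Good U (M + M) (outside us ∪ ｛ y ｝) (demand us (x ∷ R) ⊖ x) → G (y ∷ us) (replicate w y ++ R)
    new y a y∉ g′ = mkH (All-tabulate (λ p e → true≢false (∈⟪⟫⁺ (subst (_∈ˡ us) (sym e) p)) (proj₂ (∨f⁻ {not (U y)} y∉))) ∷ u) (yU ∷ i)
        (All-++⁺ (rep w) t) (Good-mono less (Good-≗ (λ v → shuffle (not (U v)) (⟪ us ⟫ v) (｛ y ｝ v)) g′)) ,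
        λ v → ≤-trans (less v) (≤-trans (⊖-≤ (demand us (x ∷ R)) x v) (b v))
      where
      yU : y ∈ U
      yU with U y | proj₁ (∨f⁻ {not (U y)} y∉)
      ... | true | _ = refl
      rep : ∀ k → All (_∈ U) (replicate k y)
      rep zero = []
      rep (suc k) = yU ∷ rep k
      shuffle : ∀ a b c → (a ∨ b) ∨ c ≡ a ∨ (c ∨ b)
      shuffle true _ _ = refl
      shuffle false true true = refl
      shuffle false true false = refl
      shuffle false false true = refl
      shuffle false false false = refl
      y≢x : y ≢ x
      y≢x refl = true≢false a (irr x)
      less : ∀ v → demand (y ∷ us) (replicate w y ++ R) v ≤ (demand us (x ∷ R) ⊖ x) v
      less v rewrite cnt-++ v (replicate w y) R | cnt-replicate v w y with v ≟ y | v ≟ x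
      ... | yes refl | yes e = ⊥-elim (y≢x e)
      ... | yes refl | no _ rewrite proj₂ (∨f⁻ {not (U y)} y∉) = ≤-reflexive (trans (+-identityʳ _) (+-comm w _))
      ... | no _ | yes _ = ≤-refl
      ... | no _ | no _ = ≤-refl

  -- The inverse of `ext`, for a vertex `y` that still has all its tokens. A set containing `x` gets
  -- back one unit of demand at `x`, and also the free neighbour `y` that pays for it. This allows
  -- large trees to be grown tentatively.
  rollback : ∀ {us x y R} → adj x y ≡ true → x ∈ U → H (y ∷ us) (replicate w y ++ R) → H us (x ∷ R)
  rollback {us} {x} {y} {R} a xU (mkH (h ∷ u) (yU ∷ i) t g) = mkH u i (xU ∷ All-++⁻ʳ (replicate w y) t) good′
    where
    y∉ : ⟪ us ⟫ y ≡ false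
    y∉ = ∉⟪⟫⁺ λ p → All-lookup h p refl
    more : ∀ v → demand us (x ∷ R) v ≡ ｛ x ｝ v ⊙ 1 + demand (y ∷ us) (replicate w y ++ R) v
    more v rewrite cnt-++ v (replicate w y) R | cnt-replicate v w y with v ≟ y
    ... | no _ = +-assoc (｛ x ｝ v ⊙ 1) _ _
    ... | yes refl rewrite y∉ = more-arith (｛ x ｝ y ⊙ 1) (cnt y R) w
    good′ : Good U (M + M) (outside us) (demand us (x ∷ R))
    good′ X s c = case bool? (X x) of λ
      { (inj₁ x∈) → ≤-trans (wt-≤-suc X x (λ v ne → ≤-reflexive (trans (more v) (cong (λ z → z ⊙ 1 + demand (y ∷ us) (replicate w y ++ R) v) (sing-∉ ne))))
                        (≤-reflexive (trans (more x) (cong (λ z → z ⊙ 1 + demand (y ∷ us) (replicate w y ++ R) x) (sing-refl x)))))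
                      (≤-trans (s≤s (g X s c)) (≤-trans (≤-trans (≤-reflexive (+-comm 1 _)) (+-monoʳ-≤ _ (∈⇒card (sing-refl y))))
                        (card-disjoint (nb X ∖ outside (y ∷ us)) ｛ y ｝ keep (λ v p → subst (_∈ (nb X ∖ outside us)) (sym (sing⁻ p)) (∧⁺ (nb⁺ x∈ a) (not⁺ (∨f (cong not yU) y∉))))
                          λ v p q → true≢false {outside (y ∷ us) v} (∨ʳ {not (U v)} (∨ˡ q)) (not⁻ (proj₂ (∧⁻ {nb X v} p))))))
      ; (inj₂ x∉) → ≤-trans (wt-agree {X = X} λ v p → ≤-reflexive (trans (more v) (cong (λ z → z ⊙ 1 + demand (y ∷ us) (replicate w y ++ R) v) (sing-∉ {v = v} {x} λ { refl → true≢false p x∉ }))))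
                      (≤-trans (g X s c) (card-mono keep)) }
      where
      keep : (nb X ∖ outside (y ∷ us)) ⊆ (nb X ∖ outside us)
      keep v p with ∧⁻ {nb X v} p
      ... | q , r with ∨f⁻ {not (U v)} (not⁻ r)
      ...   | r₁ , r₂ = ∧⁺ q (not⁺ (∨f r₁ (proj₂ (∨f⁻ {｛ y ｝ v} r₂))))

-- Connecting two vertices through binary trees

treeSize : ℕ → ℕ
treeSize zero = 0
treeSize (suc d) = 2 + (treeSize d + treeSize d)

grow-node-arith : ∀ s → s + (s + 2) ≡ 2 + (s + s)
grow-node-arith = solve-∀

grow-room₁ : ∀ l s k {n} → l + (2 + (s + s)) + k < n → l + k < n
grow-room₁ l s k {n} h = lin (2 + 2 * s) h (solve (l List.∷ s List.∷ k List.∷ n List.∷ List.[]))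

grow-room₂ : ∀ l s k {n} → l + (2 + (s + s)) + k < n → suc l + k < n
grow-room₂ l s k {n} h = lin (1 + 2 * s) h (solve (l List.∷ s List.∷ k List.∷ n List.∷ List.[]))

grow-room₃ : ∀ l s k {n} → l + (2 + (s + s)) + k < n → suc (suc l) + s + k < n
grow-room₃ l s k {n} h = lin s h (solve (l List.∷ s List.∷ k List.∷ n List.∷ List.[]))

room₄-arith : ∀ l s k {n} → l + (2 + (s + s)) + k < n → (s + (2 + l)) + s + k < n
room₄-arith l s k {n} h = lin 0 h (solve (l List.∷ s List.∷ k List.∷ n List.∷ List.[]))

module Connecting {N : ℕ} (adj : Fin N → Fin N → Bool) (host : Host adj) (edge : Linking adj (Host.U host) (Host.M host)) where

  open Host host
  open Extension adj
  open Paths adj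
  open Tokens adj host public

  -- A binary tree of new vertices hanging from a. It can be removed entirely, or up to the path to one of its leaves.
  record Grown (d : ℕ) (a : Fin N) : Set where
    field
      ys leaves toks : List (Fin N)
      len       : length ys ≡ treeSize d
      leafLen   : length leaves ≡ 2 ^ d
      leafIn    : ∀ {p} → p ∈ˡ leaves → p ∈ˡ a ∷ ys
      leafUniq  : Unique (a ∷ ys) → Unique leaves
      remove    : ∀ {us R} → a ∈ U → H (ys ++ us) (toks ++ R) → H us (a ∷ a ∷ R)
      prune     : ∀ {p} → p ∈ˡ leaves → Σ (List (Fin N)) λ xs → length xs ≡ d × Chain a xs p ×
                  (∀ {us R} → a ∈ U → H (ys ++ us) (toks ++ R) → H (xs ++ us) (tokens xs ++ R))
  open Grown

  private
    [_]′ : Fin N → List (Fin N)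
    [ x ]′ = x ∷ []

  grow-leaf : ∀ a → Grown zero a
  grow-leaf a = record
    { ys = [] ; leaves = a ∷ [] ; toks = a ∷ a ∷ [] ; len = refl ; leafLen = refl ; leafIn = λ p → p ; leafUniq = λ u → u
    ; remove = λ _ h → h
    ; prune = λ { (here refl) → [] , refl , nil , λ _ h → H-drop (a ∷ a ∷ []) h } }

  -- To keep only the path to a leaf, the sibling tree is removed, its root is rolled back, and the
  -- other tree is pruned. Each rollback needs the full set of `w` tokens of the root: two come back
  -- from removing its tree, the other three with the `w′` further ones are listed in `toks`.
  grow-node : ∀ {d a c₁ c₂} → adj a c₁ ≡ true → adj a c₂ ≡ true → c₁ ∈ U → c₂ ∈ U → Grown d c₁ → Grown d c₂ → Grown (suc d) a
  grow-node {d} {a} {c₁} {c₂} e₁ e₂ u₁ u₂ g₁ g₂ = record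
    { ys = Y ; leaves = leaves g₁ ++ leaves g₂ ; toks = T
    ; len = trans (length-++ (ys g₂)) (trans (cong₂ _+_ (len g₂) (trans (length-++ (ys g₁)) (cong (_+ 2) (len g₁)))) (grow-node-arith (treeSize d)))
    ; leafLen = trans (length-++ (leaves g₁)) (trans (cong₂ _+_ (leafLen g₁) (leafLen g₂)) (cong (2 ^ d +_) (sym (+-identityʳ _))))
    ; leafIn = λ p → there (leaf-in p)
    ; leafUniq = λ { (_ ∷ u) → let u′ = Unique-↭ Y↭ u in
        Unique-++ (leafUniq g₁ (Unique-++ˡ (c₁ ∷ ys g₁) u′)) (leafUniq g₂ (Unique-++ʳ (c₁ ∷ ys g₁) u′))
          λ p q → Unique-disjoint (c₁ ∷ ys g₁) u′ (leafIn g₁ p) (leafIn g₂ q) }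
    ; remove = λ {us} {R} aU h → rollback e₁ aU (H-↭ ↭-refl (shift₁ a c₁ R) (rollback e₂ aU (H-↭ ↭-refl
        (permute 4 (λ x X y Z → x ⊕ (x ⊕ (y ⊕ (y ⊕ (y ⊕ (y ⊕ (y ⊕ (X ⊕ (x ⊕ (x ⊕ (x ⊕ Z)))))))))) ⊜ (y ⊕ (y ⊕ (y ⊕ (y ⊕ (y ⊕ X))))) ⊕ ((x ⊕ (x ⊕ (x ⊕ (x ⊕ x)))) ⊕ Z)) ↭-refl [ c₁ ]′ (C c₂) [ c₂ ]′ (C c₁ ++ R))
        (remove g₁ u₁ (H-↭ ↭-refl (tok₁ R) (remove g₂ u₂ (H-↭ (us↭ us) (T↭ R) h)))))))
    ; prune = pr }
    where
    C : Fin N → List (Fin N)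
    C c = replicate w′ c
    Y T : List (Fin N)
    Y = ys g₂ ++ ys g₁ ++ c₂ ∷ c₁ ∷ []
    T = toks g₂ ++ toks g₁ ++ c₂ ∷ c₂ ∷ c₂ ∷ C c₂ ++ c₁ ∷ c₁ ∷ c₁ ∷ C c₁
    Y↭ : Y ↭ (c₁ ∷ ys g₁) ++ (c₂ ∷ ys g₂)
    Y↭ = permute 4 (λ a b c d → a ⊕ (b ⊕ (c ⊕ d)) ⊜ (d ⊕ b) ⊕ (c ⊕ a)) ↭-refl (ys g₂) (ys g₁) [ c₂ ]′ [ c₁ ]′
    us↭ : ∀ us → Y ++ us ↭ ys g₂ ++ (ys g₁ ++ (c₂ ∷ c₁ ∷ us))
    us↭ us = permute 5 (λ a b c d e → (a ⊕ (b ⊕ (c ⊕ d))) ⊕ e ⊜ a ⊕ (b ⊕ (c ⊕ (d ⊕ e)))) ↭-refl (ys g₂) (ys g₁) [ c₂ ]′ [ c₁ ]′ us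
    T↭ : ∀ R → T ++ R ↭ toks g₂ ++ (toks g₁ ++ (c₂ ∷ c₂ ∷ c₂ ∷ C c₂ ++ (c₁ ∷ c₁ ∷ c₁ ∷ C c₁ ++ R)))
    T↭ R = permute 7 (λ a b c d e f g → (a ⊕ (b ⊕ (c ⊕ (c ⊕ (c ⊕ (d ⊕ (e ⊕ (e ⊕ (e ⊕ f)))))))) ) ⊕ g ⊜ a ⊕ (b ⊕ (c ⊕ (c ⊕ (c ⊕ (d ⊕ (e ⊕ (e ⊕ (e ⊕ (f ⊕ g))))))))))
           ↭-refl (toks g₂) (toks g₁) [ c₂ ]′ (C c₂) [ c₁ ]′ (C c₁) R
    tok₁ : ∀ R → c₂ ∷ c₂ ∷ (toks g₁ ++ (c₂ ∷ c₂ ∷ c₂ ∷ C c₂ ++ (c₁ ∷ c₁ ∷ c₁ ∷ C c₁ ++ R))) ↭ toks g₁ ++ (c₂ ∷ c₂ ∷ c₂ ∷ c₂ ∷ c₂ ∷ C c₂ ++ (c₁ ∷ c₁ ∷ c₁ ∷ C c₁ ++ R))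
    tok₁ R = permute 3 (λ a b c → a ⊕ (a ⊕ (b ⊕ (a ⊕ (a ⊕ (a ⊕ c))))) ⊜ b ⊕ (a ⊕ (a ⊕ (a ⊕ (a ⊕ (a ⊕ c)))))) ↭-refl [ c₂ ]′ (toks g₁) (C c₂ ++ (c₁ ∷ c₁ ∷ c₁ ∷ C c₁ ++ R))
    shift₁ : ∀ a c R → a ∷ (c ∷ c ∷ c ∷ c ∷ c ∷ (C c ++ R)) ↭ (c ∷ c ∷ c ∷ c ∷ c ∷ C c) ++ (a ∷ R)
    shift₁ a c R = permute 4 (λ a c D R → a ⊕ (c ⊕ (c ⊕ (c ⊕ (c ⊕ (c ⊕ (D ⊕ R)))))) ⊜ (c ⊕ (c ⊕ (c ⊕ (c ⊕ (c ⊕ D))))) ⊕ (a ⊕ R)) ↭-refl [ a ]′ [ c ]′ (C c) R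
    leaf-in : ∀ {p} → p ∈ˡ leaves g₁ ++ leaves g₂ → p ∈ˡ Y
    leaf-in {p} q with ∈-++⁻ (leaves g₁) q
    ... | inj₁ r = ∈-resp-↭ (↭-sym Y↭) (∈-++⁺ˡ (leafIn g₁ r))
    ... | inj₂ r = ∈-resp-↭ (↭-sym Y↭) (∈-++⁺ʳ (c₁ ∷ ys g₁) (leafIn g₂ r))
    pr : ∀ {p} → p ∈ˡ leaves g₁ ++ leaves g₂ → Σ (List (Fin N)) λ xs → length xs ≡ suc d × Chain a xs p ×
           (∀ {us R} → a ∈ U → H (Y ++ us) (T ++ R) → H (xs ++ us) (tokens xs ++ R))
    pr {p} q with ∈-++⁻ (leaves g₁) q
    ... | inj₁ r with prune g₁ r
    ...   | xs , l , c , back = c₁ ∷ xs , cong suc l , e₁ ◃ c , λ {us} {R} aU h →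
            H-drop (a ∷ C c₁) (H-↭ ↭-refl
              (permute 5 (λ a b c d e → a ⊕ (b ⊕ (c ⊕ (c ⊕ (c ⊕ (d ⊕ e))))) ⊜ (a ⊕ d) ⊕ (c ⊕ (c ⊕ (c ⊕ (b ⊕ e))))) ↭-refl [ a ]′ (tokens xs) [ c₁ ]′ (C c₁) R)
              (rollback e₂ aU (H-↭
                (permute 4 (λ a b c d → a ⊕ (b ⊕ (c ⊕ d)) ⊜ b ⊕ ((c ⊕ a) ⊕ d)) ↭-refl (xs) [ c₂ ]′ [ c₁ ]′ us)
                (permute 4 (λ a b c d → a ⊕ (b ⊕ (b ⊕ (b ⊕ (b ⊕ (b ⊕ (c ⊕ d)))))) ⊜ (b ⊕ (b ⊕ (b ⊕ (b ⊕ (b ⊕ c))))) ⊕ (a ⊕ d)) ↭-refl (tokens xs) [ c₂ ]′ (C c₂) (c₁ ∷ c₁ ∷ c₁ ∷ C c₁ ++ R))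
                (back u₁ (H-↭ ↭-refl (tok₁ R) (remove g₂ u₂ (H-↭ (us↭ us) (T↭ R) h)))))))
    pr {p} q | inj₂ r with prune g₂ r
    ...   | xs , l , c , back = c₂ ∷ xs , cong suc l , e₂ ◃ c , λ {us} {R} aU h →
            H-drop (a ∷ C c₂) (H-↭ ↭-refl
              (permute 5 (λ a b c d e → a ⊕ (c ⊕ (c ⊕ (c ⊕ (d ⊕ (b ⊕ e))))) ⊜ (a ⊕ d) ⊕ (c ⊕ (c ⊕ (c ⊕ (b ⊕ e))))) ↭-refl [ a ]′ (tokens xs) [ c₂ ]′ (C c₂) R)
              (rollback e₁ aU (H-↭
                (permute 4 (λ a b c d → a ⊕ (b ⊕ (c ⊕ d)) ⊜ c ⊕ ((b ⊕ a) ⊕ d)) ↭-refl (xs) [ c₂ ]′ [ c₁ ]′ us)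
                (permute 6 (λ x X y Y s R → x ⊕ (x ⊕ (s ⊕ (y ⊕ (y ⊕ (y ⊕ (Y ⊕ (x ⊕ (x ⊕ (x ⊕ (X ⊕ R)))))))))) ⊜ (x ⊕ (x ⊕ (x ⊕ (x ⊕ (x ⊕ X))))) ⊕ (y ⊕ (y ⊕ (y ⊕ (Y ⊕ (s ⊕ R)))))) ↭-refl [ c₁ ]′ (C c₁) [ c₂ ]′ (C c₂) (tokens xs) R)
                (remove g₁ u₁ (H-↭
                  (permute 4 (λ a b c d → a ⊕ (b ⊕ (c ⊕ d)) ⊜ b ⊕ (a ⊕ (c ⊕ d))) ↭-refl xs (ys g₁) [ c₂ ]′ (c₁ ∷ us))
                  (permute 3 (λ a b c → a ⊕ (b ⊕ c) ⊜ b ⊕ (a ⊕ c)) ↭-refl (tokens xs) (toks g₁) (c₂ ∷ c₂ ∷ c₂ ∷ C c₂ ++ (c₁ ∷ c₁ ∷ c₁ ∷ C c₁ ++ R)))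
                  (back u₂ (H-↭ (us↭ us) (T↭ R) h)))))))

  grow : ∀ d {us R a} → G us (a ∷ a ∷ R) → length us + treeSize d + K < n̂ → NN (Σ (Grown d a) λ g → G (ys g ++ us) (toks g ++ R))
  grow zero {a = a} g _ = pure (grow-leaf a , g)
  grow (suc d) {us} {R} {a} g room = ext g (grow-room₁ (length us) (treeSize d) K room) >>= λ { (c₁ , e₁ , g₁) →
    ext (G-↭ ↭-refl (permute 4 (λ a c D R → (c ⊕ (c ⊕ (c ⊕ (c ⊕ (c ⊕ D))))) ⊕ (a ⊕ R) ⊜ a ⊕ (c ⊕ (c ⊕ (c ⊕ (c ⊕ (c ⊕ (D ⊕ R))))))) ↭-refl [ a ]′ [ c₁ ]′ (replicate w′ c₁) R) g₁) (grow-room₂ (length us) (treeSize d) K room) >>= λ { (c₂ , e₂ , g₂) →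
    grow d {c₂ ∷ c₁ ∷ us} {c₁ ∷ c₁ ∷ c₁ ∷ replicate w′ c₁ ++ (c₂ ∷ c₂ ∷ c₂ ∷ c₂ ∷ c₂ ∷ replicate w′ c₂ ++ R)}
      (G-↭ ↭-refl (permute 5 (λ x X y Y R → (y ⊕ (y ⊕ (y ⊕ (y ⊕ (y ⊕ Y))))) ⊕ (x ⊕ (x ⊕ (x ⊕ (x ⊕ (x ⊕ (X ⊕ R)))))) ⊜ x ⊕ (x ⊕ (x ⊕ (x ⊕ (x ⊕ (X ⊕ (y ⊕ (y ⊕ (y ⊕ (y ⊕ (y ⊕ (Y ⊕ R)))))))))))) ↭-refl [ c₁ ]′ (replicate w′ c₁) [ c₂ ]′ (replicate w′ c₂) R) g₂) (grow-room₃ (length us) (treeSize d) K room) >>= λ { (t₁ , g₃) →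
    grow d {ys t₁ ++ c₂ ∷ c₁ ∷ us} {toks t₁ ++ (c₂ ∷ c₂ ∷ c₂ ∷ replicate w′ c₂ ++ (c₁ ∷ c₁ ∷ c₁ ∷ replicate w′ c₁ ++ R))}
      (G-↭ ↭-refl (permute 6 (λ x X y Y t R → t ⊕ (x ⊕ (x ⊕ (x ⊕ (X ⊕ (y ⊕ (y ⊕ (y ⊕ (y ⊕ (y ⊕ (Y ⊕ R)))))))))) ⊜ y ⊕ (y ⊕ (t ⊕ (y ⊕ (y ⊕ (y ⊕ (Y ⊕ (x ⊕ (x ⊕ (x ⊕ (X ⊕ R))))))))))) ↭-refl [ c₁ ]′ (replicate w′ c₁) [ c₂ ]′ (replicate w′ c₂) (toks t₁) R) g₃)
      (room₄ t₁ room) >>= λ { (t₂ , g₄) →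
    pure (grow-node e₁ e₂ (inU₁ (inU (proj₁ g₂))) (inU₀ (inU (proj₁ g₂))) t₁ t₂ ,
      G-↭ (permute 5 (λ a b c d e → a ⊕ (b ⊕ (c ⊕ (d ⊕ e))) ⊜ (a ⊕ (b ⊕ (c ⊕ d))) ⊕ e) ↭-refl (ys t₂) (ys t₁) [ c₂ ]′ [ c₁ ]′ us)
          (permute 7 (λ a b c d e f g → a ⊕ (b ⊕ (c ⊕ (c ⊕ (c ⊕ (d ⊕ (e ⊕ (e ⊕ (e ⊕ (f ⊕ g))))))))) ⊜ (a ⊕ (b ⊕ (c ⊕ (c ⊕ (c ⊕ (d ⊕ (e ⊕ (e ⊕ (e ⊕ f))))))))) ⊕ g)
            ↭-refl (toks t₂) (toks t₁) [ c₂ ]′ (replicate w′ c₂) [ c₁ ]′ (replicate w′ c₁) R) g₄) } } } }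
    where
    inU₀ : ∀ {c c′ : Fin N} {us} → All (_∈ U) (c ∷ c′ ∷ us) → c ∈ U
    inU₀ (p ∷ _) = p
    inU₁ : ∀ {c c′ : Fin N} {us} → All (_∈ U) (c ∷ c′ ∷ us) → c′ ∈ U
    inU₁ (_ ∷ p ∷ _) = p
    room₄ : ∀ {c₁ c₂} (t : Grown d c₁) → length us + treeSize (suc d) + K < n̂ → length (ys t ++ c₂ ∷ c₁ ∷ us) + treeSize d + K < n̂
    room₄ {c₁} {c₂} t h = subst (λ z → z + treeSize d + K < n̂) (sym (trans (length-++ (ys t)) (cong (_+ length (c₂ ∷ c₁ ∷ us)) (len t)))) (room₄-arith (length us) (treeSize d) K h)

  3≤w : 3 ≤ w
  3≤w = s≤s (s≤s (s≤s z≤n))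

  pathSize : ℕ → ℕ
  pathSize t = 2 + (t + t)

  -- The trees of depth `t` above `a` and `b` have at least M leaves each, so some leaf of one is
  -- adjacent to some leaf of the other. The rest of both trees is given back, hence the connection
  -- permanently costs only `pathSize t` vertices, the same number every time.
  connect : ∀ {t us R a b} → M ≤ 2 ^ t → G us (a ∷ b ∷ R) → length us + (2 + (treeSize t + treeSize t)) + K < n̂ →
    NN (Σ (List (Fin N)) λ xs → length xs ≡ pathSize t × Chain a (xs ++ b ∷ []) b × G (xs ++ us) (tokens xs ++ R))
  connect {t} {us} {R} {a} {b} big g room = ext g (grow-room₁ (length us) (treeSize t) K room) >>= λ { (a′ , ea , g₁) →
    ext (G-↭ ↭-refl (permute 3 (λ a b c → a ⊕ (b ⊕ c) ⊜ b ⊕ (a ⊕ c)) ↭-refl (replicate w a′) [ b ]′ R) g₁) (grow-room₂ (length us) (treeSize t) K room) >>= λ { (b′ , eb , g₂) →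
    grow t {b′ ∷ a′ ∷ us} {a′ ∷ a′ ∷ a′ ∷ replicate w′ a′ ++ (replicate w b′ ++ R)}
      (G-↭ ↭-refl (permute 4 (λ x X y R → y ⊕ ((x ⊕ (x ⊕ (x ⊕ (x ⊕ (x ⊕ X))))) ⊕ R) ⊜ x ⊕ (x ⊕ (x ⊕ (x ⊕ (x ⊕ (X ⊕ (y ⊕ R))))))) ↭-refl [ a′ ]′ (replicate w′ a′) (replicate w b′) R) g₂) (grow-room₃ (length us) (treeSize t) K room) >>= λ { (ta , g₃) →
    grow t {ys ta ++ b′ ∷ a′ ∷ us} {toks ta ++ (a′ ∷ a′ ∷ a′ ∷ b′ ∷ b′ ∷ b′ ∷ replicate w′ a′ ++ replicate w′ b′ ++ R)}
      (G-↭ ↭-refl (permute 6 (λ x X y Y t R → t ⊕ (x ⊕ (x ⊕ (x ⊕ (X ⊕ (y ⊕ (y ⊕ (y ⊕ (y ⊕ (y ⊕ (Y ⊕ R)))))))))) ⊜ y ⊕ (y ⊕ (t ⊕ (x ⊕ (x ⊕ (x ⊕ (y ⊕ (y ⊕ (y ⊕ (X ⊕ (Y ⊕ R))))))))))) ↭-refl [ a′ ]′ (replicate w′ a′) [ b′ ]′ (replicate w′ b′) (toks ta) R) g₃) (r₄ ta room) >>= λ { (tb , g₄) →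
    let u = Unique-↭ (us↭ a′ b′ ta tb) (uniq (proj₁ g₄))
        uA = Unique-++ˡ (a′ ∷ ys ta) u
        uB = Unique-++ˡ (b′ ∷ ys tb) (Unique-++ʳ (a′ ∷ ys ta) u)
        iall = All-resp-↭ (us↭ a′ b′ ta tb) (inU (proj₁ g₄))
        iA = All-++⁻ˡ (a′ ∷ ys ta) iall
        iB = All-++⁻ˡ (b′ ∷ ys tb) (All-++⁻ʳ (a′ ∷ ys ta) iall)
    in
    edge ⟪ leaves ta ⟫ ⟪ leaves tb ⟫ (λ v p → All-lookup iA (leafIn ta (∈⟪⟫⁻ (leaves ta) p))) (λ v p → All-lookup iB (leafIn tb (∈⟪⟫⁻ (leaves tb) p)))
      (λ v p q → Unique-disjoint (a′ ∷ ys ta) u (leafIn ta (∈⟪⟫⁻ (leaves ta) p)) (∈-++⁺ˡ (leafIn tb (∈⟪⟫⁻ (leaves tb) q))))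
      (≤-trans big (≤-trans (≤-reflexive (sym (leafLen ta))) (card⟪⟫≥ (leafUniq ta uA)))) (≤-trans big (≤-trans (≤-reflexive (sym (leafLen tb))) (card⟪⟫≥ (leafUniq tb uB)))) >>= λ { (p , q , pA , qB , e) →
    pure (assemble a′ b′ ta tb ea eb g₄ iA iB (∈⟪⟫⁻ (leaves ta) pA) (∈⟪⟫⁻ (leaves tb) qB) e) } } } } }
    where
    us↭ : ∀ a′ b′ (ta : Grown t a′) (tb : Grown t b′) → ys tb ++ (ys ta ++ b′ ∷ a′ ∷ us) ↭ (a′ ∷ ys ta) ++ ((b′ ∷ ys tb) ++ us)
    us↭ a′ b′ ta tb = permute 5 (λ A B x y us → B ⊕ (A ⊕ (y ⊕ (x ⊕ us))) ⊜ (x ⊕ A) ⊕ ((y ⊕ B) ⊕ us)) ↭-refl (ys ta) (ys tb) [ a′ ]′ [ b′ ]′ us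
    r₄ : ∀ {a′ b′} (ta : Grown t a′) → length us + (2 + (treeSize t + treeSize t)) + K < n̂ → length (ys ta ++ b′ ∷ a′ ∷ us) + treeSize t + K < n̂
    r₄ {a′} {b′} ta h = subst (λ z → z + treeSize t + K < n̂) (sym (trans (length-++ (ys ta)) (cong (_+ length (b′ ∷ a′ ∷ us)) (len ta)))) (room₄-arith (length us) (treeSize t) K h)
    assemble : ∀ a′ b′ (ta : Grown t a′) (tb : Grown t b′) → adj a a′ ≡ true → adj b b′ ≡ true →
      G (ys tb ++ (ys ta ++ b′ ∷ a′ ∷ us)) (toks tb ++ (toks ta ++ (a′ ∷ a′ ∷ a′ ∷ b′ ∷ b′ ∷ b′ ∷ replicate w′ a′ ++ replicate w′ b′ ++ R))) →
      All (_∈ U) (a′ ∷ ys ta) → All (_∈ U) (b′ ∷ ys tb) → ∀ {p q} → p ∈ˡ leaves ta → q ∈ˡ leaves tb → adj p q ≡ true →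
      Σ (List (Fin N)) λ xs → length xs ≡ pathSize t × Chain a (xs ++ b ∷ []) b × G (xs ++ us) (tokens xs ++ R)
    assemble a′ b′ ta tb ea eb (h , _) (aU ∷ _) (bU ∷ _) {p} {q} pl ql e with prune ta pl | prune tb ql
    ... | xs , lx , cx , backx | zs , lz , cz , backz = path , len-path , subst (λ l → Chain a l b) (sym (cong (a′ ∷_) assoc)) (bridge adj-sym (ea ◃ cx) e (eb ◃ cz)) , (hp , bd)
      where
      path : List (Fin N)
      path = a′ ∷ xs ++ reverse (b′ ∷ zs)
      assoc : (xs ++ reverse (b′ ∷ zs)) ++ b ∷ [] ≡ xs ++ reverse (b′ ∷ zs) ++ b ∷ []
      assoc = ++-assoc xs (reverse (b′ ∷ zs)) (b ∷ [])
      len-path : length path ≡ pathSize t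
      len-path = cong suc (trans (length-++ xs) (trans (cong₂ _+_ lx (trans (length-reverse (b′ ∷ zs)) (cong suc lz))) (+-suc t t)))
      path↭ : path ↭ a′ ∷ xs ++ (b′ ∷ zs)
      path↭ = ↭-prep a′ (++⁺ˡ xs (↭-reverse (b′ ∷ zs)))
      hp : H (path ++ us) (tokens path ++ R)
      hp = H-drop (replicate w′ a′ ++ replicate w′ b′) (H-↭
        (↭-trans (permute 5 (λ X Z x y us → X ⊕ (Z ⊕ (y ⊕ (x ⊕ us))) ⊜ (x ⊕ (X ⊕ (y ⊕ Z))) ⊕ us) ↭-refl xs zs [ a′ ]′ [ b′ ]′ us) (++⁺ʳ us (↭-sym path↭)))
        (↭-trans (permute 7 (λ X Z x y A B R → X ⊕ (Z ⊕ (x ⊕ (x ⊕ (x ⊕ (y ⊕ (y ⊕ (y ⊕ (A ⊕ (B ⊕ R))))))))) ⊜ (A ⊕ B) ⊕ ((x ⊕ (x ⊕ (x ⊕ (X ⊕ (y ⊕ (y ⊕ (y ⊕ Z))))))) ⊕ R)) ↭-refl (tokens xs) (tokens zs) [ a′ ]′ [ b′ ]′ (replicate w′ a′) (replicate w′ b′) R)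
          (++⁺ˡ (replicate w′ a′ ++ replicate w′ b′) (++⁺ʳ R (↭-trans (↭-reflexive (sym (tokens-++ (a′ ∷ xs) (b′ ∷ zs)))) (tokens-↭ (↭-sym path↭))))))
        (backx aU (H-↭ (permute 4 (λ Z A y us → Z ⊕ (A ⊕ (y ⊕ us)) ⊜ A ⊕ (Z ⊕ (y ⊕ us))) ↭-refl zs (ys ta) [ b′ ]′ (a′ ∷ us))
                        (permute 3 (λ Z A R → Z ⊕ (A ⊕ R) ⊜ A ⊕ (Z ⊕ R)) ↭-refl (tokens zs) (toks ta) (a′ ∷ a′ ∷ a′ ∷ b′ ∷ b′ ∷ b′ ∷ replicate w′ a′ ++ replicate w′ b′ ++ R))
          (backz bU h))))
      -- `rollback` says nothing about this bound. It survives since a path vertex exchanges its `w`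
      -- implicit tokens for three explicit ones.
      bd : Bounded (path ++ us) (tokens path ++ R)
      bd v = ≤-trans smaller (proj₂ g v)
        where
        smaller : demand (path ++ us) (tokens path ++ R) v ≤ demand us (a ∷ b ∷ R) v
        smaller rewrite cnt-++ v (tokens path) R with ⟪ path ⟫ v in ep
        ... | true = ≤-trans (≤-reflexive (trans (cong (λ z → cnt v (tokens path) + cnt v R + not z ⊙ w) (in-front ep)) (+-identityʳ _)))
                (≤-trans ((≤-trans (cnt-tokens v {path} (Unique-++ˡ path (uniq hp))) (≤-trans (⊙-≤ (⟪ path ⟫ v) 3) 3≤w)) ⊞ ≤-trans (m≤n+m (cnt v R) (｛ b ｝ v ⊙ 1)) (m≤n+m _ (｛ a ｝ v ⊙ 1)))
                  (≤-reflexive (trans (+-comm w (cnt v (a ∷ b ∷ R))) (cong (λ z → cnt v (a ∷ b ∷ R) + not z ⊙ w) (sym (∉⟪⟫⁺ (Unique-disjoint path (uniq hp) (∈⟪⟫⁻ path ep))))))))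
          where
          in-front : ⟪ path ⟫ v ≡ true → ⟪ path ++ us ⟫ v ≡ true
          in-front p = ∈⟪⟫⁺ (∈-++⁺ˡ (∈⟪⟫⁻ path p))
        ... | false = ≤-trans ((cnt-tokens v {path} (Unique-++ˡ path (uniq hp)) ⊞ ≤-refl {cnt v R}) ⊞ ≤-refl {not (⟪ path ++ us ⟫ v) ⊙ w})
                (subst (λ z → z ⊙ 3 + cnt v R + not (⟪ path ++ us ⟫ v) ⊙ w ≤ demand us (a ∷ b ∷ R) v) (sym ep)
                  (≤-trans (m≤n+m (cnt v R) (｛ b ｝ v ⊙ 1)) (m≤n+m _ (｛ a ｝ v ⊙ 1)) ⊞ fewer))
          where
          fewer : not (⟪ path ++ us ⟫ v) ⊙ w ≤ not (⟪ us ⟫ v) ⊙ w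
          fewer with ⟪ us ⟫ v in eu
          ... | false = ⊙-≤ (not (⟪ path ++ us ⟫ v)) w
          ... | true = ≤-reflexive (cong (λ z → not z ⊙ w) (∈⟪⟫⁺ (∈-++⁺ʳ path (∈⟪⟫⁻ us eu))))

-- Switches: two wires that run straight or crossed

module _ {A : Set} where

  split-last : ∀ (xs : List A) {k} → length xs ≡ suc k → Σ (List A) λ ys → Σ A λ y → xs ≡ ys ++ y ∷ [] × length ys ≡ k
  split-last (x ∷ []) refl = [] , x , refl , refl
  split-last (x ∷ x′ ∷ xs) refl with split-last (x′ ∷ xs) refl
  ... | ys , y , e , l = x ∷ ys , y , cong (x ∷_) e , cong suc l

Room-++-arith : ∀ l j k → l + (j + k) ≡ (j + l) + k
Room-++-arith = solve-∀

link-arith : ∀ l s k → l + 0 + (2 + (s + s) + k) ≡ l + (2 + (s + s)) + k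
link-arith = solve-∀

sprout-arith : ∀ l s k {n} → l + 0 + (s + k) < n → l + k < n
sprout-arith l s k {n} h = lin s h (solve (l List.∷ s List.∷ k List.∷ n List.∷ List.[]))

switch-arith : ∀ t → (suc ((1 + (t + t)) * (2 + (2 + (t + t))))) + (suc ((1 + (t + t)) * (2 + (2 + (t + t))))) ≡ ((1 + (t + t)) * (2 + (2 + (t + t)))) + ((2 + (t + t)) + ((2 + (t + t)) + (1 + (t + t)) * (2 + (t + t))))
switch-arith = solve-∀

switch-arith′ : ∀ t → ((1 + (t + t)) * (2 + (t + t))) + ((2 + (t + t)) + ((2 + (t + t)) + ((1 + (t + t)) * (2 + (2 + (t + t)))))) ≡ (suc ((1 + (t + t)) * (2 + (2 + (t + t))))) + (suc ((1 + (t + t)) * (2 + (2 + (t + t)))))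
switch-arith′ = solve-∀

half-arith : ∀ t → (1 + (t + t)) + (1 + (t + t)) + (1 + (t + t)) * (2 + (t + t)) ≡ (1 + (t + t)) * (2 + (2 + (t + t)))
half-arith = solve-∀

module Switching {N : ℕ} (adj : Fin N → Fin N → Bool) (host : Host adj) (edge : Linking adj (Host.U host) (Host.M host)) (t : ℕ) (M≤2^t : Host.M host ≤ 2 ^ t) where

  open Host host
  open Paths adj
  open Connecting adj host edge public

  -- `Kc` is the room occupied only while a connection is being made, and `Room us k` asks for it on
  -- top of `k` permanent vertices. A path of `p` vertices without its last vertex has `p′`.
  Kc p p′ : ℕ
  Kc = 2 + (treeSize t + treeSize t) + K
  p′ = 1 + (t + t)
  p = pathSize t

  Room : List (Fin N) → ℕ → Set
  Room us k = length us + k + Kc < n̂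

  Room-≤ : ∀ {us j k} → j ≤ k → Room us k → Room us j
  Room-≤ {us} h r = ≤-<-trans (+-monoˡ-≤ Kc (+-monoʳ-≤ (length us) h)) r

  Room-++ : ∀ {us j k} xs → length xs ≡ j → Room us (j + k) → Room (xs ++ us) k
  Room-++ {us} {j} {k} xs e r = subst (λ z → z + Kc < n̂) (trans (Room-++-arith (length us) j k) (cong (_+ k) (sym (trans (length-++ xs) (cong (_+ length us) e))))) r

  link : ∀ {us R a b} → G us (a ∷ b ∷ R) → Room us 0 →
    NN (Σ (List (Fin N)) λ xs → length xs ≡ p × Chain a (xs ++ b ∷ []) b × G (xs ++ us) (tokens xs ++ R))
  link {us} g r = connect {t} M≤2^t g (subst (_< n̂) (link-arith (length us) (treeSize t) K) r)

  sprout : ∀ {us x R} → G us (x ∷ R) → Room us 0 → NN (Σ (Fin N) λ y → adj x y ≡ true × G (y ∷ us) (replicate w y ++ R))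
  sprout {us} g r = ext g (sprout-arith (length us) (2 + (treeSize t + treeSize t)) K r)

  chain-from : ∀ k {us b R} → G us (b ∷ b ∷ b ∷ R) → Room us k →
    NN (Σ (List (Fin N)) λ xs → Σ (Fin N) λ e → length xs ≡ k × Chain b xs e × G (xs ++ us) (e ∷ e ∷ R))
  chain-from zero {b = b} g r = pure ([] , b , refl , nil , G-drop (b ∷ []) g)
  chain-from (suc k) {us} {b} {R} g r = sprout g (Room-≤ {us} z≤n r) >>= λ { (y , a , g₁) →
    chain-from k {y ∷ us} {y} {R} (G-drop (y ∷ y ∷ replicate w′ y ++ b ∷ b ∷ []) (G-↭ ↭-refl (perm y) g₁)) (Room-++ {us} (y ∷ []) refl r) >>= λ { (xs , e , l , c , g₂) →
    pure (y ∷ xs , e , cong suc l , a ◃ c , G-↭ (permute 3 (λ a b c → a ⊕ (b ⊕ c) ⊜ b ⊕ (a ⊕ c)) ↭-refl xs (y ∷ []) us) ↭-refl g₂) } }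
    where
    perm : ∀ y → replicate w y ++ b ∷ b ∷ R ↭ (y ∷ y ∷ replicate w′ y ++ b ∷ b ∷ []) ++ y ∷ y ∷ y ∷ R
    perm y = permute 4 (λ y Y b R → (y ⊕ (y ⊕ (y ⊕ (y ⊕ (y ⊕ Y))))) ⊕ (b ⊕ (b ⊕ R)) ⊜ (y ⊕ (y ⊕ (Y ⊕ (b ⊕ b)))) ⊕ (y ⊕ (y ⊕ (y ⊕ R)))) ↭-refl (y ∷ []) (replicate w′ y) (b ∷ []) R

  unsnoc : ∀ {a} xs {b c} → Chain a (xs ++ b ∷ []) c → Σ (Fin N) λ q → Chain a xs q × adj q b ≡ true × b ≡ c
  unsnoc [] (e ◃ nil) = _ , nil , e , refl
  unsnoc (x ∷ xs) (e ◃ h) with unsnoc xs h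
  ... | q , c , a , eq = q , e ◃ c , a , eq

  backwards : ∀ {a xs b} → Chain a (xs ++ b ∷ []) b → Chain b (reverse xs ++ a ∷ []) a
  backwards {xs = xs} c with unsnoc xs c
  ... | q , c′ , e , _ = turn adj-sym (trans (adj-sym _ _) e) c′ nil

  -- Both chains visit the vertices of `rest` and differ only in ending at `c` or at `d`. Whichever
  -- is taken, the other end remains for the second wire of the switch.
  record Fork (s c d : Fin N) (used news : List (Fin N)) : Set where
    field
      left right rest : List (Fin N)
      chainL : Chain s left c
      chainR : Chain s right d
      permL  : left ↭ c ∷ rest
      permR  : right ↭ d ∷ rest
      cover  : rest ↭ used ++ news

  -- Two chains from s with the same vertices, ending on opposite rails, are prolonged by crossing the next rung in both directions.
  rungs : ∀ {s l r c d us R xs ys} ls rs → length ls ≡ length rs → Chain l (ls ++ c ∷ []) c → Chain r (rs ++ d ∷ []) d →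
    Chain s xs l → Chain s ys r → xs ↭ ys → G us (tokens ls ++ tokens rs ++ R) → Room us (length ls * p) →
    NN (Σ (List (Fin N)) λ news → length news ≡ length ls * p × Fork s c d (xs ++ ls ++ rs) news × G (news ++ us) R)
  rungs {s} {c = c} {d} {R = R} {xs} {ys} [] [] _ (e ◃ nil) (e′ ◃ nil) cx cy pxy g room = pure ([] , refl , record
    { left = xs ++ c ∷ [] ; right = ys ++ d ∷ [] ; rest = xs ; chainL = chain-++ cx (e ◃ nil) ; chainR = chain-++ cy (e′ ◃ nil)
    ; permL = ++-comm xs (c ∷ []) ; permR = ↭-trans (++-comm ys (d ∷ [])) (↭-prep d (↭-sym pxy))
    ; cover = ↭-sym (↭-reflexive (trans (++-identityʳ (xs ++ [])) (++-identityʳ xs))) } , g)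
  rungs {s} {l} {r} {c} {d} {us} {R} {xs} {ys} (l′ ∷ ls) (r′ ∷ rs) len (e ◃ cl) (e′ ◃ cr) cx cy pxy g room =
    link (G-↭ ↭-refl tok g) (Room-≤ {us} z≤n room) >>= λ { (cs , lc , chord , g₁) →
    rungs {xs = ys ++ r′ ∷ reverse cs ++ l′ ∷ []} {ys = xs ++ l′ ∷ cs ++ r′ ∷ []} ls rs (suc-injective len) cl cr
      (chain-++ cy (e′ ◃ backwards chord)) (chain-++ cx (e ◃ chord))
      (↭-trans (++⁺ (↭-sym pxy) (↭-prep r′ (++⁺ʳ (l′ ∷ []) (↭-reverse cs)))) (permute 4 (λ x r c l → x ⊕ (r ⊕ (c ⊕ l)) ⊜ x ⊕ (l ⊕ (c ⊕ r))) ↭-refl xs (r′ ∷ []) cs (l′ ∷ [])))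
      (G-drop (tokens cs ++ l′ ∷ l′ ∷ r′ ∷ r′ ∷ []) (G-↭ ↭-refl (permute 6 (λ C L x S y R → C ⊕ (L ⊕ (x ⊕ (x ⊕ (S ⊕ (y ⊕ (y ⊕ R)))))) ⊜ (C ⊕ (x ⊕ (x ⊕ (y ⊕ y)))) ⊕ (L ⊕ (S ⊕ R))) ↭-refl (tokens cs) (tokens ls) (l′ ∷ []) (tokens rs) (r′ ∷ []) R) g₁))
      (Room-++ {us} cs lc room) >>= λ { (news , ln , f , g₂) →
    pure (news ++ cs , trans (length-++ news) (trans (cong₂ _+_ ln lc) (+-comm (length ls * p) p)) ,
      record { left = Fork.left f ; right = Fork.right f ; rest = Fork.rest f ; chainL = Fork.chainL f ; chainR = Fork.chainR f ; permL = Fork.permL f ; permR = Fork.permR f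
             ; cover = ↭-trans (Fork.cover f) (↭-trans (++⁺ʳ news (++⁺ʳ (ls ++ rs) (++⁺ (↭-sym pxy) (↭-prep r′ (++⁺ʳ (l′ ∷ []) (↭-reverse cs))))))
                 (permute 7 (λ x r c l L S n → ((x ⊕ (r ⊕ (c ⊕ l))) ⊕ (L ⊕ S)) ⊕ n ⊜ (x ⊕ ((l ⊕ L) ⊕ (r ⊕ S))) ⊕ (n ⊕ c)) ↭-refl xs (r′ ∷ []) cs (l′ ∷ []) ls rs news)) } ,
      G-↭ (permute 3 (λ a b c → a ⊕ (b ⊕ c) ⊜ (a ⊕ b) ⊕ c) ↭-refl news cs us) ↭-refl g₂) } }
    where
    tok : tokens (l′ ∷ ls) ++ tokens (r′ ∷ rs) ++ R ↭ l′ ∷ r′ ∷ (tokens ls ++ l′ ∷ l′ ∷ tokens rs ++ r′ ∷ r′ ∷ R)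
    tok = permute 5 (λ L x S y R → (x ⊕ (x ⊕ (x ⊕ L))) ⊕ ((y ⊕ (y ⊕ (y ⊕ S))) ⊕ R) ⊜ x ⊕ (y ⊕ (L ⊕ (x ⊕ (x ⊕ (S ⊕ (y ⊕ (y ⊕ R)))))))) ↭-refl (tokens ls) (l′ ∷ []) (tokens rs) (r′ ∷ []) R

  -- `pad` counts two rails of `p′` vertices and `p′` rungs of `p` vertices between them. The chain
  -- from the second input gets as many vertices, so that all wires have equal length.
  pad wire : ℕ
  pad = p′ * (2 + p)
  wire = suc pad

  record Wires (a b c d : Fin N) (news : List (Fin N)) : Set where
    field
      wa wb′ : List (Fin N)
      chain₁ : Chain a wa c
      chain₂ : Chain b wb′ d
      len₁   : length wa ≡ wire
      len₂   : length wb′ ≡ wire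
      covers : wa ++ wb′ ↭ news

  record Switch (a b : Fin N) (us R : List (Fin N)) : Set where
    field
      c d      : Fin N
      news     : List (Fin N)
      size     : length news ≡ wire + wire
      straight : Wires a b c d news
      crossed  : Wires a b d c news
      state    : G (news ++ us) (tokens (c ∷ d ∷ []) ++ R)

  -- A chain leads from `b` to some `e`, and two rails lead from `a` to `e`, with last vertices `c`
  -- and `d`. One wire zigzags from `a` over both rails and all rungs to `c` or to `d`, depending on
  -- the rail it enters first; the other wire runs from `b` to `e` and takes the free one of the
  -- two. Both settings cover the same vertices.
  switch : ∀ {a b us R} → G us (tokens (a ∷ b ∷ []) ++ R) → Room us (wire + wire) → NN (Switch a b us R)
  switch {a} {b} {us} {R} g room =
    chain-from pad {us} {b} {a ∷ a ∷ a ∷ R} (G-↭ ↭-refl (permute 3 (λ a b R → a ⊕ (a ⊕ (a ⊕ (b ⊕ (b ⊕ (b ⊕ R))))) ⊜ b ⊕ (b ⊕ (b ⊕ (a ⊕ (a ⊕ (a ⊕ R)))))) ↭-refl (a ∷ []) (b ∷ []) R) g)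
      (Room-≤ {us} (≤-trans (n≤1+n pad) (m≤m+n wire wire)) room) >>= λ { (bs , e , lb , cb , g₁) →
    let r₁ = Room-++ {us} {pad} {(p + (p + p′ * p))} bs lb (subst (Room us) (switch-arith t) room) in
    link (G-↭ ↭-refl (permute 3 (λ a e R → e ⊕ (e ⊕ (a ⊕ (a ⊕ (a ⊕ R)))) ⊜ a ⊕ (e ⊕ (a ⊕ (e ⊕ (a ⊕ R))))) ↭-refl (a ∷ []) (e ∷ []) R) g₁) (Room-≤ {bs ++ us} z≤n r₁) >>= λ { (ls , ll , cl , g₂) →
    let r₂ = Room-++ {bs ++ us} {p} {p + p′ * p} ls ll r₁ in
    link (G-↭ ↭-refl (permute 4 (λ a e T R → T ⊕ (a ⊕ (e ⊕ (a ⊕ R))) ⊜ a ⊕ (e ⊕ (T ⊕ (a ⊕ R)))) ↭-refl (a ∷ []) (e ∷ []) (tokens ls) R) g₂) (Room-≤ {ls ++ bs ++ us} z≤n r₂) >>= λ { (rs , lr , cr , g₃) →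
    let r₃ = Room-++ {ls ++ bs ++ us} {p} {p′ * p} rs lr r₂ in
    rails bs e lb cb ls rs ll lr cl cr g₃ r₃ } } }
    where
    half : ∀ t x → x ≡ 1 + (t + t) → x + x + x * (2 + (t + t)) ≡ (1 + (t + t)) * (2 + (2 + (t + t)))
    half t x refl = half-arith t
    rails : ∀ bs e → length bs ≡ pad → Chain b bs e → ∀ ls rs → length ls ≡ p → length rs ≡ p → Chain a (ls ++ e ∷ []) e → Chain a (rs ++ e ∷ []) e →
      G (rs ++ ls ++ bs ++ us) (tokens rs ++ (tokens ls ++ a ∷ R)) → Room (rs ++ ls ++ bs ++ us) (p′ * p) → NN (Switch a b us R)
    rails bs e lb cb ls rs ll lr cl cr g r with split-last ls ll | split-last rs lr
    ... | ls′ , c , refl , ll′ | rs′ , d , refl , lr′ with unsnoc (ls′ ++ c ∷ []) cl | unsnoc (rs′ ++ d ∷ []) cr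
    ...   | _ , cl′ , ec , _ | _ , cr′ , ed , _ with unsnoc ls′ cl′ | unsnoc rs′ cr′
    ...     | _ , _ , _ , refl | _ , _ , _ , refl =
      rungs {R = tokens (c ∷ d ∷ []) ++ R} ls′ rs′ (trans ll′ (sym lr′)) cl′ cr′ nil nil ↭-refl
        (G-drop (a ∷ []) (G-↭ ↭-refl tok g)) (subst (λ z → Room ((rs′ ++ d ∷ []) ++ (ls′ ++ c ∷ []) ++ bs ++ us) (z * p)) (sym ll′) r) >>= λ { (news , ln , f , g′) → pure (result news ln f g′) }
      where
      tok : tokens (rs′ ++ d ∷ []) ++ (tokens (ls′ ++ c ∷ []) ++ a ∷ R) ↭ (a ∷ []) ++ (tokens ls′ ++ tokens rs′ ++ tokens (c ∷ d ∷ []) ++ R)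
      tok rewrite tokens-++ rs′ (d ∷ []) | tokens-++ ls′ (c ∷ []) = permute 6 (λ L S c d a R → (S ⊕ (d ⊕ (d ⊕ d))) ⊕ ((L ⊕ (c ⊕ (c ⊕ c))) ⊕ (a ⊕ R)) ⊜ a ⊕ (L ⊕ (S ⊕ (c ⊕ (c ⊕ (c ⊕ (d ⊕ (d ⊕ (d ⊕ R))))))))) ↭-refl (tokens ls′) (tokens rs′) (c ∷ []) (d ∷ []) (a ∷ []) R
      result : ∀ news → length news ≡ length ls′ * p → Fork a c d (ls′ ++ rs′) news → G (news ++ ((rs′ ++ d ∷ []) ++ (ls′ ++ c ∷ []) ++ bs ++ us)) (tokens (c ∷ d ∷ []) ++ R) → Switch a b us R
      result news ln f g′ = record
        { c = c ; d = d ; news = all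
        ; size = trans (length-++ news) (trans (cong₂ _+_ (trans ln (cong (_* p) ll′)) (trans (length-++ (rs′ ++ d ∷ [])) (cong₂ _+_ lr (trans (length-++ (ls′ ++ c ∷ [])) (cong₂ _+_ ll lb))))) (switch-arith′ t))
        ; straight = record { wa = Fork.left f ; wb′ = bs ++ d ∷ [] ; chain₁ = Fork.chainL f ; chain₂ = chain-++ cb (trans (adj-sym e d) ed ◃ nil)
                            ; len₁ = trans (↭-length (Fork.permL f)) rest-len ; len₂ = blen d
                            ; covers = ↭-trans (++⁺ʳ (bs ++ d ∷ []) (↭-trans (Fork.permL f) (↭-prep c (Fork.cover f))))
                                (permute 6 (λ c d L S n B → (c ⊕ ((L ⊕ S) ⊕ n)) ⊕ (B ⊕ d) ⊜ n ⊕ ((S ⊕ d) ⊕ ((L ⊕ c) ⊕ B))) ↭-refl (c ∷ []) (d ∷ []) ls′ rs′ news bs) }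
        ; crossed = record { wa = Fork.right f ; wb′ = bs ++ c ∷ [] ; chain₁ = Fork.chainR f ; chain₂ = chain-++ cb (trans (adj-sym e c) ec ◃ nil)
                            ; len₁ = trans (↭-length (Fork.permR f)) rest-len ; len₂ = blen c
                            ; covers = ↭-trans (++⁺ʳ (bs ++ c ∷ []) (↭-trans (Fork.permR f) (↭-prep d (Fork.cover f))))
                                (permute 6 (λ c d L S n B → (d ⊕ ((L ⊕ S) ⊕ n)) ⊕ (B ⊕ c) ⊜ n ⊕ ((S ⊕ d) ⊕ ((L ⊕ c) ⊕ B))) ↭-refl (c ∷ []) (d ∷ []) ls′ rs′ news bs) }
        ; state = G-↭ (permute 5 (λ n S L B u → n ⊕ (S ⊕ (L ⊕ (B ⊕ u))) ⊜ (n ⊕ (S ⊕ (L ⊕ B))) ⊕ u) ↭-refl news (rs′ ++ d ∷ []) (ls′ ++ c ∷ []) bs us) ↭-refl g′ }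
        where
        all : List (Fin N)
        all = news ++ ((rs′ ++ d ∷ []) ++ (ls′ ++ c ∷ []) ++ bs)
        rest-len : suc (length (Fork.rest f)) ≡ wire
        rest-len = cong suc (trans (↭-length (Fork.cover f)) (trans (length-++ (ls′ ++ rs′)) (trans (cong₂ _+_ (trans (length-++ ls′) (cong (length ls′ +_) (trans lr′ (sym ll′)))) ln) (half t (length ls′) ll′))))
        blen : ∀ x → length (bs ++ x ∷ []) ≡ wire
        blen x = trans (length-++ bs) (trans (+-comm (length bs) 1) (cong suc lb))

-- Two fixpoint-free involutions of Bool × X, one of them negating the first component, admit a common proper 2-colouring.

module _ {X : Set} (_≟X_ : (x y : X) → Dec (x ≡ y)) where

  private
    E : Set
    E = Bool × X

  flip : E → E
  flip (b , x) = not b , x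

  module _ (x : X) (L : List X) (x∉L : x ∉ˡ L) (β : E → E)
           (closed : ∀ e → proj₂ e ∈ˡ x ∷ L → proj₂ (β e) ∈ˡ x ∷ L)
           (invol : ∀ e → proj₂ e ∈ˡ x ∷ L → β (β e) ≡ e)
           (free : ∀ e → proj₂ e ∈ˡ x ∷ L → β e ≢ e) where

    private
      -- `β` with the two points over `x` taken out: a partner over `x` is replaced by the partner
      -- of the other point over `x`. In the union of the two matchings this shortens an alternating
      -- cycle.
      β′ : E → E
      β′ e with proj₂ (β e) ≟X x
      ... | yes _ = β (flip (β e))
      ... | no _ = β e

      at-x : ∀ e → proj₂ e ≡ x → e ≡ (false , x) ⊎ e ≡ (true , x)
      at-x (false , _) refl = inj₁ refl
      at-x (true , _) refl = inj₂ refl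

      flip≢ : ∀ e → flip e ≢ e
      flip≢ (true , _) ()
      flip≢ (false , _) ()

      flip-at : ∀ {d e} → proj₂ d ≡ x → proj₂ e ≡ x → d ≢ e → d ≡ flip e
      flip-at {false , _} {false , _} refl refl h = ⊥-elim (h refl)
      flip-at {false , _} {true , _} refl refl h = refl
      flip-at {true , _} {false , _} refl refl h = refl
      flip-at {true , _} {true , _} refl refl h = ⊥-elim (h refl)

      not-x : ∀ {y} → y ∈ˡ L → y ≢ x
      not-x p refl = x∉L p

      in-L : ∀ {y} → y ∈ˡ x ∷ L → y ≢ x → y ∈ˡ L
      in-L (here e) h = ⊥-elim (h e)
      in-L (there p) h = p

      module Detour (e : E) (p : proj₂ e ∈ˡ L) (q : proj₂ (β e) ≡ x) where
        bx : proj₂ (flip (β e)) ∈ˡ x ∷ L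
        bx = here q
        away : proj₂ (β (flip (β e))) ≢ x
        away r = not-x p (trans (cong proj₂ (trans (sym (invol e (there p))) (cong β back))) r)
          where
          back : β e ≡ flip (β e)
          back = ⊥-elim (not-x p (trans (cong proj₂ (sym eq)) q))
            where
            eq : flip (β e) ≡ e
            eq = trans (sym (invol (flip (β e)) bx)) (trans (cong β (trans (flip-at r q (free (flip (β e)) bx)) (flip-flip (β e)))) (invol e (there p)))
              where
              flip-flip : ∀ d → flip (flip d) ≡ d
              flip-flip (true , _) = refl
              flip-flip (false , _) = refl

    closed′ : ∀ e → proj₂ e ∈ˡ L → proj₂ (β′ e) ∈ˡ L
    closed′ e p with proj₂ (β e) ≟X x
    ... | yes q = in-L (closed _ (Detour.bx e p q)) (Detour.away e p q)
    ... | no q = in-L (closed e (there p)) q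

    invol′ : ∀ e → proj₂ e ∈ˡ L → β′ (β′ e) ≡ e
    invol′ e p with proj₂ (β e) ≟X x
    invol′ e p | yes q with proj₂ (β (β (flip (β e)))) ≟X x
    ... | yes r = trans (cong (λ d → β (flip d)) (invol _ (here q))) (trans (cong β (flip-flip (β e))) (invol e (there p)))
      where
      flip-flip : ∀ d → flip (flip d) ≡ d
      flip-flip (true , _) = refl
      flip-flip (false , _) = refl
    ... | no r = ⊥-elim (r (trans (cong proj₂ (invol _ (here q))) q))
    invol′ e p | no q with proj₂ (β (β e)) ≟X x
    ... | yes r = ⊥-elim (not-x p (trans (cong proj₂ (sym (invol e (there p)))) r))
    ... | no r = invol e (there p)

    free′ : ∀ e → proj₂ e ∈ˡ L → β′ e ≢ e
    free′ e p eq with proj₂ (β e) ≟X x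
    ... | no q = free e (there p) eq
    ... | yes q = flip≢ (β e) (trans (sym (invol _ (here q))) (cong β eq))

    module _ (f : E → Bool) (ok : ∀ e → proj₂ e ∈ˡ L → f (flip e) ≡ not (f e) × f (β′ e) ≡ not (f e)) where

      private
        o i : E
        o = false , x
        i = true , x

        -- If `β` exchanges the two points over `x`, the colour of the first is arbitrary. Otherwise
        -- its partner forces it, and the partner of the second point agrees because `β′` pairs the
        -- two partners.
        f₀-of : Dec (proj₂ (β o) ≡ x) → Bool
        f₀-of (yes _) = false
        f₀-of (no _) = not (f (β o))

        f₀ : Bool
        f₀ = f₀-of (proj₂ (β o) ≟X x)

      colour : E → Bool
      colour (b , y) with y ≟X x
      ... | yes _ = b xor f₀
      ... | no _ = f (b , y)

      private
        colour-x : ∀ b → colour (b , x) ≡ b xor f₀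
        colour-x b with x ≟X x
        ... | yes _ = refl
        ... | no n = ⊥-elim (n refl)

        colour-L : ∀ e → proj₂ e ≢ x → colour e ≡ f e
        colour-L (b , y) n with y ≟X x
        ... | yes q = ⊥-elim (n q)
        ... | no _ = refl

        not-not : ∀ b → not (not b) ≡ b
        not-not true = refl
        not-not false = refl

        main-o′ : (d : Dec (proj₂ (β o) ≡ x)) → f₀ ≡ f₀-of d → colour (β o) ≡ not f₀ × colour (β i) ≡ f₀
        main-o′ (yes q) eq = trans (cong colour βo) (colour-x true) , trans (cong colour βi) (colour-x false)
          where
          βo : β o ≡ i
          βo = flip-at q refl (free o (here refl))
          βi : β i ≡ o
          βi = trans (cong β (sym βo)) (invol o (here refl))
        main-o′ (no q) eq = trans (colour-L (β o) q) (trans (sym (not-not _)) (cong not (sym eq))) ,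
                            trans (colour-L (β i) r) (trans (trans (cong f (sym β′u)) (proj₂ (ok (β o) (in-L (closed o (here refl)) q)))) (sym eq))
          where
          r : proj₂ (β i) ≢ x
          r e = q (cong proj₂ (trans (cong β (sym (flip-at {β i} {i} e refl (free i (here refl))))) (invol i (here refl))))
          β′u : β′ (β o) ≡ β i
          β′u with proj₂ (β (β o)) ≟X x
          ... | yes _ = cong (λ d → β (flip d)) (invol o (here refl))
          ... | no n = ⊥-elim (n (cong proj₂ (invol o (here refl))))

        main-o : colour (β o) ≡ not f₀ × colour (β i) ≡ f₀
        main-o = main-o′ (proj₂ (β o) ≟X x) refl

        f₀-spec : colour o ≡ f₀ × colour i ≡ not f₀
        f₀-spec = colour-x false , colour-x true

      colour-ok : ∀ e → proj₂ e ∈ˡ x ∷ L → colour (flip e) ≡ not (colour e) × colour (β e) ≡ not (colour e)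
      colour-ok (false , y) (here refl) = trans (proj₂ f₀-spec) (cong not (sym (proj₁ f₀-spec))) , trans (proj₁ main-o) (cong not (sym (proj₁ f₀-spec)))
      colour-ok (true , y) (here refl) = trans (proj₁ f₀-spec) (trans (sym (not-not f₀)) (cong not (sym (proj₂ f₀-spec)))) ,
                                         trans (proj₂ main-o) (trans (sym (not-not f₀)) (cong not (sym (proj₂ f₀-spec))))
      colour-ok e@(b , y) (there p) = trans (colour-L (flip e) (not-x p)) (trans (proj₁ (ok e p)) (cong not (sym (colour-L e (not-x p))))) , second (proj₂ (β e) ≟X x)
        where
        second : Dec (proj₂ (β e) ≡ x) → colour (β e) ≡ not (colour e)
        second (no q) = trans (colour-L (β e) q) (trans (trans (cong f (sym (β′-no q))) (proj₂ (ok e p))) (cong not (sym (colour-L e (not-x p)))))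
          where
          β′-no : proj₂ (β e) ≢ x → β′ e ≡ β e
          β′-no q with proj₂ (β e) ≟X x
          ... | yes r = ⊥-elim (q r)
          ... | no _ = refl
        second (yes q) with at-x (β e) q
        ...   | inj₁ βe = trans (cong colour βe) (trans (proj₁ f₀-spec) (trans (sym (not-not f₀)) (cong not (trans (sym (proj₁ main-o)) (cong colour (trans (cong β (sym βe)) (invol e (there p))))))))
        ...   | inj₂ βe = trans (cong colour βe) (trans (proj₂ f₀-spec) (cong not (trans (sym (proj₂ main-o)) (cong colour (trans (cong β (sym βe)) (invol e (there p)))))))

  two-colouring : ∀ L → Unique L → (β : E → E) → (∀ e → proj₂ e ∈ˡ L → proj₂ (β e) ∈ˡ L) → (∀ e → proj₂ e ∈ˡ L → β (β e) ≡ e) →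
    (∀ e → proj₂ e ∈ˡ L → β e ≢ e) → Σ (E → Bool) λ f → ∀ e → proj₂ e ∈ˡ L → f (flip e) ≡ not (f e) × f (β e) ≡ not (f e)
  two-colouring [] u β c i r = (λ _ → false) , λ e ()
  two-colouring (x ∷ L) (h ∷ u) β c i r =
    let x∉ = λ p → All-lookup h p refl
        f , ok = two-colouring L u _ (closed′ x L x∉ β c i r) (invol′ x L x∉ β c i r) (free′ x L x∉ β c i r)
    in colour x L x∉ β c i r f ok , colour-ok x L x∉ β c i r f ok

-- Beneš networks

Ix : ℕ → Set
Ix zero = ⊤
Ix (suc q) = Bool × Ix q

_≟Ix_ : ∀ {q} (i j : Ix q) → Dec (i ≡ j)
_≟Ix_ {zero} i j = yes refl
_≟Ix_ {suc q} (b , i) (c , j) with b ≟ᵇ c | i ≟Ix j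
... | yes refl | yes refl = yes refl
... | no n | _ = no λ e → n (cong proj₁ e)
... | yes _ | no n = no λ e → n (cong proj₂ e)

ixs : ∀ q → List (Ix q)
ixs zero = tt ∷ []
ixs (suc q) = map (false ,_) (ixs q) ++ map (true ,_) (ixs q)

Unique-map : ∀ {A B : Set} (f : A → B) → (∀ {x y} → f x ≡ f y → x ≡ y) → ∀ {xs} → Unique xs → Unique (map f xs)
Unique-map f inj [] = []
Unique-map f inj {x ∷ xs} (h ∷ u) = All-tabulate (λ q e → bad (∈-map⁻ f q) e) ∷ Unique-map f inj u
  where
  bad : ∀ {z} → Σ _ (λ y → y ∈ˡ xs × z ≡ f y) → f x ≡ z → ⊥
  bad (y , p , refl) e = All-lookup h p (inj e)

ixs-all : ∀ {q} (i : Ix q) → i ∈ˡ ixs q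
ixs-all {zero} tt = here refl
ixs-all {suc q} (false , i) = ∈-++⁺ˡ (∈-map⁺ (false ,_) (ixs-all i))
ixs-all {suc q} (true , i) = ∈-++⁺ʳ (map (false ,_) (ixs q)) (∈-map⁺ (true ,_) (ixs-all i))

ixs-unique : ∀ q → Unique (ixs q)
ixs-unique zero = [] ∷ []
ixs-unique (suc q) = Unique-++ (Unique-map (false ,_) (λ { refl → refl }) (ixs-unique q)) (Unique-map (true ,_) (λ { refl → refl }) (ixs-unique q))
  λ p r → clash (∈-map⁻ (false ,_) p) (∈-map⁻ (true ,_) r)
  where
  clash : ∀ {v} → Σ (Ix q) (λ y → y ∈ˡ ixs q × v ≡ (false , y)) → Σ (Ix q) (λ y → y ∈ˡ ixs q × v ≡ (true , y)) → ⊥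
  clash (_ , _ , refl) (_ , _ , ())

record Perm (q : ℕ) : Set where
  field
    to from : Ix q → Ix q
    from-to : ∀ i → from (to i) ≡ i
    to-from : ∀ i → to (from i) ≡ i
open Perm

xor-cancel : ∀ c s → (c xor s) xor s ≡ c
xor-cancel true true = refl
xor-cancel true false = refl
xor-cancel false true = refl
xor-cancel false false = refl

-- `s₁` and `s₂` set the switches of the first and the last layer, and `sub c` is the permutation
-- left to the subnetwork `c`.
record Beneš {q} (π : Perm (suc q)) : Set where
  field
    s₁ s₂ : Ix q → Bool
    sub   : Bool → Perm q
    spec  : ∀ b x → let c = b xor s₁ x in to π (b , x) ≡ (c xor s₂ (to (sub c) x) , to (sub c) x)

opaque
  -- The looping argument: the two inputs of a first switch, and likewise the two inputs routed to
  -- the same last switch, must use different subnetworks. These are two fixpoint-free involutions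
  -- on the inputs, `flip` and its conjugate by `π`; a common proper 2-colouring names the
  -- subnetwork of every input.
  beneš : ∀ {q} (π : Perm (suc q)) → Beneš π
  beneš {q} π with two-colouring _≟Ix_ (ixs q) (ixs-unique q) (λ e → from π (flip _≟Ix_ (to π e))) (λ e _ → ixs-all _)
                     (λ e _ → trans (cong (λ z → from π (flip _≟Ix_ z)) (to-from π _)) (trans (cong (from π) (flip-flip (to π e))) (from-to π e)))
                     (λ e _ eq → flip≢ (to π e) (trans (sym (to-from π _)) (cong (to π) eq)))
    where
    flip-flip : ∀ (d : Bool × Ix q) → flip _≟Ix_ (flip _≟Ix_ d) ≡ d
    flip-flip (true , _) = refl
    flip-flip (false , _) = refl
    flip≢ : ∀ (d : Bool × Ix q) → flip _≟Ix_ d ≢ d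
    flip≢ (true , _) ()
    flip≢ (false , _) ()
  ... | f , ok = record { s₁ = s₁ ; s₂ = s₂ ; sub = sub ; spec = spec }
    where
    s₁ s₂ : Ix q → Bool
    s₁ x = f (false , x)
    s₂ y = f (from π (false , y))
    f-in : ∀ b x → f (b , x) ≡ b xor s₁ x
    f-in false x = refl
    f-in true x = proj₁ (ok (false , x) (ixs-all x))
    f-out : ∀ b y → f (from π (b , y)) ≡ b xor s₂ y
    f-out false y = refl
    f-out true y = trans (cong (λ z → f (from π (flip _≟Ix_ z))) (sym (to-from π (false , y)))) (proj₂ (ok (from π (false , y)) (ixs-all _)))
    fwd bwd : Bool → Ix q → Ix q
    fwd c x = proj₂ (to π (c xor s₁ x , x))
    bwd c y = proj₂ (from π (c xor s₂ y , y))
    move : ∀ {c d s} → c ≡ d xor s → d ≡ c xor s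
    move {d = d} {s} refl = sym (xor-cancel d s)
    bwd-bit : ∀ c y → from π (c xor s₂ y , y) ≡ (c xor s₁ (bwd c y) , bwd c y)
    bwd-bit c y = cong (_, bwd c y) (move (trans (sym (trans (f-out (c xor s₂ y) y) (xor-cancel c (s₂ y)))) (f-in (proj₁ e) (proj₂ e))))
      where
      e : Bool × Ix q
      e = from π (c xor s₂ y , y)
    fwd-bit : ∀ c x → to π (c xor s₁ x , x) ≡ (c xor s₂ (fwd c x) , fwd c x)
    fwd-bit c x = cong (_, fwd c x) (move (trans (sym (trans (f-in (c xor s₁ x) x) (xor-cancel c (s₁ x)))) (trans (cong f (sym (from-to π _))) (f-out (proj₁ e) (proj₂ e)))))
      where
      e : Bool × Ix q
      e = to π (c xor s₁ x , x)
    sub : Bool → Perm q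
    sub c = record
      { to = fwd c ; from = bwd c
      ; from-to = λ x → cong proj₂ (trans (cong (from π) (sym (fwd-bit c x))) (from-to π _))
      ; to-from = λ y → cong proj₂ (trans (cong (to π) (sym (bwd-bit c y))) (to-from π _)) }
    spec : ∀ b x → to π (b , x) ≡ ((b xor s₁ x) xor s₂ (fwd (b xor s₁ x) x) , fwd (b xor s₁ x) x)
    spec b x = trans (cong (λ z → to π (z , x)) (sym (xor-cancel b (s₁ x)))) (fwd-bit (b xor s₁ x) x)

cat-length-arith : ∀ a h → a * h + a * h ≡ (a + (a + 0)) * h
cat-length-arith = solve-∀

module _ {N : ℕ} where

  cat : ∀ q → (Ix q → List (Fin N)) → List (Fin N)
  cat zero P = P tt
  cat (suc q) P = cat q (λ i → P (false , i)) ++ cat q (λ i → P (true , i))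

  cat-cong : ∀ q {P Q} → (∀ i → P i ↭ Q i) → cat q P ↭ cat q Q
  cat-cong zero h = h tt
  cat-cong (suc q) h = ++⁺ (cat-cong q λ i → h (false , i)) (cat-cong q λ i → h (true , i))

  cat-++ : ∀ q P Q → cat q (λ i → P i ++ Q i) ↭ cat q P ++ cat q Q
  cat-++ zero P Q = ↭-refl
  cat-++ (suc q) P Q = ↭-trans (++⁺ (cat-++ q _ _) (cat-++ q _ _))
    (permute 4 (λ a b c d → (a ⊕ b) ⊕ (c ⊕ d) ⊜ (a ⊕ c) ⊕ (b ⊕ d)) ↭-refl (cat q λ i → P (false , i)) (cat q λ i → Q (false , i)) (cat q λ i → P (true , i)) (cat q λ i → Q (true , i)))

  cat-length : ∀ q {P h} → (∀ i → length (P i) ≡ h) → length (cat q P) ≡ 2 ^ q * h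
  cat-length zero {h = h} e = trans (e tt) (sym (+-identityʳ h))
  cat-length (suc q) {P} {h} e = trans (length-++ (cat q λ i → P (false , i))) (trans (cong₂ _+_ (cat-length q λ i → e (false , i)) (cat-length q λ i → e (true , i))) (cat-length-arith (2 ^ q) h))

  cat-switch : ∀ q (P : Bool → Ix q → List (Fin N)) (s : Ix q → Bool) → cat q (λ x → P (s x) x) ++ cat q (λ x → P (not (s x)) x) ↭ cat q (P false) ++ cat q (P true)
  cat-switch q P s = ↭-trans (↭-sym (cat-++ q _ _)) (↭-trans (cat-cong q λ x → either (s x) x) (cat-++ q _ _))
    where
    either : ∀ b x → P b x ++ P (not b) x ↭ P false x ++ P true x
    either false x = ↭-refl
    either true x = ++-comm (P true x) (P false x)

  -- The decomposition of `π` serves here too: it reduces the claim to two permutations of half the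
  -- size and two layers of exchanges.
  cat-perm : ∀ q (π : Perm q) P → cat q (λ i → P (to π i)) ↭ cat q P
  cat-perm zero π P = ↭-refl
  cat-perm (suc q) π P = ↭-trans (++⁺ (cat-cong q λ x → ↭-reflexive (cong P (spec false x))) (cat-cong q λ x → ↭-reflexive (cong P (spec true x))))
    (↭-trans (cat-switch q (λ c x → P (c xor s₂ (to (sub c) x) , to (sub c) x)) s₁)
    (↭-trans (++⁺ (cat-perm q (sub false) λ y → P (s₂ y , y)) (cat-perm q (sub true) λ y → P (not (s₂ y) , y)))
             (cat-switch q (λ b y → P (b , y)) s₂)))
    where open Beneš (beneš π)

  tk : ∀ q → (Ix q → Fin N) → List (Fin N)
  tk zero f = tokens (f tt ∷ [])
  tk (suc q) f = tk q (λ i → f (false , i)) ++ tk q (λ i → f (true , i))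

-- Beneš networks made of paths

depthOf : ℕ → ℕ → ℕ
depthOf w zero = 0
depthOf w (suc q) = w + (depthOf w q + w)

layer-arith : ∀ a h → (a + (a + 0)) * h ≡ a * h + a * h
layer-arith = solve-∀

network-arith : ∀ a w d → (a + (a + 0)) * (w + (d + w)) ≡ a * (w + w) + (a * d + (a * d + a * (w + w)))
network-arith = solve-∀

result-arith′ : ∀ a w d → a * (w + w) + (a * d + (a * d + a * (w + w))) ≡ (a + (a + 0)) * (w + (d + w))
result-arith′ = solve-∀

module Networks {N : ℕ} (adj : Fin N → Fin N → Bool) (host : Host adj) (edge : Linking adj (Host.U host) (Host.M host)) (t : ℕ) (M≤2^t : Host.M host ≤ 2 ^ t) where

  open Host host
  open Paths adj
  open Switching adj host edge t M≤2^t public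

  record Layer (q : ℕ) (ins : Bool → Ix q → Fin N) (us R : List (Fin N)) : Set where
    field
      outs  : Bool → Ix q → Fin N
      news  : List (Fin N)
      size  : length news ≡ 2 ^ q * (wire + wire)
      state : G (news ++ us) (tk q (outs false) ++ (tk q (outs true) ++ R))
      wires : ∀ (s : Ix q → Bool) → Σ (Bool → Ix q → List (Fin N)) λ W →
              (∀ b i → Chain (ins b i) (W b i) (outs (b xor s i) i) × length (W b i) ≡ wire) × cat q (W false) ++ cat q (W true) ↭ news

  layer : ∀ q {ins us R} → G us (tk q (ins false) ++ (tk q (ins true) ++ R)) → Room us (2 ^ q * (wire + wire)) → NN (Layer q ins us R)
  layer zero {ins} {us} {R} g room = switch g (subst (Room us) (+-identityʳ (wire + wire)) room) >>= λ S → let open Switch S in pure record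
    { outs = λ b _ → if b then d else c ; news = news ; size = trans size (sym (+-identityʳ _)) ; state = state
    ; wires = λ s → zero-wires S (s tt) }
    where
    zero-wires : (S : Switch (ins false tt) (ins true tt) us R) → ∀ b → Σ (Bool → ⊤ → List (Fin N)) λ W →
      (∀ b′ i → Chain (ins b′ i) (W b′ i) (if b′ xor b then Switch.d S else Switch.c S) × length (W b′ i) ≡ wire) × W false tt ++ W true tt ↭ Switch.news S
    zero-wires S false = let open Wires (Switch.straight S) in (λ b _ → if b then wb′ else wa) , (λ { false _ → chain₁ , len₁ ; true _ → chain₂ , len₂ }) , covers
    zero-wires S true = let open Wires (Switch.crossed S) in (λ b _ → if b then wb′ else wa) , (λ { false _ → chain₁ , len₁ ; true _ → chain₂ , len₂ }) , covers
  layer (suc q) {ins} {us} {R} g room =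
    layer q {λ b i → ins b (false , i)} {us} {tk q (λ i → ins false (true , i)) ++ (tk q (λ i → ins true (true , i)) ++ R)}
      (G-↭ ↭-refl (permute 5 (λ a b c d e → (a ⊕ b) ⊕ ((c ⊕ d) ⊕ e) ⊜ a ⊕ (c ⊕ (b ⊕ (d ⊕ e)))) ↭-refl (tk q λ i → ins false (false , i)) (tk q λ i → ins false (true , i)) (tk q λ i → ins true (false , i)) (tk q λ i → ins true (true , i)) R) g)
      (Room-≤ {us} (m≤m+n _ _) room′) >>= λ L₀ →
    layer q {λ b i → ins b (true , i)} {Layer.news L₀ ++ us} {tk q (Layer.outs L₀ false) ++ (tk q (Layer.outs L₀ true) ++ R)}
      (G-↭ ↭-refl (permute 5 (λ a b c d e → a ⊕ (b ⊕ (c ⊕ (d ⊕ e))) ⊜ c ⊕ (d ⊕ (a ⊕ (b ⊕ e)))) ↭-refl (tk q (Layer.outs L₀ false)) (tk q (Layer.outs L₀ true)) (tk q λ i → ins false (true , i)) (tk q λ i → ins true (true , i)) R) (Layer.state L₀))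
      (Room-++ {us} (Layer.news L₀) (Layer.size L₀) room′) >>= λ L₁ → pure record
    { outs = λ { b (false , i) → Layer.outs L₀ b i ; b (true , i) → Layer.outs L₁ b i }
    ; news = Layer.news L₁ ++ Layer.news L₀
    ; size = trans (length-++ (Layer.news L₁)) (trans (cong₂ _+_ (Layer.size L₁) (Layer.size L₀)) (sym (layer-arith (2 ^ q) (wire + wire))))
    ; state = G-↭ (permute 3 (λ a b c → a ⊕ (b ⊕ c) ⊜ (a ⊕ b) ⊕ c) ↭-refl (Layer.news L₁) (Layer.news L₀) us)
        (permute 5 (λ a b c d e → c ⊕ (d ⊕ (a ⊕ (b ⊕ e))) ⊜ (a ⊕ c) ⊕ ((b ⊕ d) ⊕ e)) ↭-refl (tk q (Layer.outs L₀ false)) (tk q (Layer.outs L₀ true)) (tk q (Layer.outs L₁ false)) (tk q (Layer.outs L₁ true)) R) (Layer.state L₁)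
    ; wires = λ s → let W₀ , c₀ , p₀ = Layer.wires L₀ (λ i → s (false , i))
                        W₁ , c₁ , p₁ = Layer.wires L₁ (λ i → s (true , i))
                    in (λ { b (false , i) → W₀ b i ; b (true , i) → W₁ b i }) , (λ { b (false , i) → c₀ b i ; b (true , i) → c₁ b i }) ,
                       ↭-trans (permute 4 (λ a b c d → (a ⊕ b) ⊕ (c ⊕ d) ⊜ (b ⊕ d) ⊕ (a ⊕ c)) ↭-refl (cat q (W₀ false)) (cat q (W₁ false)) (cat q (W₀ true)) (cat q (W₁ true))) (++⁺ p₁ p₀) }
    where
    room′ : Room us (2 ^ q * (wire + wire) + 2 ^ q * (wire + wire))
    room′ = subst (Room us) (layer-arith (2 ^ q) (wire + wire)) room

  depth : ℕ → ℕ
  depth = depthOf wire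

  -- `π` comes after `outs` and `news`: the vertices are fixed before the permutation is known, and
  -- neither the set that is covered nor the lengths of the routes depend on it.
  record Network (q : ℕ) (ins : Ix q → Fin N) (us R : List (Fin N)) : Set where
    field
      outs  : Ix q → Fin N
      news  : List (Fin N)
      size  : length news ≡ 2 ^ q * depth q
      state : G (news ++ us) (tk q outs ++ R)
      route : ∀ (π : Perm q) → Σ (Ix q → List (Fin N)) λ P → (∀ i → Chain (ins i) (P i) (outs (to π i)) × length (P i) ≡ depth q) × cat q P ↭ news

  network : ∀ q {ins us R} → G us (tk q ins ++ R) → Room us (2 ^ q * depth q) → NN (Network q ins us R)
  network zero {ins} {us} {R} g room = pure base
    where
    base : Network zero ins us R
    base = record { outs = ins ; news = [] ; size = refl ; state = g ; route = λ π → (λ _ → []) , (λ _ → nil , refl) , ↭-refl }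
  network (suc q) {ins} {us} {R} g room =
    layer q {λ b i → ins (b , i)} {us} {R} (G-↭ ↭-refl (↭-reflexive (++-assoc (tk q λ i → ins (false , i)) _ R)) g) (Room-≤ {us} (m≤m+n _ _) room′) >>= λ L₁ →
    let r₁ = Room-++ {us} (Layer.news L₁) (Layer.size L₁) room′ in
    network q {Layer.outs L₁ false} {Layer.news L₁ ++ us} {tk q (Layer.outs L₁ true) ++ R} (Layer.state L₁) (Room-≤ {Layer.news L₁ ++ us} (m≤m+n _ _) r₁) >>= λ N₀ →
    let r₂ = Room-++ {Layer.news L₁ ++ us} (Network.news N₀) (Network.size N₀) r₁ in
    network q {Layer.outs L₁ true} {Network.news N₀ ++ (Layer.news L₁ ++ us)} {tk q (Network.outs N₀) ++ R}
      (G-↭ ↭-refl (permute 3 (λ a b c → a ⊕ (b ⊕ c) ⊜ b ⊕ (a ⊕ c)) ↭-refl (tk q (Network.outs N₀)) (tk q (Layer.outs L₁ true)) R) (Network.state N₀)) (Room-≤ {Network.news N₀ ++ (Layer.news L₁ ++ us)} (m≤m+n _ _) r₂) >>= λ N₁ →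
    let r₃ = Room-++ {Network.news N₀ ++ (Layer.news L₁ ++ us)} (Network.news N₁) (Network.size N₁) r₂ in
    layer q {λ b → if b then Network.outs N₁ else Network.outs N₀} {Network.news N₁ ++ (Network.news N₀ ++ (Layer.news L₁ ++ us))} {R}
      (G-↭ ↭-refl (permute 3 (λ a b c → a ⊕ (b ⊕ c) ⊜ b ⊕ (a ⊕ c)) ↭-refl (tk q (Network.outs N₁)) (tk q (Network.outs N₀)) R) (Network.state N₁)) r₃ >>= λ L₂ →
    pure (result L₁ N₀ N₁ L₂)
    where
    room′ : Room us (2 ^ q * (wire + wire) + (2 ^ q * depth q + (2 ^ q * depth q + 2 ^ q * (wire + wire))))
    room′ = subst (Room us) (network-arith (2 ^ q) wire (depth q)) room
    result : (L₁ : Layer q (λ b i → ins (b , i)) us R) →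
      (N₀ : Network q (Layer.outs L₁ false) (Layer.news L₁ ++ us) (tk q (Layer.outs L₁ true) ++ R)) →
      (N₁ : Network q (Layer.outs L₁ true) (Network.news N₀ ++ (Layer.news L₁ ++ us)) (tk q (Network.outs N₀) ++ R)) →
      (L₂ : Layer q (λ b → if b then Network.outs N₁ else Network.outs N₀) (Network.news N₁ ++ (Network.news N₀ ++ (Layer.news L₁ ++ us))) R) →
      Network (suc q) ins us R
    result L₁ N₀ N₁ L₂ = record
      { outs = λ { (b , i) → Layer.outs L₂ b i }
      ; news = n₂ ++ (m₁ ++ (m₀ ++ n₁))
      ; size = trans (length-++ n₂) (trans (cong₂ _+_ (Layer.size L₂) (trans (length-++ m₁) (cong₂ _+_ (Network.size N₁) (trans (length-++ m₀) (cong₂ _+_ (Network.size N₀) (Layer.size L₁)))))) (result-arith′ (2 ^ q) wire (depth q)))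
      ; state = G-↭ (permute 5 (λ a b c d e → a ⊕ (b ⊕ (c ⊕ (d ⊕ e))) ⊜ (a ⊕ (b ⊕ (c ⊕ d))) ⊕ e) ↭-refl n₂ m₁ m₀ n₁ us)
          (↭-reflexive (sym (++-assoc (tk q (Layer.outs L₂ false)) _ R))) (Layer.state L₂)
      ; route = route }
      where
      n₁ n₂ m₀ m₁ : List (Fin N)
      n₁ = Layer.news L₁
      n₂ = Layer.news L₂
      m₀ = Network.news N₀
      m₁ = Network.news N₁
      route : ∀ (π : Perm (suc q)) → Σ (Ix (suc q) → List (Fin N)) λ P →
        (∀ i → Chain (ins i) (P i) (Layer.outs L₂ (proj₁ (to π i)) (proj₂ (to π i))) × length (P i) ≡ depth (suc q)) × cat (suc q) P ↭ n₂ ++ (m₁ ++ (m₀ ++ n₁))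
      route π = P , (λ i → chains (proj₁ i) (proj₂ i)) , covers
        where
        open Beneš (beneš π)
        W₁ = Layer.wires L₁ s₁
        W₂ = Layer.wires L₂ s₂
        V₀ = Network.route N₀ (sub false)
        V₁ = Network.route N₁ (sub true)
        mid : Bool → Ix q → List (Fin N)
        mid false = proj₁ V₀
        mid true = proj₁ V₁
        tail : Bool → Ix q → List (Fin N)
        tail c x = mid c x ++ proj₁ W₂ c (to (sub c) x)
        P : Ix (suc q) → List (Fin N)
        P (b , x) = proj₁ W₁ b x ++ tail (b xor s₁ x) x
        mid-ok : ∀ c x → Chain (Layer.outs L₁ c x) (mid c x) ((if c then Network.outs N₁ else Network.outs N₀) (to (sub c) x)) × length (mid c x) ≡ depth q
        mid-ok false x = proj₁ (proj₂ V₀) x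
        mid-ok true x = proj₁ (proj₂ V₁) x
        chains : ∀ b x → Chain (ins (b , x)) (P (b , x)) (Layer.outs L₂ (proj₁ (to π (b , x))) (proj₂ (to π (b , x)))) × length (P (b , x)) ≡ depth (suc q)
        chains b x = let c = b xor s₁ x ; y = to (sub c) x in
          subst (λ z → Chain (ins (b , x)) (P (b , x)) (Layer.outs L₂ (proj₁ z) (proj₂ z))) (sym (spec b x))
            (chain-++ (proj₁ (proj₁ (proj₂ W₁) b x)) (chain-++ (proj₁ (mid-ok c x)) (proj₁ (proj₁ (proj₂ W₂) c y)))) ,
          trans (length-++ (proj₁ W₁ b x)) (cong₂ _+_ (proj₂ (proj₁ (proj₂ W₁) b x)) (trans (length-++ (mid c x)) (cong₂ _+_ (proj₂ (mid-ok c x)) (proj₂ (proj₁ (proj₂ W₂) c y)))))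
        halves : ∀ c → cat q (tail c) ↭ cat q (mid c) ++ cat q (proj₁ W₂ c)
        halves c = ↭-trans (cat-++ q (mid c) (λ x → proj₁ W₂ c (to (sub c) x))) (++⁺ˡ (cat q (mid c)) (cat-perm q (sub c) (proj₁ W₂ c)))
        covers : cat (suc q) P ↭ n₂ ++ (m₁ ++ (m₀ ++ n₁))
        covers = ↭-trans (++⁺ (cat-++ q (proj₁ W₁ false) (λ x → tail (s₁ x) x)) (cat-++ q (proj₁ W₁ true) (λ x → tail (not (s₁ x)) x)))
          (↭-trans (permute 4 (λ a b c d → (a ⊕ b) ⊕ (c ⊕ d) ⊜ (a ⊕ c) ⊕ (b ⊕ d)) ↭-refl (cat q (proj₁ W₁ false)) (cat q (λ x → tail (s₁ x) x)) (cat q (proj₁ W₁ true)) (cat q (λ x → tail (not (s₁ x)) x)))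
          (↭-trans (++⁺ (proj₂ (proj₂ W₁)) (↭-trans (cat-switch q tail s₁) (++⁺ (halves false) (halves true))))
          (↭-trans (permute 5 (λ n a b c d → n ⊕ ((a ⊕ b) ⊕ (c ⊕ d)) ⊜ (b ⊕ d) ⊕ (c ⊕ (a ⊕ n))) ↭-refl n₁ (cat q (mid false)) (cat q (proj₁ W₂ false)) (cat q (mid true)) (cat q (proj₁ W₂ true)))
            (++⁺ (proj₂ (proj₂ W₂)) (++⁺ (proj₂ (proj₂ V₁)) (++⁺ʳ n₁ (proj₂ (proj₂ V₀))))))))

-- Rooted trees whose edges to children come in three kinds: ordinary ones, long paths with prescribed interior vertices,
-- and pendant leaves that are to be embedded last.

module _ {n : ℕ} where

  mutual
    data Tr : Set where
      node : Fin n → Fo → Tr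

    data Fo : Set where
      tip   : Fo
      short : Tr → Fo → Fo
      long  : List (Fin n) → Tr → Fo → Fo
      pend  : Fin n → Fo → Fo

  root : Tr → Fin n
  root (node v f) = v

  mutual
    verts : Tr → List (Fin n)
    verts (node v f) = v ∷ vertsF f

    vertsF : Fo → List (Fin n)
    vertsF tip = []
    vertsF (short t f) = verts t ++ vertsF f
    vertsF (long ps t f) = ps ++ verts t ++ vertsF f
    vertsF (pend v f) = v ∷ vertsF f

  links : Fin n → List (Fin n) → Fin n → List (Fin n × Fin n)
  links u [] v = (u , v) ∷ []
  links u (p ∷ ps) v = (u , p) ∷ links p ps v

  mutual
    edges : Tr → List (Fin n × Fin n)
    edges (node v f) = edgesF v f

    edgesF : Fin n → Fo → List (Fin n × Fin n)
    edgesF u tip = []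
    edgesF u (short t f) = (u , root t) ∷ edges t ++ edgesF u f
    edgesF u (long ps t f) = links u ps (root t) ++ edges t ++ edgesF u f
    edgesF u (pend v f) = (u , v) ∷ edgesF u f

  width : Fo → ℕ
  width tip = 0
  width (short t f) = suc (width f)
  width (long ps t f) = suc (width f)
  width (pend v f) = suc (width f)

  mutual
    Narrow : ℕ → Tr → Set
    Narrow Δ (node v f) = width f ≤ Δ × NarrowF Δ f

    NarrowF : ℕ → Fo → Set
    NarrowF Δ tip = ⊤
    NarrowF Δ (short t f) = Narrow Δ t × NarrowF Δ f
    NarrowF Δ (long ps t f) = Narrow Δ t × NarrowF Δ f
    NarrowF Δ (pend v f) = NarrowF Δ f

  mutual
    Plain : Tr → Set
    Plain (node v f) = PlainF f

    PlainF : Fo → Set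
    PlainF tip = ⊤
    PlainF (short t f) = Plain t × PlainF f
    PlainF (long ps t f) = ⊥
    PlainF (pend v f) = ⊥

  module _ (p x : Fin n) where

    mutual
      attach : Tr → Tr
      attach (node v f) with v ≟ p
      ... | yes _ = node v (short (node x tip) f)
      ... | no _ = node v (attachF f)

      attachF : Fo → Fo
      attachF tip = tip
      attachF (short t f) = short (attach t) (attachF f)
      attachF (long ps t f) = long ps t f
      attachF (pend v f) = pend v f

    root-attach : ∀ t → root (attach t) ≡ root t
    root-attach (node v f) with v ≟ p
    ... | yes _ = refl
    ... | no _ = refl

    mutual
      attach-∉ : ∀ t → p ∉ˡ verts t → attach t ≡ t
      attach-∉ (node v f) h with v ≟ p
      ... | yes e = ⊥-elim (h (here (sym e)))
      ... | no _ = cong (node v) (attachF-∉ f (λ q → h (there q)))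

      attachF-∉ : ∀ f → p ∉ˡ vertsF f → attachF f ≡ f
      attachF-∉ tip h = refl
      attachF-∉ (short t f) h = cong₂ short (attach-∉ t (λ q → h (∈-++⁺ˡ q))) (attachF-∉ f (λ q → h (∈-++⁺ʳ (verts t) q)))
      attachF-∉ (long ps t f) h = refl
      attachF-∉ (pend v f) h = refl

    mutual
      attach-plain : ∀ t → Plain t → Plain (attach t)
      attach-plain (node v f) h with v ≟ p
      ... | yes _ = tt , h
      ... | no _ = attachF-plain f h

      attachF-plain : ∀ f → PlainF f → PlainF (attachF f)
      attachF-plain tip h = tt
      attachF-plain (short t f) (h , k) = attach-plain t h , attachF-plain f k

    mutual
      attach-verts : ∀ t → Plain t → Unique (verts t) → p ∈ˡ verts t → verts (attach t) ↭ x ∷ verts t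
      attach-verts (node v f) pl (h ∷ u) q with v ≟ p
      ... | yes _ = ↭-swap v x ↭-refl
      ... | no ne with q
      ...   | here e = ⊥-elim (ne (sym e))
      ...   | there r = ↭-trans (↭-prep v (attachF-verts f pl u r)) (↭-swap v x ↭-refl)

      attachF-verts : ∀ f → PlainF f → Unique (vertsF f) → p ∈ˡ vertsF f → vertsF (attachF f) ↭ x ∷ vertsF f
      attachF-verts (short t f) (pl , pf) u q with ∈-++⁻ (verts t) q
      ... | inj₁ r rewrite attachF-∉ f (Unique-disjoint (verts t) u r) = ++⁺ʳ (vertsF f) (attach-verts t pl (Unique-++ˡ (verts t) u) r)
      ... | inj₂ r rewrite attach-∉ t (λ s → Unique-disjoint (verts t) u s r) =
        ↭-trans (++⁺ˡ (verts t) (attachF-verts f pf (Unique-++ʳ (verts t) u) r)) (shift x (verts t) (vertsF f))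

    mutual
      attach-edges : ∀ t → Plain t → Unique (verts t) → p ∈ˡ verts t → edges (attach t) ↭ (p , x) ∷ edges t
      attach-edges (node v f) pl (h ∷ u) q with v ≟ p
      ... | yes refl = ↭-refl
      ... | no ne with q
      ...   | here e = ⊥-elim (ne (sym e))
      ...   | there r = attachF-edges v f pl u r

      attachF-edges : ∀ v f → PlainF f → Unique (vertsF f) → p ∈ˡ vertsF f → edgesF v (attachF f) ↭ (p , x) ∷ edgesF v f
      attachF-edges v (short t f) (pl , pf) u q with ∈-++⁻ (verts t) q
      ... | inj₁ r rewrite attachF-∉ f (Unique-disjoint (verts t) u r) | root-attach t =
        ↭-trans (↭-prep (v , root t) (++⁺ʳ (edgesF v f) (attach-edges t pl (Unique-++ˡ (verts t) u) r))) (↭-swap (v , root t) (p , x) ↭-refl)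
      ... | inj₂ r rewrite attach-∉ t (λ s → Unique-disjoint (verts t) u s r) =
        ↭-trans (↭-prep (v , root t) (↭-trans (++⁺ˡ (edges t) (attachF-edges v f pf (Unique-++ʳ (verts t) u) r)) (shift (p , x) (edges t) (edgesF v f)))) (↭-swap (v , root t) (p , x) ↭-refl)

  Unique-length : ∀ {xs ys : List (Fin n)} → Unique xs → (∀ {v} → v ∈ˡ xs → v ∈ˡ ys) → length xs ≤ length ys
  Unique-length {xs} {ys} u h = ≤-trans (card⟪⟫≥ u) (≤-trans (card-mono λ v p → ∈⟪⟫⁺ (h (∈⟪⟫⁻ xs p))) (card⟪⟫≤ ys))

  Unique-bound : ∀ {xs : List (Fin n)} → Unique xs → length xs ≤ n
  Unique-bound u = ≤-trans (card⟪⟫≥ u) (card≤N _)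

  ∈-filterᵇ : ∀ (f : Fin n → Bool) {x xs} → x ∈ˡ xs → f x ≡ true → x ∈ˡ filterᵇ f xs
  ∈-filterᵇ f {x} (here refl) e rewrite e = here refl
  ∈-filterᵇ f {x} {y ∷ xs} (there p) e with f y
  ... | true = there (∈-filterᵇ f p e)
  ... | false = ∈-filterᵇ f p e

-- Rooted description of a connected acyclic graph

module TreeExtraction {n : ℕ} (T : SimpleGraph n) (acyclic : Acyclic T) (connected : Connected T) where

  open SimpleGraph T using (adj) renaming (sym to adj-sym; irrefl to adj-irr)

  Adj-sym : ∀ {u v} → Adj T u v → Adj T v u
  Adj-sym {u} {v} a = trans (adj-sym v u) a

  record SimplePath (vs : List (Fin n)) (a b : Fin n) : Set where
    field
      inner  : List (Fin n)
      linked : Linked (Adj T) (a ∷ (inner ∷ʳ b))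
      unique : Unique (a ∷ (inner ∷ʳ b))
      within : ∀ {v} → v ∈ˡ a ∷ (inner ∷ʳ b) → v ∈ˡ vs
  open SimplePath

  linked-∷ʳ : ∀ {a} xs {b c} → Linked (Adj T) (a ∷ (xs ∷ʳ b)) → Adj T b c → Linked (Adj T) (a ∷ ((xs ∷ʳ b) ∷ʳ c))
  linked-∷ʳ [] (e ∷ [-]) a = e ∷ a ∷ [-]
  linked-∷ʳ (x ∷ xs) (e ∷ l) a = e ∷ linked-∷ʳ xs l a

  record Grown′ : Set where
    field
      t        : Tr {n}
      plain    : Plain t
      distinct : Unique (verts t)
      sound    : ∀ {x y} → (x , y) ∈ˡ edges t → Adj T x y
      complete : ∀ {x y} → x ∈ˡ verts t → y ∈ˡ verts t → Adj T x y → (x , y) ∈ˡ edges t ⊎ (y , x) ∈ˡ edges t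
      paths    : ∀ {x y} → x ∈ˡ verts t → y ∈ˡ verts t → x ≢ y → SimplePath (verts t) x y
  open Grown′

  start : Fin n → Grown′
  start r = record { t = node r tip ; plain = tt ; distinct = [] ∷ [] ; sound = λ ()
    ; complete = λ { (here refl) (here refl) a → true≢false a (adj-irr r) }
    ; paths = λ { (here refl) (here refl) ne → ⊥-elim (ne refl) } }

  add : (g : Grown′) → ∀ p x → p ∈ˡ verts (t g) → x ∉ˡ verts (t g) → Adj T p x → Grown′
  add g p x pin xout a = record
    { t = attach p x (t g) ; plain = attach-plain p x (t g) (plain g) ; distinct = Unique-↭ (↭-sym V↭) newU
    ; sound = λ q → case ∈-resp-↭ E↭ q of λ { (here refl) → a ; (there r) → sound g r }
    ; complete = λ q r e → complete′ (∈-resp-↭ V↭ q) (∈-resp-↭ V↭ r) e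
    ; paths = λ q r ne → paths′ (∈-resp-↭ V↭ q) (∈-resp-↭ V↭ r) ne }
    where
    V↭ : verts (attach p x (t g)) ↭ x ∷ verts (t g)
    V↭ = attach-verts p x (t g) (plain g) (distinct g) pin
    E↭ : edges (attach p x (t g)) ↭ (p , x) ∷ edges (t g)
    E↭ = attach-edges p x (t g) (plain g) (distinct g) pin
    newU : Unique (x ∷ verts (t g))
    newU = All-tabulate (λ q e → xout (subst (_∈ˡ _) (sym e) q)) ∷ distinct g
    old : ∀ {v} → v ∈ˡ verts (t g) → v ∈ˡ verts (attach p x (t g))
    old q = ∈-resp-↭ (↭-sym V↭) (there q)
    only-parent : ∀ {y} → y ∈ˡ verts (t g) → Adj T y x → y ≡ p
    only-parent {y} q e with y ≟ p
    ... | yes eq = eq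
    -- A second neighbour `y` of `x` would close the path from `p` to `y` into a cycle through `x`.
    ... | no ne = ⊥-elim (acyclic (x , p ∷ inner P , y , s≤s z≤n ,
        All-tabulate (λ r eq → xout (subst (_∈ˡ _) (sym eq) (within P r))) ∷ unique P , Adj-sym a ∷ linked P , e))
      where
      P : SimplePath (verts (t g)) p y
      P = paths g pin q (λ eq → ne (sym eq))
    complete′ : ∀ {y z} → y ∈ˡ x ∷ verts (t g) → z ∈ˡ x ∷ verts (t g) → Adj T y z → (y , z) ∈ˡ edges (attach p x (t g)) ⊎ (z , y) ∈ˡ edges (attach p x (t g))
    complete′ (here refl) (here refl) e = true≢false e (adj-irr x)
    complete′ (here refl) (there r) e with only-parent r (Adj-sym e)
    ... | refl = inj₂ (∈-resp-↭ (↭-sym E↭) (here refl))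
    complete′ (there q) (here refl) e with only-parent q e
    ... | refl = inj₁ (∈-resp-↭ (↭-sym E↭) (here refl))
    complete′ (there q) (there r) e with complete g q r e
    ... | inj₁ s = inj₁ (∈-resp-↭ (↭-sym E↭) (there s))
    ... | inj₂ s = inj₂ (∈-resp-↭ (↭-sym E↭) (there s))
    paths′ : ∀ {y z} → y ∈ˡ x ∷ verts (t g) → z ∈ˡ x ∷ verts (t g) → y ≢ z → SimplePath (verts (attach p x (t g))) y z
    paths′ (here refl) (here refl) ne = ⊥-elim (ne refl)
    paths′ {z = z} (here refl) (there r) ne with p ≟ z
    ... | yes refl = record { inner = [] ; linked = Adj-sym a ∷ [-] ; unique = ((λ e → xout (subst (_∈ˡ _) (sym e) pin)) ∷ []) ∷ ([] ∷ [])
                            ; within = λ { (here refl) → ∈-resp-↭ (↭-sym V↭) (here refl) ; (there (here refl)) → old pin } }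
    ... | no ne′ = let P = paths g pin r ne′ in record
        { inner = p ∷ inner P ; linked = Adj-sym a ∷ linked P ; unique = All-tabulate (λ s eq → xout (subst (_∈ˡ _) (sym eq) (within P s))) ∷ unique P
        ; within = λ { (here refl) → ∈-resp-↭ (↭-sym V↭) (here refl) ; (there s) → old (within P s) } }
    paths′ {y = y} (there q) (here refl) ne with y ≟ p
    ... | yes refl = record { inner = [] ; linked = a ∷ [-] ; unique = ((λ e → xout (subst (_∈ˡ _) e pin)) ∷ []) ∷ ([] ∷ [])
                            ; within = λ { (here refl) → old pin ; (there (here refl)) → ∈-resp-↭ (↭-sym V↭) (here refl) } }
    ... | no ne′ = let P = paths g q pin ne′ in record
        { inner = inner P ∷ʳ p ; linked = linked-∷ʳ (inner P) (linked P) a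
        ; unique = Unique-++ {xs = y ∷ (inner P ∷ʳ p)} {x ∷ []} (unique P) ([] ∷ []) (λ { s (here refl) → xout (within P s) })
        ; within = λ s → case ∈-++⁻ (y ∷ (inner P ∷ʳ p)) s of λ { (inj₁ r) → old (within P r) ; (inj₂ (here refl)) → ∈-resp-↭ (↭-sym V↭) (here refl) } }
    paths′ (there q) (there r) ne = let P = paths g q r ne in record { inner = inner P ; linked = linked P ; unique = unique P ; within = λ s → old (within P s) }

  crossing : (g : Grown′) → ∀ {u v} → Walk T u v → u ∈ˡ verts (t g) → v ∉ˡ verts (t g) →
    Σ (Fin n) λ p → Σ (Fin n) λ x → p ∈ˡ verts (t g) × x ∉ˡ verts (t g) × Adj T p x
  crossing g Walk.here q r = ⊥-elim (r q)
  crossing g (step {u} {v} e w) q r with bool? (⟪ verts (t g) ⟫ v)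
  ... | inj₁ s = crossing g w (∈⟪⟫⁻ _ s) r
  ... | inj₂ s = u , v , q , ∉⟪⟫⁻ s , e

  all-or-missing : ∀ {m} (X : Fin m → Bool) → (∀ v → X v ≡ true) ⊎ Σ (Fin m) λ v → X v ≡ false
  all-or-missing {zero} X = inj₁ λ ()
  all-or-missing {suc m} X with bool? (X fzero) | all-or-missing (X ∘ fsuc)
  ... | inj₂ e | _ = inj₂ (fzero , e)
  ... | inj₁ e | inj₂ (v , e′) = inj₂ (fsuc v , e′)
  ... | inj₁ e | inj₁ h = inj₁ λ { fzero → e ; (fsuc v) → h v }

  root∈ : ∀ (t : Tr {n}) → root t ∈ˡ verts t
  root∈ (node v f) = here refl

  grow-all : ∀ fuel (g : Grown′) → n ≤ length (verts (t g)) + fuel → Σ Grown′ λ g → ∀ v → v ∈ˡ verts (t g)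
  grow-all fuel g h with all-or-missing ⟪ verts (t g) ⟫
  ... | inj₁ all = g , λ v → ∈⟪⟫⁻ _ (all v)
  grow-all zero g h | inj₂ (v , out) = ⊥-elim (<-irrefl refl (≤-trans (Unique-bound (All-tabulate (λ q e → ∉⟪⟫⁻ {xs = verts (t g)} out (subst (_∈ˡ _) (sym e) q)) ∷ distinct g)) (≤-trans h (≤-reflexive (+-identityʳ _)))))
  grow-all (suc fuel) g h | inj₂ (v , out) with crossing g (connected (root (t g)) v) (root∈ (t g)) (∉⟪⟫⁻ out)
  ... | p , x , pin , xout , a = grow-all fuel (add g p x pin xout a)
        (≤-trans h (≤-reflexive (trans (+-suc _ fuel) (cong (_+ fuel) (sym (↭-length (attach-verts p x (t g) (plain g) (distinct g) pin)))))))

  module _ {Δ : ℕ} (maxdeg : MaxDegreeAtMost T Δ) where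

    roots : Fo {n} → List (Fin n)
    roots tip = []
    roots (short t f) = root t ∷ roots f
    roots (long ps t f) = roots f
    roots (pend v f) = roots f

    roots⊆ : ∀ f {v} → v ∈ˡ roots f → v ∈ˡ vertsF f
    roots⊆ (short t f) (here refl) = ∈-++⁺ˡ (root∈ t)
    roots⊆ (short t f) (there p) = ∈-++⁺ʳ (verts t) (roots⊆ f p)
    roots⊆ (long ps t f) p = ∈-++⁺ʳ ps (∈-++⁺ʳ (verts t) (roots⊆ f p))
    roots⊆ (pend v f) p = there (roots⊆ f p)

    roots-unique : ∀ f → Unique (vertsF f) → Unique (roots f)
    roots-unique tip u = []
    roots-unique (short t f) u = All-tabulate (λ q e → Unique-disjoint (verts t) u (root∈ t) (subst (_∈ˡ vertsF f) (sym e) (roots⊆ f q))) ∷ roots-unique f (Unique-++ʳ (verts t) u)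
    roots-unique (long ps t f) u = roots-unique f (Unique-++ʳ (verts t) (Unique-++ʳ ps u))
    roots-unique (pend v f) (_ ∷ u) = roots-unique f u

    roots-adj : ∀ v f {x} → x ∈ˡ roots f → (v , x) ∈ˡ edgesF v f
    roots-adj v (short t f) (here refl) = here refl
    roots-adj v (short t f) (there p) = there (∈-++⁺ʳ (edges t) (roots-adj v f p))
    roots-adj v (long ps t f) p = ∈-++⁺ʳ (links v ps (root t)) (∈-++⁺ʳ (edges t) (roots-adj v f p))
    roots-adj v (pend w f) p = there (roots-adj v f p)

    width-roots : ∀ f → PlainF f → width f ≡ length (roots f)
    width-roots tip _ = refl
    width-roots (short t f) (_ , p) = cong suc (width-roots f p)

    mutual
      narrow : ∀ t → Plain t → Unique (verts t) → (∀ {x y} → (x , y) ∈ˡ edges t → Adj T x y) → Narrow Δ t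
      narrow (node v f) p (_ ∷ u) s = ≤-trans (≤-reflexive (width-roots f p)) (≤-trans
        (Unique-length (roots-unique f u) λ q → ∈-filterᵇ (adj v) (∈-allFin _) (s (roots-adj v f q))) (maxdeg v)) , narrowF v f p u s

      narrowF : ∀ v f → PlainF f → Unique (vertsF f) → (∀ {x y} → (x , y) ∈ˡ edgesF v f → Adj T x y) → NarrowF Δ f
      narrowF v tip _ _ _ = tt
      narrowF v (short t f) (p , pf) u s = narrow t p (Unique-++ˡ (verts t) u) (λ q → s (there (∈-++⁺ˡ q))) ,
        narrowF v f pf (Unique-++ʳ (verts t) u) (λ q → s (there (∈-++⁺ʳ (edges t) q)))

record TreeShape {n} (T : SimpleGraph n) (Δ : ℕ) : Set where
  field
    shape    : Tr {n}
    plain    : Plain shape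
    narrow   : Narrow Δ shape
    distinct : Unique (verts shape)
    spanning : ∀ v → v ∈ˡ verts shape
    covered  : ∀ {x y} → Adj T x y → (x , y) ∈ˡ edges shape ⊎ (y , x) ∈ˡ edges shape

tree-shape : ∀ {n} (T : SimpleGraph n) {Δ} → IsTree T → MaxDegreeAtMost T Δ → TreeShape T Δ
tree-shape {suc n} T (_ , connected , acyclic) maxdeg with grow-all (suc n) (start fzero) (m≤n+m (suc n) 1)
  where open TreeExtraction T acyclic connected
... | g , all = record { shape = t ; plain = plain ; narrow = TreeExtraction.narrow T acyclic connected maxdeg t plain distinct sound
                       ; distinct = distinct ; spanning = all ; covered = λ e → complete (all _) (all _) e }
  where open TreeExtraction.Grown′ g

-- Leaves and long bare paths of a tree

module _ {n : ℕ} where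

  mutual
    #long : Tr {n} → ℕ
    #long (node v f) = #longF f

    #longF : Fo {n} → ℕ
    #longF tip = 0
    #longF (short t f) = #long t + #longF f
    #longF (long ps t f) = suc (#long t + #longF f)
    #longF (pend v f) = #longF f

  mutual
    #pend : Tr {n} → ℕ
    #pend (node v f) = #pendF f

    #pendF : Fo {n} → ℕ
    #pendF tip = 0
    #pendF (short t f) = #pend t + #pendF f
    #pendF (long ps t f) = #pend t + #pendF f
    #pendF (pend v f) = suc (#pendF f)

  mutual
    -- A childless root counts as a leaf, a root with one child does not.
    #leaves : Tr {n} → ℕ
    #leaves (node v tip) = 1
    #leaves (node v f) = #leavesF f

    #leavesF : Fo {n} → ℕ
    #leavesF tip = 0
    #leavesF (short t f) = #leaves t + #leavesF f
    #leavesF (long ps t f) = #leaves t + #leavesF f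
    #leavesF (pend v f) = suc (#leavesF f)

  mutual
    Longs : ℕ → Tr {n} → Set
    Longs k (node v f) = LongsF k f

    LongsF : ℕ → Fo {n} → Set
    LongsF k tip = ⊤
    LongsF k (short t f) = Longs k t × LongsF k f
    LongsF k (long ps t f) = length ps ≡ k × Longs k t × LongsF k f
    LongsF k (pend v f) = ⊥

  mutual
    Pends : Tr {n} → Set
    Pends (node v f) = PendsF f

    PendsF : Fo {n} → Set
    PendsF tip = ⊤
    PendsF (short t f) = Pends t × PendsF f
    PendsF (long ps t f) = ⊥
    PendsF (pend v f) = PendsF f

  mutual
    plain⇒longs : ∀ k t → Plain t → Longs k t
    plain⇒longs k (node v f) p = plainF⇒longs k f p

    plainF⇒longs : ∀ k f → PlainF f → LongsF k f
    plainF⇒longs k tip p = tt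
    plainF⇒longs k (short t f) (p , q) = plain⇒longs k t p , plainF⇒longs k f q

  mutual
    plain⇒#long : ∀ t → Plain t → #long t ≡ 0
    plain⇒#long (node v f) p = plainF⇒#long f p

    plainF⇒#long : ∀ f → PlainF f → #longF f ≡ 0
    plainF⇒#long tip p = refl
    plainF⇒#long (short t f) (p , q) = cong₂ _+_ (plain⇒#long t p) (plainF⇒#long f q)

  -- Two descriptions of the same rooted tree.
  record _≋_ (t s : Tr {n}) : Set where
    field
      root≡   : root s ≡ root t
      verts≡  : verts s ≡ verts t
      edges≡  : edges s ≡ edges t
      narrow≋ : ∀ {Δ} → 1 ≤ Δ → Narrow Δ t → Narrow Δ s
  open _≋_ public

  record _≋F_ (f g : Fo {n}) : Set where
    field
      vertsF≡  : vertsF g ≡ vertsF f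
      edgesF≡  : ∀ u → edgesF u g ≡ edgesF u f
      width≡   : width g ≡ width f
      narrowF≋ : ∀ {Δ} → 1 ≤ Δ → NarrowF Δ f → NarrowF Δ g
  open _≋F_ public

  tip≋ : tip ≋F tip
  tip≋ = record { vertsF≡ = refl ; edgesF≡ = λ _ → refl ; width≡ = refl ; narrowF≋ = λ _ x → x }

  node≋ : ∀ {v f g} → f ≋F g → node v f ≋ node v g
  node≋ {v} e = record { root≡ = refl ; verts≡ = cong (v ∷_) (vertsF≡ e) ; edges≡ = edgesF≡ e v
                       ; narrow≋ = λ { {Δ} d (w , h) → subst (_≤ Δ) (sym (width≡ e)) w , narrowF≋ e d h } }

  short≋ : ∀ {t s f g} → t ≋ s → f ≋F g → short t f ≋F short s g
  short≋ e d = record { vertsF≡ = cong₂ _++_ (verts≡ e) (vertsF≡ d)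
    ; edgesF≡ = λ u → cong₂ _∷_ (cong (u ,_) (root≡ e)) (cong₂ _++_ (edges≡ e) (edgesF≡ d u)) ; width≡ = cong suc (width≡ d)
    ; narrowF≋ = λ δ → λ { (p , q) → narrow≋ e δ p , narrowF≋ d δ q } }

  long≋ : ∀ {ps t s f g} → t ≋ s → f ≋F g → long ps t f ≋F long ps s g
  long≋ {ps} e d = record { vertsF≡ = cong (ps ++_) (cong₂ _++_ (verts≡ e) (vertsF≡ d))
    ; edgesF≡ = λ u → cong₂ _++_ (cong (links u ps) (root≡ e)) (cong₂ _++_ (edges≡ e) (edgesF≡ d u)) ; width≡ = cong suc (width≡ d)
    ; narrowF≋ = λ δ → λ { (p , q) → narrow≋ e δ p , narrowF≋ d δ q } }

  pend≋ : ∀ {v f g} → f ≋F g → pend v f ≋F pend v g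
  pend≋ {v} d = record { vertsF≡ = cong (v ∷_) (vertsF≡ d) ; edgesF≡ = λ u → cong (_ ∷_) (edgesF≡ d u) ; width≡ = cong suc (width≡ d) ; narrowF≋ = narrowF≋ d }

  mutual
    pendify : Tr {n} → Tr {n}
    pendify (node v f) = node v (pendifyF f)

    pendifyF : Fo {n} → Fo {n}
    pendifyF tip = tip
    pendifyF (short (node v tip) f) = pend v (pendifyF f)
    pendifyF (short t f) = short (pendify t) (pendifyF f)
    pendifyF (long ps t f) = long ps t f
    pendifyF (pend v f) = pend v f

  leaf≋ : ∀ {v f g} → f ≋F g → short (node v tip) f ≋F pend v g
  leaf≋ {v} d = record { vertsF≡ = cong (v ∷_) (vertsF≡ d) ; edgesF≡ = λ u → cong (_ ∷_) (edgesF≡ d u) ; width≡ = cong suc (width≡ d) ; narrowF≋ = λ δ h → narrowF≋ d δ (proj₂ h) }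

  mutual
    pendify≋ : ∀ t → Plain t → t ≋ pendify t
    pendify≋ (node v f) p = node≋ (pendifyF≋ f p)

    pendifyF≋ : ∀ f → PlainF f → f ≋F pendifyF f
    pendifyF≋ tip p = tip≋
    pendifyF≋ (short (node v tip) f) (p , q) = leaf≋ (pendifyF≋ f q)
    pendifyF≋ (short t@(node v (short _ _)) f) (p , q) = short≋ (pendify≋ t p) (pendifyF≋ f q)

  mutual
    pendify-pends : ∀ t → Plain t → Pends (pendify t)
    pendify-pends (node v f) p = pendifyF-pends f p

    pendifyF-pends : ∀ f → PlainF f → PendsF (pendifyF f)
    pendifyF-pends tip p = tt
    pendifyF-pends (short (node v tip) f) (p , q) = pendifyF-pends f q
    pendifyF-pends (short t@(node v (short _ _)) f) (p , q) = pendify-pends t p , pendifyF-pends f q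

  pendifyF-count : ∀ f → PlainF f → #pendF (pendifyF f) ≡ #leavesF f
  pendifyF-count tip p = refl
  pendifyF-count (short (node v tip) f) (p , q) = cong suc (pendifyF-count f q)
  pendifyF-count (short (node v (short s g)) f) (p , q) = cong₂ _+_ (pendifyF-count (short s g) p) (pendifyF-count f q)

  -- The one is lost for the tree with a single vertex, whose root does not become a pendant leaf.
  pendify-leaves : ∀ t → Plain t → #leaves t ≤ suc (#pend (pendify t))
  pendify-leaves (node v tip) p = ≤-refl
  pendify-leaves (node v (short s f)) p = ≤-trans (≤-reflexive (sym (pendifyF-count (short s f) p))) (n≤1+n _)

  chainT : List (Fin n) → Tr {n} → Tr {n}
  chainT [] t = t
  chainT (c ∷ cs) t = node c (short (chainT cs t) tip)

  chain-verts : ∀ cs t → verts (chainT cs t) ≡ cs ++ verts t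
  chain-verts [] t = refl
  chain-verts (c ∷ cs) t = cong (c ∷_) (trans (++-identityʳ _) (chain-verts cs t))

  chain-edges : ∀ u cs t → (u , root (chainT cs t)) ∷ edges (chainT cs t) ≡ links u cs (root t) ++ edges t
  chain-edges u [] t = refl
  chain-edges u (c ∷ cs) t = cong ((u , c) ∷_) (trans (++-identityʳ _) (chain-edges c cs t))

  chain-narrow : ∀ {Δ} cs {t} → 1 ≤ Δ → Narrow Δ t → Narrow Δ (chainT cs t)
  chain-narrow [] d h = h
  chain-narrow (c ∷ cs) d h = d , (chain-narrow cs d h , tt)

  narrow-chain : ∀ {Δ} cs {t} → Narrow Δ (chainT cs t) → Narrow Δ t
  narrow-chain [] h = h
  narrow-chain (c ∷ cs) (_ , h , _) = narrow-chain cs h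

  chain-#long : ∀ cs t → #long (chainT cs t) ≡ #long t
  chain-#long [] t = refl
  chain-#long (c ∷ cs) t = trans (+-identityʳ _) (chain-#long cs t)

  chain-longs : ∀ {k} cs {t} → Longs k t → Longs k (chainT cs t)
  chain-longs [] h = h
  chain-longs (c ∷ cs) h = chain-longs cs h , tt

  unroll≋ : ∀ {ps t f g} → f ≋F g → long ps t f ≋F short (chainT ps t) g
  unroll≋ {ps} {t} {f} {g} d = record
    { vertsF≡ = trans (cong₂ _++_ (chain-verts ps t) (vertsF≡ d)) (++-assoc ps (verts t) (vertsF f))
    ; edgesF≡ = λ u → trans (cong₂ _++_ (chain-edges u ps t) (edgesF≡ d u)) (++-assoc (links u ps (root t)) (edges t) (edgesF u f))
    ; width≡ = cong suc (width≡ d) ; narrowF≋ = λ δ → λ { (p , q) → chain-narrow ps δ p , narrowF≋ d δ q } }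

  roll≋ : ∀ {ps t f g} → f ≋F g → short (chainT ps t) f ≋F long ps t g
  roll≋ {ps} {t} {f} {g} d = record
    { vertsF≡ = trans (sym (++-assoc ps (verts t) (vertsF g))) (cong₂ _++_ (sym (chain-verts ps t)) (vertsF≡ d))
    ; edgesF≡ = λ u → trans (sym (++-assoc (links u ps (root t)) (edges t) (edgesF u g))) (cong₂ _++_ (sym (chain-edges u ps t)) (edgesF≡ d u))
    ; width≡ = cong suc (width≡ d) ; narrowF≋ = λ δ → λ { (p , q) → narrow-chain ps p , narrowF≋ d δ q } }

  ≋-trans : ∀ {t s r} → t ≋ s → s ≋ r → t ≋ r
  ≋-trans e d = record { root≡ = trans (root≡ d) (root≡ e) ; verts≡ = trans (verts≡ d) (verts≡ e) ; edges≡ = trans (edges≡ d) (edges≡ e)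
                       ; narrow≋ = λ δ h → narrow≋ d δ (narrow≋ e δ h) }

  ≋F-trans : ∀ {t s r} → t ≋F s → s ≋F r → t ≋F r
  ≋F-trans e d = record { vertsF≡ = trans (vertsF≡ d) (vertsF≡ e) ; edgesF≡ = λ u → trans (edgesF≡ d u) (edgesF≡ e u) ; width≡ = trans (width≡ d) (width≡ e)
                       ; narrowF≋ = λ δ h → narrowF≋ d δ (narrowF≋ e δ h) }

  lo-leaf : ∀ k → 1 + (2 * k + 1) ≤ suc k * 0 + 2 * suc k * 1 + 0
  lo-leaf k  = lin (0) (z≤n {0}) (solve (k List.∷ List.[]))

  lo-cut : ∀ k s L l → s + (2 * k + 1) ≤ suc k * L + 2 * suc k * l + k → suc s + (2 * k + 1) ≤ suc k * suc L + 2 * suc k * l + 0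
  lo-cut k s L l h1 = lin (0) (h1) (solve (k List.∷ s List.∷ L List.∷ l List.∷ List.[]))

  lo-more : ∀ k s L l c → s + (2 * k + 1) ≤ suc k * L + 2 * suc k * l + c → suc s + (2 * k + 1) ≤ suc k * L + 2 * suc k * l + suc c
  lo-more k s L l c h1 = lin (0) (h1) (solve (k List.∷ s List.∷ L List.∷ l List.∷ c List.∷ List.[]))

  lo-branch : ∀ k s L l w → s + suc w * suc k ≤ suc k * L + 2 * suc k * l → 1 ≤ w → suc s + (2 * k + 1) ≤ suc k * L + 2 * suc k * l + 0
  lo-branch k s L l w h1 h2 = lin (0) (h1 ⊞ (suc k) · h2) (solve (k List.∷ s List.∷ L List.∷ l List.∷ w List.∷ List.[]))

  lo-cons : ∀ k s L l c s' L' l' w → s + (2 * k + 1) ≤ suc k * L + 2 * suc k * l + c → c ≤ k → s' + w * suc k ≤ suc k * L' + 2 * suc k * l' → s + s' + suc w * suc k ≤ suc k * (L + L') + 2 * suc k * (l + l')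
  lo-cons k s L l c s' L' l' w h1 h2 h3 = lin (0) (h1 ⊞ h2 ⊞ h3) (solve (k List.∷ s List.∷ L List.∷ l List.∷ c List.∷ s' List.∷ L' List.∷ l' List.∷ w List.∷ List.[]))

  -- Cutting the maximal chains of unary vertices, from the bottom, into long edges with k interior vertices. The first
  -- component of the result is the list of unary vertices at the top that are not yet part of a long edge.
  module Lengthen (k : ℕ) where

    extendT : Fin n → List (Fin n) × Tr {n} → List (Fin n) × Tr {n}
    extendT v (cs , s) with length cs ≤? k
    ... | yes _ with k ≤? length cs
    -- By both tests the open chain has exactly `k` vertices; it turns into a long edge with upper
    -- end `v`.
    ...   | yes _ = [] , node v (long cs s tip)
    ...   | no _ = v ∷ cs , s
    extendT v (cs , s) | no _ = v ∷ cs , s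

    wrap : List (Fin n) × Tr {n} → Tr {n}
    wrap (cs , s) = chainT cs s

    mutual
      lengthen : Tr {n} → List (Fin n) × Tr {n}
      lengthen (node v (short t tip)) = extendT v (lengthen t)
      lengthen (node v f) = [] , node v (lengthenF f)

      lengthenF : Fo {n} → Fo {n}
      lengthenF (short t f) = short (wrap (lengthen t)) (lengthenF f)
      lengthenF f = f

    -- A tree with l leaves has at most l - 1 branching vertices. Each of these at most 2l - 1
    -- vertices is the bottom of a segment which is cut into blocks of k + 1 vertices, one for each
    -- long edge, and a remainder of at most k; the remainder at the very top is the open chain,
    -- counted separately. Summing up gives `count`.
    record Spec (s l : ℕ) (r : List (Fin n) × Tr {n}) : Set where
      field
        longs : Longs k (proj₂ r)
        open′ : length (proj₁ r) ≤ k
        count : s + (2 * k + 1) ≤ suc k * #long (proj₂ r) + 2 * suc k * l + length (proj₁ r)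
    open Spec

    extend≋ : ∀ v t r → t ≋ wrap r → node v (short t tip) ≋ wrap (extendT v r)
    extend≋ v t (cs , s) e with length cs ≤? k
    ... | yes _ with k ≤? length cs
    ...   | yes _ = ≋-trans (node≋ (short≋ e tip≋)) (node≋ (roll≋ {cs} tip≋))
    ...   | no _ = node≋ (short≋ e tip≋)
    extend≋ v t (cs , s) e | no _ = node≋ (short≋ e tip≋)

    extend-spec : ∀ {s l} v r → Spec s l r → Spec (suc s) l (extendT v r)
    extend-spec {s} {l} v (cs , t) S with length cs ≤? k
    ... | no h = ⊥-elim (h (open′ S))
    ... | yes h with k ≤? length cs
    ...   | no h′ = record { longs = longs S ; open′ = ≰⇒> h′ ; count = lo-more k s (#long t) l (length cs) (count S) }
    ...   | yes h′ = record { longs = ≤-antisym h h′ , longs S , tt ; open′ = z≤n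
              ; count = subst (λ z → suc s + (2 * k + 1) ≤ suc k * suc z + 2 * suc k * l + 0) (sym (+-identityʳ (#long t)))
                  (lo-cut k s (#long t) l (subst (λ z → s + (2 * k + 1) ≤ suc k * #long t + 2 * suc k * l + z) (≤-antisym h h′) (count S))) }

    mutual
      lengthen≋ : ∀ t → Plain t → t ≋ wrap (lengthen t)
      lengthen≋ (node v tip) p = node≋ tip≋
      lengthen≋ (node v (short t tip)) (p , _) = extend≋ v t (lengthen t) (lengthen≋ t p)
      lengthen≋ (node v (short t f@(short _ _))) p = node≋ (lengthenF≋ (short t f) p)

      lengthenF≋ : ∀ f → PlainF f → f ≋F lengthenF f
      lengthenF≋ tip p = tip≋
      lengthenF≋ (short t f) (p , q) = short≋ (lengthen≋ t p) (lengthenF≋ f q)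

    record SpecF (f : Fo {n}) : Set where
      field
        longsF : LongsF k (lengthenF f)
        countF : length (vertsF f) + width f * suc k ≤ suc k * #longF (lengthenF f) + 2 * suc k * #leavesF f
    open SpecF

    mutual
      lengthen-spec : ∀ t → Plain t → Spec (length (verts t)) (#leaves t) (lengthen t)
      lengthen-spec (node v tip) p = record { longs = tt ; open′ = z≤n ; count = lo-leaf k }
      lengthen-spec (node v (short t tip)) (p , _) =
        subst (λ z → Spec z (#leaves t + 0) (extendT v (lengthen t))) (cong (λ z → suc (length z)) (sym (++-identityʳ (verts t))))
          (subst (λ z → Spec (suc (length (verts t))) z (extendT v (lengthen t))) (sym (+-identityʳ (#leaves t))) (extend-spec v (lengthen t) (lengthen-spec t p)))
      lengthen-spec (node v (short t f@(short _ _))) p = let S = lengthenF-spec (short t f) p in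
        record { longs = longsF S ; open′ = z≤n ; count = lo-branch k (length (vertsF (short t f))) (#longF (lengthenF (short t f))) (#leavesF (short t f)) (width f) (countF S) (s≤s z≤n) }

      lengthenF-spec : ∀ f → PlainF f → SpecF f
      lengthenF-spec tip p = record { longsF = tt ; countF = z≤n }
      lengthenF-spec (short t f) (p , q) = let S = lengthen-spec t p ; F = lengthenF-spec f q in record
        { longsF = chain-longs (proj₁ (lengthen t)) (longs S) , longsF F
        ; countF = subst₂-≤ (cong (_+ suc (width f) * suc k) (sym (length-++ (verts t)))) (cong (λ z → suc k * (z + #longF (lengthenF f)) + 2 * suc k * (#leaves t + #leavesF f)) (sym (chain-#long (proj₁ (lengthen t)) (proj₂ (lengthen t)))))
            (lo-cons k (length (verts t)) (#long (proj₂ (lengthen t))) (#leaves t) (length (proj₁ (lengthen t))) (length (vertsF f)) (#longF (lengthenF f)) (#leavesF f) (width f) (count S) (open′ S) (countF F)) }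
        where
        subst₂-≤ : ∀ {a b c d} → a ≡ c → b ≡ d → a ≤ b → c ≤ d
        subst₂-≤ refl refl h = h

  mutual
    -- The number is a budget of long edges that is carried through the tree and returned with what
    -- is left of it; once it is spent, long edges are dissolved into ordinary ones.
    trim : ℕ → Tr {n} → Tr {n} × ℕ
    trim b (node v f) = node v (proj₁ (trimF b f)) , proj₂ (trimF b f)

    trimF : ℕ → Fo {n} → Fo {n} × ℕ
    trimF b tip = tip , b
    trimF b (short t f) = let t′ , b₁ = trim b t ; f′ , b₂ = trimF b₁ f in short t′ f′ , b₂
    trimF zero (long ps t f) = let t′ , b₁ = trim zero t ; f′ , b₂ = trimF b₁ f in short (chainT ps t′) f′ , b₂
    trimF (suc b) (long ps t f) = let t′ , b₁ = trim b t ; f′ , b₂ = trimF b₁ f in long ps t′ f′ , b₂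
    trimF b (pend v f) = let f′ , b₁ = trimF b f in pend v f′ , b₁

  mutual
    trim≋ : ∀ b t → t ≋ proj₁ (trim b t)
    trim≋ b (node v f) = node≋ (trimF≋ b f)

    trimF≋ : ∀ b f → f ≋F proj₁ (trimF b f)
    trimF≋ b tip = tip≋
    trimF≋ b (short t f) = short≋ (trim≋ b t) (trimF≋ (proj₂ (trim b t)) f)
    trimF≋ zero (long ps t f) = ≋F-trans (long≋ {ps} (trim≋ zero t) (trimF≋ (proj₂ (trim zero t)) f)) (unroll≋ {ps} (record { vertsF≡ = refl ; edgesF≡ = λ _ → refl ; width≡ = refl ; narrowF≋ = λ _ x → x }))
    trimF≋ (suc b) (long ps t f) = long≋ {ps} (trim≋ b t) (trimF≋ (proj₂ (trim b t)) f)
    trimF≋ b (pend v f) = pend≋ (trimF≋ b f)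

  mutual
    trim-longs : ∀ {k} b t → Longs k t → Longs k (proj₁ (trim b t))
    trim-longs b (node v f) h = trimF-longs b f h

    trimF-longs : ∀ {k} b f → LongsF k f → LongsF k (proj₁ (trimF b f))
    trimF-longs b tip h = tt
    trimF-longs b (short t f) (h , g) = trim-longs b t h , trimF-longs (proj₂ (trim b t)) f g
    trimF-longs zero (long ps t f) (_ , h , g) = chain-longs ps (trim-longs zero t h) , trimF-longs (proj₂ (trim zero t)) f g
    trimF-longs (suc b) (long ps t f) (l , h , g) = l , trim-longs b t h , trimF-longs (proj₂ (trim b t)) f g

  mutual
    trim-left : ∀ b t → proj₂ (trim b t) ≡ b ∸ #long t
    trim-left b (node v f) = trimF-left b f

    trimF-left : ∀ b f → proj₂ (trimF b f) ≡ b ∸ #longF f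
    trimF-left b tip = refl
    trimF-left b (short t f) = both b t f
    trimF-left zero (long ps t f) = trans (both zero t f) (0∸n≡0 (#long t + #longF f))
    trimF-left (suc b) (long ps t f) = both b t f
    trimF-left b (pend v f) = trimF-left b f

    both : ∀ b t f → proj₂ (trimF (proj₂ (trim b t)) f) ≡ b ∸ (#long t + #longF f)
    both b t f = trans (trimF-left (proj₂ (trim b t)) f) (trans (cong (_∸ #longF f) (trim-left b t)) (∸-+-assoc b (#long t) (#longF f)))

  mutual
    trim-count : ∀ b t → #long (proj₁ (trim b t)) + proj₂ (trim b t) ≡ b
    trim-count b (node v f) = trimF-count b f

    trimF-count : ∀ b f → #longF (proj₁ (trimF b f)) + proj₂ (trimF b f) ≡ b
    trimF-count b tip = refl
    trimF-count b (short t f) = both-count b t f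
    trimF-count zero (long ps t f) = trans (cong (λ z → z + #longF (proj₁ (trimF (proj₂ (trim zero t)) f)) + proj₂ (trimF (proj₂ (trim zero t)) f)) (chain-#long ps (proj₁ (trim zero t)))) (both-count zero t f)
    trimF-count (suc b) (long ps t f) = cong suc (both-count b t f)
    trimF-count b (pend v f) = trimF-count b f

    both-count : ∀ b t f → (#long (proj₁ (trim b t)) + #longF (proj₁ (trimF (proj₂ (trim b t)) f))) + proj₂ (trimF (proj₂ (trim b t)) f) ≡ b
    both-count b t f = trans (+-assoc (#long (proj₁ (trim b t))) _ _) (trans (cong (#long (proj₁ (trim b t)) +_) (trimF-count (proj₂ (trim b t)) f)) (trim-count b t))

  lo-many : ∀ k Q l s L c → suc k * Q + 2 * suc k * l ≤ s → s + (2 * k + 1) ≤ suc k * L + 2 * suc k * l + c → c ≤ k → suc k * Q ≤ suc k * L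
  lo-many k Q l s L c h1 h2 h3 = lin (1 + k) (h1 ⊞ h2 ⊞ h3) (solve (k List.∷ Q List.∷ l List.∷ s List.∷ L List.∷ c List.∷ List.[]))

  -- The number of long edges has to be exactly Q, the number of routes of the network, so the
  -- surplus ones are dissolved.
  many-longs : ∀ k Q t → Plain t → suc k * Q + 2 * suc k * #leaves t ≤ length (verts t) →
    Σ (Tr {n}) λ s → t ≋ s × Longs k s × #long s ≡ Q
  many-longs k Q t p h = let open Lengthen k ; r = lengthen t ; S = lengthen-spec t p ; s = wrap r ; open Spec S in
    proj₁ (trim Q s) , ≋-trans (lengthen≋ t p) (trim≋ Q s) , trim-longs Q s (chain-longs (proj₁ r) longs) ,
    trans (sym (+-identityʳ _)) (trans (cong (#long (proj₁ (trim Q s)) +_) (sym (trans (trim-left Q s) (m≤n⇒m∸n≡0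
      (subst (Q ≤_) (sym (chain-#long (proj₁ r) (proj₂ r))) (*-cancelˡ-≤ (suc k) (lo-many k Q (#leaves t) (length (verts t)) (#long (proj₂ r)) (length (proj₁ r)) h count open′))))))) (trim-count Q s))

-- Greedy embedding up to long paths and pendant leaves

replicate-+ : ∀ {A : Set} a b (x : A) → replicate (a + b) x ≡ replicate a x ++ replicate b x
replicate-+ zero b x = refl
replicate-+ (suc a) b x = cong (x ∷_) (replicate-+ a b x)

module _ {n : ℕ} where

  mutual
    #nodes : Tr {n} → ℕ
    #nodes (node v f) = suc (#nodesF f)

    #nodesF : Fo {n} → ℕ
    #nodesF tip = 0
    #nodesF (short t f) = #nodes t + #nodesF f
    #nodesF (long ps t f) = #nodes t + #nodesF f
    #nodesF (pend v f) = #nodesF f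

  -- For every child one token to find its image and three that stay at this end of a long path; for
  -- other children the surplus is dropped. The bound 3 + 4Δ on `w` adds three tokens for a vertex
  -- that is the lower end of a long path.
  cost : Fo {n} → ℕ
  cost tip = 0
  cost (short t f) = 4 + cost f
  cost (long ps t f) = 4 + cost f
  cost (pend v f) = 4 + cost f

  cost-width : ∀ f → cost f ≡ 4 * width f
  cost-width tip = refl
  cost-width (short t f) = trans (cong (4 +_) (cost-width f)) (sym (*-suc 4 (width f)))
  cost-width (long ps t f) = trans (cong (4 +_) (cost-width f)) (sym (*-suc 4 (width f)))
  cost-width (pend v f) = trans (cong (4 +_) (cost-width f)) (sym (*-suc 4 (width f)))

-- A partial embedding: images of the branch vertices, together with the long paths and pendant leaves still to be filled in.

record LongD (n N : ℕ) : Set where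
  constructor mkL
  field
    u v   : Fin n
    gu gv : Fin N
    ps    : List (Fin n)

record PendD (n N : ℕ) : Set where
  constructor mkP
  field
    u leaf : Fin n
    gu     : Fin N

module _ {n N : ℕ} where

  interiors : List (LongD n N) → List (Fin n)
  interiors [] = []
  interiors (l ∷ ls) = LongD.ps l ++ interiors ls

  leavesOf : List (PendD n N) → List (Fin n)
  leavesOf = map PendD.leaf

  longTokens : List (LongD n N) → List (Fin N)
  longTokens [] = []
  longTokens (l ∷ ls) = tokens (LongD.gu l ∷ LongD.gv l ∷ []) ++ longTokens ls

  pendTokens : List (PendD n N) → List (Fin N)
  pendTokens = map PendD.gu

  interiors-++ : ∀ ls ms → interiors (ls ++ ms) ≡ interiors ls ++ interiors ms
  interiors-++ [] ms = refl
  interiors-++ (l ∷ ls) ms = trans (cong (LongD.ps l ++_) (interiors-++ ls ms)) (sym (++-assoc (LongD.ps l) _ _))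

  longTokens-++ : ∀ ls ms → longTokens (ls ++ ms) ≡ longTokens ls ++ longTokens ms
  longTokens-++ [] ms = refl
  longTokens-++ (l ∷ ls) ms = cong (tokens (LongD.gu l ∷ LongD.gv l ∷ []) ++_) (longTokens-++ ls ms)

-- The interface between trees and hosts. It is instantiated by the token states, once in a host
-- without spare vertices and once in a host with room, and by the plain greedy states behind
-- Chvátal's theorem.
record Extender {N : ℕ} (adj : Fin N → Fin N → Bool) : Set₁ where
  field
    G       : List (Fin N) → List (Fin N) → Set
    w Δ cap : ℕ
    w-big   : 3 + 4 * Δ ≤ w
    G-↭    : ∀ {us us′ R R′} → us ↭ us′ → R ↭ R′ → G us R → G us′ R′
    G-drop  : ∀ {us} T {R} → G us (T ++ R) → G us R
    ext     : ∀ {us x R} → G us (x ∷ R) → length us < cap → NN (Σ (Fin N) λ y → adj x y ≡ true × G (y ∷ us) (replicate w y ++ R))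

room-split-arith : ∀ a l b → (a + l) + b ≡ l + (a + b)
room-split-arith = solve-∀

module Embedding {n N : ℕ} (adj : Fin N → Fin N → Bool) (extender : Extender adj) where

  open Extender extender

  Pairs : Set
  Pairs = List (Fin n × Fin N)

  data Kept (np : Pairs) (lo : List (LongD n N)) (pe : List (PendD n N)) (x y : Fin n) : Set where
    direct : ∀ {gx gy} → (x , gx) ∈ˡ np → (y , gy) ∈ˡ np → adj gx gy ≡ true → Kept np lo pe x y
    onLong : ∀ l → l ∈ˡ lo → (LongD.u l , LongD.gu l) ∈ˡ np → (LongD.v l , LongD.gv l) ∈ˡ np → (x , y) ∈ˡ links (LongD.u l) (LongD.ps l) (LongD.v l) → Kept np lo pe x y
    onPend : ∀ p → p ∈ˡ pe → (PendD.u p , PendD.gu p) ∈ˡ np → x ≡ PendD.u p → y ≡ PendD.leaf p → Kept np lo pe x y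

  kept-mono : ∀ {np np′ lo lo′ pe pe′ x y} → (∀ {a} → a ∈ˡ np → a ∈ˡ np′) → (∀ {a} → a ∈ˡ lo → a ∈ˡ lo′) → (∀ {a} → a ∈ˡ pe → a ∈ˡ pe′) →
    Kept np lo pe x y → Kept np′ lo′ pe′ x y
  kept-mono f g h (direct a b e) = direct (f a) (f b) e
  kept-mono f g h (onLong l a b c e) = onLong l (g a) (f b) (f c) e
  kept-mono f g h (onPend p a b e e′) = onPend p (h a) (f b) e e′

  -- One record for trees and for forests: `above` is the parent of a forest, which is embedded
  -- elsewhere, and `spare` holds the three tokens left at the root of a tree, in case a long path
  -- ends there.
  record Part (vs : List (Fin n)) (es : List (Fin n × Fin n)) (nodes longs pends : ℕ) (Sized : ℕ → Set) (above : Pairs) (spare us R : List (Fin N)) : Set where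
    field
      np : Pairs
      lo : List (LongD n N)
      pe : List (PendD n N)
      vertices : vs ↭ map proj₁ np ++ (interiors lo ++ leavesOf pe)
      kept     : ∀ {x y} → (x , y) ∈ˡ es → Kept (above ++ np) lo pe x y
      #np      : length np ≡ nodes
      #lo      : length lo ≡ longs
      #pe      : length pe ≡ pends
      state    : G (map proj₂ np ++ us) (longTokens lo ++ (pendTokens pe ++ (spare ++ R)))
      sized    : ∀ {k} → Sized k → All (λ l → length (LongD.ps l) ≡ k) lo
      anchored : ∀ {a} → a ∈ˡ pe → (PendD.u a , PendD.gu a) ∈ˡ above ++ np
  open Part

  TreePart : Tr {n} → Fin N → List (Fin N) → List (Fin N) → Set
  TreePart t y us R = Σ (Part (verts t) (edges t) (#nodes t) (#long t) (#pend t) (λ k → Longs k t) [] (y ∷ y ∷ y ∷ []) us R) λ P → (root t , y) ∈ˡ np P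

  ForestPart : Fo {n} → Fin n → Fin N → List (Fin N) → List (Fin N) → Set
  ForestPart f u g us R = Part (vertsF f) (edgesF u f) (#nodesF f) (#longF f) (#pendF f) (λ k → LongsF k f) ((u , g) ∷ []) [] us R

  private
    room-split : ∀ a b {us} (xs : List (Fin N)) → length xs ≡ a → length us + (a + b) ≤ cap → length (xs ++ us) + b ≤ cap
    room-split a b {us} xs refl h = ≤-trans (≤-reflexive (trans (cong (_+ b) (length-++ xs)) (room-split-arith (length xs) (length us) b))) h

    ∈-mid : ∀ {A : Set} {a x : A} {xs} ys → a ∈ˡ x ∷ xs → a ∈ˡ x ∷ (ys ++ xs)
    ∈-mid ys (here e) = here e
    ∈-mid ys (there p) = there (∈-++⁺ʳ ys p)

    vertices↭ : ∀ {vt vf : List (Fin n)} (a b il jl ip jp : List (Fin n)) → vt ↭ a ++ (il ++ ip) → vf ↭ b ++ (jl ++ jp) → vt ++ vf ↭ (a ++ b) ++ ((il ++ jl) ++ (ip ++ jp))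
    vertices↭ a b il jl ip jp p q = ↭-trans (++⁺ p q) (permute 6 (λ a b c d e f → (a ⊕ (c ⊕ e)) ⊕ (b ⊕ (d ⊕ f)) ⊜ (a ⊕ b) ⊕ ((c ⊕ d) ⊕ (e ⊕ f))) ↭-refl a b il jl ip jp)

  join : ∀ {t f u g y us R} → adj g y ≡ true → (P : TreePart t y us (replicate (cost f) g ++ (g ∷ g ∷ g ∷ R))) →
    ForestPart f u g (map proj₂ (np (proj₁ P)) ++ us) (longTokens (lo (proj₁ P)) ++ (pendTokens (pe (proj₁ P)) ++ R)) → ForestPart (short t f) u g us R
  join {t} {f} {u} {g} {y} {us} {R} a (P , r) Q = record
    { np = np P ++ np Q ; lo = lo P ++ lo Q ; pe = pe P ++ pe Q
    ; vertices = subst (verts t ++ vertsF f ↭_) (cong₂ _++_ (sym (map-++ proj₁ (np P) (np Q))) (cong₂ _++_ (sym (interiors-++ (lo P) (lo Q))) (sym (map-++ PendD.leaf (pe P) (pe Q))))) (vertices↭ (map proj₁ (np P)) (map proj₁ (np Q)) (interiors (lo P)) (interiors (lo Q)) (leavesOf (pe P)) (leavesOf (pe Q)) (vertices P) (vertices Q))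
    ; kept = λ { (here refl) → direct (here refl) (there (∈-++⁺ˡ r)) a
               ; (there q) → case ∈-++⁻ (edges t) q of λ
                 { (inj₁ z) → kept-mono (λ q → there (∈-++⁺ˡ q)) ∈-++⁺ˡ ∈-++⁺ˡ (kept P z)
                 ; (inj₂ z) → kept-mono (∈-mid (np P)) (∈-++⁺ʳ (lo P)) (∈-++⁺ʳ (pe P)) (kept Q z) } }
    ; #np = trans (length-++ (np P)) (cong₂ _+_ (#np P) (#np Q)) ; #lo = trans (length-++ (lo P)) (cong₂ _+_ (#lo P) (#lo Q)) ; #pe = trans (length-++ (pe P)) (cong₂ _+_ (#pe P) (#pe Q))
    ; state = G-↭ (↭-trans (permute 3 (λ a b c → b ⊕ (a ⊕ c) ⊜ (a ⊕ b) ⊕ c) ↭-refl (map proj₂ (np P)) (map proj₂ (np Q)) us) (↭-reflexive (cong (_++ us) (sym (map-++ proj₂ (np P) (np Q))))))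
        (↭-trans (permute 5 (λ a b c d e → c ⊕ (d ⊕ (a ⊕ (b ⊕ e))) ⊜ (a ⊕ c) ⊕ ((b ⊕ d) ⊕ e)) ↭-refl (longTokens (lo P)) (pendTokens (pe P)) (longTokens (lo Q)) (pendTokens (pe Q)) R)
          (↭-reflexive (cong₂ (λ x y → x ++ (y ++ R)) (sym (longTokens-++ (lo P) (lo Q))) (sym (map-++ PendD.gu (pe P) (pe Q)))))) (state Q)
    ; sized = λ { (h , k) → All-++⁺ (sized P h) (sized Q k) }
    ; anchored = λ a → case ∈-++⁻ (pe P) a of λ { (inj₁ z) → there (∈-++⁺ˡ (anchored P z)) ; (inj₂ z) → ∈-mid (np P) (anchored Q z) } }

  joinLong : ∀ {ps t f u g y us R} (P : TreePart t y us (replicate (cost f) g ++ (g ∷ g ∷ g ∷ R))) →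
    ForestPart f u g (map proj₂ (np (proj₁ P)) ++ us) (longTokens (lo (proj₁ P)) ++ (pendTokens (pe (proj₁ P)) ++ (tokens (g ∷ y ∷ []) ++ R))) → ForestPart (long ps t f) u g us R
  joinLong {ps} {t} {f} {u} {g} {y} {us} {R} (P , r) Q = record
    { np = np P ++ np Q ; lo = l ∷ lo P ++ lo Q ; pe = pe P ++ pe Q
    ; vertices = ↭-trans (++⁺ˡ ps (subst (verts t ++ vertsF f ↭_) (cong₂ _++_ (sym (map-++ proj₁ (np P) (np Q))) (cong₂ _++_ (sym (interiors-++ (lo P) (lo Q))) (sym (map-++ PendD.leaf (pe P) (pe Q))))) (vertices↭ (map proj₁ (np P)) (map proj₁ (np Q)) (interiors (lo P)) (interiors (lo Q)) (leavesOf (pe P)) (leavesOf (pe Q)) (vertices P) (vertices Q))))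
        (permute 4 (λ p a b c → p ⊕ (a ⊕ (b ⊕ c)) ⊜ a ⊕ ((p ⊕ b) ⊕ c)) ↭-refl ps (map proj₁ (np P ++ np Q)) (interiors (lo P ++ lo Q)) (leavesOf (pe P ++ pe Q)))
    ; kept = λ q → case ∈-++⁻ (links u ps (root t)) q of λ
        { (inj₁ z) → onLong l (here refl) (here refl) (there (∈-++⁺ˡ r)) z
        ; (inj₂ q′) → case ∈-++⁻ (edges t) q′ of λ
                 { (inj₁ z) → kept-mono (λ q → there (∈-++⁺ˡ q)) (λ q → there (∈-++⁺ˡ q)) ∈-++⁺ˡ (kept P z)
                 ; (inj₂ z) → kept-mono (∈-mid (np P)) (λ q → there (∈-++⁺ʳ (lo P) q)) (∈-++⁺ʳ (pe P)) (kept Q z) } }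
    ; #np = trans (length-++ (np P)) (cong₂ _+_ (#np P) (#np Q)) ; #lo = cong suc (trans (length-++ (lo P)) (cong₂ _+_ (#lo P) (#lo Q))) ; #pe = trans (length-++ (pe P)) (cong₂ _+_ (#pe P) (#pe Q))
    ; state = G-↭ (↭-trans (permute 3 (λ a b c → b ⊕ (a ⊕ c) ⊜ (a ⊕ b) ⊕ c) ↭-refl (map proj₂ (np P)) (map proj₂ (np Q)) us) (↭-reflexive (cong (_++ us) (sym (map-++ proj₂ (np P) (np Q))))))
        (↭-trans (permute 6 (λ a b c d l e → c ⊕ (d ⊕ (a ⊕ (b ⊕ (l ⊕ e)))) ⊜ (l ⊕ (a ⊕ c)) ⊕ ((b ⊕ d) ⊕ e)) ↭-refl (longTokens (lo P)) (pendTokens (pe P)) (longTokens (lo Q)) (pendTokens (pe Q)) (tokens (g ∷ y ∷ [])) R)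
          (↭-reflexive (cong₂ (λ x z → (tokens (g ∷ y ∷ []) ++ x) ++ (z ++ R)) (sym (longTokens-++ (lo P) (lo Q))) (sym (map-++ PendD.gu (pe P) (pe Q)))))) (state Q)
    ; sized = λ { (e , h , k) → e ∷ All-++⁺ (sized P h) (sized Q k) }
    ; anchored = λ a → case ∈-++⁻ (pe P) a of λ { (inj₁ z) → there (∈-++⁺ˡ (anchored P z)) ; (inj₂ z) → ∈-mid (np P) (anchored Q z) } }
    where
    l : LongD n N
    l = mkL u (root t) g y ps

  mutual
    embT : ∀ (t : Tr {n}) {x us R} → Narrow Δ t → G us (x ∷ R) → length us + #nodes t ≤ cap → NN (Σ (Fin N) λ y → adj x y ≡ true × TreePart t y us R)
    embT (node v h) {x} {us} {R} (wd , nr) g room = ext g (≤-trans (≤-trans (≤-reflexive (+-comm 1 (length us))) (+-monoʳ-≤ (length us) (s≤s z≤n))) room) >>= λ { (y , a , g₁) →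
      embF h {v} {y} {y ∷ us} {y ∷ y ∷ y ∷ R} nr (prepare y g₁) (≤-trans (≤-reflexive (sym (+-suc (length us) (#nodesF h)))) room) >>= λ P →
      pure (y , a , record { np = (v , y) ∷ np P ; lo = lo P ; pe = pe P ; vertices = ↭-prep v (vertices P) ; kept = kept P ; #np = cong suc (#np P) ; #lo = #lo P ; #pe = #pe P
                           ; state = G-↭ (shift y (map proj₂ (np P)) us) ↭-refl (state P) ; sized = sized P ; anchored = anchored P } , here refl) }
      where
      enough : 3 + cost h ≤ w
      enough = ≤-trans (+-monoʳ-≤ 3 (≤-trans (≤-reflexive (cost-width h)) (*-monoʳ-≤ 4 wd))) w-big
      prepare : ∀ y → G (y ∷ us) (replicate w y ++ R) → G (y ∷ us) (replicate (cost h) y ++ (y ∷ y ∷ y ∷ R))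
      prepare y g with m≤n⇒∃[o]m+o≡n enough
      ... | o , refl rewrite replicate-+ (cost h) o y = G-drop (replicate o y) (G-↭ ↭-refl
        (permute 4 (λ y c o R → (y ⊕ (y ⊕ (y ⊕ (c ⊕ o)))) ⊕ R ⊜ o ⊕ (c ⊕ (y ⊕ (y ⊕ (y ⊕ R))))) ↭-refl (y ∷ []) (replicate (cost h) y) (replicate o y) R) g)

    embF : ∀ (f : Fo {n}) {u g us R} → NarrowF Δ f → G us (replicate (cost f) g ++ R) → length us + #nodesF f ≤ cap → NN (ForestPart f u g us R)
    embF tip nr g room = pure record { np = [] ; lo = [] ; pe = [] ; vertices = ↭-refl ; kept = λ () ; #np = refl ; #lo = refl ; #pe = refl ; state = g ; sized = λ _ → [] ; anchored = λ () }
    embF (short t f) {u} {g} {us} {R} (nt , nf) G₀ room =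
      embT t {g} {us} {replicate (cost f) g ++ (g ∷ g ∷ g ∷ R)} nt (G-↭ ↭-refl (split-tokens f g R) G₀) (≤-trans (+-monoʳ-≤ (length us) (m≤m+n _ _)) room) >>= λ { (y , a , P , r) →
      embF f {u} {g} {map proj₂ (np P) ++ us} {longTokens (lo P) ++ (pendTokens (pe P) ++ R)} nf
        (G-drop (y ∷ y ∷ y ∷ g ∷ g ∷ g ∷ []) (G-↭ ↭-refl (permute 6 (λ l p y c g R → l ⊕ (p ⊕ (y ⊕ (y ⊕ (y ⊕ (c ⊕ (g ⊕ (g ⊕ (g ⊕ R)))))))) ⊜ (y ⊕ (y ⊕ (y ⊕ (g ⊕ (g ⊕ g))))) ⊕ (c ⊕ (l ⊕ (p ⊕ R)))) ↭-refl
           (longTokens (lo P)) (pendTokens (pe P)) (y ∷ []) (replicate (cost f) g) (g ∷ []) R) (state P)))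
        (room-split (#nodes t) (#nodesF f) {us} (map proj₂ (np P)) (trans (length-map proj₂ (np P)) (#np P)) room) >>= λ Q → pure (join {t} {f} a (P , r) Q) }
    embF (long ps t f) {u} {g} {us} {R} (nt , nf) G₀ room =
      -- The lower end of a long path is put next to the upper end merely to find a new vertex; the
      -- path between them comes later.
      embT t {g} {us} {replicate (cost f) g ++ (g ∷ g ∷ g ∷ R)} nt (G-↭ ↭-refl (split-tokens f g R) G₀) (≤-trans (+-monoʳ-≤ (length us) (m≤m+n _ _)) room) >>= λ { (y , a , P , r) →
      embF f {u} {g} {map proj₂ (np P) ++ us} {longTokens (lo P) ++ (pendTokens (pe P) ++ (tokens (g ∷ y ∷ []) ++ R))} nf
        (G-↭ ↭-refl (permute 6 (λ l p y c g R → l ⊕ (p ⊕ (y ⊕ (y ⊕ (y ⊕ (c ⊕ (g ⊕ (g ⊕ (g ⊕ R)))))))) ⊜ c ⊕ (l ⊕ (p ⊕ ((g ⊕ (g ⊕ (g ⊕ (y ⊕ (y ⊕ y))))) ⊕ R)))) ↭-refl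
           (longTokens (lo P)) (pendTokens (pe P)) (y ∷ []) (replicate (cost f) g) (g ∷ []) R) (state P))
        (room-split (#nodes t) (#nodesF f) {us} (map proj₂ (np P)) (trans (length-map proj₂ (np P)) (#np P)) room) >>= λ Q → pure (joinLong {ps} {t} {f} (P , r) Q) }
    embF (pend v f) {u} {g} {us} {R} nf G₀ room =
      embF f {u} {g} {us} {g ∷ R} nf (G-drop (g ∷ g ∷ g ∷ []) (G-↭ ↭-refl (permute 3 (λ g c R → g ⊕ (g ⊕ (g ⊕ (g ⊕ (c ⊕ R)))) ⊜ (g ⊕ (g ⊕ g)) ⊕ (c ⊕ (g ⊕ R))) ↭-refl (g ∷ []) (replicate (cost f) g) R) G₀)) room >>= λ Q →
      pure record { np = np Q ; lo = lo Q ; pe = mkP u v g ∷ pe Q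
        ; vertices = ↭-trans (↭-prep v (vertices Q)) (permute 4 (λ v a b c → v ⊕ (a ⊕ (b ⊕ c)) ⊜ a ⊕ (b ⊕ (v ⊕ c))) ↭-refl (v ∷ []) (map proj₁ (np Q)) (interiors (lo Q)) (leavesOf (pe Q)))
        ; kept = λ { (here refl) → onPend (mkP u v g) (here refl) (here refl) refl refl ; (there q) → kept-mono (λ a → a) (λ a → a) there (kept Q q) }
        ; #np = #np Q ; #lo = #lo Q ; #pe = cong suc (#pe Q)
        ; state = G-↭ ↭-refl (permute 4 (λ l p g R → l ⊕ (p ⊕ (g ⊕ R)) ⊜ l ⊕ ((g ⊕ p) ⊕ R)) ↭-refl (longTokens (lo Q)) (pendTokens (pe Q)) (g ∷ []) R) (state Q)
        ; sized = λ () ; anchored = λ { (here refl) → here refl ; (there a) → anchored Q a } }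

    split-tokens : ∀ (f : Fo {n}) g R → g ∷ g ∷ g ∷ g ∷ (replicate (cost f) g ++ R) ↭ g ∷ (replicate (cost f) g ++ (g ∷ g ∷ g ∷ R))
    split-tokens f g R = permute 3 (λ g c R → g ⊕ (g ⊕ (g ⊕ (g ⊕ (c ⊕ R)))) ⊜ g ⊕ (c ⊕ (g ⊕ (g ⊕ (g ⊕ R))))) ↭-refl (g ∷ []) (replicate (cost f) g) R

-- From a filled partial embedding to a red copy

module Completion {n N : ℕ} (adj : Fin N → Fin N → Bool) (adj-sym : ∀ u v → adj u v ≡ adj v u) (T : SimpleGraph n) {Δ : ℕ} (S : TreeShape T Δ) where

  open Paths adj
  open TreeShape S

  RedCopy : Set
  RedCopy = Σ (Fin n → Fin N) λ f → Injective _≡_ _≡_ f × (∀ x y → Adj T x y → adj (f x) (f y) ≡ true)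

  Fill : LongD n N → List (Fin N) → Set
  Fill l gs = length gs ≡ length (LongD.ps l) × Chain (LongD.gu l) (gs ++ LongD.gv l ∷ []) (LongD.gv l)

  data Fills : List (LongD n N) → List (List (Fin N)) → Set where
    []  : Fills [] []
    _∷_ : ∀ {l gs ls gss} → Fill l gs → Fills ls gss → Fills (l ∷ ls) (gs ∷ gss)

  flatten : List (List (Fin N)) → List (Fin N)
  flatten [] = []
  flatten (gs ∷ gss) = gs ++ flatten gss

  pairsL : List (LongD n N) → List (List (Fin N)) → List (Fin n × Fin N)
  pairsL (l ∷ ls) (gs ∷ gss) = zip (LongD.ps l) gs ++ pairsL ls gss
  pairsL _ _ = []

  zip₁ : ∀ {A B : Set} (xs : List A) (ys : List B) → length ys ≡ length xs → map proj₁ (zip xs ys) ≡ xs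
  zip₁ [] [] e = refl
  zip₁ (x ∷ xs) (y ∷ ys) e = cong (x ∷_) (zip₁ xs ys (suc-injective e))

  zip₂ : ∀ {A B : Set} (xs : List A) (ys : List B) → length ys ≡ length xs → map proj₂ (zip xs ys) ≡ ys
  zip₂ [] [] e = refl
  zip₂ (x ∷ xs) (y ∷ ys) e = cong (y ∷_) (zip₂ xs ys (suc-injective e))

  pairsL₁ : ∀ {ls gss} → Fills ls gss → map proj₁ (pairsL ls gss) ≡ interiors ls
  pairsL₁ [] = refl
  pairsL₁ {l ∷ ls} {gs ∷ gss} ((e , _) ∷ h) = trans (map-++ proj₁ (zip (LongD.ps l) gs) _) (cong₂ _++_ (zip₁ (LongD.ps l) gs e) (pairsL₁ h))

  pairsL₂ : ∀ {ls gss} → Fills ls gss → map proj₂ (pairsL ls gss) ≡ flatten gss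
  pairsL₂ [] = refl
  pairsL₂ {l ∷ ls} {gs ∷ gss} ((e , _) ∷ h) = trans (map-++ proj₂ (zip (LongD.ps l) gs) _) (cong₂ _++_ (zip₂ (LongD.ps l) gs e) (pairsL₂ h))

  Realised : List (Fin n × Fin N) → Fin n → Fin n → Set
  Realised Π x y = Σ (Fin N) λ gx → Σ (Fin N) λ gy → (x , gx) ∈ˡ Π × (y , gy) ∈ˡ Π × adj gx gy ≡ true

  realise-links : ∀ {Π u v gu gv} ps gs → length gs ≡ length ps → Chain gu (gs ++ gv ∷ []) gv → (u , gu) ∈ˡ Π → (v , gv) ∈ˡ Π →
    (∀ {a} → a ∈ˡ zip ps gs → a ∈ˡ Π) → ∀ {x y} → (x , y) ∈ˡ links u ps v → Realised Π x y
  realise-links [] [] e (a ◃ nil) pu pv h (here refl) = _ , _ , pu , pv , a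
  realise-links (p ∷ ps) (g ∷ gs) e (a ◃ c) pu pv h (here refl) = _ , _ , pu , h (here refl) , a
  realise-links (p ∷ ps) (g ∷ gs) e (a ◃ c) pu pv h (there q) = realise-links ps gs (suc-injective e) c (h (here refl)) pv (λ z → h (there z)) q

  realise-longs : ∀ {Π ls gss l} → Fills ls gss → l ∈ˡ ls → (LongD.u l , LongD.gu l) ∈ˡ Π → (LongD.v l , LongD.gv l) ∈ˡ Π →
    (∀ {a} → a ∈ˡ pairsL ls gss → a ∈ˡ Π) → ∀ {x y} → (x , y) ∈ˡ links (LongD.u l) (LongD.ps l) (LongD.v l) → Realised Π x y
  realise-longs {ls = l ∷ ls} {gs ∷ gss} ((e , c) ∷ _) (here refl) pu pv h q = realise-links (LongD.ps l) gs e c pu pv (λ z → h (∈-++⁺ˡ z)) q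
  realise-longs {ls = l ∷ ls} {gs ∷ gss} (_ ∷ fs) (there p) pu pv h q = realise-longs fs p pu pv (λ z → h (∈-++⁺ʳ (zip (LongD.ps l) gs) z)) q

  realise-pend : ∀ {Π} (pe : List (PendD n N)) ys {p} → Pointwise (λ x y → adj x y ≡ true) (pendTokens pe) ys → p ∈ˡ pe → (PendD.u p , PendD.gu p) ∈ˡ Π →
    (∀ {a} → a ∈ˡ zip (leavesOf pe) ys → a ∈ˡ Π) → Realised Π (PendD.u p) (PendD.leaf p)
  realise-pend (p ∷ pe) (y ∷ ys) (a ∷ _) (here refl) pu h = _ , _ , pu , h (here refl) , a
  realise-pend (p ∷ pe) (y ∷ ys) (_ ∷ as) (there q) pu h = realise-pend pe ys as q pu (λ z → h (there z))

  pw-length : ∀ {xs ys : List (Fin N)} → Pointwise (λ x y → adj x y ≡ true) xs ys → length ys ≡ length xs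
  pw-length [] = refl
  pw-length (_ ∷ p) = cong suc (pw-length p)

  Unique-at : ∀ {A B : Set} (f : A → B) {xs a b} → Unique (map f xs) → a ∈ˡ xs → b ∈ˡ xs → f a ≡ f b → a ≡ b
  Unique-at f (h ∷ u) (here refl) (here refl) e = refl
  Unique-at f (h ∷ u) (here refl) (there q) e = ⊥-elim (All-lookup h (∈-map⁺ f q) e)
  Unique-at f (h ∷ u) (there p) (here refl) e = ⊥-elim (All-lookup h (∈-map⁺ f p) (sym e))
  Unique-at f (h ∷ u) (there p) (there q) e = Unique-at f u p q e

  assemble : ∀ Π → verts shape ↭ map proj₁ Π → Unique (map proj₂ Π) → (∀ {x y} → (x , y) ∈ˡ edges shape → Realised Π x y) → RedCopy
  assemble Π p u real = f , inj , hom
    where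
    image : ∀ x → Σ (Fin N) λ g → (x , g) ∈ˡ Π
    image x with ∈-map⁻ proj₁ (∈-resp-↭ p (spanning x))
    ... | (.x , g) , q , refl = g , q
    f : Fin n → Fin N
    f x = proj₁ (image x)
    inj : Injective _≡_ _≡_ f
    inj {x} {y} e = cong proj₁ (Unique-at proj₂ u (proj₂ (image x)) (proj₂ (image y)) e)
    f-unique : ∀ {x g} → (x , g) ∈ˡ Π → f x ≡ g
    f-unique {x} q = cong proj₂ (Unique-at proj₁ (Unique-↭ p distinct) (proj₂ (image x)) q refl)
    real-f : ∀ {x y} → (x , y) ∈ˡ edges shape → adj (f x) (f y) ≡ true
    real-f q with real q
    ... | gx , gy , px , py , a = trans (cong₂ adj (f-unique px) (f-unique py)) a
    hom : ∀ x y → Adj T x y → adj (f x) (f y) ≡ true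
    hom x y e with covered e
    ... | inj₁ q = real-f q
    ... | inj₂ q = trans (adj-sym (f x) (f y)) (real-f q)

  module _ (extender : Extender adj) where

    open Embedding {n} adj extender

    complete : ∀ {t y us R gss ys} → shape ≋ t → (P : TreePart t y us R) → let open Part (proj₁ P) in
      Fills lo gss → Pointwise (λ x y → adj x y ≡ true) (pendTokens pe) ys → Unique (map proj₂ np ++ (flatten gss ++ ys)) → RedCopy
    complete {t} {gss = gss} {ys} e (P , _) fl pw u = assemble Π V↭ (subst Unique (sym Π₂) u) λ q → realise (kept (subst (_ ∈ˡ_) (sym (edges≡ e)) q))
      where
      open Part P
      Π : List (Fin n × Fin N)
      Π = np ++ (pairsL lo gss ++ zip (leavesOf pe) ys)
      len : length ys ≡ length (leavesOf pe)
      len = trans (pw-length pw) (trans (length-map PendD.gu pe) (sym (length-map PendD.leaf pe)))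
      Π₁ : map proj₁ Π ≡ map proj₁ np ++ (interiors lo ++ leavesOf pe)
      Π₁ = trans (map-++ proj₁ np _) (cong (map proj₁ np ++_) (trans (map-++ proj₁ (pairsL lo gss) _) (cong₂ _++_ (pairsL₁ fl) (zip₁ (leavesOf pe) ys len))))
      Π₂ : map proj₂ Π ≡ map proj₂ np ++ (flatten gss ++ ys)
      Π₂ = trans (map-++ proj₂ np _) (cong (map proj₂ np ++_) (trans (map-++ proj₂ (pairsL lo gss) _) (cong₂ _++_ (pairsL₂ fl) (zip₂ (leavesOf pe) ys len))))
      V↭ : verts shape ↭ map proj₁ Π
      V↭ = ↭-trans (↭-reflexive (sym (verts≡ e))) (↭-trans vertices (↭-reflexive (sym Π₁)))
      realise : ∀ {x y} → Kept np lo pe x y → Realised Π x y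
      realise (direct a b c) = _ , _ , ∈-++⁺ˡ a , ∈-++⁺ˡ b , c
      realise (onLong l a b c q) = realise-longs fl a (∈-++⁺ˡ b) (∈-++⁺ˡ c) (λ z → ∈-++⁺ʳ np (∈-++⁺ˡ z)) q
      realise (onPend p a b refl refl) = realise-pend pe ys pw a (∈-++⁺ˡ b) (λ z → ∈-++⁺ʳ np (∈-++⁺ʳ (pairsL lo gss) z))

-- Families indexed by the ends of a network

module _ {A : Set} where

  collect : ∀ q → (Ix q → A) → List A
  collect zero f = f tt ∷ []
  collect (suc q) f = collect q (λ i → f (false , i)) ++ collect q (λ i → f (true , i))

  split-length : ∀ a {b} (xs : List A) → length xs ≡ a + b → Σ (List A) λ ys → Σ (List A) λ zs → xs ≡ ys ++ zs × length ys ≡ a × length zs ≡ b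
  split-length zero xs e = [] , xs , refl , refl , e
  split-length (suc a) (x ∷ xs) e with split-length a xs (suc-injective e)
  ... | ys , zs , e′ , l , m = x ∷ ys , zs , cong (x ∷_) e′ , cong suc l , m

  indexed : ∀ q (xs : List A) → length xs ≡ 2 ^ q → Σ (Ix q → A) λ f → collect q f ≡ xs
  indexed zero (x ∷ []) e = (λ _ → x) , refl
  indexed (suc q) xs e with split-length (2 ^ q) xs e
  ... | ys , zs , refl , l , m with indexed q ys l | indexed q zs (trans m (+-identityʳ _))
  ...   | f , ef | g , eg = (λ { (false , i) → f i ; (true , i) → g i }) , cong₂ _++_ ef eg

  collect-length : ∀ q (f : Ix q → A) → length (collect q f) ≡ 2 ^ q
  collect-length zero f = refl
  collect-length (suc q) f = trans (length-++ (collect q λ i → f (false , i))) (cong₂ _+_ (collect-length q _) (trans (collect-length q _) (sym (+-identityʳ _))))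

  ∈-collect : ∀ q (f : Ix q → A) i → f i ∈ˡ collect q f
  ∈-collect zero f tt = here refl
  ∈-collect (suc q) f (false , i) = ∈-++⁺ˡ (∈-collect q _ i)
  ∈-collect (suc q) f (true , i) = ∈-++⁺ʳ (collect q λ i → f (false , i)) (∈-collect q _ i)

  ∈-collect⁻ : ∀ q (f : Ix q → A) {v} → v ∈ˡ collect q f → Σ (Ix q) λ i → v ≡ f i
  ∈-collect⁻ zero f (here e) = tt , e
  ∈-collect⁻ (suc q) f p with ∈-++⁻ (collect q λ i → f (false , i)) p
  ... | inj₁ r with ∈-collect⁻ q _ r
  ...   | i , e = (false , i) , e
  ∈-collect⁻ (suc q) f p | inj₂ r with ∈-collect⁻ q _ r
  ...   | i , e = (true , i) , e

  collect-injective : ∀ q (f : Ix q → A) → Unique (collect q f) → ∀ {i j} → f i ≡ f j → i ≡ j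
  collect-injective zero f u e = refl
  collect-injective (suc q) f u {false , i} {false , j} e = cong (false ,_) (collect-injective q _ (Unique-++ˡ (collect q λ i → f (false , i)) u) e)
  collect-injective (suc q) f u {true , i} {true , j} e = cong (true ,_) (collect-injective q _ (Unique-++ʳ (collect q λ i → f (false , i)) u) e)
  collect-injective (suc q) f u {false , i} {true , j} e =
    ⊥-elim (Unique-disjoint (collect q λ i → f (false , i)) u (∈-collect q _ i) (subst (_∈ˡ collect q λ i → f (true , i)) (sym e) (∈-collect q _ j)))
  collect-injective (suc q) f u {true , i} {false , j} e =
    ⊥-elim (Unique-disjoint (collect q λ i → f (false , i)) u (∈-collect q _ j) (subst (_∈ˡ collect q λ i → f (true , i)) e (∈-collect q _ i)))

module _ {N : ℕ} where

  cat-collect : ∀ q (f : Ix q → Fin N) → cat q (λ i → f i ∷ []) ≡ collect q f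
  cat-collect zero f = refl
  cat-collect (suc q) f = cong₂ _++_ (cat-collect q _) (cat-collect q _)

  tk-collect : ∀ q (f : Ix q → Fin N) → tk q f ≡ tokens (collect q f)
  tk-collect zero f = refl
  tk-collect (suc q) f = trans (cong₂ _++_ (tk-collect q _) (tk-collect q _)) (sym (tokens-++ (collect q λ i → f (false , i)) _))

  pointwise-collect : ∀ {R : Fin N → Fin N → Set} q (f : Ix q → Fin N) {ms} → Pointwise R (collect q f) ms → Σ (Ix q → Fin N) λ g → collect q g ≡ ms × ∀ i → R (f i) (g i)
  pointwise-collect zero f {m ∷ []} (r ∷ []) = (λ _ → m) , refl , λ _ → r
  pointwise-collect {R} (suc q) f p with pw-split (collect q λ i → f (false , i)) p
    where
    pw-split : ∀ xs {ys ms} → Pointwise R (xs ++ ys) ms → Σ (List (Fin N)) λ ms₁ → Σ (List (Fin N)) λ ms₂ → ms ≡ ms₁ ++ ms₂ × Pointwise R xs ms₁ × Pointwise R ys ms₂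
    pw-split [] p = [] , _ , refl , [] , p
    pw-split (x ∷ xs) (r ∷ p) with pw-split xs p
    ... | a , b , refl , pa , pb = _ ∷ a , b , refl , r ∷ pa , pb
  ... | a , b , refl , pa , pb with pointwise-collect q _ pa | pointwise-collect q _ pb
  ...   | g , eg , rg | h , eh , rh = (λ { (false , i) → g i ; (true , i) → h i }) , cong₂ _++_ eg eh , λ { (false , i) → rg i ; (true , i) → rh i }

  members : 𝕊 N → List (Fin N)
  members X = filterᵇ X (allFin N)

  members⁺ : ∀ X {v} → v ∈ X → v ∈ˡ members X
  members⁺ X p = ∈-filterᵇ X (∈-allFin _) p

  filterᵇ⁻ : ∀ (X : 𝕊 N) xs {v} → v ∈ˡ filterᵇ X xs → v ∈ˡ xs × v ∈ X
  filterᵇ⁻ X (x ∷ xs) p with X x in e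
  filterᵇ⁻ X (x ∷ xs) (here refl) | true = here refl , e
  filterᵇ⁻ X (x ∷ xs) (there p) | true with filterᵇ⁻ X xs p
  ... | q , r = there q , r
  filterᵇ⁻ X (x ∷ xs) p | false with filterᵇ⁻ X xs p
  ... | q , r = there q , r

  filterᵇ-unique : ∀ (X : 𝕊 N) {xs} → Unique xs → Unique (filterᵇ X xs)
  filterᵇ-unique X [] = []
  filterᵇ-unique X {x ∷ xs} (h ∷ u) with X x
  ... | true = All-tabulate (λ p e → All-lookup h (proj₁ (filterᵇ⁻ X xs p)) e) ∷ filterᵇ-unique X u
  ... | false = filterᵇ-unique X u

  members-unique : ∀ X → Unique (members X)
  members-unique X = filterᵇ-unique X (Unique-allFin N)

  members⁻ : ∀ X {v} → v ∈ˡ members X → v ∈ X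
  members⁻ X p = proj₂ (filterᵇ⁻ X (allFin N) p)

  cnt-unique : ∀ v {xs : List (Fin N)} → Unique xs → cnt v xs ≤ ⟪ xs ⟫ v ⊙ 1
  cnt-unique v {[]} u = z≤n
  cnt-unique v {x ∷ xs} (h ∷ u) with v ≟ x
  ... | no _ = cnt-unique v u
  ... | yes refl = ≤-reflexive (cong suc (cnt-∉ λ p → All-lookup h p refl))

  cnt-∈ : ∀ {v} {xs : List (Fin N)} → v ∈ˡ xs → 1 ≤ cnt v xs
  cnt-∈ {v} (here refl) rewrite sing-refl v = s≤s z≤n
  cnt-∈ {v} {x ∷ xs} (there p) = ≤-trans (cnt-∈ p) (m≤n+m _ _)

longTokens-↭ : ∀ {n N} q (f : Ix q → LongD n N) → longTokens (collect q f) ↭ tk q (λ i → LongD.gu (f i)) ++ tk q (λ i → LongD.gv (f i))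
longTokens-↭ zero f = permute 2 (λ a b → a ⊕ (a ⊕ (a ⊕ (b ⊕ (b ⊕ b)))) ⊜ (a ⊕ (a ⊕ a)) ⊕ (b ⊕ (b ⊕ b))) ↭-refl (LongD.gu (f tt) ∷ []) (LongD.gv (f tt) ∷ [])
longTokens-↭ (suc q) f = ↭-trans (↭-reflexive (longTokens-++ (collect q λ i → f (false , i)) _)) (↭-trans (++⁺ (longTokens-↭ q _) (longTokens-↭ q _))
  (permute 4 (λ a b c d → (a ⊕ b) ⊕ (c ⊕ d) ⊜ (a ⊕ c) ⊕ (b ⊕ d)) ↭-refl (tk q λ i → LongD.gu (f (false , i))) (tk q λ i → LongD.gv (f (false , i))) (tk q λ i → LongD.gu (f (true , i))) (tk q λ i → LongD.gv (f (true , i)))))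

nodesF-count-arith : ∀ a b k l m → (a + k * l) + (b + k * m) ≡ (a + b) + k * (l + m)
nodesF-count-arith = solve-∀

nodesF-count-arith′ : ∀ a b k l m → k + ((a + k * l) + (b + k * m)) ≡ (a + b) + k * suc (l + m)
nodesF-count-arith′ = solve-∀

module _ {n : ℕ} where

  mutual
    longs-#pend : ∀ {k} (t : Tr {n}) → Longs k t → #pend t ≡ 0
    longs-#pend (node v f) h = longsF-#pend f h

    longsF-#pend : ∀ {k} (f : Fo {n}) → LongsF k f → #pendF f ≡ 0
    longsF-#pend tip h = refl
    longsF-#pend (short t f) (h , g) = cong₂ _+_ (longs-#pend t h) (longsF-#pend f g)
    longsF-#pend (long ps t f) (_ , h , g) = cong₂ _+_ (longs-#pend t h) (longsF-#pend f g)

  mutual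
    nodes-count : ∀ {k} (t : Tr {n}) → Longs k t → length (verts t) ≡ #nodes t + k * #long t
    nodes-count (node v f) h = cong suc (nodesF-count f h)

    nodesF-count : ∀ {k} (f : Fo {n}) → LongsF k f → length (vertsF f) ≡ #nodesF f + k * #longF f
    nodesF-count {k} tip h = sym (*-zeroʳ k)
    nodesF-count {k} (short t f) (h , g) = trans (length-++ (verts t)) (trans (cong₂ _+_ (nodes-count t h) (nodesF-count f g)) (nodesF-count-arith (#nodes t) (#nodesF f) k (#long t) (#longF f)))
    nodesF-count {k} (long ps t f) (e , h , g) = trans (length-++ ps) (trans (cong₂ _+_ e (trans (length-++ (verts t)) (cong₂ _+_ (nodes-count t h) (nodesF-count f g)))) (nodesF-count-arith′ (#nodes t) (#nodesF f) k (#long t) (#longF f)))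

  shape-length : ∀ {T : SimpleGraph n} {Δ} (S : TreeShape T Δ) → length (verts (TreeShape.shape S)) ≡ n
  shape-length S = ≤-antisym (Unique-bound distinct) (≤-trans (≤-reflexive (sym card-full)) (≤-trans (card-mono λ v _ → ∈⟪⟫⁺ (spanning v)) (card⟪⟫≤ (verts shape))))
    where open TreeShape S

-- M + Kc with M = 2^t: fewer than M vertices are missed by a set of M vertices and its neighbours,
-- and `Kc` is the transient room for one connection.
slack : ℕ → ℕ → ℕ
slack wb t = 2 ^ t + (2 + (treeSize t + treeSize t) + (wb + 1) * (2 ^ t + 2 ^ t))

module Dense {N : ℕ} (adj : Fin N → Fin N → Bool) (U : 𝕊 N) (M : ℕ) (edge : Linking adj U M) where

  open Extension adj

  missed : ∀ X B → X ⊆ U → M ≤ card X → B ⊆ U → (∀ v → v ∈ B → v ∉ X × v ∉ nb X) → card B < M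
  missed X B s c b h = ≰⇒> λ le → edge X B s b (λ v p q → true≢false p (proj₁ (h v q))) c le
    λ { (p , q , pX , qB , a) → true≢false (nb⁺ pX a) (proj₂ (h q qB)) }

  spread : ∀ X → X ⊆ U → M ≤ card X → card U ∸ M ≤ card ((X ∪ nb X) ∩ U)
  spread X s c = m≤n+o⇒m∸n≤o (card U) M (≤-trans (card-cover (U ∖ (X ∪ nb X)) ((X ∪ nb X) ∩ U) split)
      (+-monoˡ-≤ (card ((X ∪ nb X) ∩ U)) (<⇒≤ (missed X (U ∖ (X ∪ nb X)) s c (λ v p → proj₁ (∧⁻ p)) λ v p → ∨f⁻ {X v} (not⁻ (proj₂ (∧⁻ {U v} p)))))))
    where
    split : ∀ v → v ∈ U → v ∈ (U ∖ (X ∪ nb X)) ⊎ v ∈ ((X ∪ nb X) ∩ U)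
    split v p with bool? ((X ∪ nb X) v)
    ... | inj₁ q = inj₂ (∧⁺ q p)
    ... | inj₂ q = inj₁ (∧⁺ p (not⁺ q))

-- The exact embedding lemma for trees with many long bare paths: U may have exactly as many vertices as the tree.

record ExactHost {N : ℕ} (adj : Fin N → Fin N → Bool) : Set where
  field
    irr      : ∀ x → adj x x ≡ false
    adj-sym  : ∀ u v → adj u v ≡ adj v u
    U        : 𝕊 N
    t q w′  : ℕ
    edge     : Linking adj U (2 ^ t)
    robust   : ∀ X → X ⊆ U → card X ≤ 2 ^ t + 2 ^ t → (8 + w′) * card X ≤ card (Extension.nb adj X ∩ U)
    large    : slack (8 + w′) t < 2 ^ q

left-++-arith : ∀ j l k → (j + l) + k ≡ l + (j + k)
left-++-arith = solve-∀

left⇒room-arith : ∀ l k q u m c → l + k + q ≤ u → m + c < q → suc (l + k + c) + m ≤ u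
left⇒room-arith l k q u m c h1 h2 = lin 0 (h1 ⊞ h2) (solve (l List.∷ k List.∷ q List.∷ u List.∷ m List.∷ c List.∷ List.[]))

big-K-double : ∀ m → 18 * m ≡ 9 * (m + m)
big-K-double = solve-∀

small-few-bad : ∀ a z y r m q → a ≤ y + (z + r) → z ≤ m + m → y ≤ z → r < m → m + a ≡ q → m + 18 * m < q → q < q
small-few-bad a z y r m q h1 h2 h3 h4 h5 h6 = lin (1 + 13 * m) (h1 ⊞ 2 · h2 ⊞ h3 ⊞ h4 ⊞ ≡⇒≥ h5 ⊞ h6) (solve (a List.∷ z List.∷ y List.∷ r List.∷ m List.∷ q List.∷ List.[]))

build-frame-arith : ∀ Q d p v J → (Q + (Q + (v + (Q * d + (Q * p + (Q * p + J)))))) + Q ≡ (v + (d + (p + (3 + p))) * Q) + J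
build-frame-arith = solve-∀

lengths-sum : ∀ a b c d e f g → a + (b + (c + (d + (e + (f + (g + 0)))))) ≡ g + (f + (e + (d + (c + (b + a)))))
lengths-sum = solve-∀

module Exact {N : ℕ} (adj : Fin N → Fin N → Bool) (exactHost : ExactHost adj) where

  open ExactHost exactHost

  M Q n̂ : ℕ
  M = 2 ^ t
  Q = 2 ^ q
  n̂ = card U ∸ M

  1≤M : 1 ≤ M
  1≤M = m^n>0 2 t

  open Extension adj
  open Paths adj
  open Dense adj U M edge

  host : Host adj
  host = record { irr = irr ; adj-sym = adj-sym ; U = U ; M = M ; w′ = w′ ; n̂ = n̂ ; 1≤M = 1≤M ; robust = robust ; spread = spread }

  open Networks adj host edge t ≤-refl

  large′ : M + Kc < Q
  large′ = large

  Left : List (Fin N) → ℕ → Set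
  Left us k = length us + k + Q ≤ card U

  left-≤ : ∀ {us j k} → j ≤ k → Left us k → Left us j
  left-≤ {us} h r = ≤-trans (+-monoˡ-≤ Q (+-monoʳ-≤ (length us) h)) r

  left-++ : ∀ {us j k} xs → length xs ≡ j → Left us (j + k) → Left (xs ++ us) k
  left-++ {us} {j} {k} xs refl r = ≤-trans (≤-reflexive (cong (_+ Q) (trans (cong (_+ k) (length-++ xs)) (left-++-arith (length xs) (length us) k)))) r

  left⇒room : ∀ {us k} → Left us k → Room us k
  left⇒room {us} {k} h = m+n≤o⇒m≤o∸n (suc (length us + k + Kc)) (left⇒room-arith (length us) k Q (card U) M Kc h large′)

  -- A means of using up `k` further vertices of `U`; it keeps one token from which to continue.
  sprouts : ∀ k {us x R} → G us (x ∷ R) → Room us k →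
    NN (Σ (List (Fin N)) λ xs → Σ (Fin N) λ x′ → length xs ≡ k × G (xs ++ us) (x′ ∷ (tokens xs ++ R)))
  sprouts zero {x = x} g r = pure ([] , x , refl , g)
  sprouts (suc k) {us} {x} {R} g r = sprout g (Room-≤ {us} z≤n r) >>= λ { (y , a , g₁) →
    sprouts k {y ∷ us} {y} {y ∷ y ∷ y ∷ R} (G-drop (y ∷ replicate w′ y) (G-↭ ↭-refl
      (permute 3 (λ y c R → (y ⊕ (y ⊕ (y ⊕ (y ⊕ (y ⊕ c))))) ⊕ R ⊜ (y ⊕ c) ⊕ (y ⊕ (y ⊕ (y ⊕ (y ⊕ R))))) ↭-refl (y ∷ []) (replicate w′ y) R) g₁)) (Room-++ {us} (y ∷ []) refl r) >>= λ { (xs , x′ , l , g₂) →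
    pure (y ∷ xs , x′ , cong suc l , G-↭ (shift y xs us)
      (permute 4 (λ x t y R → x ⊕ (t ⊕ (y ⊕ (y ⊕ (y ⊕ R)))) ⊜ x ⊕ ((y ⊕ (y ⊕ (y ⊕ t))) ⊕ R)) ↭-refl (x′ ∷ []) (tokens xs) (y ∷ []) R) g₂) } }

  neighbours-of : ∀ (Z : 𝕊 N) ms {us R} → G us (ms ++ R) → Room us (length (filterᵇ Z ms)) →
    NN (Σ (List (Fin N)) λ ys → Pointwise (λ x y → adj x y ≡ true) (filterᵇ Z ms) ys × G (ys ++ us) (tokens ys ++ R))
  neighbours-of Z [] g r = pure ([] , [] , g)
  neighbours-of Z (m ∷ ms) {us} {R} g r with Z m
  ... | false = neighbours-of Z ms (G-drop (m ∷ []) g) r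
  ... | true = sprout g (Room-≤ {us} z≤n r) >>= λ { (y , a , g₁) →
    neighbours-of Z ms {y ∷ us} {y ∷ y ∷ y ∷ R} (G-drop (y ∷ y ∷ replicate w′ y) (G-↭ ↭-refl
      (permute 4 (λ y c m R → (y ⊕ (y ⊕ (y ⊕ (y ⊕ (y ⊕ c))))) ⊕ (m ⊕ R) ⊜ (y ⊕ (y ⊕ c)) ⊕ (m ⊕ (y ⊕ (y ⊕ (y ⊕ R))))) ↭-refl (y ∷ []) (replicate w′ y) ms R) g₁)) (Room-++ {us} (y ∷ []) refl r) >>= λ { (ys , pw , g₂) →
    pure (y ∷ ys , a ∷ pw , G-↭ (shift y ys us) (permute 3 (λ t y R → t ⊕ (y ⊕ (y ⊕ (y ⊕ R))) ⊜ (y ⊕ (y ⊕ (y ⊕ t))) ⊕ R) ↭-refl (tokens ys) (y ∷ []) R) g₂) } }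

  -- Hall's condition from small subsets of `U` into the list. In the matching it is applied to
  -- leftover vertices that have no neighbour in a given part of the list.
  Dominates : List (Fin N) → Set
  Dominates xs = ∀ Z → Z ⊆ U → card Z ≤ M → card Z ≤ card (nb Z ∩ ⟪ xs ⟫)

  matched-nb : ∀ {zs ys} → Pointwise (λ x y → adj x y ≡ true) zs ys → Unique ys → ∀ Z → Z ⊆ ⟪ zs ⟫ → card Z ≤ card (nb Z ∩ ⟪ ys ⟫)
  matched-nb [] u Z h = ≤-trans (card-mono h) (≤-trans (≤-reflexive card-∅) z≤n)
  matched-nb {z ∷ zs} {y ∷ ys} (a ∷ pw) (h ∷ u) Z s with bool? (Z z)
  ... | inj₂ z∉ = ≤-trans (matched-nb pw u Z λ v p → case ∨⁻ {｛ z ｝ v} (s v p) of λ { (inj₁ e) → true≢false (subst (_∈ Z) (sing⁻ e) p) z∉ ; (inj₂ q) → q })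
                    (card-mono λ v p → ∧⁺ {nb Z v} (proj₁ (∧⁻ {nb Z v} p)) (∨ʳ {｛ y ｝ v} (proj₂ (∧⁻ {nb Z v} p))))
  ... | inj₁ z∈ = ≤-trans (card-cover ｛ z ｝ (Z ∖ ｛ z ｝) λ v p → case bool? (｛ z ｝ v) of λ { (inj₁ e) → inj₁ e ; (inj₂ e) → inj₂ (∧⁺ p (not⁺ e)) })
      (≤-trans (card-sing z ⊞ matched-nb pw u (Z ∖ ｛ z ｝) λ v p → case ∨⁻ {｛ z ｝ v} (s v (proj₁ (∧⁻ p))) of λ { (inj₁ e) → true≢false e (not⁻ (proj₂ (∧⁻ {Z v} p))) ; (inj₂ q) → q })
      (≤-trans (+-monoˡ-≤ _ (∈⇒card (sing-refl y)))
        (card-disjoint ｛ y ｝ (nb (Z ∖ ｛ z ｝) ∩ ⟪ ys ⟫)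
          (λ v p → subst (_∈ (nb Z ∩ ⟪ y ∷ ys ⟫)) (sym (sing⁻ p)) (∧⁺ (nb⁺ z∈ a) (∨ˡ (sing-refl y))))
          (λ v p → ∧⁺ (nb-mono (λ _ r → proj₁ (∧⁻ r)) v (proj₁ (∧⁻ p))) (∨ʳ (proj₂ (∧⁻ {nb (Z ∖ ｛ z ｝) v} p))))
          λ v p r → All-lookup h (∈⟪⟫⁻ ys (proj₂ (∧⁻ {nb (Z ∖ ｛ z ｝) v} r))) (sym (sing⁻ p)))))

  -- A set Z₀ expanding badly into xs is small, and each of its vertices is given its own neighbour among ys.
  dominating-list : ∀ {us R x} → G us (x ∷ (members U ++ R)) → Left us Q →
    NN (Σ (List (Fin N)) λ xs → Σ (Fin N) λ x′ → length xs ≡ Q × Dominates xs × G (xs ++ us) (x′ ∷ (tokens xs ++ R)))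
  dominating-list {us} {R} {x} g left with m≤n⇒∃[o]m+o≡n (≤-trans (m≤m+n M Kc) (<⇒≤ large′))
  -- M of the Q places are reserved for the private neighbours of the bad set and for padding.
  ... | a , Ma≡Q = sprouts a g (left⇒room {us} (left-≤ {us} a≤Q left)) >>= λ { (xs , x₁ , lx , g₁) →
    maximal (Bad xs) ∅ ((λ v ()) , ≤-trans (≤-reflexive card-∅) z≤n , card-mono λ v p → none (nb⁻ (proj₁ (∧⁻ p)))) >>= λ { (Z , bad , best) →
    let few = small xs lx (uniq (proj₁ g₁)) (inU (proj₁ g₁)) Z bad
        lz = ≤-trans (length-filter Z) (<⇒≤ few)
        j , zj = m≤n⇒∃[o]m+o≡n lz
    in neighbours-of Z (members U) {xs ++ us} {x₁ ∷ (tokens xs ++ R)} (G-↭ ↭-refl (permute 4 (λ x t m R → x ⊕ (t ⊕ (m ⊕ R)) ⊜ m ⊕ (x ⊕ (t ⊕ R))) ↭-refl (x₁ ∷ []) (tokens xs) (members U) R) g₁)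
      (left⇒room {xs ++ us} (left-≤ {xs ++ us} lz (left-++ {us} {a} {M} xs lx (subst (Left us) (trans (sym Ma≡Q) (+-comm M a)) left)))) >>= λ { (ys , pw , g₂) →
    let ly = pwl pw in
    sprouts j {ys ++ (xs ++ us)} {x₁} {tokens ys ++ (tokens xs ++ R)} (G-↭ ↭-refl (permute 3 (λ a b c → a ⊕ (b ⊕ c) ⊜ b ⊕ (a ⊕ c)) ↭-refl (tokens ys) (x₁ ∷ []) (tokens xs ++ R)) g₂)
      (left⇒room {ys ++ (xs ++ us)} (left-++ {xs ++ us} {length (filterᵇ Z (members U))} {j} ys ly (subst (Left (xs ++ us)) (sym zj) (left-++ {us} {a} {M} xs lx (subst (Left us) (trans (sym Ma≡Q) (+-comm M a)) left))))) >>= λ { (pad , x₂ , lp , g₃) →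
    pure (pad ++ (ys ++ xs) , x₂ ,
      trans (length-++ pad) (trans (cong₂ _+_ lp (trans (length-++ ys) (cong₂ _+_ ly lx))) (trans (trans (sym (+-assoc j _ a)) (cong (_+ a) (trans (+-comm j _) zj))) Ma≡Q)) ,
      dominates xs ys pad Z few best bad pw (Unique-++ʳ pad (uniq (proj₁ g₃))) ,
      G-↭ (permute 4 (λ p y x u → p ⊕ (y ⊕ (x ⊕ u)) ⊜ (p ⊕ (y ⊕ x)) ⊕ u) ↭-refl pad ys xs us)
          (↭-trans (permute 5 (λ c p y x u → c ⊕ (p ⊕ (y ⊕ (x ⊕ u))) ⊜ c ⊕ ((p ⊕ (y ⊕ x)) ⊕ u)) ↭-refl (x₂ ∷ []) (tokens pad) (tokens ys) (tokens xs) R)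
            (↭-prep x₂ (++⁺ʳ R (↭-reflexive (sym (trans (tokens-++ pad (ys ++ xs)) (cong (tokens pad ++_) (tokens-++ ys xs)))))))) g₃) } } } }
    where
    a≤Q : a ≤ Q
    a≤Q = subst (a ≤_) Ma≡Q (m≤n+m a M)
    Bad : List (Fin N) → 𝕊 N → Set
    Bad xs Z = Z ⊆ U × card Z ≤ M + M × card (nb Z ∩ ⟪ xs ⟫) ≤ card Z
    none : ∀ {v} {A : Set} → Σ (Fin N) (λ x → x ∈ ∅ × adj x v ≡ true) → A
    none (_ , () , _)
    length-filter : ∀ Z → length (filterᵇ Z (members U)) ≤ card Z
    length-filter Z = ≤-trans (card⟪⟫≥ (filterᵇ-unique Z (members-unique U))) (card-mono λ v p → proj₂ (filterᵇ⁻ Z (members U) (∈⟪⟫⁻ _ p)))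
    pwl : ∀ {xs ys} → Pointwise (λ x y → adj x y ≡ true) xs ys → length ys ≡ length xs
    pwl [] = refl
    pwl (_ ∷ p) = cong suc (pwl p)
    -- For |Z| at least M the list would be covered by at most 2M vertices of N(Z), at most 2M of Z
    -- and fewer than M missed ones, while Q - M exceeds 18M.
    small : ∀ xs → length xs ≡ a → Unique (xs ++ us) → All (_∈ U) (xs ++ us) → ∀ Z → Bad xs Z → card Z < M
    small xs lx u iu Z (s , c , b) = ≰⇒> λ le → <-irrefl refl (small-few-bad a (card Z) (card (nb Z ∩ ⟪ xs ⟫)) (card (U ∖ (Z ∪ nb Z))) M Q
        (≤-trans (≤-reflexive (sym lx)) (≤-trans (card⟪⟫≥ (Unique-++ˡ xs u)) (≤-trans (card-cover (nb Z ∩ ⟪ xs ⟫) (Z ∪ (U ∖ (Z ∪ nb Z))) split)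
          (+-monoʳ-≤ _ (card-∪ Z (U ∖ (Z ∪ nb Z)))))))
        c b (missed Z (U ∖ (Z ∪ nb Z)) s le (λ v p → proj₁ (∧⁻ p)) λ v p → ∨f⁻ {Z v} (not⁻ (proj₂ (∧⁻ {U v} p)))) Ma≡Q
        (≤-<-trans (+-monoʳ-≤ M (≤-trans big-K (m≤n+m K (2 + (treeSize t + treeSize t))))) large′))
      where
      big-K : 18 * M ≤ K
      big-K = ≤-trans (≤-reflexive (big-K-double M)) (*-monoˡ-≤ (M + M) (s≤s (s≤s (s≤s (s≤s (s≤s (s≤s (s≤s (s≤s (m≤n+m 1 w′))))))))))
      split : ∀ v → v ∈ ⟪ xs ⟫ → v ∈ (nb Z ∩ ⟪ xs ⟫) ⊎ v ∈ (Z ∪ (U ∖ (Z ∪ nb Z)))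
      split v p with bool? (nb Z v) | bool? (Z v)
      ... | inj₁ r | _ = inj₁ (∧⁺ r p)
      ... | inj₂ r | inj₁ z = inj₂ (∨ˡ z)
      ... | inj₂ r | inj₂ z = inj₂ (∨ʳ (∧⁺ (All-lookup iu (∈-++⁺ˡ (∈⟪⟫⁻ xs p))) (not⁺ (∨f z r))))
    dominates : ∀ xs ys pad Z₀ → card Z₀ < M → (∀ Y → Bad xs Y → card Y ≤ card Z₀) → Bad xs Z₀ → Pointwise (λ x y → adj x y ≡ true) (filterᵇ Z₀ (members U)) ys →
      Unique (ys ++ (xs ++ us)) → Dominates (pad ++ (ys ++ xs))
    dominates xs ys pad Z₀ few best (s₀ , c₀ , b₀) pw u Z s c = ≤-trans (card-cover (Z ∖ Z₀) (Z ∩ Z₀) λ v p → case bool? (Z₀ v) of λ { (inj₁ z) → inj₂ (∧⁺ p z) ; (inj₂ z) → inj₁ (∧⁺ p (not⁺ z)) })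
      (≤-trans (outer ⊞ matched-nb pw (Unique-++ˡ ys u) (Z ∩ Z₀) λ v p → ∈⟪⟫⁺ (∈-filterᵇ Z₀ (members⁺ U (s v (proj₁ (∧⁻ p)))) (proj₂ (∧⁻ {Z v} p))))
        (card-disjoint (nb (Z ∖ Z₀) ∩ ⟪ xs ⟫) (nb (Z ∩ Z₀) ∩ ⟪ ys ⟫)
          (λ v p → ∧⁺ (nb-mono (λ _ r → proj₁ (∧⁻ r)) v (proj₁ (∧⁻ p))) (∈⟪⟫⁺ (∈-++⁺ʳ pad (∈-++⁺ʳ ys (∈⟪⟫⁻ xs (proj₂ (∧⁻ {nb (Z ∖ Z₀) v} p)))))))
          (λ v p → ∧⁺ (nb-mono (λ _ r → proj₁ (∧⁻ r)) v (proj₁ (∧⁻ p))) (∈⟪⟫⁺ (∈-++⁺ʳ pad (∈-++⁺ˡ (∈⟪⟫⁻ ys (proj₂ (∧⁻ {nb (Z ∩ Z₀) v} p)))))))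
          λ v p r → Unique-disjoint ys u (∈⟪⟫⁻ ys (proj₂ (∧⁻ {nb (Z ∩ Z₀) v} r))) (∈-++⁺ˡ (∈⟪⟫⁻ xs (proj₂ (∧⁻ {nb (Z ∖ Z₀) v} p))))))
      where
      A : 𝕊 N
      A = Z ∖ Z₀
      A+Z₀ : card A + card Z₀ ≤ card (A ∪ Z₀)
      A+Z₀ = card-disjoint A Z₀ (λ v → ∨ˡ) (λ v → ∨ʳ) λ v p r → true≢false r (not⁻ (proj₂ (∧⁻ {Z v} p)))
      -- Otherwise `A` together with `Z₀` would be a larger bad set. Bad sets may have up to 2M
      -- vertices to make room for this union.
      outer : card A ≤ card (nb A ∩ ⟪ xs ⟫)
      outer = ≮⇒≥ λ lt → <-irrefl refl (<-≤-trans (≤-<-trans z≤n lt) (cancel {card A} {card Z₀} (≤-trans A+Z₀ (best (A ∪ Z₀)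
        ( (λ v p → case ∨⁻ {A v} p of λ { (inj₁ r) → s v (proj₁ (∧⁻ r)) ; (inj₂ r) → s₀ v r })
        , ≤-trans (card-∪ A Z₀) (≤-trans (card-mono (λ v p → proj₁ (∧⁻ p))) c ⊞ <⇒≤ few)
        , ≤-trans (card-cover (nb A ∩ ⟪ xs ⟫) (nb Z₀ ∩ ⟪ xs ⟫) (λ v p → case nb-∪ v (proj₁ (∧⁻ p)) of λ { (inj₁ r) → inj₁ (∧⁺ r (proj₂ (∧⁻ {nb (A ∪ Z₀) v} p))) ; (inj₂ r) → inj₂ (∧⁺ r (proj₂ (∧⁻ {nb (A ∪ Z₀) v} p))) }))
            (≤-trans (<⇒≤ lt ⊞ b₀) A+Z₀))))))
        where
        cancel : ∀ {a b} → a + b ≤ b → a ≤ 0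
        cancel {a} {b} h = +-cancelʳ-≤ b a 0 h

  outside-free : ∀ us {v} → v ∉ outside us → v ∈ U × v ∉ ⟪ us ⟫
  outside-free us {v} h with U v | ∨f⁻ {not (U v)} h
  ... | true | _ , r = refl , r

  -- Hall's condition holds for two different reasons. A subset of at most M vertices of the list is
  -- served by the tokens. For a larger subset fewer than M leftover vertices Y have no neighbour in
  -- it; by domination Y has at least |Y| neighbours in the list, all outside the subset, so the
  -- subset has at most Q - |Y| vertices and sees at least as many.
  matching : ∀ {us R} xs → (∀ {v} → v ∈ˡ xs → v ∈ˡ us) → Unique xs → length xs ≡ Q → Dominates xs → G us (xs ++ R) → length us + Q ≡ card U →
    NN (Σ (List (Fin N)) λ ms → Pointwise (λ x y → adj x y ≡ true) xs ms × Unique ms × All (_∉ outside us) ms)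
  matching {us} {R} xs sub u lx dom (h , _) full = hall xs (outside us) λ X → ≤-trans (restrict X) (≤-trans (expand X) (card-mono λ v p →
      ∧⁺ {nb X v} (nb-mono (λ _ r → proj₁ (∧⁻ r)) v (proj₁ (∧⁻ {nb (X ∩ ⟪ xs ⟫) v} p))) (proj₂ (∧⁻ {nb (X ∩ ⟪ xs ⟫) v} p))))
    where
    xs⊆U : ∀ {v} → v ∈ ⟪ xs ⟫ → v ∈ U
    xs⊆U p = All-lookup (inU h) (sub (∈⟪⟫⁻ xs p))
    cnt≥1 : ∀ {v} → 1 ≤ cnt v xs → v ∈ ⟪ xs ⟫
    cnt≥1 {v} c with ⟪ xs ⟫ v in e
    ... | true = refl
    ... | false = ⊥-elim (<-irrefl refl (≤-trans c (≤-reflexive (cnt-∉ (∉⟪⟫⁻ {xs = xs} e)))))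
    restrict : ∀ X → wt X (λ v → cnt v xs) ≤ card (X ∩ ⟪ xs ⟫)
    restrict X = ≤-trans (wt-set {Y = X ∩ ⟪ xs ⟫} _ λ v p c → ∧⁺ p (cnt≥1 c)) (wt-mono (X ∩ ⟪ xs ⟫) λ v → ≤-trans (cnt-unique v u) (⊙-≤ (⟪ xs ⟫ v) 1))
    W : 𝕊 N
    W = U ∖ ⟪ us ⟫
    W≥Q : Q ≤ card W
    W≥Q = +-cancelˡ-≤ (length us) Q (card W) (≤-trans (≤-reflexive full) (≤-trans (card-cover ⟪ us ⟫ W λ v p → case bool? (⟪ us ⟫ v) of λ { (inj₁ r) → inj₁ r ; (inj₂ r) → inj₂ (∧⁺ p (not⁺ r)) }) (+-monoˡ-≤ _ (card⟪⟫≤ us))))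
    expand : ∀ X → card (X ∩ ⟪ xs ⟫) ≤ card (nb (X ∩ ⟪ xs ⟫) ∖ outside us)
    expand X with card (X ∩ ⟪ xs ⟫) ≤? M
    ... | yes le = ≤-trans (wt-agree {X = X ∩ ⟪ xs ⟫} λ v p → ≤-trans (≤-trans (cnt-∈ (∈⟪⟫⁻ xs (proj₂ (∧⁻ {X v} p)))) (≤-trans (m≤m+n (cnt v xs) (cnt v R)) (≤-reflexive (sym (cnt-++ v xs R))))) (m≤m+n _ _))
                     (good h (X ∩ ⟪ xs ⟫) (λ v p → xs⊆U (proj₂ (∧⁻ {X v} p))) (≤-trans le (m≤m+n M M)))
    ... | no nle = cancel (≤-trans (+-monoʳ-≤ (card X′) small) (≤-trans (+-comm≤ (card X′) (card (nb Y ∩ ⟪ xs ⟫))) (≤-trans apart (≤-trans (card⟪⟫≤ xs) (≤-reflexive lx)))))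
                     (≤-trans W≥Q (card-cover (nb X′ ∖ outside us) Y split))
      where
      X′ Y : 𝕊 N
      X′ = X ∩ ⟪ xs ⟫
      Y = W ∖ nb X′
      +-comm≤ : ∀ a b → a + b ≤ b + a
      +-comm≤ a b = ≤-reflexive (+-comm a b)
      Y⊆U : Y ⊆ U
      Y⊆U v p = proj₁ (∧⁻ (proj₁ (∧⁻ p)))
      Y-free : ∀ v → v ∈ Y → v ∉ ⟪ us ⟫
      Y-free v p = not⁻ (proj₂ (∧⁻ {U v} (proj₁ (∧⁻ p))))
      Y-far : ∀ v → v ∈ Y → v ∉ nb X′
      Y-far v p = not⁻ (proj₂ (∧⁻ {W v} p))
      notX : ∀ v → v ∈ Y → v ∉ X′
      notX v p with X′ v in e
      ... | false = refl
      ... | true = true≢false (∈⟪⟫⁺ (sub (∈⟪⟫⁻ xs (proj₂ (∧⁻ {X v} e))))) (Y-free v p)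
      few : card Y < M
      few = missed X′ Y (λ v p → xs⊆U (proj₂ (∧⁻ {X v} p))) (<⇒≤ (≰⇒> nle)) Y⊆U λ v p → notX v p , Y-far v p
      small : card Y ≤ card (nb Y ∩ ⟪ xs ⟫)
      small = dom Y Y⊆U (<⇒≤ few)
      apart : card (nb Y ∩ ⟪ xs ⟫) + card X′ ≤ card ⟪ xs ⟫
      apart = card-disjoint (nb Y ∩ ⟪ xs ⟫) X′ (λ v p → proj₂ (∧⁻ {nb Y v} p)) (λ v p → proj₂ (∧⁻ {X v} p)) λ v p r → far (nb⁻ (proj₁ (∧⁻ p))) r
        where
        far : ∀ {v} → Σ (Fin N) (λ y → y ∈ Y × adj y v ≡ true) → v ∈ X′ → ⊥
        far {v} (y , yY , a) r = true≢false (nb⁺ r (trans (adj-sym v y) a)) (Y-far y yY)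
      split : ∀ v → v ∈ W → v ∈ (nb X′ ∖ outside us) ⊎ v ∈ Y
      split v p with bool? (nb X′ v)
      ... | inj₁ r = inj₁ (∧⁺ r (not⁺ (∨f (cong not (proj₁ (∧⁻ p))) (not⁻ (proj₂ (∧⁻ {U v} p))))))
      ... | inj₂ r = inj₂ (∧⁺ p (not⁺ r))
      cancel : ∀ {x y ρ} → x + y ≤ Q → Q ≤ ρ + y → x ≤ ρ
      cancel {x} {y} {ρ} a b = +-cancelʳ-≤ y x ρ (≤-trans a b)

  linkAll : ∀ r {A B : Ix r → Fin N} {us R} → G us (tk r A ++ (tk r B ++ R)) → Room us (2 ^ r * p) →
    NN (Σ (Ix r → List (Fin N)) λ C → (∀ i → length (C i) ≡ p × Chain (A i) (C i ++ B i ∷ []) (B i)) × G (cat r C ++ us) (collect r B ++ R))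
  linkAll zero {A} {B} {us} {R} g room = link (G-↭ ↭-refl (permute 3 (λ a b R → a ⊕ (a ⊕ (a ⊕ (b ⊕ (b ⊕ (b ⊕ R))))) ⊜ a ⊕ (b ⊕ (a ⊕ (a ⊕ (b ⊕ (b ⊕ R)))))) ↭-refl (A tt ∷ []) (B tt ∷ []) R) g) (Room-≤ {us} z≤n room) >>= λ { (xs , l , c , g₁) →
    pure ((λ _ → xs) , (λ _ → l , c) , G-drop (tokens xs ++ A tt ∷ A tt ∷ B tt ∷ []) (G-↭ ↭-refl (permute 4 (λ t a b R → t ⊕ (a ⊕ (a ⊕ (b ⊕ (b ⊕ R)))) ⊜ (t ⊕ (a ⊕ (a ⊕ b))) ⊕ (b ⊕ R)) ↭-refl (tokens xs) (A tt ∷ []) (B tt ∷ []) R) g₁)) }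
  linkAll (suc r) {A} {B} {us} {R} g room =
    linkAll r {A₀} {B₀} {us} {tk r A₁ ++ (tk r B₁ ++ R)} (G-↭ ↭-refl (permute 5 (λ a b c d R → (a ⊕ b) ⊕ ((c ⊕ d) ⊕ R) ⊜ a ⊕ (c ⊕ (b ⊕ (d ⊕ R)))) ↭-refl (tk r A₀) (tk r A₁) (tk r B₀) (tk r B₁) R) g)
      (Room-≤ {us} (m≤m+n _ _) room′) >>= λ { (C , ok , g₁) →
    linkAll r {A₁} {B₁} {cat r C ++ us} {collect r B₀ ++ R} (G-↭ ↭-refl (permute 4 (λ c a b R → c ⊕ (a ⊕ (b ⊕ R)) ⊜ a ⊕ (b ⊕ (c ⊕ R))) ↭-refl (collect r B₀) (tk r A₁) (tk r B₁) R) g₁)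
      (Room-++ {us} (cat r C) (cat-length r λ i → proj₁ (ok i)) room′) >>= λ { (D , ok′ , g₂) →
    pure ((λ { (false , i) → C i ; (true , i) → D i }) , (λ { (false , i) → ok i ; (true , i) → ok′ i }) ,
      G-↭ (permute 3 (λ a b c → b ⊕ (a ⊕ c) ⊜ (a ⊕ b) ⊕ c) ↭-refl (cat r C) (cat r D) us) (permute 3 (λ a b c → b ⊕ (a ⊕ c) ⊜ (a ⊕ b) ⊕ c) ↭-refl (collect r B₀) (collect r B₁) R) g₂) } }
    where
    A₀ A₁ B₀ B₁ : Ix r → Fin N
    A₀ i = A (false , i)
    A₁ i = A (true , i)
    B₀ i = B (false , i)
    B₁ i = B (true , i)
    room′ : Room us (2 ^ r * p + 2 ^ r * p)
    room′ = subst (Room us) (layer-arith (2 ^ r) p) room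

  -- Interior vertices of a long path: a route through the network, a link to X, the three vertices
  -- from X over a leftover vertex to Y, and a link to the lower end.
  k : ℕ
  k = depth q + (p + (3 + p))

  module _ {n : ℕ} {T : SimpleGraph n} {Δ : ℕ} (S : TreeShape T Δ) (1≤Δ : 1 ≤ Δ) (4Δ≤w′ : 4 * Δ ≤ w′) where

    open TreeShape S
    open Completion adj adj-sym T S

    cap : ℕ
    cap = card U ∸ Q

    ext-cap : ∀ {us x R} → G us (x ∷ R) → length us < cap → NN (Σ (Fin N) λ y → adj x y ≡ true × G (y ∷ us) (replicate w y ++ R))
    ext-cap {us} g lt = sprout g (left⇒room {us} (≤-trans (≤-reflexive (cong (_+ Q) (+-identityʳ (length us)))) (fits (≤-trans (n≤1+n _) lt) (≤-trans (s≤s z≤n) lt))))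
      where
      fits : ∀ {l} → l ≤ cap → 1 ≤ cap → l + Q ≤ card U
      fits {l} h pos = ≤-trans (+-monoˡ-≤ Q h) (≤-reflexive (m∸n+n≡m {card U} {Q} (<⇒≤ (m∸n≢0⇒n<m {card U} {Q} λ e → <-irrefl (sym e) pos))))

    w-big : 3 + 4 * Δ ≤ w
    w-big = ≤-trans (+-monoʳ-≤ 3 4Δ≤w′) (m≤n+m (3 + w′) 2)

    extender : Extender adj
    extender = record { G = G ; w = w ; Δ = Δ ; cap = cap ; w-big = w-big ; G-↭ = λ p q → G-↭ p q ; G-drop = λ T → G-drop T ; ext = ext-cap }

    open Embedding {n} adj extender

    fills-++ : ∀ {ls ms gss hss} → Fills ls gss → Fills ms hss → Fills (ls ++ ms) (gss ++ hss)
    fills-++ [] h = h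
    fills-++ (f ∷ fs) h = f ∷ fills-++ fs h

    fills-collect : ∀ r {f : Ix r → LongD n N} {gs : Ix r → List (Fin N)} → (∀ i → Fill (f i) (gs i)) → Fills (collect r f) (collect r gs)
    fills-collect zero h = h tt ∷ []
    fills-collect (suc r) h = fills-++ (fills-collect r λ i → h (false , i)) (fills-collect r λ i → h (true , i))

    flatten-++ : ∀ xss yss → flatten (xss ++ yss) ≡ flatten xss ++ flatten yss
    flatten-++ [] yss = refl
    flatten-++ (xs ∷ xss) yss = trans (cong (xs ++_) (flatten-++ xss yss)) (sym (++-assoc xs _ _))

    flatten-collect : ∀ r (gs : Ix r → List (Fin N)) → flatten (collect r gs) ≡ cat r gs
    flatten-collect zero gs = ++-identityʳ _
    flatten-collect (suc r) gs = trans (flatten-++ (collect r λ i → gs (false , i)) _) (cong₂ _++_ (flatten-collect r _) (flatten-collect r _))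

    -- Every vertex of `U` starts with two tokens, one for each of the two dominating lists; the
    -- token at `u₀` starts the growth.
    initial : ∀ {u₀} → u₀ ∈ U → G [] (u₀ ∷ (members U ++ (members U ++ [])))
    initial {u₀} u₀∈ = mkH [] [] (u₀∈ ∷ All-++⁺ mem (All-++⁺ mem [])) good₀ , bound₀
      where
      mem : All (_∈ U) (members U)
      mem = All-tabulate (members⁻ U)
      bound₀ : Bounded [] (u₀ ∷ (members U ++ (members U ++ [])))
      bound₀ v rewrite cnt-++ v (members U) (members U ++ []) | cnt-++ v (members U) [] = +-monoˡ-≤ w (⊙-≤ (｛ u₀ ｝ v) 1 ⊞ (one ⊞ (one ⊞ z≤n {0})))
        where
        one : cnt v (members U) ≤ 1
        one = ≤-trans (cnt-unique v (members-unique U)) (⊙-≤ (⟪ members U ⟫ v) 1)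
      good₀ : Good U (M + M) (outside []) (demand [] (u₀ ∷ (members U ++ (members U ++ []))))
      good₀ X s c = ≤-trans (wt-mono X bound₀) (≤-trans (≤-reflexive (wt-const X (8 + w′))) (≤-trans (robust X s c)
        (card-mono λ v p → ∧⁺ (proj₁ (∧⁻ p)) (not⁺ (∨f (cong not (proj₂ (∧⁻ {nb X v} p))) refl)))))

    -- X and Y are dominating sets; the network joins the lower ends u of the long paths to X, and the rest W of U is matched to both X and Y.
    record Frame (t′ : Tr {n}) : Set where
      field
        {y₀} : Fin N
        {us₀ R₀} : List (Fin N)
        part : TreePart t′ y₀ us₀ R₀
        f    : Ix q → LongD n N
        f≡   : collect q f ≡ Part.lo (proj₁ part)
        X Y outs : Ix q → Fin N
        C D  : Ix q → List (Fin N)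
        news junk : List (Fin N)
        route : ∀ (π : Perm q) → Σ (Ix q → List (Fin N)) λ P → (∀ i → Chain (LongD.gu (f i)) (P i) (outs (Perm.to π i)) × length (P i) ≡ depth q) × cat q P ↭ news
        linkC : ∀ i → length (C i) ≡ p × Chain (outs i) (C i ++ X i ∷ []) (X i)
        linkD : ∀ i → length (D i) ≡ p × Chain (LongD.gv (f i)) (D i ++ Y i ∷ []) (Y i)
        domX  : Dominates (collect q X)
        domY  : Dominates (collect q Y)
        state : G (junk ++ (cat q D ++ (cat q C ++ (news ++ (map proj₂ (Part.np (proj₁ part)) ++ (collect q Y ++ collect q X)))))) (collect q X ++ collect q Y)
        exactly : length (junk ++ (cat q D ++ (cat q C ++ (news ++ (map proj₂ (Part.np (proj₁ part)) ++ (collect q Y ++ collect q X)))))) + Q ≡ card U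
      np′ rest used : List (Fin N)
      np′ = map proj₂ (Part.np (proj₁ part))
      rest = cat q D ++ (cat q C ++ (news ++ (np′ ++ (collect q Y ++ collect q X))))
      used = junk ++ rest

    finish-frame : ∀ {t′} → shape ≋ t′ → Longs k t′ → #pend t′ ≡ 0 → Frame t′ → NN RedCopy
    finish-frame {t′} e longs nopend F =
      matching {R = collect q Y} (collect q X) (λ p → in-used (∈-++⁺ʳ (collect q Y) p)) uX (collect-length q X) domX state exactly >>= λ { (ms , pwX , uM , outM) →
      matching {R = collect q X} (collect q Y) (λ p → in-used (∈-++⁺ˡ p)) uY (collect-length q Y) domY (G-↭ ↭-refl (++-comm (collect q X) (collect q Y)) state) exactly >>= λ { (ms′ , pwY , uM′ , outM′) →
      pure (conclude (pointwise-collect q X pwX) uM outM (pointwise-collect q Y pwY) uM′ outM′) } }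
      where
      open Frame F
      P₀ = proj₁ part
      u-used : Unique used
      u-used = uniq (proj₁ state)
      uXY : Unique (collect q Y ++ collect q X)
      uXY = Unique-++ʳ np′ (Unique-++ʳ news (Unique-++ʳ (cat q C) (Unique-++ʳ (cat q D) (Unique-++ʳ junk u-used))))
      uX : Unique (collect q X)
      uX = Unique-++ʳ (collect q Y) uXY
      uY : Unique (collect q Y)
      uY = Unique-++ˡ (collect q Y) uXY
      in-used : ∀ {v} → v ∈ˡ collect q Y ++ collect q X → v ∈ˡ used
      in-used p = ∈-++⁺ʳ junk (∈-++⁺ʳ (cat q D) (∈-++⁺ʳ (cat q C) (∈-++⁺ʳ news (∈-++⁺ʳ np′ p))))

      -- W has exactly Q vertices, so a duplicate-free list of Q vertices of W contains every vertex of W.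
      onto : ∀ (g : Ix q → Fin N) → Unique (collect q g) → All (_∉ outside used) (collect q g) → ∀ {v} → v ∉ outside used → Σ (Ix q) λ j → v ≡ g j
      onto g u av {v} v∉ with bool? (⟪ collect q g ⟫ v)
      ... | inj₁ p = ∈-collect⁻ q g (∈⟪⟫⁻ _ p)
      ... | inj₂ p = ⊥-elim (<-irrefl refl (≤-trans (≤-trans too-many (≤-trans (card⟪⟫≥ all-unique) (card-mono λ z r → all-in (∈⟪⟫⁻ (v ∷ (collect q g ++ used)) r))))
              (≤-reflexive (sym (trans (sym (+-comm (length used) Q)) exactly)))))
        where
        too-many : suc (Q + length used) ≤ length (v ∷ (collect q g ++ used))
        too-many = ≤-reflexive (cong suc (sym (trans (length-++ (collect q g)) (cong (_+ length used) (collect-length q g)))))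
        v-new : ∀ {z} → z ∈ˡ collect q g ++ used → v ≢ z
        v-new r refl with ∈-++⁻ (collect q g) r
        ... | inj₁ s = ∉⟪⟫⁻ {xs = collect q g} p s
        ... | inj₂ s = ∉⟪⟫⁻ {xs = used} (proj₂ (outside-free used v∉)) s
        all-unique : Unique (v ∷ (collect q g ++ used))
        all-unique = All-tabulate v-new ∷ Unique-++ u u-used λ r s → ∉⟪⟫⁻ {xs = used} (proj₂ (outside-free used (All-lookup av r))) s
        all-in : ∀ {z} → z ∈ˡ v ∷ (collect q g ++ used) → z ∈ U
        all-in (here refl) = proj₁ (outside-free used v∉)
        all-in (there r) with ∈-++⁻ (collect q g) r
        ... | inj₁ s = proj₁ (outside-free used (All-lookup av s))
        ... | inj₂ s = All-lookup (inU (proj₁ state)) s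

      conclude : ∀ {ms ms′} → (Σ (Ix q → Fin N) λ g → collect q g ≡ ms × ∀ i → adj (X i) (g i) ≡ true) → Unique ms → All (_∉ outside used) ms →
        (Σ (Ix q → Fin N) λ g → collect q g ≡ ms′ × ∀ i → adj (Y i) (g i) ≡ true) → Unique ms′ → All (_∉ outside used) ms′ → RedCopy
      conclude (μ , refl , aμ) uμ oμ (ν , refl , aν) uν oν =
        complete extender {gss = collect q gs} {ys = []} e part
          (subst (λ l → Fills l (collect q gs)) f≡ (fills-collect q fill)) no-pend unique
        where
        -- Both matchings are onto the leftover vertices. `τ` sends `i` to the index of the vertex
        -- of X that is matched to the same leftover vertex as `Y i`, so the route of `i` has to end
        -- there.
        τ : Perm q
        τ = record { to = λ i → proj₁ (fwd i) ; from = λ j → proj₁ (bwd j)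
                   ; from-to = λ i → collect-injective q ν uν (trans (sym (proj₂ (bwd (proj₁ (fwd i))))) (sym (proj₂ (fwd i))))
                   ; to-from = λ j → collect-injective q μ uμ (trans (sym (proj₂ (fwd (proj₁ (bwd j))))) (sym (proj₂ (bwd j)))) }
          where
          fwd : ∀ i → Σ (Ix q) λ j → ν i ≡ μ j
          fwd i = onto μ uμ oμ (All-lookup oν (∈-collect q ν i))
          bwd : ∀ j → Σ (Ix q) λ i → μ j ≡ ν i
          bwd j = onto ν uν oν (All-lookup oμ (∈-collect q μ j))
        τ-spec : ∀ i → ν i ≡ μ (Perm.to τ i)
        τ-spec i = proj₂ (onto μ uμ oμ (All-lookup oν (∈-collect q ν i)))
        R = route τ
        P : Ix q → List (Fin N)
        P = proj₁ R
        gs : Ix q → List (Fin N)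
        gs i = P i ++ (C (Perm.to τ i) ++ (X (Perm.to τ i) ∷ ν i ∷ Y i ∷ reverse (D i)))
        fill : ∀ i → Fill (f i) (gs i)
        fill i = trans len (sym size-ps) , subst (λ l → Chain (LongD.gu (f i)) l (LongD.gv (f i))) reassoc
            (chain-++ (proj₁ (proj₁ (proj₂ R) i)) (chain-++ (proj₂ (linkC j)) (subst (λ z → adj (X j) z ≡ true) (sym (τ-spec i)) (aμ j) ◃ (trans (adj-sym (ν i) (Y i)) (aν i) ◃ backwards (proj₂ (linkD i))))))
          where
          j = Perm.to τ i
          len : length (gs i) ≡ k
          len = trans (length-++ (P i)) (cong₂ _+_ (proj₂ (proj₁ (proj₂ R) i)) (trans (length-++ (C j)) (cong₂ _+_ (proj₁ (linkC j)) (cong (λ z → 3 + z) (trans (length-reverse (D i)) (proj₁ (linkD i)))))))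
          size-ps : length (LongD.ps (f i)) ≡ k
          size-ps = All-lookup (Part.sized P₀ longs) (subst (f i ∈ˡ_) f≡ (∈-collect q f i))
          reassoc : P i ++ ((C j ++ X j ∷ []) ++ (ν i ∷ Y i ∷ (reverse (D i) ++ LongD.gv (f i) ∷ []))) ≡ gs i ++ LongD.gv (f i) ∷ []
          reassoc = trans (cong (P i ++_) (trans (++-assoc (C j) _ _) (sym (++-assoc (C j) _ _)))) (sym (++-assoc (P i) _ _))
        no-pend : Pointwise (λ x y → adj x y ≡ true) (pendTokens (Part.pe P₀)) []
        no-pend with Part.pe P₀ | Part.#pe P₀
        ... | [] | _ = []
        ... | _ ∷ _ | l = ⊥-elim (0≢1+n (trans (sym nopend) (sym l)))
        cover : cat q gs ↭ news ++ (cat q C ++ (collect q X ++ (collect q ν ++ (collect q Y ++ cat q D))))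
        cover = ↭-trans (cat-++ q P _) (++⁺ (proj₂ (proj₂ R)) (↭-trans (cat-++ q (λ i → C (Perm.to τ i)) _) (++⁺ (cat-perm q τ C)
          (↭-trans (cat-++ q (λ i → X (Perm.to τ i) ∷ []) _) (++⁺ (↭-trans (cat-perm q τ λ i → X i ∷ []) (↭-reflexive (cat-collect q X)))
          (↭-trans (cat-++ q (λ i → ν i ∷ []) _) (++⁺ (↭-reflexive (cat-collect q ν))
          (↭-trans (cat-++ q (λ i → Y i ∷ []) _) (++⁺ (↭-reflexive (cat-collect q Y)) (cat-cong q λ i → ↭-reverse (D i)))))))))))
        unique : Unique (np′ ++ (flatten (collect q gs) ++ []))
        unique = Unique-↭ (↭-trans (permute 7 (λ ν D C n np Y X → ν ⊕ (D ⊕ (C ⊕ (n ⊕ (np ⊕ (Y ⊕ X))))) ⊜ np ⊕ (n ⊕ (C ⊕ (X ⊕ (ν ⊕ (Y ⊕ D)))))) ↭-refl (collect q ν) (cat q D) (cat q C) news np′ (collect q Y) (collect q X))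
            (++⁺ˡ np′ (↭-trans (↭-sym cover) (↭-reflexive (sym (trans (++-identityʳ _) (flatten-collect q gs)))))))
          (Unique-++ uν (Unique-++ʳ junk u-used) λ r s → ∉⟪⟫⁻ {xs = used} (proj₂ (outside-free used (All-lookup oν r))) (∈-++⁺ʳ junk s))

    build-frame : ∀ t′ → shape ≋ t′ → Longs k t′ → #long t′ ≡ Q → n ≤ card U → NN (Frame t′)
    build-frame t′ e longs count n≤U =
      dominating-list {[]} {members U ++ []} {u₀} (initial u₀∈) (left-≤ {[]} (m≤m+n Q _) left₀) >>= λ { (xs , x₁ , lx , dx , g₁) →
      let us₁ = xs ++ []
          left₁ = left-++ {[]} xs lx left₀ in
      dominating-list {us₁} {tokens xs ++ []} {x₁} (G-↭ ↭-refl (permute 3 (λ x m t → x ⊕ (t ⊕ m) ⊜ x ⊕ (m ⊕ t)) ↭-refl (x₁ ∷ []) (members U ++ []) (tokens xs)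
           `then` ↭-prep x₁ (↭-trans (++⁺ʳ (tokens xs) (↭-reflexive (++-identityʳ (members U)))) (++⁺ˡ (members U) (↭-reflexive (sym (++-identityʳ (tokens xs))))))) g₁) (left-≤ {us₁} (m≤m+n Q _) left₁) >>= λ { (ys , x₂ , ly , dy , g₂) →
      let us₂ = ys ++ us₁
          left₂ = left-++ {us₁} ys ly left₁ in
      embT t′ {x₂} {us₂} {tokens ys ++ (tokens xs ++ [])} (narrow≋ e 1≤Δ narrow) g₂
        (m+n≤o⇒m≤o∸n (length us₂ + #nodes t′) (left-≤ {us₂} (m≤m+n (#nodes t′) _) left₂)) >>= λ { (y , _ , P , r) →
      let us₃ = map proj₂ (Part.np P) ++ us₂
          left₃ = left-++ {us₂} (map proj₂ (Part.np P)) (trans (length-map proj₂ (Part.np P)) (Part.#np P)) left₂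
          f , f≡ = indexed q (Part.lo P) (trans (Part.#lo P) count)
          X , X≡ = indexed q xs lx
          Y , Y≡ = indexed q ys ly
          gu = λ i → LongD.gu (f i)
          gv = λ i → LongD.gv (f i)
          tX = ↭-reflexive (trans (cong tokens (sym X≡)) (sym (tk-collect q X)))
          tY = ↭-reflexive (trans (cong tokens (sym Y≡)) (sym (tk-collect q Y)))
          tL = ↭-trans (↭-reflexive (cong longTokens (sym f≡))) (longTokens-↭ q f)
      in
      network q {gu} {us₃} {tk q gv ++ (tk q X ++ (tk q Y ++ y ∷ []))}
        (G-drop (pendTokens (Part.pe P) ++ y ∷ y ∷ []) (G-↭ ↭-refl
          (↭-trans (++⁺ tL (++⁺ˡ (pendTokens (Part.pe P)) (↭-prep y (↭-prep y (↭-prep y (++⁺ tY (↭-trans (↭-reflexive (++-identityʳ (tokens xs))) tX)))))))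
            (permute 6 (λ a b p y Y X → (a ⊕ b) ⊕ (p ⊕ (y ⊕ (y ⊕ (y ⊕ (Y ⊕ X))))) ⊜ (p ⊕ (y ⊕ y)) ⊕ (a ⊕ (b ⊕ (X ⊕ (Y ⊕ y))))) ↭-refl (tk q gu) (tk q gv) (pendTokens (Part.pe P)) (y ∷ []) (tk q Y) (tk q X))) (Part.state P)))
        (left⇒room {us₃} (left-≤ {us₃} (m≤m+n (Q * depth q) _) left₃)) >>= λ Nw →
      let us₄ = Network.news Nw ++ us₃
          left₄ = left-++ {us₃} (Network.news Nw) (Network.size Nw) left₃ in
      linkAll q {Network.outs Nw} {X} {us₄} {tk q gv ++ (tk q Y ++ y ∷ [])}
        (G-↭ ↭-refl (permute 4 (λ o v X R → o ⊕ (v ⊕ (X ⊕ R)) ⊜ o ⊕ (X ⊕ (v ⊕ R))) ↭-refl (tk q (Network.outs Nw)) (tk q gv) (tk q X) (tk q Y ++ y ∷ [])) (Network.state Nw))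
        (left⇒room {us₄} (left-≤ {us₄} (m≤m+n (Q * p) _) left₄)) >>= λ { (C , okC , g₅) →
      let us₅ = cat q C ++ us₄
          left₅ = left-++ {us₄} (cat q C) (cat-length q λ i → proj₁ (okC i)) left₄ in
      linkAll q {gv} {Y} {us₅} {y ∷ collect q X}
        (G-↭ ↭-refl (permute 4 (λ X v Y y → X ⊕ (v ⊕ (Y ⊕ y)) ⊜ v ⊕ (Y ⊕ (y ⊕ X))) ↭-refl (collect q X) (tk q gv) (tk q Y) (y ∷ [])) g₅)
        (left⇒room {us₅} (left-≤ {us₅} (m≤m+n (Q * p) _) left₅)) >>= λ { (D , okD , g₆) →
      let us₆ = cat q D ++ us₅
          left₆ = left-++ {us₅} (cat q D) (cat-length q λ i → proj₁ (okD i)) left₅ in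
      -- One of the spare tokens at the image `y` of the root has been carried along for this
      -- purpose.
      sprouts J {us₆} {y} {collect q X ++ collect q Y} (G-↭ ↭-refl (permute 3 (λ Y y X → Y ⊕ (y ⊕ X) ⊜ y ⊕ (X ⊕ Y)) ↭-refl (collect q Y) (y ∷ []) (collect q X)) g₆) (left⇒room {us₆} left₆) >>= λ { (js , x₃ , lj , g₇) →
      pure record
        { part = P , r ; f = f ; f≡ = f≡ ; X = X ; Y = Y ; outs = Network.outs Nw ; C = C ; D = D ; news = Network.news Nw ; junk = js
        ; route = Network.route Nw ; linkC = okC ; linkD = okD ; domX = subst Dominates (sym X≡) dx ; domY = subst Dominates (sym Y≡) dy
        ; state = subst (λ z → G z (collect q X ++ collect q Y)) (us≡ js (cat q D) (cat q C) (Network.news Nw) (map proj₂ (Part.np P)) (sym Y≡) (sym X≡)) (G-drop (x₃ ∷ tokens js) g₇)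
        ; exactly = trans (cong (λ z → length z + Q) (sym (us≡ js (cat q D) (cat q C) (Network.news Nw) (map proj₂ (Part.np P)) (sym Y≡) (sym X≡))))
            (trans (cong (_+ Q) (lengths js (cat q D) (cat q C) (Network.news Nw) (map proj₂ (Part.np P)) ys xs lj (cat-length q λ i → proj₁ (okD i)) (cat-length q λ i → proj₁ (okC i)) (Network.size Nw) (trans (length-map proj₂ (Part.np P)) (Part.#np P)) ly lx)) total) } } } } } } }
      where
      _`then`_ : ∀ {a b c : List (Fin N)} → a ↭ b → b ↭ c → a ↭ c
      _`then`_ = ↭-trans
      verts-n : #nodes t′ + k * Q ≡ n
      verts-n = trans (cong (λ z → #nodes t′ + k * z) (sym count)) (trans (sym (nodes-count t′ longs)) (trans (cong length (verts≡ e)) (shape-length S)))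
      -- The excess of |U| over |T|. So many vertices are thrown away, so that exactly Q remain for
      -- the matchings.
      J : ℕ
      J = proj₁ (m≤n⇒∃[o]m+o≡n n≤U)
      total : (Q + (Q + (#nodes t′ + (Q * depth q + (Q * p + (Q * p + J)))))) + Q ≡ card U
      total = trans (build-frame-arith Q (depth q) p (#nodes t′) J) (trans (cong (_+ J) verts-n) (proj₂ (m≤n⇒∃[o]m+o≡n n≤U)))
      left₀ : Left [] (Q + (Q + (#nodes t′ + (Q * depth q + (Q * p + (Q * p + J))))))
      left₀ = ≤-reflexive total
      nonempty : Σ (Fin N) (_∈ U)
      nonempty = card-positive (≤-trans (m^n>0 2 q) (≤-trans (m≤n+m Q _) left₀))
      u₀ : Fin N
      u₀ = proj₁ nonempty
      u₀∈ : u₀ ∈ U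
      u₀∈ = proj₂ nonempty
      us≡ : ∀ js cD cC nw np {ys ys′ xs xs′ : List (Fin N)} → ys ≡ ys′ → xs ≡ xs′ →
        js ++ (cD ++ (cC ++ (nw ++ (np ++ (ys ++ (xs ++ [])))))) ≡ js ++ (cD ++ (cC ++ (nw ++ (np ++ (ys′ ++ xs′)))))
      us≡ js cD cC nw np {ys} refl refl = cong (λ z → js ++ (cD ++ (cC ++ (nw ++ (np ++ (ys ++ z)))))) (++-identityʳ _)
      lengths : ∀ (js cD cC nw np ys xs : List (Fin N)) {a b c d e f g} → length js ≡ a → length cD ≡ b → length cC ≡ c → length nw ≡ d → length np ≡ e → length ys ≡ f → length xs ≡ g →
        length (js ++ (cD ++ (cC ++ (nw ++ (np ++ (ys ++ (xs ++ []))))))) ≡ g + (f + (e + (d + (c + (b + a)))))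
      lengths js cD cC nw np ys xs refl refl refl refl refl refl refl
        rewrite length-++ js {cD ++ (cC ++ (nw ++ (np ++ (ys ++ (xs ++ [])))))} | length-++ cD {cC ++ (nw ++ (np ++ (ys ++ (xs ++ []))))} | length-++ cC {nw ++ (np ++ (ys ++ (xs ++ [])))}
              | length-++ nw {np ++ (ys ++ (xs ++ []))} | length-++ np {ys ++ (xs ++ [])} | length-++ ys {xs ++ []} | length-++ xs {[]} =
        lengths-sum (length js) (length cD) (length cC) (length nw) (length np) (length ys) (length xs)

    exact-embedding : ∀ t′ → shape ≋ t′ → Longs k t′ → #long t′ ≡ Q → n ≤ card U → NN RedCopy
    exact-embedding t′ e longs count n≤U = build-frame t′ e longs count n≤U >>= finish-frame e longs (longs-#pend t′ longs)

-- Trees in a host with room, and leaves attached last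

module _ {n : ℕ} where

  mutual
    pends-#long : ∀ (t : Tr {n}) → Pends t → #long t ≡ 0
    pends-#long (node v f) h = pendsF-#long f h

    pendsF-#long : ∀ (f : Fo {n}) → PendsF f → #longF f ≡ 0
    pendsF-#long tip h = refl
    pendsF-#long (short t f) (h , g) = cong₂ _+_ (pends-#long t h) (pendsF-#long f g)
    pendsF-#long (pend v f) h = pendsF-#long f h

  mutual
    pends-count : ∀ (t : Tr {n}) → Pends t → length (verts t) ≡ #nodes t + #pend t
    pends-count (node v f) h = cong suc (pendsF-count f h)

    pendsF-count : ∀ (f : Fo {n}) → PendsF f → length (vertsF f) ≡ #nodesF f + #pendF f
    pendsF-count tip h = refl
    pendsF-count (short t f) (h , g) = trans (length-++ (verts t)) (trans (cong₂ _+_ (pends-count t h) (pendsF-count f g)) (+-interchange (#nodes t) _ _ _))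
    pendsF-count (pend v f) h = trans (cong suc (pendsF-count f h)) (sym (+-suc (#nodesF f) (#pendF f)))

  ≋-refl : ∀ (t : Tr {n}) → t ≋ t
  ≋-refl t = record { root≡ = refl ; verts≡ = refl ; edges≡ = refl ; narrow≋ = λ _ h → h }

empty-list : ∀ {A : Set} {xs : List A} → length xs ≡ 0 → xs ≡ []
empty-list {xs = []} e = refl

module Expanding {N : ℕ} (adj : Fin N → Fin N → Bool) (host : Host adj)
                 {n : ℕ} {T : SimpleGraph n} {Δ : ℕ} (S : TreeShape T Δ) (1≤Δ : 1 ≤ Δ) (4Δ≤w′ : 4 * Δ ≤ Host.w′ host) where

  open Host host
  open Extension adj
  open Tokens adj host
  open TreeShape S
  open Completion adj adj-sym T S

  w-big : 3 + 4 * Δ ≤ w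
  w-big = ≤-trans (+-monoʳ-≤ 3 4Δ≤w′) (m≤n+m (3 + w′) 2)

  initial : ∀ {u₀} → u₀ ∈ U → G [] (u₀ ∷ [])
  initial {u₀} u₀∈ = mkH [] [] (u₀∈ ∷ []) good₀ , bound₀
    where
    bound₀ : Bounded [] (u₀ ∷ [])
    bound₀ v = ≤-trans (+-monoˡ-≤ w (≤-trans (≤-reflexive (+-identityʳ _)) (⊙-≤ (｛ u₀ ｝ v) 1))) (m≤n+m (6 + w′) 2)
    good₀ : Good U (M + M) (outside []) (demand [] (u₀ ∷ []))
    good₀ X s c = ≤-trans (wt-mono X bound₀) (≤-trans (≤-reflexive (wt-const X (8 + w′))) (≤-trans (robust X s c)
      (card-mono λ v p → ∧⁺ (proj₁ (∧⁻ p)) (not⁺ (∨f (cong not (proj₂ (∧⁻ {nb X v} p))) refl)))))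

  module _ (t′ : Tr {n}) (e : shape ≋ t′) (room : #nodes t′ + K ≤ n̂) where

    private
      ext′ : ∀ {us x R} → G us (x ∷ R) → length us < #nodes t′ → NN (Σ (Fin N) λ y → adj x y ≡ true × G (y ∷ us) (replicate w y ++ R))
      ext′ g lt = ext g (<-≤-trans (+-monoˡ-< K lt) room)

    extender : Extender adj
    extender = record { G = G ; w = w ; Δ = Δ ; cap = #nodes t′ ; w-big = w-big ; G-↭ = λ p q → G-↭ p q ; G-drop = λ T → G-drop T ; ext = ext′ }

    open Embedding {n} adj extender

    embed-nodes : 1 ≤ card U → NN (Σ (Fin N) λ y → TreePart t′ y [] [])
    embed-nodes ne with card-positive ne
    ... | u₀ , u₀∈ = embT t′ {u₀} {[]} {[]} (narrow≋ e 1≤Δ narrow) (initial u₀∈) ≤-refl >>= λ { (y , _ , P) → pure (y , P) }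

    finish : ∀ {y ys} (P : TreePart t′ y [] []) → #long t′ ≡ 0 → Pointwise (λ x y → adj x y ≡ true) (pendTokens (Part.pe (proj₁ P))) ys →
      Unique ys → All (_∉ outside (map proj₂ (Part.np (proj₁ P)) ++ [])) ys → RedCopy
    finish {ys = ys} P nolong pw u av = complete extender {gss = []} e P
      (subst (λ l → Fills l []) (sym (empty-list (trans (Part.#lo (proj₁ P)) nolong))) []) pw
      (Unique-++ (subst Unique (++-identityʳ _) (uniq (proj₁ (Part.state (proj₁ P))))) u λ p q →
        ∉⟪⟫⁻ {xs = map proj₂ (Part.np (proj₁ P)) ++ []} (proj₂ (∨f⁻ {not (U _)} (All-lookup av q))) (∈-++⁺ˡ p))

  -- The `K` vertices beyond |T| keep `ext` applicable until the last vertex is placed.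
  embed-plain : 1 ≤ card U → n + K ≤ n̂ → NN RedCopy
  embed-plain ne room = embed-nodes shape (≋-refl shape) room′ ne >>= λ { (y , P) →
    pure (finish shape (≋-refl shape) room′ P (plain⇒#long shape plain)
      (subst (λ l → Pointwise _ (pendTokens l) []) (sym (empty-list (trans (Part.#pe (proj₁ P)) (longs-#pend {k = 0} shape (plain⇒longs 0 shape plain))))) []) [] []) }
    where
    room′ : #nodes shape + K ≤ n̂
    room′ = ≤-trans (+-monoˡ-≤ K (≤-trans (m≤m+n (#nodes shape) _) (≤-reflexive (trans (sym (nodes-count shape (plain⇒longs 0 shape plain))) (shape-length S))))) room
    open Embedding {n} adj (extender shape (≋-refl shape) room′)

  cnt-total : ∀ (X : 𝕊 N) R → wt X (λ v → cnt v R) ≤ length R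
  cnt-total X [] = ≤-trans (≤-reflexive (wt-const X 0)) z≤n
  cnt-total X (x ∷ R) = ≤-trans (wt-≤-suc X x (λ v ne → ≤-reflexive (cong (λ b → b ⊙ 1 + cnt v R) (sing-∉ ne))) (≤-reflexive (cong (λ b → b ⊙ 1 + cnt x R) (sing-refl x)))) (s≤s (cnt-total X R))

  -- The leaves are attached last, all at once, by Hall's theorem.
  embed-with-leaves : 1 ≤ card U → n̂ ≡ n → suc K ≤ #leaves shape ∸ 1 → NN RedCopy
  embed-with-leaves ne refl many = embed-nodes t′ e room ne >>= λ { (y , P , r) →
    let us = map proj₂ (Part.np P) ++ [] in
    hall (pendTokens (Part.pe P)) (outside us) (λ X → condition P X) >>= λ { (ys , pw , u , av) → pure (finish t′ e room (P , r) (pends-#long t′ pends) pw u av) } }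
    where
    t′ : Tr {n}
    t′ = pendify shape
    e : shape ≋ t′
    e = pendify≋ shape plain
    pends : Pends t′
    pends = pendify-pends shape plain
    total : #nodes t′ + #pend t′ ≡ n
    total = trans (sym (pends-count t′ pends)) (trans (cong length (verts≡ e)) (shape-length S))
    room : #nodes t′ + K ≤ n
    room = ≤-trans (+-monoʳ-≤ (#nodes t′) (≤-trans (n≤1+n K) (≤-trans many (∸-monoˡ-≤ 1 (pendify-leaves shape plain))))) (≤-reflexive total)
    open Embedding {n} adj (extender t′ e room)
    condition : ∀ {y} (P : Part (verts t′) (edges t′) (#nodes t′) (#long t′) (#pend t′) (λ k → Longs k t′) [] (y ∷ y ∷ y ∷ []) [] []) X →
      wt X (λ v → cnt v (pendTokens (Part.pe P))) ≤ ρ X (outside (map proj₂ (Part.np P) ++ []))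
    condition {y} P X = ≤-trans (wt-set {Y = X′} _ λ v p c → ∧⁺ p (∈⟪⟫⁺ (anchored-in c))) (≤-trans inner (card-mono λ v p →
        ∧⁺ {nb X v} (nb-mono (λ _ r → proj₁ (∧⁻ r)) v (proj₁ (∧⁻ {nb X′ v} p))) (proj₂ (∧⁻ {nb X′ v} p))))
      where
      us toks : List (Fin N)
      us = map proj₂ (Part.np P) ++ []
      toks = pendTokens (Part.pe P)
      X′ : 𝕊 N
      X′ = X ∩ ⟪ us ⟫
      h : H us (longTokens (Part.lo P) ++ (toks ++ (y ∷ y ∷ y ∷ [])))
      h = proj₁ (Part.state P)
      us⊆U : ∀ {v} → v ∈ ⟪ us ⟫ → v ∈ U
      us⊆U p = All-lookup (inU h) (∈⟪⟫⁻ us p)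
      anchored-in : ∀ {v} → 1 ≤ cnt v toks → v ∈ˡ us
      anchored-in {v} c with bool? (⟪ toks ⟫ v)
      ... | inj₂ q = ⊥-elim (<-irrefl refl (≤-trans c (≤-reflexive (cnt-∉ (∉⟪⟫⁻ {xs = toks} q)))))
      ... | inj₁ q with ∈-map⁻ PendD.gu (∈⟪⟫⁻ toks q)
      ...   | d , d∈ , refl = ∈-++⁺ˡ (∈-map⁺ proj₂ (Part.anchored P d∈))
      inner : wt X′ (λ v → cnt v toks) ≤ ρ X′ (outside us)
      inner with card X′ ≤? M + M
      ... | yes le = ≤-trans (wt-mono X′ λ v → ≤-trans (≤-trans (m≤m+n (cnt v toks) _) (≤-reflexive (sym (cnt-++ v toks _))))
                       (≤-trans (m≤n+m (cnt v (toks ++ (y ∷ y ∷ y ∷ []))) (cnt v (longTokens (Part.lo P)))) (≤-trans (≤-reflexive (sym (cnt-++ v (longTokens (Part.lo P)) _))) (m≤m+n _ _))))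
                     (good h X′ (λ v p → us⊆U (proj₂ (∧⁻ {X v} p))) le)
      -- A large set of anchors sees, itself included, n vertices of `U`; all but the embedded nodes
      -- are free, which is one for every pendant leaf.
      ... | no nle = ≤-trans (cnt-total X′ toks) (+-cancelˡ-≤ (#nodes t′) (length toks) (ρ X′ (outside us)) (≤-trans (≤-reflexive (trans (cong (#nodes t′ +_) (trans (length-map PendD.gu (Part.pe P)) (Part.#pe P))) total))
                       (≤-trans (spread X′ (λ v p → us⊆U (proj₂ (∧⁻ {X v} p))) (≤-trans (m≤m+n M M) (<⇒≤ (≰⇒> nle))))
                         (≤-trans (card-cover ⟪ us ⟫ (nb X′ ∖ outside us) split) (+-monoˡ-≤ _ (≤-trans (card⟪⟫≤ us) (≤-reflexive (trans (cong length (++-identityʳ (map proj₂ (Part.np P)))) (trans (length-map proj₂ (Part.np P)) (Part.#np P))))))))))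
        where
        split : ∀ v → v ∈ ((X′ ∪ nb X′) ∩ U) → v ∈ ⟪ us ⟫ ⊎ v ∈ (nb X′ ∖ outside us)
        split v p with ∧⁻ {X′ v ∨ nb X′ v} p | bool? (⟪ us ⟫ v)
        ... | _ , _ | inj₁ z = inj₁ z
        ... | q , vU | inj₂ z with ∨⁻ {X′ v} q
        ...   | inj₁ x = inj₁ (proj₂ (∧⁻ {X v} x))
        ...   | inj₂ x = inj₂ (∧⁺ x (not⁺ (∨f (cong not vU) z)))

-- Blue families, culling and stars

∑-single : ∀ {n} {f : Fin n → ℕ} x → (∀ y → y ≢ x → f y ≡ 0) → ∑ f ≤ f x
∑-single {suc n} {f} fzero h = ≤-reflexive (trans (cong (f fzero +_) (trans (∑-cong {g = λ _ → 0} λ i → h (fsuc i) λ ()) (trans (∑-const n 0) (*-zeroʳ n)))) (+-identityʳ _))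
∑-single {suc n} {f} (fsuc x) h = ≤-trans (≤-reflexive (cong (_+ ∑ (f ∘ fsuc)) (h fzero λ ()))) (∑-single x λ y ne → h (fsuc y) λ { refl → ne refl })

-- adj is the red graph; blue means non-adjacent.

module Blue {N : ℕ} (adj : Fin N → Fin N → Bool) (adj-sym : ∀ u v → adj u v ≡ adj v u) where

  open Extension adj

  far : 𝕊 N → 𝕊 N → 𝕊 N
  far U X = U ∖ (X ∪ nb X)

  far⊆ : ∀ {U X} → far U X ⊆ U
  far⊆ v p = proj₁ (∧⁻ p)

  far⁺ : ∀ {U X v} → v ∈ U → v ∉ X → v ∉ nb X → v ∈ far U X
  far⁺ p q r = ∧⁺ p (not⁺ (∨f q r))

  far⁻ : ∀ {U X v} → v ∈ far U X → v ∈ U × v ∉ X × v ∉ nb X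
  far⁻ {U} {X} {v} p with ∧⁻ {U v} p
  ... | q , r with ∨f⁻ {X v} (not⁻ r)
  ...   | s , t = q , s , t

  far-mono : ∀ {U V X} → U ⊆ V → far U X ⊆ far V X
  far-mono h v p = ∧⁺ (h v (proj₁ (∧⁻ p))) (proj₂ (∧⁻ p))

  far-swap : ∀ {U V X Y} → X ⊆ U → V ⊆ far U Y → X ⊆ far U Y → Y ⊆ U → Y ⊆ far U X
  far-swap {U} {V} {X} {Y} xu vu xf yu v p with bool? (X v) | bool? (nb X v)
  ... | inj₁ q | _ = true≢false p (proj₁ (proj₂ (far⁻ {U} {Y} (xf v q))))
  ... | inj₂ q | inj₂ r = far⁺ {U} {X} (yu v p) q r
  ... | inj₂ q | inj₁ r with nb⁻ {X} r
  ...   | x , xX , a = true≢false (nb⁺ p (trans (adj-sym v x) a)) (proj₂ (proj₂ (far⁻ {U} {Y} (xf x xX))))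

  far-size : ∀ U X → card U ≤ card (far U X) + (card X + card ((nb X ∩ U) ∖ X))
  far-size U X = ≤-trans (card-cover (far U X) (X ∪ ((nb X ∩ U) ∖ X)) split) (+-monoʳ-≤ _ (card-∪ X ((nb X ∩ U) ∖ X)))
    where
    split : ∀ v → v ∈ U → v ∈ far U X ⊎ v ∈ (X ∪ ((nb X ∩ U) ∖ X))
    split v p with bool? (X v) | bool? (nb X v)
    ... | inj₁ q | _ = inj₂ (∨ˡ q)
    ... | inj₂ q | inj₁ r = inj₂ (∨ʳ (∧⁺ (∧⁺ r p) (not⁺ q)))
    ... | inj₂ q | inj₂ r = inj₁ (far⁺ {U} {X} p q r)

  -- k pairwise blue sets of m vertices each, and the same preceded by a set of a vertices
  BK : ℕ → 𝕊 N → ℕ → Set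
  BK m U zero = ⊤
  BK m U (suc k) = Σ (𝕊 N) λ P → P ⊆ U × m ≤ card P × BK m (far U P) k

  KK : ℕ → ℕ → 𝕊 N → ℕ → Set
  KK a m U k = Σ (𝕊 N) λ P → P ⊆ U × a ≤ card P × BK m (far U P) k

  BK-mono : ∀ {m U V} k → U ⊆ V → BK m U k → BK m V k
  BK-mono zero h b = tt
  BK-mono {U = U} {V} (suc k) h (P , s , c , b) = P , (λ v p → h v (s v p)) , c , BK-mono k (far-mono {U} {V} {P} h) b

  -- Being blue to each other is symmetric, so the small set `P` found inside `V` may stay in front
  -- although `S` was chosen before it.
  KK-insert : ∀ {a m U V S} k → S ⊆ U → m ≤ card S → V ⊆ far U S → KK a m V k → KK a m U (suc k)
  KK-insert {a} {m} {U} {V} {S} k s c vf (P , pV , cP , b) = P , (λ v p → proj₁ (far⁻ {U} {S} (vf v (pV v p)))) , cP , S , S-far , c , BK-mono k sub b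
    where
    S-far : S ⊆ far U P
    S-far = far-swap {U} {V} {P} {S} (λ v p → proj₁ (far⁻ {U} {S} (vf v (pV v p)))) vf (λ v p → vf v (pV v p)) s
    sub : far V P ⊆ far (far U P) S
    sub v p with far⁻ {V} {P} p
    ... | vV , vP , vnP with far⁻ {U} {S} (vf v vV)
    ...   | vU , vS , vnS = far⁺ {far U P} {S} (far⁺ {U} {P} vU vP vnP) vS vnS

  -- If a set X outside `B` expanded by less than the factor `D`, then X together with `B` would be
  -- bad as well; by maximality X would be empty, and the empty set does not expand too little. The
  -- bound on |X| + |B| keeps the union within size `l`.
  cull : ∀ U l D → NN (Σ (𝕊 N) λ B → B ⊆ U × card B ≤ l × card ((nb B ∩ U) ∖ B) ≤ D * card B ×
           (∀ X → X ⊆ (U ∖ B) → card X + card B ≤ l → D * card X ≤ card (nb X ∩ (U ∖ B))))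
  cull U l D = maximal Bad ∅ ((λ v ()) , ≤-trans (≤-reflexive card-∅) z≤n , ≤-trans (card-mono none) (≤-trans (≤-reflexive card-∅) z≤n)) >>= λ { (B , (s , c , b) , best) → pure (B , s , c , b , expand B s b best) }
    where
    Bad : 𝕊 N → Set
    Bad B = B ⊆ U × card B ≤ l × card ((nb B ∩ U) ∖ B) ≤ D * card B
    none : ((nb ∅ ∩ U) ∖ ∅) ⊆ ∅
    none v p with nb⁻ {∅} (proj₁ (∧⁻ (proj₁ (∧⁻ {nb ∅ v ∧ U v} p))))
    ... | _ , () , _
    expand : ∀ B → B ⊆ U → card ((nb B ∩ U) ∖ B) ≤ D * card B → (∀ Y → Bad Y → card Y ≤ card B) →
      ∀ X → X ⊆ (U ∖ B) → card X + card B ≤ l → D * card X ≤ card (nb X ∩ (U ∖ B))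
    expand B s b best X sX cl = ≮⇒≥ λ lt → <-irrefl refl (<-≤-trans lt (≤-trans (*-monoʳ-≤ D (empty lt)) (≤-trans (≤-reflexive (*-zeroʳ D)) z≤n)))
      where
      sum≤ : card X + card B ≤ card (X ∪ B)
      sum≤ = card-disjoint X B (λ v → ∨ˡ) (λ v → ∨ʳ) λ v p q → true≢false q (not⁻ (proj₂ (∧⁻ {U v} (sX v p))))
      split : ∀ v → v ∈ ((nb (X ∪ B) ∩ U) ∖ (X ∪ B)) → v ∈ (nb X ∩ (U ∖ B)) ⊎ v ∈ ((nb B ∩ U) ∖ B)
      split v p with ∧⁻ {nb (X ∪ B) v ∧ U v} p
      ... | q , r with ∧⁻ {nb (X ∪ B) v} q | ∨f⁻ {X v} (not⁻ r)
      ...   | nb∈ , vU | _ , vB with nb-∪ v nb∈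
      ...     | inj₁ z = inj₁ (∧⁺ z (∧⁺ vU (not⁺ vB)))
      ...     | inj₂ z = inj₂ (∧⁺ (∧⁺ z vU) (not⁺ vB))
      empty : card (nb X ∩ (U ∖ B)) < D * card X → card X ≤ 0
      empty lt = +-cancelʳ-≤ (card B) (card X) 0 (≤-trans sum≤ (best (X ∪ B)
        ((λ v p → case ∨⁻ {X v} p of λ { (inj₁ q) → proj₁ (∧⁻ (sX v q)) ; (inj₂ q) → s v q }) , ≤-trans (card-∪ X B) cl ,
         ≤-trans (card-cover (nb X ∩ (U ∖ B)) ((nb B ∩ U) ∖ B) split) (≤-trans (<⇒≤ lt ⊞ b) (≤-trans (≤-reflexive (sym (*-distribˡ-+ D (card X) (card B)))) (*-monoʳ-≤ D sum≤))))))

  card-as-∑ : ∀ (X : 𝕊 N) → card X ≡ ∑ (λ v → X v ⊙ 1)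
  card-as-∑ X = wt-∑ X _

  double-count : ∀ (X : 𝕊 N) (r : Fin N → 𝕊 N) → wt X (λ v → card (r v)) ≡ ∑ (λ u → ∑ λ v → X v ⊙ (r v u ⊙ 1))
  double-count X r = trans (wt-∑ X _) (trans (∑-cong λ v → trans (cong (X v ⊙_) (card-as-∑ (r v))) (push (X v) (λ u → r v u ⊙ 1))) (∑-swap λ v u → X v ⊙ (r v u ⊙ 1)))
    where
    push : ∀ b (f : Fin N → ℕ) → b ⊙ ∑ f ≡ ∑ (λ u → b ⊙ f u)
    push true f = refl
    push false f = sym (trans (∑-const N 0) (*-zeroʳ N))

  nb-count : ∀ X E d → (∀ v → v ∈ X → card (adj v ∩ E) ≤ d) → card (nb X ∩ E) ≤ d * card X
  nb-count X E d h = ≤-trans (≤-trans (≤-reflexive (card-as-∑ (nb X ∩ E))) (∑-mono point)) (≤-trans (≤-reflexive (sym (double-count X λ v → adj v ∩ E)))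
    (≤-trans (wt-agree {X = X} h) (≤-reflexive (wt-const X d))))
    where
    point : ∀ u → (nb X ∩ E) u ⊙ 1 ≤ ∑ (λ v → X v ⊙ ((adj v u ∧ E u) ⊙ 1))
    point u with (nb X ∩ E) u in e
    ... | false = z≤n
    ... | true with nb⁻ (proj₁ (∧⁻ {nb X u} e))
    ...   | v , vX , a = ≤-trans (≤-reflexive (sym (cong₂ (λ b c → b ⊙ (c ⊙ 1)) vX (∧⁺ a (proj₂ (∧⁻ {nb X u} e)))))) (term≤∑ _ v)

  -- `own` names the centre of every leaf, which makes stars with different centres disjoint.
  star : (Fin N → Fin N) → 𝕊 N → Fin N → 𝕊 N
  star own A y u = A u ∧ (isYes (own u ≟ y) ∧ adj y u)

  star⁺ : ∀ {own A y u} → u ∈ A → own u ≡ y → adj y u ≡ true → u ∈ star own A y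
  star⁺ {u = u} p refl a = ∧⁺ p (∧⁺ (sing-refl _) a)

  star⁻ : ∀ {own A y u} → u ∈ star own A y → u ∈ A × own u ≡ y × adj y u ≡ true
  star⁻ {own} {A} {y} {u} p with ∧⁻ {A u} p
  ... | q , r with ∧⁻ {isYes (own u ≟ y)} r
  ...   | s , a = q , sing⁻ s , a

  star-count : ∀ own A X d → (∀ y → y ∈ X → d ≤ card (star own A y)) → d * card X ≤ card (nb X ∩ A)
  star-count own A X d h = ≤-trans (≤-trans (≤-reflexive (sym (wt-const X d))) (wt-agree {X = X} h)) (≤-trans (≤-reflexive (double-count X (star own A)))
      (≤-trans (∑-mono point) (≤-reflexive (sym (card-as-∑ (nb X ∩ A))))))
    where
    point : ∀ u → ∑ (λ v → X v ⊙ (star own A v u ⊙ 1)) ≤ (nb X ∩ A) u ⊙ 1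
    point u = ≤-trans (∑-single (own u) off) on
      where
      off : ∀ v → v ≢ own u → X v ⊙ (star own A v u ⊙ 1) ≡ 0
      off v ne with X v | star own A v u in e
      ... | false | _ = refl
      ... | true | false = refl
      ... | true | true = ⊥-elim (ne (sym (proj₁ (proj₂ (star⁻ {own} {A} e)))))
      on : X (own u) ⊙ (star own A (own u) u ⊙ 1) ≤ (nb X ∩ A) u ⊙ 1
      on with X (own u) in eX | star own A (own u) u in e
      ... | false | _ = z≤n
      ... | true | false = z≤n
      ... | true | true with star⁻ {own} {A} e
      ...   | uA , _ , a = ≤-reflexive (cong (_⊙ 1) (sym (∧⁺ (nb⁺ eX a) uA)))

  -- A maximal family of disjoint stars with centres in `Z` and leaves in `W`: apart from the
  -- centres, the vertices of `Z` have few neighbours in `W` once the small set `L` is discarded.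
  record Stars (W Z : 𝕊 N) (d : ℕ) : Set where
    field
      Y L   : 𝕊 N
      own   : Fin N → Fin N
      Y⊆Z   : Y ⊆ Z
      L⊆W   : L ⊆ W
      |L|   : card L ≤ d * card Y
      stars : ∀ y → y ∈ Y → d ≤ card (star own L y)
      stuck : ∀ v → v ∈ Z → v ∉ Y → card (adj v ∩ (W ∖ L)) ≤ d

  max-stars : ∀ W Z d → NN (Stars W Z d)
  max-stars W Z d = maximal Family ∅ ((λ v ()) , ∅ , (λ v → v) , (λ v ()) , ≤-trans (≤-reflexive card-∅) z≤n , λ y ()) >>= λ { (Y , (s , L , own , l , c , st) , best) →
      pure record { Y = Y ; L = L ; own = own ; Y⊆Z = s ; L⊆W = l ; |L| = c ; stars = st ; stuck = λ v vZ v∉ → ≮⇒≥ λ lt → grow Y s L own l c st best v vZ v∉ (<⇒≤ lt) } }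
    where
    Family : 𝕊 N → Set
    Family Y = Y ⊆ Z × Σ (𝕊 N) λ L → Σ (Fin N → Fin N) λ own → L ⊆ W × card L ≤ d * card Y × (∀ y → y ∈ Y → d ≤ card (star own L y))
    grow : ∀ Y → Y ⊆ Z → ∀ L own → L ⊆ W → card L ≤ d * card Y → (∀ y → y ∈ Y → d ≤ card (star own L y)) → (∀ Y′ → Family Y′ → card Y′ ≤ card Y) →
      ∀ v → v ∈ Z → v ∉ Y → d ≤ card (adj v ∩ (W ∖ L)) → ⊥
    grow Y s L own l c st best v vZ v∉ big with subset-of-size (adj v ∩ (W ∖ L)) d big
    ... | L′ , sL′ , cL′ = <-irrefl refl (≤-trans (card-insert-≥ v∉) (best (Y ∪ ｛ v ｝) (sub , L ∪ L′ , own′ , subL , size , stars′)))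
      where
      own′ : Fin N → Fin N
      own′ u = if L′ u then v else own u
      sub : (Y ∪ ｛ v ｝) ⊆ Z
      sub z p with ∨⁻ {Y z} p
      ... | inj₁ q = s z q
      ... | inj₂ q = subst (_∈ Z) (sym (sing⁻ q)) vZ
      new : ∀ {u} → u ∈ L′ → adj v u ≡ true × u ∈ W × u ∉ L
      new {u} p with ∧⁻ {adj v u} (sL′ u p)
      ... | a , q = a , proj₁ (∧⁻ q) , not⁻ (proj₂ (∧⁻ {W u} q))
      subL : (L ∪ L′) ⊆ W
      subL z p with ∨⁻ {L z} p
      ... | inj₁ q = l z q
      ... | inj₂ q = proj₁ (proj₂ (new q))
      size : card (L ∪ L′) ≤ d * card (Y ∪ ｛ v ｝)
      size = ≤-trans (card-∪ L L′) (≤-trans (c ⊞ ≤-reflexive cL′) (≤-trans (≤-reflexive (trans (+-comm (d * card Y) d) (sym (*-suc d (card Y))))) (*-monoʳ-≤ d (card-insert-≥ v∉))))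
      stars′ : ∀ y → y ∈ (Y ∪ ｛ v ｝) → d ≤ card (star own′ (L ∪ L′) y)
      stars′ y p with ∨⁻ {Y y} p
      ... | inj₂ q = ≤-trans (≤-reflexive (sym cL′)) (card-mono λ u r → subst (λ z → u ∈ star own′ (L ∪ L′) z) (sym (sing⁻ q))
                       (star⁺ {own′} {L ∪ L′} (∨ʳ {L u} r) (cong (λ b → if b then v else own u) r) (proj₁ (new r))))
      ... | inj₁ q = ≤-trans (st y q) (card-mono λ u r → let uL , e , a = star⁻ {own} {L} r in
                       star⁺ {own′} {L ∪ L′} (∨ˡ uL) (trans (cong (λ b → if b then v else own u) (old uL)) e) a)
        where
        old : ∀ {u} → u ∈ L → u ∉ L′
        old {u} uL with L′ u in e
        ... | false = refl
        ... | true = true≢false uL (proj₂ (proj₂ (new e)))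

-- Inequalities of the induction

cull-front : ∀ ν k a u f b x D l m → ν * suc k + a ≤ u → u ≤ f + (b + x) → x ≤ D * b → b ≤ l → (D + 1) * l + m ≤ ν → ν * k + m ≤ f
cull-front ν k a u f b x D l m h1 h2 h3 h4 h5 = lin (a) (h1 ⊞ h2 ⊞ h3 ⊞ (D + 1) · h4 ⊞ h5) (solve (ν List.∷ k List.∷ a List.∷ u List.∷ f List.∷ b List.∷ x List.∷ D List.∷ l List.∷ m List.∷ List.[]))

thin-out : ∀ x x₁ e b D m → (D + 1) * m ≤ x → x ≤ x₁ + e → e ≤ D * b → b ≤ m → m ≤ x₁
thin-out x x₁ e b D m h1 h2 h3 h4 = lin (0) (h1 ⊞ h2 ⊞ h3 ⊞ D · h4) (solve (x List.∷ x₁ List.∷ e List.∷ b List.∷ D List.∷ m List.∷ List.[]))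

remainder : ∀ ν k a u v c → ν * suc k + a ≤ u → u ≤ v + c → c ≤ ν → ν * k + a ≤ v
remainder ν k a u v c h1 h2 h3 = lin (0) (h1 ⊞ h2 ⊞ h3) (solve (ν List.∷ k List.∷ a List.∷ u List.∷ v List.∷ c List.∷ List.[]))

inhabited : ∀ ν k a u u′ b → ν * suc k + a ≤ u → u ≤ u′ + b → b < a → 1 ≤ u′
inhabited ν k a u u′ b h1 h2 h3 = lin (ν + k * ν) (h1 ⊞ h2 ⊞ h3) (solve (ν List.∷ k List.∷ a List.∷ u List.∷ u′ List.∷ b List.∷ List.[]))

dec-front : ∀ ν i u e f b x D m → ν * suc i ≤ u + e → u ≤ f + (b + x) → x ≤ D * b → b ≤ m + (m + m) → e + (D + 1) * (m + (m + m)) + m ≤ ν → ν * i + m ≤ f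
dec-front ν i u e f b x D m h1 h2 h3 h4 h5 = lin (0) (h1 ⊞ h2 ⊞ h3 ⊞ (D + 1) · h4 ⊞ h5) (solve (ν List.∷ i List.∷ u List.∷ e List.∷ f List.∷ b List.∷ x List.∷ D List.∷ m List.∷ List.[]))

dec-rest : ∀ ν i u e u′ b m v c κ → ν * suc i ≤ u + e → u ≤ u′ + b → b ≤ m → u′ ≤ v + c → c < suc ν + κ → ν * i ≤ v + (e + m + κ)
dec-rest ν i u e u′ b m v c κ h1 h2 h3 h4 h5 = lin (0) (h1 ⊞ h2 ⊞ h3 ⊞ h4 ⊞ h5) (solve (ν List.∷ i List.∷ u List.∷ e List.∷ u′ List.∷ b List.∷ m List.∷ v List.∷ c List.∷ κ List.∷ List.[]))

dec-total : ∀ ν i e δ v w s → v ≤ w + δ → ν * i ≤ v + e → w ≤ s → i * ν + 1 ≤ s + (e + δ + 1)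
dec-total ν i e δ v w s h1 h2 h3 = lin (0) (h1 ⊞ h2 ⊞ h3) (solve (ν List.∷ i List.∷ e List.∷ δ List.∷ v List.∷ w List.∷ s List.∷ List.[]))

dec-rich : ∀ ν i e δ v w ε η λ₁ p q c m → v ≤ w + δ → ν * i ≤ v + e → w ≤ η + λ₁ → η ≤ ε + (p + q) → λ₁ + (p + q) ≤ c → m + e + δ + c ≤ ν → ν * i + m ≤ ε + ν
dec-rich ν i e δ v w ε η λ₁ p q c m h1 h2 h3 h4 h5 h6 = lin (0) (h1 ⊞ h2 ⊞ h3 ⊞ h4 ⊞ h5 ⊞ h6) (solve (ν List.∷ i List.∷ e List.∷ δ List.∷ v List.∷ w List.∷ ε List.∷ η List.∷ λ₁ List.∷ p List.∷ q List.∷ c List.∷ m List.∷ List.[]))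

dec-thick : ∀ ν i u e u′ b₁ m v z a y y₀ f b x D l → ν * suc i ≤ u + e → u ≤ u′ + b₁ → b₁ ≤ m → u′ ≤ v + z → v < ν * i + m → z ≤ a + y → y ≤ y₀ → a ≤ f + (b + x) → x ≤ D * b → b ≤ l → (D + 1) * l + (m + (m + m)) + e + y₀ ≤ ν → m ≤ f
dec-thick ν i u e u′ b₁ m v z a y y₀ f b x D l h1 h2 h3 h4 h5 h6 h7 h8 h9 h10 h11 = lin (1) (h1 ⊞ h2 ⊞ h3 ⊞ h4 ⊞ h5 ⊞ h6 ⊞ h7 ⊞ h8 ⊞ h9 ⊞ (D + 1) · h10 ⊞ h11) (solve (ν List.∷ i List.∷ u List.∷ e List.∷ u′ List.∷ b₁ List.∷ m List.∷ v List.∷ z List.∷ a List.∷ y List.∷ y₀ List.∷ f List.∷ b List.∷ x List.∷ D List.∷ l List.∷ List.[]))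

fin-rich : ∀ ν k a u w δ η λ₁ ε p c m → ν * suc k + a ≤ u → u ≤ w + δ → w ≤ η + λ₁ → η ≤ ε + p → λ₁ + p ≤ c → m + δ + c ≤ ν → ν * suc k + m ≤ ε + ν
fin-rich ν k a u w δ η λ₁ ε p c m h1 h2 h3 h4 h5 h6 = lin (a) (h1 ⊞ h2 ⊞ h3 ⊞ h4 ⊞ h5 ⊞ h6) (solve (ν List.∷ k List.∷ a List.∷ u List.∷ w List.∷ δ List.∷ η List.∷ λ₁ List.∷ ε List.∷ p List.∷ c List.∷ m List.∷ List.[]))

fin-total : ∀ ν k a u w c y r s → ν * suc k + a ≤ u → u ≤ w + c → c ≤ y + r → r < a → w ≤ s → suc k * ν + 1 ≤ s + y
fin-total ν k a u w c y r s h1 h2 h3 h4 h5 = lin (0) (h1 ⊞ h2 ⊞ h3 ⊞ h4 ⊞ h5) (solve (ν List.∷ k List.∷ a List.∷ u List.∷ w List.∷ c List.∷ y List.∷ r List.∷ s List.∷ List.[]))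

glue-rest : ∀ L ν a s y y₁ y₂ → suc L * ν + 1 ≤ (a + s) + y → y ≤ y₁ + y₂ → a + y₁ ≤ ν → L * ν + 1 ≤ s + y₂
glue-rest L ν a s y y₁ y₂ h1 h2 h3 = lin (0) (h1 ⊞ h2 ⊞ h3) (solve (L List.∷ ν List.∷ a List.∷ s List.∷ y List.∷ y₁ List.∷ y₂ List.∷ List.[]))

glue-star : ∀ L D c s → suc L * D + 1 ≤ c + s → c < D → L * D + 1 ≤ s
glue-star L D c s h1 h2 = lin (1) (h1 ⊞ h2) (solve (L List.∷ D List.∷ c List.∷ s List.∷ List.[]))

glue-robust : ∀ D x x₁ x₂ c → x ≤ x₁ + x₂ → (D + D) * x₁ ≤ c → (D + D) * x₂ ≤ c → 2 * (D * x) ≤ 2 * c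
glue-robust D x x₁ x₂ c h1 h2 h3 = lin (0) ((2 * D) · h1 ⊞ h2 ⊞ h3) (solve (D List.∷ x List.∷ x₁ List.∷ x₂ List.∷ c List.∷ List.[]))

glue-part : ∀ a p y m M → M ≤ a → a ≤ p + y → y + m ≤ M → m ≤ p
glue-part a p y m M h1 h2 h3 = lin (0) (h1 ⊞ h2 ⊞ h3) (solve (a List.∷ p List.∷ y List.∷ m List.∷ M List.∷ List.[]))

rich-arith : ∀ ν i m → ν * i + m + ν ≡ ν * suc i + m
rich-arith = solve-∀

e≤E-arith : ∀ e m κ δ → e + (δ + δ) + (m + m) ≤ (m + m) + (δ + δ) + (e + m + κ)
e≤E-arith e m κ δ = lin (m + κ) (z≤n {0}) (solve (e List.∷ m List.∷ κ List.∷ δ List.∷ List.[]))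

e′δ′≤E-arith : ∀ e m δ → 1 ≤ m → e + δ + 1 ≤ (m + m) + (δ + δ) + e
e′δ′≤E-arith e m δ h1 = lin (m + δ) (h1) (solve (e List.∷ m List.∷ δ List.∷ List.[]))

numeric-arith : ∀ e E m M D c → e ≤ E → m ≤ M → e + (D + 1) * (m + (m + m)) + m ≤ (c + 4) * (E + (m + (m + m))) + ((D + D) + 1) * (M + M + m)
numeric-arith e E m M D c h1 h2 = lin (3 * E + 2 * M + 9 * m + 2 * D * M + D * m + E * c + 3 * c * m) (h1 ⊞ (2 * D) · h2) (solve (e List.∷ E List.∷ m List.∷ M List.∷ D List.∷ c List.∷ List.[]))

inhabited′-arith : ∀ ν νi u e u′ b m E c x → ν + νi ≤ u + e → u ≤ u′ + b → b < m → e ≤ E → (c + 4) * (E + (m + (m + m))) + x ≤ ν → 1 ≤ u′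
inhabited′-arith ν νi u e u′ b m E c x h1 h2 h3 h4 h5 = lin (3 * E + 11 * m + x + νi + E * c + 3 * c * m) (h1 ⊞ h2 ⊞ h3 ⊞ h4 ⊞ h5) (solve (ν List.∷ νi List.∷ u List.∷ e List.∷ u′ List.∷ b List.∷ m List.∷ E List.∷ c List.∷ x List.∷ List.[]))

enough-swap₃ : ∀ a b c → a + b + c ≡ a + (c + b)
enough-swap₃ = solve-∀

enough-factor : ∀ d y m → d * y + (d * m + d * m) ≡ d * (y + (m + m))
enough-factor = solve-∀

enough-arith : ∀ c E m e δ x → e + δ + 1 ≤ E → m + e + δ + c * (E + (m + m)) ≤ (c + 4) * (E + (m + (m + m))) + x
enough-arith c E m e δ x h1 = lin (1 + 3 * E + 11 * m + x + c * m) (h1) (solve (c List.∷ E List.∷ m List.∷ e List.∷ δ List.∷ x List.∷ List.[]))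

finishing-regroup : ∀ m δ e → m + (δ + (e + δ) + m) ≡ (m + m) + (δ + δ) + e
finishing-regroup = solve-∀

thick-arith : ∀ x c E m e y → e ≤ E → y ≤ E → x + (m + (m + m)) + e + y ≤ (c + 4) * (E + (m + (m + m))) + x
thick-arith x c E m e y h1 h2 = lin (2 * E + 9 * m + E * c + 3 * c * m) (h1 ⊞ h2) (solve (x List.∷ c List.∷ E List.∷ m List.∷ e List.∷ y List.∷ List.[]))

conclude-arith : ∀ c E m δ x → δ ≤ E → m + δ + c * (E + m) ≤ (c + 4) * (E + (m + (m + m))) + x
conclude-arith c E m δ x h1 = lin (3 * E + 11 * m + x + 2 * c * m) (h1) (solve (c List.∷ E List.∷ m List.∷ δ List.∷ x List.∷ List.[]))

-- Induction on the number of parts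

module Induction {N : ℕ} (adj : Fin N → Fin N → Bool) (adj-sym : ∀ u v → adj u v ≡ adj v u) (ν m : ℕ) (1≤m : 1 ≤ m) where

  open Extension adj
  open Blue adj adj-sym

  UB : ℕ → Set
  UB k = ∀ a → a ≤ m → ∀ U → ν * k + a ≤ card U → NN (KK a m U k)

  UB-zero : UB zero
  UB-zero a _ U h = pure (U , (λ v p → p) , ≤-trans (m≤n+m a _) h , tt)

  leaveout : ∀ (U B : 𝕊 N) → card U ≤ card (U ∖ B) + card B
  leaveout U B = card-cover (U ∖ B) B λ v p → case bool? (B v) of λ { (inj₁ q) → inj₂ q ; (inj₂ q) → inj₁ (∧⁺ p (not⁺ q)) }

  module Many (D : ℕ) (noT : ∀ U → 1 ≤ card U → (∀ X → X ⊆ U → card X ≤ (D + 1) * m + (D + 1) * m → D * card X ≤ card (nb X ∩ U)) →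
                            (∀ X → X ⊆ U → (D + 1) * m ≤ card X → suc ν ≤ card ((X ∪ nb X) ∩ U)) → ⊥)
              (large : (D + 1) * ((D + 1) * m + (D + 1) * m + m) + m ≤ ν) where

    -- A culled set of at least `a` vertices is the first set of the family. Otherwise the rest of
    -- `U` expands, and since T does not embed there, some set X with its neighbours has at most ν
    -- vertices; a part of X joins the family given by induction.
    step-many : ∀ k → UB k → UB (suc k)
    step-many k ub a a≤m U hU = cull U l D >>= λ { (B , B⊆U , B≤l , nB , expand) → case a ≤? card B of λ
      { (yes big) → ub m ≤-refl (far U B) (cull-front ν k a (card U) (card (far U B)) (card B) (card ((nb B ∩ U) ∖ B)) D l m hU (far-size U B) nB B≤l large) >>= λ b → pure (B , B⊆U , big , b)
      ; (no small) → λ fail → noT (U ∖ B) (inhabited ν k a (card U) (card (U ∖ B)) (card B) hU (leaveout U B) (≰⇒> small))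
          (λ X s c → expand X s (≤-trans (+-monoʳ-≤ (card X) (≤-trans (<⇒≤ (≰⇒> small)) a≤m)) (+-monoˡ-≤ m c)))
          (λ X s c → ≰⇒> λ few → dense B B⊆U nB (≰⇒> small) X s c few fail) } }
      where
      l : ℕ
      l = (D + 1) * m + (D + 1) * m + m
      dense : ∀ B → B ⊆ U → card ((nb B ∩ U) ∖ B) ≤ D * card B → card B < a → ∀ X → X ⊆ (U ∖ B) → (D + 1) * m ≤ card X → card ((X ∪ nb X) ∩ (U ∖ B)) ≤ ν → NN (KK a m U (suc k))
      dense B B⊆U nB b<a X s c few = ub a a≤m V (remainder ν k a (card U) (card V) (card ((X ∪ nb X) ∩ (U ∖ B))) hU (card-cover V ((X ∪ nb X) ∩ (U ∖ B)) cover) few) >>= λ K → pure (KK-insert k X₁⊆U thick (λ v p → p) K)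
        where
        X₁ V : 𝕊 N
        -- As `X₁` has no neighbours in `B`, passing to `V` removes only vertices of X and N(X)
        -- outside `B`, at most ν of them. Not even the vertices of `B` may be lost, since the count
        -- is exact. The neighbours of `B` outside it number at most D * m, so (D + 1) * m vertices
        -- of X leave m.
        X₁ = X ∖ nb B
        V = far U X₁
        X₁⊆U : X₁ ⊆ U
        X₁⊆U v p = proj₁ (∧⁻ (s v (proj₁ (∧⁻ p))))
        thick : m ≤ card X₁
        thick = thin-out (card X) (card X₁) (card ((nb B ∩ U) ∖ B)) (card B) D m c
          (card-cover X₁ ((nb B ∩ U) ∖ B) λ v p → case bool? (nb B v) of λ
            { (inj₁ q) → inj₂ (∧⁺ (∧⁺ q (proj₁ (∧⁻ (s v p)))) (proj₂ (∧⁻ {U v} (s v p))))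
            ; (inj₂ q) → inj₁ (∧⁺ p (not⁺ q)) }) nB (≤-trans (<⇒≤ b<a) a≤m)
        cover : ∀ v → v ∈ U → v ∈ V ⊎ v ∈ ((X ∪ nb X) ∩ (U ∖ B))
        cover v p with bool? (X₁ v) | bool? (nb X₁ v)
        ... | inj₂ q | inj₂ r = inj₁ (far⁺ {U} {X₁} p q r)
        ... | inj₁ q | _ = inj₂ (∧⁺ (∨ˡ {X v} (proj₁ (∧⁻ {X v} q))) (s v (proj₁ (∧⁻ {X v} q))))
        ... | inj₂ _ | inj₁ r = inj₂ (∧⁺ (∨ʳ {X v} (nb-mono (λ _ z → proj₁ (∧⁻ z)) v r)) (∧⁺ p (not⁺ outB)))
          where
          outB : v ∉ B
          outB with B v in e | nb⁻ r
          ... | false | _ = refl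
          ... | true | x , xX , a = true≢false (nb⁺ e (trans (adj-sym v x) a)) (not⁻ (proj₂ (∧⁻ {X x} xX)))

  -- The case of few leaves. `κ` is the surplus of the embedding with room, `M` the size from which
  -- sets must be linked in the exact embedding, `E` a bound for all vertices lost, and `k̂` bounds
  -- the number of pieces.
  record Thin : Set where
    field
      D M κ k̂ E : ℕ
      noT-plain : ∀ U → 1 ≤ card U → (∀ X → X ⊆ U → card X ≤ m + m → D * card X ≤ card (nb X ∩ U)) →
                  (∀ X → X ⊆ U → m ≤ card X → suc ν + κ ≤ card ((X ∪ nb X) ∩ U)) → ⊥
      noT-exact : ∀ U → Linking adj U M → (∀ X → X ⊆ U → card X ≤ M + M → D * card X ≤ card (nb X ∩ U)) → suc ν ≤ card U → ⊥
      fits      : E + m ≤ M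
      large     : ((k̂ * (D + D) + 1) + 4) * (E + (m + (m + m))) + ((D + D) + 1) * (M + M + m) ≤ ν

  module Few (thin : Thin) where

    open Thin thin

    -- The second condition gives a red edge between any two disjoint sets of m vertices of `A`. The
    -- expansion is 2D since adding star centres will halve it.
    Core : 𝕊 N → Set
    Core A = (∀ X → X ⊆ A → card X ≤ M + M → (D + D) * card X ≤ card (nb X ∩ A)) × ¬ BK m A 2

    ⋃ : List (𝕊 N) → 𝕊 N
    ⋃ [] = ∅
    ⋃ (A ∷ As) = A ∪ ⋃ As

    total : List (𝕊 N) → ℕ
    total [] = 0
    total (A ∷ As) = card A + total As

    card-⋃ : ∀ As → card (⋃ As) ≤ total As
    card-⋃ [] = ≤-reflexive card-∅
    card-⋃ (A ∷ As) = ≤-trans (card-∪ A (⋃ As)) (+-monoʳ-≤ (card A) (card-⋃ As))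

    starSum : (Fin N → Fin N) → List (𝕊 N) → Fin N → ℕ
    starSum own [] y = 0
    starSum own (A ∷ As) y = card (star own A y) + starSum own As y

    star-⋃ : ∀ own As L y → L ⊆ ⋃ As → card (star own L y) ≤ starSum own As y
    star-⋃ own [] L y h = ≤-trans (card-mono λ v p → h v (proj₁ (star⁻ {own} {L} p))) (≤-reflexive card-∅)
    star-⋃ own (A ∷ As) L y h = ≤-trans (card-cover (star own A y) (star own (L ∖ A) y) split) (+-monoʳ-≤ _ (star-⋃ own As (L ∖ A) y inside))
      where
      split : ∀ v → v ∈ star own L y → v ∈ star own A y ⊎ v ∈ star own (L ∖ A) y
      split v p with star⁻ {own} {L} p | bool? (A v)
      ... | vL , e , a | inj₁ q = inj₁ (star⁺ {own} {A} q e a)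
      ... | vL , e , a | inj₂ q = inj₂ (star⁺ {own} {L ∖ A} (∧⁺ vL (not⁺ q)) e a)
      inside : (L ∖ A) ⊆ ⋃ As
      inside v p with ∨⁻ {A v} (h v (proj₁ (∧⁻ p)))
      ... | inj₁ q = true≢false q (not⁻ (proj₂ (∧⁻ {L v} p)))
      ... | inj₂ q = q

    -- Each centre of a large star goes to a piece containing many of its leaves.
    glue : ∀ As Y own → All Core As → All (λ A → ∀ v → v ∈ A → v ∈ Y → ⊥) As → (∀ y → y ∈ Y → length As * (D + D) + 1 ≤ starSum own As y) →
      length As * ν + 1 ≤ total As + card Y → card Y + m ≤ M → ⊥
    glue [] Y own _ _ st tot _ with card-positive {X = Y} tot
    ... | y , y∈ with st y y∈
    ...   | ()
    glue (A ∷ As) Y own ((rob , dense) ∷ cores) (dis ∷ diss) st tot fits with suc ν ≤? card A + card Y₁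
      where
      Y₁ : 𝕊 N
      Y₁ y = Y y ∧ isYes ((D + D) ≤? card (star own A y))
    -- `A` and its centres account for at most ν vertices, so the count survives without them. A
    -- centre outside `Y₁` has fewer than 2D leaves in `A` and keeps enough in the other pieces.
    ... | no few = glue As Y₂ own cores (All-map (λ h v p q → h v p (proj₁ (∧⁻ q))) diss)
        (λ y p → glue-star (length As) (D + D) (card (star own A y)) (starSum own As y) (st y (proj₁ (∧⁻ p))) (short-star y p))
        (glue-rest (length As) ν (card A) (total As) (card Y) (card Y₁) (card Y₂) tot (card-cover Y₁ Y₂ λ v p → case bool? (Y₁ v) of λ { (inj₁ q) → inj₁ q ; (inj₂ q) → inj₂ (∧⁺ p (not⁺ q)) }) (≤-pred (≰⇒> few)))
        (≤-trans (+-monoˡ-≤ m (card-mono λ v p → proj₁ (∧⁻ p))) fits)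
      where
      Y₁ Y₂ : 𝕊 N
      Y₁ y = Y y ∧ isYes ((D + D) ≤? card (star own A y))
      Y₂ = Y ∖ Y₁
      short-star : ∀ y → y ∈ Y₂ → card (star own A y) < D + D
      short-star y p with ∧⁻ {Y y} p
      ... | q , r with (D + D) ≤? card (star own A y)
      ...   | no n = ≰⇒> n
      ...   | yes _ = true≢false (trans (cong (_∧ true) q) refl) (not⁻ r)
    ... | yes enough = noT-exact Hs edge robust (≤-trans enough (card-disjoint A Y₁ (λ v → ∨ˡ) (λ v → ∨ʳ) λ v p q → dis v p (proj₁ (∧⁻ q))))
      where
      Y₁ Hs : 𝕊 N
      Y₁ y = Y y ∧ isYes ((D + D) ≤? card (star own A y))
      Hs = A ∪ Y₁
      long-star : ∀ y → y ∈ Y₁ → D + D ≤ card (star own A y)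
      long-star y p with ∧⁻ {Y y} p
      ... | q , r with (D + D) ≤? card (star own A y)
      ...   | yes h = h
      inA : ∀ X → X ⊆ Hs → card X ≤ card (X ∩ A) + card (X ∩ Y₁)
      inA X s = card-cover (X ∩ A) (X ∩ Y₁) λ v p → case ∨⁻ {A v} (s v p) of λ { (inj₁ q) → inj₁ (∧⁺ p q) ; (inj₂ q) → inj₂ (∧⁺ p q) }
      robust : ∀ X → X ⊆ Hs → card X ≤ M + M → D * card X ≤ card (nb X ∩ Hs)
      -- The parts of `X` in `A` and in `Y₁` both expand into `A` by 2D, and one of them is at least
      -- half of `X`.
      robust X s c = *-cancelˡ-≤ 2 (glue-robust D (card X) (card (X ∩ A)) (card (X ∩ Y₁)) (card (nb X ∩ Hs)) (inA X s)
        (≤-trans (rob (X ∩ A) (λ v p → proj₂ (∧⁻ {X v} p)) (≤-trans (card-mono λ v p → proj₁ (∧⁻ p)) c)) (within (X ∩ A) λ v p → proj₁ (∧⁻ p)))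
        (≤-trans (star-count own A (X ∩ Y₁) (D + D) λ y p → long-star y (proj₂ (∧⁻ {X y} p))) (within (X ∩ Y₁) λ v p → proj₁ (∧⁻ p))))
        where
        within : ∀ X′ → X′ ⊆ X → card (nb X′ ∩ A) ≤ card (nb X ∩ Hs)
        within X′ h = card-mono λ v p → ∧⁺ {nb X v} (nb-mono h v (proj₁ (∧⁻ p))) (∨ˡ (proj₂ (∧⁻ {nb X′ v} p)))
      edge : ∀ P Q → P ⊆ Hs → Q ⊆ Hs → (∀ v → v ∈ P → v ∈ Q → ⊥) → M ≤ card P → M ≤ card Q → NN (Σ (Fin N) λ p → Σ (Fin N) λ q → p ∈ P × q ∈ Q × adj p q ≡ true)
      edge P Q sP sQ dPQ cP cQ none = dense (P ∩ A , (λ v p → proj₂ (∧⁻ {P v} p)) , part P sP cP , Q ∩ A , Qfar , part Q sQ cQ , tt)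
        where
        part : ∀ X → X ⊆ Hs → M ≤ card X → m ≤ card (X ∩ A)
        part X s c = glue-part (card X) (card (X ∩ A)) (card Y₁) m M c (≤-trans (inA X s) (+-monoʳ-≤ _ (card-mono λ v p → proj₂ (∧⁻ {X v} p)))) (≤-trans (+-monoˡ-≤ m (card-mono λ v p → proj₁ (∧⁻ p))) fits)
        Qfar : (Q ∩ A) ⊆ far A (P ∩ A)
        Qfar v p = far⁺ {A} {P ∩ A} (proj₂ (∧⁻ {Q v} p)) not-in not-nb
          where
          not-in : v ∉ (P ∩ A)
          not-in with (P ∩ A) v in e
          ... | false = refl
          ... | true = ⊥-elim (dPQ v (proj₁ (∧⁻ e)) (proj₁ (∧⁻ p)))
          not-nb : v ∉ nb (P ∩ A)
          not-nb with nb (P ∩ A) v in e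
          ... | false = refl
          ... | true with nb⁻ e
          ...   | x , xP , a = ⊥-elim (none (x , v , proj₁ (∧⁻ xP) , proj₁ (∧⁻ p) , a))

    record Pieces (U : 𝕊 N) (j δ : ℕ) : Set where
      field
        As     : List (𝕊 N)
        #As    : length As ≡ j
        cores  : All Core As
        inside : ⋃ As ⊆ U
        rest   : card (U ∖ ⋃ As) ≤ δ

    -- Vertices outside the pieces when |U| falls short of ν times their number by at most e. A cut
    -- raises the shortfall to e + m + κ; then two culled sets of fewer than m vertices, the loss in
    -- `V`, and the star centres (at most the shortfall plus that loss) are left over. With no
    -- piece, `U` itself has fewer than m vertices.
    loss : ℕ → ℕ → ℕ
    loss zero e = m
    loss (suc i) e = (m + m) + (loss i (e + m + κ) + loss i (e + m + κ)) + (e + m + κ)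

    Below : ℕ → Set
    Below k = ∀ i → i < k → UB i

    below : ∀ {j k} → j ≤ k → Below k → Below j
    below h b i lt = b i (<-≤-trans lt h)

    -- With a = m the induction hypothesis for i counts i + 1 sets of equal size m, as `KK m m E i`
    -- unfolds to `BK m E (suc i)`; hence one multiple of ν may be missing.
    rich : ∀ i E → Below i → ν * i + m ≤ card E + ν → NN (BK m E i)
    rich zero E b h = pure tt
    rich (suc i) E b h = b i ≤-refl m ≤-refl E (+-cancelʳ-≤ ν (ν * i + m) (card E) (≤-trans (≤-reflexive (rich-arith ν i m)) h))

    blue-pair : ∀ {U P Q E} k → P ⊆ U → Q ⊆ far U P → E ⊆ far (far U P) Q → m ≤ card P → m ≤ card Q → BK m E k → BK m U (suc (suc k))
    blue-pair {E = E} k p q e cp cq b = _ , p , cp , _ , q , cq , BK-mono k e b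

    size-split : ∀ (E X : 𝕊 N) → card E ≤ card (E ∖ nb X) + card (nb X ∩ E)
    size-split E X = card-cover (E ∖ nb X) (nb X ∩ E) λ v p → case bool? (nb X v) of λ { (inj₁ q) → inj₂ (∧⁺ q p) ; (inj₂ q) → inj₁ (∧⁺ p (not⁺ q)) }

    not∈ : ∀ {v} (X : 𝕊 N) → (v ∈ X → ⊥) → v ∉ X
    not∈ {v} X h with bool? (X v)
    ... | inj₁ e = ⊥-elim (h e)
    ... | inj₂ e = e

    private
      degree-bound : ∀ {j} → j ≤ k̂ → j * (D + D) + 1 ≤ k̂ * (D + D) + 1
      degree-bound h = +-monoˡ-≤ 1 (*-monoˡ-≤ (D + D) h)

      m≤M : m ≤ M
      m≤M = ≤-trans (m≤n+m m E) fits

    record Level : Set where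
      field
        i e   : ℕ
        U     : 𝕊 N
        i<k̂  : suc i ≤ k̂
        ub    : Below (suc i)
        noK   : ¬ BK m U (suc (suc i))
        h     : ν * suc i ≤ card U + e
        small : loss (suc i) e ≤ E

    record Cut (U : 𝕊 N) : Set where
      field
        B S    : 𝕊 N
        B<m    : card B < m
        S⊆     : S ⊆ (U ∖ B)
        m≤S    : m ≤ card S
        narrow : card ((S ∪ nb S) ∩ (U ∖ B)) < suc ν + κ

    module Cutting (level : Level) where

      open Level level

      e′ δ′ d : ℕ
      e′ = e + m + κ
      δ′ = loss i e′
      d = i * (D + D) + 1
      e≤E : e + (δ′ + δ′) + (m + m) ≤ E
      e≤E = ≤-trans (e≤E-arith e m κ δ′) small
      e′δ′≤E : e′ + δ′ + 1 ≤ E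
      e′δ′≤E = ≤-trans (e′δ′≤E-arith e′ m δ′ 1≤m) small
      δ′≤E : δ′ ≤ E
      δ′≤E = ≤-trans (≤-trans (m≤n+m δ′ e′) (m≤m+n (e′ + δ′) 1)) e′δ′≤E
      B-small : ∀ B → B ⊆ U → card B ≤ m + (m + m) → card ((nb B ∩ U) ∖ B) ≤ D * card B → NN (card B < m)
      B-small B s c nB with m ≤? card B
      ... | no n = pure (≰⇒> n)
      ... | yes big = ub i ≤-refl m ≤-refl (far U B) (dec-front ν i (card U) e (card (far U B)) (card B) (card ((nb B ∩ U) ∖ B)) D m h (far-size U B) nB c numeric) >>= λ K → ⊥-elim (noK (B , s , big , K))
        where
        numeric : e + (D + 1) * (m + (m + m)) + m ≤ ν
        numeric = ≤-trans (numeric-arith e E m M D (k̂ * (D + D) + 1) (≤-trans (≤-trans (m≤m+n e (δ′ + δ′)) (m≤m+n _ (m + m))) e≤E) m≤M) large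
      escape : ∀ B → card B < m → (∀ X → X ⊆ (U ∖ B) → card X + card B ≤ m + (m + m) → D * card X ≤ card (nb X ∩ (U ∖ B))) →
        NN (Σ (𝕊 N) λ S → S ⊆ (U ∖ B) × m ≤ card S × card ((S ∪ nb S) ∩ (U ∖ B)) < suc ν + κ)
      escape B B<m expand = counterexample (λ X f p q → ≤-stable λ g → f λ f′ → g (f′ p q))
          (noT-plain (U ∖ B) inhabited′ (λ X s c → expand X s (≤-trans (c ⊞ <⇒≤ B<m) (≤-reflexive (+-assoc m m m))))) >>= λ { (X , nf) →
        em (X ⊆ (U ∖ B) × m ≤ card X) >>= λ
          { (inj₁ (s , c)) → pure (X , s , c , ≰⇒> λ le → nf λ _ _ → le)
          ; (inj₂ n) → ⊥-elim (nf λ s c → ⊥-elim (n (s , c))) } }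
        where
        inhabited′ : 1 ≤ card (U ∖ B)
        inhabited′ = inhabited′-arith ν (ν * i) (card U) e (card (U ∖ B)) (card B) m E ((k̂ * (D + D) + 1)) ((D + D + 1) * (M + M + m)) (subst (_≤ card U + e) (*-suc ν i) h) (leaveout U B) B<m (≤-trans (≤-trans (m≤m+n e (δ′ + δ′)) (m≤m+n _ (m + m))) e≤E) large

      cut : NN (Cut U)
      cut = cull U (m + (m + m)) D >>= λ { (B , B⊆U , B≤l , nB , expand) →
        B-small B B⊆U B≤l nB >>= λ B<m →
        escape B B<m expand >>= λ { (S , S⊆ , m≤S , narrow) → pure record { B = B ; S = S ; B<m = B<m ; S⊆ = S⊆ ; m≤S = m≤S ; narrow = narrow } } }

    -- The set S of a cut sees little of U. Away from S induction gives a union of cores; the vertices close to S, apart from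
    -- the few centres of large stars, form one more core.
    module Splitting (level : Level) (cut : Cut (Level.U level)) where

      open Level level
      open Cutting level using (e′; δ′; d; e≤E; e′δ′≤E)
      open Cut cut

      U′ V Z : 𝕊 N
      U′ = U ∖ B
      V = far U′ S
      Z = (S ∪ nb S) ∩ U′
      U′⊆U : U′ ⊆ U
      U′⊆U v p = proj₁ (∧⁻ p)
      V⊆U : V ⊆ U
      V⊆U v p = U′⊆U v (far⊆ {U′} {S} v p)
      noV : ¬ BK m V (suc i)
      noV K = noK (BK-mono (suc (suc i)) U′⊆U (S , S⊆ , m≤S , K))
      VZ : card U′ ≤ card V + card Z
      VZ = card-cover V Z λ v p → case bool? ((S ∪ nb S) v) of λ { (inj₁ q) → inj₂ (∧⁺ q p) ; (inj₂ q) → inj₁ (∧⁺ p (not⁺ q)) }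
      hV : ν * i ≤ card V + e′
      hV = dec-rest ν i (card U) e (card U′) (card B) m (card V) (card Z) κ h (leaveout U B) (<⇒≤ B<m) VZ narrow
      V∩Z : ∀ v → v ∈ V → v ∈ Z → ⊥
      V∩Z v p q = true≢false (proj₁ (∧⁻ q)) (not⁻ (proj₂ (∧⁻ {U′ v} p)))

      module Peeling (R : Pieces V i δ′) (St : Stars (⋃ (Pieces.As R)) Z d) where

        open Pieces R
        open Stars St

        -- The cores inside `V` lack at most e′ + δ′ vertices of i * ν. One more centre than that,
        -- and `glue` finds T.
        overflow : (Σ (𝕊 N) λ Y′ → Y′ ⊆ Y × card Y′ ≡ suc (e′ + δ′)) → ⊥
        overflow (Y′ , s , c) = glue As Y′ own cores (All-⊆ As (λ v p → inside v p))
            (λ y p → ≤-trans (≤-reflexive (cong (λ z → z * (D + D) + 1) #As)) (≤-trans (stars y (s y p)) (star-⋃ own As L y L⊆W)))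
            (≤-trans (≤-reflexive (cong (λ z → z * ν + 1) #As)) (≤-trans (dec-total ν i e′ δ′ (card V) (card (⋃ As)) (total As)
              (≤-trans (leaveout V (⋃ As)) (≤-trans (+-monoˡ-≤ _ rest) (≤-reflexive (+-comm δ′ _)))) hV (card-⋃ As)) (+-monoʳ-≤ (total As) (≤-reflexive (trans (+-comm (e′ + δ′) 1) (sym c))))))
            (≤-trans (+-monoˡ-≤ m (≤-trans (≤-reflexive (trans c (+-comm 1 (e′ + δ′)))) e′δ′≤E)) fits)
          where
          All-⊆ : ∀ Bs → ⋃ Bs ⊆ V → All (λ A → ∀ v → v ∈ A → v ∈ Y′ → ⊥) Bs
          All-⊆ [] h = []
          All-⊆ (A ∷ Bs) h = (λ v p q → V∩Z v (h v (∨ˡ p)) (Y⊆Z v (s v q))) ∷ All-⊆ Bs λ v p → h v (∨ʳ {A v} p)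

        W A₀ : 𝕊 N
        W = ⋃ As
        A₀ = Z ∖ Y
        W≥ : card V ≤ card W + δ′
        W≥ = ≤-trans (leaveout V W) (≤-trans (+-monoˡ-≤ _ rest) (≤-reflexive (+-comm δ′ _)))
        A₀⊆U′ : A₀ ⊆ U′
        A₀⊆U′ v p = proj₂ (∧⁻ {(S ∪ nb S) v} (proj₁ (∧⁻ p)))
        few-nbs : ∀ P → P ⊆ A₀ → card P ≡ m → card (nb P ∩ (W ∖ L)) ≤ d * m
        few-nbs P s c = ≤-trans (nb-count P (W ∖ L) d λ v p → stuck v (proj₁ (∧⁻ (s v p))) (not⁻ (proj₂ (∧⁻ {Z v} (s v p))))) (≤-reflexive (cong (d *_) c))

        module _ (y≤ : card Y ≤ e′ + δ′) where

          -- Vertices of `A₀` have at most d neighbours in `W` outside `L`, so two blue sets of m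
          -- vertices leave almost all of `W` untouched. By induction that rest contains i blue
          -- sets, which together with the two contradict `noK`.
          noA₀ : ¬ BK m A₀ 2
          noA₀ (P , sP , cP , Q , sQ , cQ , _) with subset-of-size P m cP | subset-of-size Q m cQ
          ... | P₁ , sP₁ , eP₁ | Q₁ , sQ₁ , eQ₁ = rich i Ê (below (n≤1+n i) ub) enough (λ K → noK (blue-pair {P = P₁} {Q₁} {Ê} i
                P₁⊆U Q₁far sub (≤-reflexive (sym eP₁)) (≤-reflexive (sym eQ₁)) K))
            where
            Ê : 𝕊 N
            Ê = ((W ∖ L) ∖ nb P₁) ∖ nb Q₁
            P₁⊆A₀ : P₁ ⊆ A₀
            P₁⊆A₀ v p = sP v (sP₁ v p)
            Q₁⊆A₀ : Q₁ ⊆ A₀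
            Q₁⊆A₀ v p = far⊆ {A₀} {P} v (sQ v (sQ₁ v p))
            P₁⊆U : P₁ ⊆ U
            P₁⊆U v p = U′⊆U v (A₀⊆U′ v (P₁⊆A₀ v p))
            Q₁far : Q₁ ⊆ far U P₁
            Q₁far v p with far⁻ {A₀} {P} (sQ v (sQ₁ v p))
            ... | _ , vP , vnP = far⁺ {U} {P₁} (U′⊆U v (A₀⊆U′ v (Q₁⊆A₀ v p))) (not∈ P₁ λ q → true≢false (sP₁ v q) vP) (not∈ (nb P₁) λ q → true≢false (nb-mono sP₁ v q) vnP)
            sub : Ê ⊆ far (far U P₁) Q₁
            sub v p with ∧⁻ {((W ∖ L) ∖ nb P₁) v} p
            ... | p₁ , nQ with ∧⁻ {(W ∖ L) v} p₁
            ...   | p₂ , nP = far⁺ {far U P₁} {Q₁} (far⁺ {U} {P₁} (V⊆U v vV) (not∈ P₁ λ q → V∩Z v vV (proj₁ (∧⁻ (P₁⊆A₀ v q)))) (not⁻ nP)) (not∈ Q₁ λ q → V∩Z v vV (proj₁ (∧⁻ (Q₁⊆A₀ v q)))) (not⁻ nQ)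
              where
              vV : v ∈ V
              vV = inside v (proj₁ (∧⁻ p₂))
            c′ : ℕ
            c′ = (k̂ * (D + D) + 1) * (E + (m + m))
            enough : ν * i + m ≤ card Ê + ν
            enough = dec-rich ν i e′ δ′ (card V) (card W) (card Ê) (card (W ∖ L)) (card L) (card (nb P₁ ∩ (W ∖ L))) (card (nb Q₁ ∩ ((W ∖ L) ∖ nb P₁))) c′ m W≥ hV (leaveout W L)
              (≤-trans (size-split (W ∖ L) P₁) (≤-trans (+-monoˡ-≤ _ (size-split ((W ∖ L) ∖ nb P₁) Q₁)) (≤-reflexive (enough-swap₃ (card Ê) _ _))))
              (≤-trans (|L| ⊞ (few-nbs P₁ P₁⊆A₀ eP₁ ⊞ ≤-trans (card-mono λ v p → ∧⁺ {nb Q₁ v} (proj₁ (∧⁻ {nb Q₁ v} p)) (proj₁ (∧⁻ {(W ∖ L) v} (proj₂ (∧⁻ {nb Q₁ v} p))))) (few-nbs Q₁ Q₁⊆A₀ eQ₁)))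
                (≤-trans (≤-reflexive (enough-factor d (card Y) m)) (*-mono-≤ (degree-bound (≤-trans (n≤1+n i) i<k̂)) (+-monoˡ-≤ (m + m) (≤-trans y≤ (≤-trans (m≤m+n (e′ + δ′) 1) e′δ′≤E))))))
              (≤-trans (enough-arith (k̂ * (D + D) + 1) E m e′ δ′ ((D + D + 1) * (M + M + m)) e′δ′≤E) large)

          finishing : ∀ B₀ → B₀ ⊆ A₀ → card B₀ ≤ M + M + m → card ((nb B₀ ∩ A₀) ∖ B₀) ≤ (D + D) * card B₀ →
            (∀ X → X ⊆ (A₀ ∖ B₀) → card X + card B₀ ≤ M + M + m → (D + D) * card X ≤ card (nb X ∩ (A₀ ∖ B₀))) → NN (Pieces U (suc i) (loss (suc i) e))
          finishing B₀ B₀⊆ B₀≤ nB₀ expand₀ = em (card V < ν * i + m) >>= λ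
            -- With ν * i + m vertices, `V` would contain i + 1 blue sets, against `noV`. So `V` is
            -- smaller, `Z` is large, and a culled set of m vertices of `A₀` would form a forbidden
            -- blue pair with the vertices far from it.
            { (inj₂ n) → λ _ → ub i ≤-refl m ≤-refl V (≮⇒≥ n) λ K → noV K
            ; (inj₁ V<) → let B₀<m = ≰⇒> λ big → noA₀ (B₀ , B₀⊆ , big , far A₀ B₀ , (λ v p → p) , thick V< , tt) in pure record
              { As = (A₀ ∖ B₀) ∷ As ; #As = cong suc #As
              ; cores = ((λ X s c → expand₀ X s (c ⊞ <⇒≤ B₀<m)) , λ K → noA₀ (BK-mono 2 (λ v p → proj₁ (∧⁻ p)) K)) ∷ cores
              ; inside = λ v p → case ∨⁻ {(A₀ ∖ B₀) v} p of λ { (inj₁ q) → U′⊆U v (A₀⊆U′ v (proj₁ (∧⁻ q))) ; (inj₂ q) → V⊆U v (inside v q) }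
              ; rest = ≤-trans (card-cover B (((V ∖ W) ∪ Y) ∪ B₀) cover) (≤-trans (<⇒≤ B<m ⊞ ≤-trans (card-∪ ((V ∖ W) ∪ Y) B₀) (≤-trans (card-∪ (V ∖ W) Y) (rest ⊞ y≤) ⊞ <⇒≤ B₀<m)) (≤-reflexive (finishing-regroup m δ′ e′))) } }
            where
            thick : card V < ν * i + m → m ≤ card (far A₀ B₀)
            thick V< = dec-thick ν i (card U) e (card U′) (card B) m (card V) (card Z) (card A₀) (card Y) (e′ + δ′) (card (far A₀ B₀)) (card B₀) (card ((nb B₀ ∩ A₀) ∖ B₀)) (D + D) (M + M + m)
              h (leaveout U B) (<⇒≤ B<m) VZ V< (leaveout Z Y) y≤ (far-size A₀ B₀) nB₀ B₀≤
              (≤-trans (thick-arith ((D + D + 1) * (M + M + m)) (k̂ * (D + D) + 1) E m e (e′ + δ′) (≤-trans (≤-trans (m≤m+n e (δ′ + δ′)) (m≤m+n _ (m + m))) e≤E) (≤-trans (m≤m+n (e′ + δ′) 1) e′δ′≤E)) large)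
            cover : ∀ v → v ∈ (U ∖ ((A₀ ∖ B₀) ∪ W)) → v ∈ B ⊎ v ∈ (((V ∖ W) ∪ Y) ∪ B₀)
            cover v p with ∧⁻ {U v} p
            ... | vU , r with ∨f⁻ {(A₀ ∖ B₀) v} (not⁻ r) | bool? (B v) | bool? (Y v) | bool? (B₀ v) | bool? ((S ∪ nb S) v)
            ...   | _ , _ | inj₁ b | _ | _ | _ = inj₁ b
            ...   | _ , _ | inj₂ b | inj₁ y | _ | _ = inj₂ (∨ˡ (∨ʳ {(V ∖ W) v} y))
            ...   | _ , _ | inj₂ b | inj₂ y | inj₁ z | _ = inj₂ (∨ʳ z)
            ...   | _ , w | inj₂ b | inj₂ y | inj₂ z | inj₂ s = inj₂ (∨ˡ (∨ˡ (∧⁺ (∧⁺ (∧⁺ vU (not⁺ b)) (not⁺ s)) (not⁺ w))))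
            ...   | a , w | inj₂ b | inj₂ y | inj₂ z | inj₁ s = true≢false (∧⁺ (∧⁺ (∧⁺ s (∧⁺ vU (not⁺ b))) (not⁺ y)) (not⁺ z)) a

        peel : NN (Pieces U (suc i) (loss (suc i) e))
        peel with suc (e′ + δ′) ≤? card Y
        ... | yes many = ⊥-elim (overflow (subset-of-size Y (suc (e′ + δ′)) many))
        ... | no few = cull A₀ (M + M + m) (D + D) >>= λ { (B₀ , B₀⊆ , B₀≤ , nB₀ , expand₀) → finishing (≤-pred (≰⇒> few)) B₀ B₀⊆ B₀≤ nB₀ expand₀ }

    dec : ∀ j e U → j ≤ k̂ → Below j → ¬ BK m U (suc j) → ν * j ≤ card U + e → loss j e ≤ E → NN (Pieces U j (loss j e))
    dec zero e U _ _ noK h small = pure record { As = [] ; #As = refl ; cores = [] ; inside = λ v () ; rest = ≮⇒≥ λ lt → noK (U , (λ v p → p) , ≤-trans (<⇒≤ lt) (card-mono λ v p → proj₁ (∧⁻ p)) , tt) }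
    dec (suc i) e U i<k̂ ub noK h small = Cutting.cut level >>= λ cut → let open Splitting level cut in
      dec i (Cutting.e′ level) V (≤-trans (n≤1+n i) i<k̂) (below (n≤1+n i) ub) noV hV (Cutting.δ′≤E level) >>= λ R →
      max-stars (⋃ (Pieces.As R)) Z (Cutting.d level) >>= λ St → Peeling.peel R St
      where
      level : Level
      level = record { i = i ; e = e ; U = U ; i<k̂ = i<k̂ ; ub = ub ; noK = noK ; h = h ; small = small }

    -- Here no vertex is lost. If at least `a` vertices outside the cores are not star centres, then
    -- `a` of them see little of the cores and begin the family. If there are fewer than `a`, the
    -- cores and the centres together have more than ν vertices per core, and `glue` applies.
    step-few : ∀ k → suc k ≤ k̂ → Below (suc k) → loss (suc k) 0 ≤ E → UB (suc k)
    step-few k k<k̂ ub small a a≤m U hU fail = (dec (suc k) 0 U k<k̂ ub noK (≤-trans (≤-trans (m≤m+n _ a) hU) (≤-reflexive (sym (+-identityʳ _)))) small >>= λ R →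
      max-stars (⋃ (Pieces.As R)) (U ∖ ⋃ (Pieces.As R)) (suc k * (D + D) + 1) >>= λ St → conclude R St) id
      where
      noK : ¬ BK m U (suc (suc k))
      noK (P , s , c , K) = fail (P , s , ≤-trans a≤m c , K)
      conclude : (R : Pieces U (suc k) (loss (suc k) 0)) → Stars (⋃ (Pieces.As R)) (U ∖ ⋃ (Pieces.As R)) (suc k * (D + D) + 1) → NN ⊥
      conclude R St with a ≤? card ((U ∖ ⋃ (Pieces.As R)) ∖ Stars.Y St)
      ... | yes many with subset-of-size ((U ∖ ⋃ (Pieces.As R)) ∖ Stars.Y St) a many
      ...   | P , sP , cP = rich (suc k) Ê ub (fin-rich ν k a (card U) (card W) δ (card (W ∖ L)) (card L) (card Ê) (card (nb P ∩ (W ∖ L))) ((k̂ * (D + D) + 1) * (E + m)) m hU W≥ (leaveout W L) (size-split (W ∖ L) P)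
              (≤-trans (|L| ⊞ nb-count P (W ∖ L) d λ v p → stuck v (proj₁ (∧⁻ (sP v p))) (not⁻ (proj₂ (∧⁻ {(U ∖ W) v} (sP v p)))))
                (≤-trans (≤-reflexive (sym (*-distribˡ-+ d (card Y) (card P)))) (*-mono-≤ (degree-bound k<k̂) (≤-trans (≤-trans (card-mono Y⊆Z) rest) small ⊞ ≤-trans (≤-reflexive cP) a≤m))))
              (≤-trans (conclude-arith (k̂ * (D + D) + 1) E m δ ((D + D + 1) * (M + M + m)) small) large)) >>= λ K → ⊥-elim (fail (P , P⊆U , ≤-reflexive (sym cP) , BK-mono (suc k) sub K))
        where
        open Pieces R
        open Stars St
        W Ê : 𝕊 N
        W = ⋃ As
        Ê = (W ∖ L) ∖ nb P
        δ d : ℕ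
        δ = loss (suc k) 0
        d = suc k * (D + D) + 1
        W≥ : card U ≤ card W + δ
        W≥ = ≤-trans (leaveout U W) (≤-trans (+-monoˡ-≤ _ rest) (≤-reflexive (+-comm δ _)))
        P⊆U : P ⊆ U
        P⊆U v p = proj₁ (∧⁻ (proj₁ (∧⁻ (sP v p))))
        sub : Ê ⊆ far U P
        sub v p with ∧⁻ {(W ∖ L) v} p
        ... | q , r = far⁺ {U} {P} (inside v (proj₁ (∧⁻ q))) (not∈ P λ z → true≢false (proj₁ (∧⁻ q)) (not⁻ (proj₂ (∧⁻ {U v} (proj₁ (∧⁻ (sP v z))))))) (not⁻ r)
      conclude R St | no few = ⊥-elim (glue As Y own cores (All-apart As (λ v p → p))
          (λ y p → ≤-trans (≤-reflexive (cong (λ z → z * (D + D) + 1) #As)) (≤-trans (stars y p) (star-⋃ own As L y L⊆W)))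
          (≤-trans (≤-reflexive (cong (λ z → z * ν + 1) #As)) (fin-total ν k a (card U) (card W) (card (U ∖ W)) (card Y) (card ((U ∖ W) ∖ Y)) (total As) hU
            (≤-trans (leaveout U W) (≤-reflexive (+-comm _ (card W)))) (≤-trans (leaveout (U ∖ W) Y) (≤-reflexive (+-comm _ (card Y)))) (≰⇒> few) (card-⋃ As)))
          (≤-trans (+-monoˡ-≤ m (≤-trans (≤-trans (card-mono Y⊆Z) rest) small)) fits))
        where
        open Pieces R
        open Stars St
        W : 𝕊 N
        W = ⋃ As
        All-apart : ∀ Bs → ⋃ Bs ⊆ W → All (λ A → ∀ v → v ∈ A → v ∈ Y → ⊥) Bs
        All-apart [] h = []
        All-apart (A ∷ Bs) h = (λ v p q → true≢false (h v (∨ˡ p)) (not⁻ (proj₂ (∧⁻ {U v} (Y⊆Z v q))))) ∷ All-apart Bs λ v p → h v (∨ʳ {A v} p)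

-- Decidability of copies removes the double negation from the final statement.

module _ {N : ℕ} where

  cons : ∀ {n} → Fin N → (Fin n → Fin N) → Fin (suc n) → Fin N
  cons x f fzero = x
  cons x f (fsuc i) = f i

  search : ∀ {n} (P : (Fin n → Fin N) → Set) → (∀ {f g} → (∀ i → f i ≡ g i) → P f → P g) → (∀ f → Dec (P f)) → Dec (Σ (Fin n → Fin N) P)
  search {zero} P resp dec with dec (λ ())
  ... | yes p = yes (_ , p)
  ... | no n = no λ { (f , p) → n (resp (λ ()) p) }
  search {suc n} P resp dec with any? (λ x → search (λ f → P (cons x f)) (λ h → resp λ { fzero → refl ; (fsuc i) → h i }) (λ f → dec (cons x f)))
  ... | yes (x , f , p) = yes (cons x f , p)
  ... | no n = no λ { (f , p) → n (f fzero , f ∘ fsuc , resp (λ { fzero → refl ; (fsuc i) → refl }) p) }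

  module _ (V : Set) (A : V → V → Set) (A? : ∀ x y → Dec (A x y)) (s : ℕ) (enc : V → Fin s) (dec : Fin s → V) (dec-enc : ∀ x → dec (enc x) ≡ x)
           (c : Coloring N) (b : Bool) where

    private
      ∀? : ∀ {Q : V → Set} → (∀ x → Dec (Q x)) → Dec (∀ x → Q x)
      ∀? {Q} q = map′ (λ h x → subst Q (dec-enc x) (h (enc x))) (λ h i → h (dec i)) (all? λ i → q (dec i))

      enc-injective : ∀ {x y} → enc x ≡ enc y → x ≡ y
      enc-injective {x} {y} e = trans (sym (dec-enc x)) (trans (cong dec e) (dec-enc y))

      Copy : (V → Fin N) → Set
      Copy f = (∀ x y → f x ≡ f y → x ≡ y) × (∀ x y → A x y → c (f x) (f y) ≡ b)

      copy? : ∀ f → Dec (Copy f)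
      copy? f = ∀? (λ x → ∀? λ y → (f x ≟ f y) →-dec map′ enc-injective (cong enc) (enc x ≟ enc y)) ×-dec ∀? (λ x → ∀? λ y → A? x y →-dec (c (f x) (f y) ≟ᵇ b))

      copy-resp : ∀ {f g} → (∀ x → f x ≡ g x) → Copy f → Copy g
      copy-resp h (i , p) = (λ x y e → i x y (trans (h x) (trans e (sym (h y))))) , λ x y a → trans (cong₂ c (sym (h x)) (sym (h y))) (p x y a)

    mono-copy? : Dec (MonoCopy V A c b)
    mono-copy? = map′ (λ { (g , i , p) → (λ x → g (enc x)) , (λ {x} {y} e → i x y e) , p })
      (λ { (f , i , p) → (λ j → f (dec j)) , copy-resp (λ x → cong f (sym (dec-enc x))) ((λ x y e → i e) , p) })
      (search (λ g → Copy (λ x → g (enc x))) (λ h → copy-resp λ x → h (enc x)) (λ g → copy? _))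

vertexCount : ∀ k → (Fin k → ℕ) → ℕ
vertexCount zero m = 0
vertexCount (suc k) m = m fzero + vertexCount k (m ∘ fsuc)

encode : ∀ k m → KVert k m → Fin (vertexCount k m)
encode (suc k) m (fzero , j) = j ↑ˡ vertexCount k (m ∘ fsuc)
encode (suc k) m (fsuc i , j) = m fzero ↑ʳ encode k (m ∘ fsuc) (i , j)

shiftK : ∀ {k} {m : Fin (suc k) → ℕ} → Fin (m fzero) ⊎ KVert k (m ∘ fsuc) → KVert (suc k) m
shiftK (inj₁ j) = fzero , j
shiftK (inj₂ (i , j)) = fsuc i , j

decode : ∀ k m → Fin (vertexCount k m) → KVert k m
decode (suc k) m v with splitAt (m fzero) v
... | inj₁ j = fzero , j
... | inj₂ r = shiftK {k} {m} (inj₂ (decode k (m ∘ fsuc) r))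

decode-encode : ∀ k m x → decode k m (encode k m x) ≡ x
decode-encode (suc k) m (fzero , j) rewrite splitAt-↑ˡ (m fzero) j (vertexCount k (m ∘ fsuc)) = refl
decode-encode (suc k) m (fsuc i , j) rewrite splitAt-↑ʳ (m fzero) (vertexCount k (m ∘ fsuc)) (encode k (m ∘ fsuc) (i , j)) =
  cong (λ z → shiftK {k} {m} (inj₂ z)) (decode-encode k (m ∘ fsuc) (i , j))

stable-arrow : ∀ {N n} (T : SimpleGraph n) k m (c : Coloring N) → NN (MonoCopy (Fin n) (Adj T) c true ⊎ MonoCopy (KVert k m) (KAdj k m) c false) →
  MonoCopy (Fin n) (Adj T) c true ⊎ MonoCopy (KVert k m) (KAdj k m) c false
stable-arrow {n = n} T k m c h with mono-copy? (Fin n) (Adj T) (λ x y → SimpleGraph.adj T x y ≟ᵇ true) n (λ x → x) (λ x → x) (λ _ → refl) c true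
... | yes p = inj₁ p
... | no np with mono-copy? (KVert k m) (KAdj k m) (λ x y → ¬? (proj₁ x ≟ proj₁ y)) (vertexCount k m) (encode k m) (decode k m) (decode-encode k m) c false
...   | yes q = inj₂ q
...   | no nq = ⊥-elim (h λ { (inj₁ p) → np p ; (inj₂ q) → nq q })

-- Blue copies from blue families, and Chvátal's theorem

chvátal-arith : ∀ ν k u f s x d → ν * suc k + 1 ≤ u → u ≤ f + (s + x) → s ≤ 1 → x ≤ d → d < ν → ν * k + 1 ≤ f
chvátal-arith ν k u f s x d h1 h2 h3 h4 h5 = lin 0 (h1 ⊞ h2 ⊞ h3 ⊞ h4 ⊞ h5) (solve (ν List.∷ k List.∷ u List.∷ f List.∷ s List.∷ x List.∷ d List.∷ List.[]))

module Red {N : ℕ} (c : Coloring N) (c-sym : SymmetricColoring c) where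

  -- The diagonal is cut off, as a colouring is arbitrary there.
  red : Fin N → Fin N → Bool
  red u v = c u v ∧ not (isYes (u ≟ v))

  red-irr : ∀ x → red x x ≡ false
  red-irr x with x ≟ x
  ... | no n = ⊥-elim (n refl)
  ... | yes _ with c x x
  ...   | true = refl
  ...   | false = refl

  red-sym : ∀ u v → red u v ≡ red v u
  red-sym u v with u ≟ v | v ≟ u
  ... | yes _ | yes _ = cong (_∧ false) (c-sym u v)
  ... | no _ | no _ = cong (_∧ true) (c-sym u v)
  ... | yes refl | no n = ⊥-elim (n refl)
  ... | no n | yes refl = ⊥-elim (n refl)

  red⇒c : ∀ {u v} → red u v ≡ true → c u v ≡ true
  red⇒c p = proj₁ (∧⁻ p)

  blue⇒c : ∀ {u v} → u ≢ v → red u v ≡ false → c u v ≡ false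
  blue⇒c {u} {v} ne p with u ≟ v
  ... | yes e = ⊥-elim (ne e)
  ... | no _ with c u v
  ...   | false = refl
  ...   | true = true≢false refl p

  open Extension red
  open Blue red red-sym

  pick : ∀ s (X : 𝕊 N) → s ≤ card X → Σ (Fin s → Fin N) λ f → Injective _≡_ _≡_ f × ∀ i → f i ∈ X
  pick zero X h = (λ ()) , (λ {x} → λ { {()} }) , λ ()
  pick (suc s) X h with card-positive {X = X} (≤-trans (s≤s z≤n) h)
  ... | x , x∈ with pick s (X ∖ ｛ x ｝) (≤-pred (≤-trans h (≤-trans (card-cover ｛ x ｝ (X ∖ ｛ x ｝) λ v p → case bool? (｛ x ｝ v) of λ { (inj₁ q) → inj₁ q ; (inj₂ q) → inj₂ (∧⁺ p (not⁺ q)) }) (+-monoˡ-≤ _ (card-sing x)))))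
  ...   | f , inj , f∈ = cons x f , inj′ , λ { fzero → x∈ ; (fsuc i) → proj₁ (∧⁻ (f∈ i)) }
    where
    fresh : ∀ i → f i ≢ x
    fresh i refl = true≢false (sing-refl (f i)) (not⁻ (proj₂ (∧⁻ {X (f i)} (f∈ i))))
    inj′ : Injective _≡_ _≡_ (cons x f)
    inj′ {fzero} {fzero} e = refl
    inj′ {fzero} {fsuc j} e = ⊥-elim (fresh j (sym e))
    inj′ {fsuc i} {fzero} e = ⊥-elim (fresh i e)
    inj′ {fsuc i} {fsuc j} e = cong fsuc (inj e)

  record Blocks (U : 𝕊 N) (k : ℕ) (s : Fin k → ℕ) : Set where
    field
      block : Fin k → 𝕊 N
      sub   : ∀ i → block i ⊆ U
      size  : ∀ i → s i ≤ card (block i)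
      apart : ∀ i j → i ≢ j → ∀ {u v} → u ∈ block i → v ∈ block j → u ≢ v × red u v ≡ false

  extendBlocks : ∀ {U k s P a} → P ⊆ U → a ≤ card P → Blocks (far U P) k s → (s′ : Fin (suc k) → ℕ) → s′ fzero ≤ a → (∀ i → s′ (fsuc i) ≤ s i) → Blocks U (suc k) s′
  extendBlocks {U} {k} {s} {P} p c B s′ h₀ h = record
    { block = block′ ; sub = λ { fzero → p ; (fsuc i) v q → far⊆ {U} {P} v (sub i v q) }
    ; size = λ { fzero → ≤-trans h₀ c ; (fsuc i) → ≤-trans (h i) (size i) } ; apart = apart′ }
    where
    open Blocks B
    block′ : Fin (suc k) → 𝕊 N
    block′ fzero = P
    block′ (fsuc i) = block i
    cross : ∀ {u v} → u ∈ P → v ∈ far U P → u ≢ v × red u v ≡ false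
    cross {u} {v} uP vf with far⁻ {U} {P} vf
    ... | _ , v∉ , vn = (λ { refl → true≢false uP v∉ }) , none
      where
      none : red u v ≡ false
      none with red u v in e
      ... | false = refl
      ... | true = true≢false (nb⁺ uP e) vn
    apart′ : ∀ i j → i ≢ j → ∀ {u v} → u ∈ block′ i → v ∈ block′ j → u ≢ v × red u v ≡ false
    apart′ fzero fzero ne = ⊥-elim (ne refl)
    apart′ fzero (fsuc j) ne p q = cross p (sub j _ q)
    apart′ (fsuc i) fzero ne p q with cross q (sub i _ p)
    ... | a , b = (λ e → a (sym e)) , trans (red-sym _ _) b
    apart′ (fsuc i) (fsuc j) ne p q = apart i j (λ e → ne (cong fsuc e)) p q

  blocks : ∀ {m U} k → BK m U k → Blocks U k (λ _ → m)
  blocks zero _ = record { block = λ () ; sub = λ () ; size = λ () ; apart = λ () }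
  blocks {m} (suc k) (P , p , c , b) = extendBlocks p c (blocks k b) (λ _ → m) ≤-refl (λ _ → ≤-refl)

  blue-copy : ∀ {a mx U} k (m : Fin (suc k) → ℕ) → m fzero ≤ a → (∀ i → m i ≤ mx) → KK a mx U k → MonoCopy (KVert (suc k) m) (KAdj (suc k) m) c false
  blue-copy {a} {mx} {U} k m h₀ h (P , p , cP , b) = f , inj , hom
    where
    open Blocks (extendBlocks p cP (blocks k b) m h₀ (λ i → h (fsuc i)))
    F : ∀ i → Σ (Fin (m i) → Fin N) λ f → Injective _≡_ _≡_ f × ∀ j → f j ∈ block i
    F i = pick (m i) (block i) (size i)
    f : KVert (suc k) m → Fin N
    f (i , j) = proj₁ (F i) j
    inj : Injective _≡_ _≡_ f
    inj {i , j} {i′ , j′} e with i ≟ i′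
    ... | no ne = ⊥-elim (proj₁ (apart i i′ ne (proj₂ (proj₂ (F i)) j) (proj₂ (proj₂ (F i′)) j′)) e)
    ... | yes refl = cong (i ,_) (proj₁ (proj₂ (F i)) e)
    hom : ∀ x y → KAdj (suc k) m x y → c (f x) (f y) ≡ false
    hom (i , j) (i′ , j′) ne with apart i i′ ne (proj₂ (proj₂ (F i)) j) (proj₂ (proj₂ (F i′)) j′)
    ... | a , r = blue⇒c a r

  -- Chvátal's theorem on T against complete graphs
  module Greedy (ν : ℕ) (1≤ν : 1 ≤ ν) {T : SimpleGraph (suc ν)} {Δ : ℕ} (S : TreeShape T Δ) where

    open Completion red red-sym T S
    open TreeShape S

    module _ (U : 𝕊 N) (deg : ∀ v → v ∈ U → ν ≤ card (red v ∩ U)) where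

      Gr : List (Fin N) → List (Fin N) → Set
      Gr us R = Unique us × All (_∈ U) us × All (_∈ U) R × ((us ≡ [] × length R ≡ 1) ⊎ All (_∈ˡ us) R)

      w : ℕ
      w = 3 + 4 * Δ

      Gr-↭ : ∀ {us us′ R R′} → us ↭ us′ → R ↭ R′ → Gr us R → Gr us′ R′
      Gr-↭ p q (u , i , j , t) = Unique-↭ p u , All-resp-↭ p i , All-resp-↭ q j , (case t of λ
        { (inj₁ (refl , e)) → inj₁ (empty-list (sym (↭-length p)) , trans (sym (↭-length q)) e)
        ; (inj₂ a) → inj₂ (All-resp-↭ q (All-map (∈-resp-↭ p) a)) })

      Gr-drop : ∀ {us} T {R} → Gr us (T ++ R) → Gr us R
      Gr-drop [] g = g
      Gr-drop (x ∷ T) {R} (u , i , j , inj₁ (e , l)) = u , i , All-++⁻ʳ (x ∷ T) j , inj₂ (subst (All _) (sym R≡[]) [])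
        where
        R≡[] : R ≡ []
        R≡[] = empty-list (n≤0⇒n≡0 (≤-trans (m≤n+m (length R) (length T)) (≤-reflexive (trans (sym (length-++ T)) (suc-injective l)))))
      Gr-drop (x ∷ T) (u , i , j , inj₂ a) = u , i , All-++⁻ʳ (x ∷ T) j , inj₂ (All-++⁻ʳ (x ∷ T) a)

      Gr-ext : ∀ {us x R} → Gr us (x ∷ R) → length us < suc ν → NN (Σ (Fin N) λ y → red x y ≡ true × Gr (y ∷ us) (replicate w y ++ R))
      Gr-ext {us} {x} {R} (u , i , xU ∷ j , t) lt = pure (y , proj₁ (∧⁻ (proj₁ (∧⁻ y∈))) , fresh ∷ u , yU ∷ i , All-++⁺ (rep w) j , inj₂ (toks t))
        where
        free : 1 ≤ card ((red x ∩ U) ∖ ⟪ us ⟫)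
        free = room t
          where
          split : ∀ us′ → (∀ v → v ∈ (red x ∩ U) → v ∈ ⟪ us ⟫ → v ∈ us′) → card us′ < ν → 1 ≤ card ((red x ∩ U) ∖ ⟪ us ⟫)
          split us′ h l = +-cancelˡ-≤ (card us′) 1 _ (≤-trans (≤-reflexive (+-comm (card us′) 1)) (≤-trans l (≤-trans (deg x xU) (card-cover us′ ((red x ∩ U) ∖ ⟪ us ⟫)
            λ v p → case bool? (⟪ us ⟫ v) of λ { (inj₁ q) → inj₁ (h v p q) ; (inj₂ q) → inj₂ (∧⁺ p (not⁺ q)) }))))
          room : (us ≡ [] × length (x ∷ R) ≡ 1) ⊎ All (_∈ˡ us) (x ∷ R) → 1 ≤ card ((red x ∩ U) ∖ ⟪ us ⟫)
          room (inj₁ (refl , _)) = split ∅ (λ v _ ()) (subst (_< ν) (sym card-∅) 1≤ν)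
          room (inj₂ (x∈ ∷ _)) = split (⟪ us ⟫ ∖ ｛ x ｝) (λ v p q → ∧⁺ q (not⁺ (sing-∉ λ { refl → true≢false (proj₁ (∧⁻ p)) (red-irr v) })))
            (≤-trans (≤-trans (≤-reflexive (+-comm 1 _)) (≤-trans (+-monoʳ-≤ _ (∈⇒card (sing-refl x))) (card-disjoint {X = ⟪ us ⟫} (⟪ us ⟫ ∖ ｛ x ｝) ｛ x ｝ (λ v p → proj₁ (∧⁻ p)) (λ v p → subst (_∈ ⟪ us ⟫) (sym (sing⁻ p)) (∈⟪⟫⁺ x∈))
              λ v p q → true≢false q (not⁻ (proj₂ (∧⁻ {⟪ us ⟫ v} p)))))) (≤-trans (card⟪⟫≤ us) (≤-pred lt)))
        chosen : Σ (Fin N) (_∈ ((red x ∩ U) ∖ ⟪ us ⟫))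
        chosen = card-positive free
        y : Fin N
        y = proj₁ chosen
        y∈ : y ∈ ((red x ∩ U) ∖ ⟪ us ⟫)
        y∈ = proj₂ chosen
        yU : y ∈ U
        yU = proj₂ (∧⁻ {red x y} (proj₁ (∧⁻ y∈)))
        fresh : All (y ≢_) us
        fresh = All-tabulate λ p e → ∉⟪⟫⁻ {xs = us} (not⁻ (proj₂ (∧⁻ {(red x ∩ U) y} y∈))) (subst (_∈ˡ us) (sym e) p)
        rep : ∀ k → All (_∈ U) (replicate k y)
        rep zero = []
        rep (suc k) = yU ∷ rep k
        rep′ : ∀ k → All (_∈ˡ y ∷ us) (replicate k y)
        rep′ zero = []
        rep′ (suc k) = here refl ∷ rep′ k
        toks : (us ≡ [] × length (x ∷ R) ≡ 1) ⊎ All (_∈ˡ us) (x ∷ R) → All (_∈ˡ y ∷ us) (replicate w y ++ R)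
        toks (inj₁ (_ , l)) = All-++⁺ (rep′ w) (subst (All _) (sym (empty-list {xs = R} (suc-injective l))) [])
        toks (inj₂ (_ ∷ a)) = All-++⁺ (rep′ w) (All-map there a)

      extender : Extender red
      extender = record { G = Gr ; w = w ; Δ = Δ ; cap = suc ν ; w-big = ≤-refl ; G-↭ = Gr-↭ ; G-drop = Gr-drop ; ext = Gr-ext }

      open Embedding {suc ν} red extender

      greedy : ∀ {v} → v ∈ U → NN RedCopy
      greedy {v} vU = embT shape {v} {[]} {[]} narrow ([] , [] , vU ∷ [] , inj₁ (refl , refl)) nodes >>= λ { (y , _ , P , r) →
        pure (complete extender {gss = []} {ys = []}
          (≋-refl shape) (P , r) (subst (λ l → Fills l []) (sym (empty-list (trans (Part.#lo P) (plain⇒#long shape plain)))) [])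
          (subst (λ l → Pointwise _ (pendTokens l) []) (sym (empty-list (trans (Part.#pe P) (longs-#pend {k = 0} shape (plain⇒longs 0 shape plain))))) []) (proj₁ (Part.state P))) }
        where
        nodes : #nodes shape ≤ suc ν
        nodes = ≤-trans (m≤m+n (#nodes shape) _) (≤-reflexive (trans (sym (nodes-count shape (plain⇒longs 0 shape plain))) (shape-length S)))

    -- If all red degrees in `U` are at least ν, T embeds greedily. Otherwise a vertex of smaller
    -- degree becomes a blue singleton, and it and its neighbours cost at most ν vertices.
    chvátal : ¬ RedCopy → ∀ k U → ν * k + 1 ≤ card U → NN (BK 1 U (suc k))
    chvátal noT zero U h = pure (U , (λ v p → p) , ≤-trans (m≤n+m 1 (ν * 0)) h , tt)
    chvátal noT (suc k) U h = em (∀ v → v ∈ U → ν ≤ card (red v ∩ U)) >>= λ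
      { (inj₁ deg) → λ _ → greedy U deg (proj₂ (card-positive {X = U} (≤-trans (m≤n+m 1 _) h))) noT
      ; (inj₂ low) → counterexample (λ v f p → ≤-stable λ g → f λ f′ → g (f′ p)) low >>= λ { (v , nf) → em (v ∈ U) >>= λ
        { (inj₂ v∉) → λ _ → nf λ p → ⊥-elim (v∉ p)
        ; (inj₁ v∈) → let few = ≰⇒> {ν} {card (red v ∩ U)} λ le → nf λ _ → le in
            chvátal noT k (far U ｛ v ｝) (chvátal-arith ν k (card U) (card (far U ｛ v ｝)) (card ｛ v ｝) (card ((nb ｛ v ｝ ∩ U) ∖ ｛ v ｝)) (card (red v ∩ U)) h (far-size U ｛ v ｝) (card-sing v) (card-mono (nbs v)) few) >>= λ b →
            pure (｛ v ｝ , (λ z q → subst (_∈ U) (sym (sing⁻ q)) v∈) , ∈⇒card (sing-refl v) , b) } } }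
      where
      nbs : ∀ v → ((nb ｛ v ｝ ∩ U) ∖ ｛ v ｝) ⊆ (red v ∩ U)
      nbs v z p with ∧⁻ {nb ｛ v ｝ z} (proj₁ (∧⁻ p))
      ... | q , zU with nb⁻ q
      ...   | x , xv , a = ∧⁺ (subst (λ y → red y z ≡ true) (sing⁻ xv) a) zU

-- The extremal colouring: k red cliques on ν vertices each, and fewer than m₀ further vertices.

module LowerBound (ν′ k : ℕ) where

  ν : ℕ
  ν = suc ν′

  class : ∀ {N} → Fin N → ℕ
  class u = toℕ u / ν

  cliques : ∀ N → Coloring N
  cliques N u v = isYes (class u ≟ℕ class v)

  cliques-sym : ∀ N → SymmetricColoring (cliques N)
  cliques-sym N u v with class u ≟ℕ class v | class v ≟ℕ class u
  ... | yes _ | yes _ = refl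
  ... | no _ | no _ = refl
  ... | yes e | no n = ⊥-elim (n (sym e))
  ... | no n | yes e = ⊥-elim (n (sym e))

  same-class : ∀ {N} (u v : Fin N) → cliques N u v ≡ true → class u ≡ class v
  same-class u v p with class u ≟ℕ class v
  ... | yes e = e

  other-class : ∀ {N} (u v : Fin N) → cliques N u v ≡ false → class u ≢ class v
  other-class u v p with class u ≟ℕ class v
  ... | no n = n

  residue-injective : ∀ {N} (u v : Fin N) → class u ≡ class v → toℕ u % ν ≡ toℕ v % ν → u ≡ v
  residue-injective u v e r = toℕ-injective (trans (m≡m%n+[m/n]*n (toℕ u) ν) (trans (cong₂ (λ a b → a + b * ν) r e) (sym (m≡m%n+[m/n]*n (toℕ v) ν))))

  no-red-copy : ∀ {N} (T : SimpleGraph (suc ν)) → Connected T → ¬ MonoCopy (Fin (suc ν)) (Adj T) (cliques N) true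
  no-red-copy {N} T conn (f , inj , hom) = <-irrefl refl (injective⇒≤ {f = λ x → fromℕ< (m%n<n (toℕ (f x)) ν)} λ {x} {y} e →
      inj (residue-injective (f x) (f y) (all-same (conn x y)) (trans (sym (toℕ-fromℕ< _)) (trans (cong toℕ e) (toℕ-fromℕ< _)))))
    where
    all-same : ∀ {x y} → Walk T x y → class (f x) ≡ class (f y)
    all-same Walk.here = refl
    all-same (step {u} {v} a w) = trans (same-class (f u) (f v) (hom u v a)) (all-same w)

  no-blue-copy : ∀ {N μ} (m : Fin (suc k) → ℕ) → suc μ ≤ ν → (∀ i → suc μ ≤ m i) → N ≤ ν * k + μ → ¬ MonoCopy (KVert (suc k) m) (KAdj (suc k) m) (cliques N) false
  no-blue-copy {N} {μ} m μ<ν μ<m N≤ (f , inj , hom) with onto (fromℕ k)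
    where
    class≤k : ∀ (u : Fin N) → class u < suc k
    class≤k u = m<n*o⇒m/o<n {n = suc k} (<-≤-trans (toℕ<n u) (≤-trans N≤ (≤-trans (+-monoʳ-≤ (ν * k) (≤-trans (n≤1+n μ) μ<ν)) (≤-reflexive (trans (+-comm (ν * k) ν) (cong (ν +_) (*-comm ν k)))))))
    first : ∀ i → KVert (suc k) m
    first i = i , fromℕ< (≤-trans (s≤s z≤n) (μ<m i))
    h : Fin (suc k) → Fin (suc k)
    h i = fromℕ< (class≤k (f (first i)))
    toℕ-h : ∀ i → toℕ (h i) ≡ class (f (first i))
    toℕ-h i = toℕ-fromℕ< _
    h-injective : ∀ {i j} → h i ≡ h j → i ≡ j
    h-injective {i} {j} e with i ≟ j
    ... | yes p = p
    ... | no ne = ⊥-elim (other-class (f (first i)) (f (first j)) (hom _ _ ne) (trans (sym (toℕ-h i)) (trans (cong toℕ e) (toℕ-h j))))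
    onto : ∀ q → Σ (Fin (suc k)) λ i → h i ≡ q × (∀ j → class (f (i , j)) ≡ toℕ q)
    onto q = top (hit q)
      where
      hit : ∀ q → Σ (Fin (suc k)) λ i → h i ≡ q
      hit q with any? (λ i → h i ≟ q)
      ... | yes p = p
      ... | no none = ⊥-elim (<-irrefl refl (injective⇒≤ {f = λ i → punchOut {i = q} {h i} (λ e → none (i , sym e))} λ {i} {j} e →
              h-injective (punchOut-injective (λ e → none (i , sym e)) (λ e → none (j , sym e)) e)))
      top : (Σ (Fin (suc k)) λ i → h i ≡ q) → Σ (Fin (suc k)) λ i → h i ≡ q × (∀ j → class (f (i , j)) ≡ toℕ q)
      top (i , e) = i , e , λ j → trans (rest j (hit (fromℕ< (class≤k (f (i , j)))))) (trans (sym (toℕ-h i)) (cong toℕ e))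
        where
        rest : ∀ j → (Σ (Fin (suc k)) λ i′ → h i′ ≡ fromℕ< (class≤k (f (i , j)))) → class (f (i , j)) ≡ class (f (first i))
        rest j (i′ , e′) with i ≟ i′
        ... | yes refl = trans (sym (trans (cong toℕ e′) (toℕ-fromℕ< _))) (toℕ-h i)
        ... | no ne = ⊥-elim (other-class (f (i , j)) (f (first i′)) (hom _ _ ne) (trans (sym (toℕ-fromℕ< (class≤k (f (i , j))))) (trans (cong toℕ (sym e′)) (toℕ-h i′))))
  ... | i , _ , last = <-irrefl refl (≤-trans (μ<m i) (injective⇒≤ {f = λ j → fromℕ< (small j)} λ {j} {j′} e →
          snd-injective (inj (residue-injective (f (i , j)) (f (i , j′)) (trans (last j) (sym (last j′))) (trans (sym (toℕ-fromℕ< (small j))) (trans (cong toℕ e) (toℕ-fromℕ< (small j′))))))))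
    where
    snd-injective : ∀ {j j′ : Fin (m i)} → (i , j) ≡ (i , j′) → j ≡ j′
    snd-injective refl = refl
    small : ∀ j → toℕ (f (i , j)) % ν < μ
    small j = +-cancelˡ-< (ν * k) _ μ (<-≤-trans (≤-<-trans (≤-reflexive (trans (+-comm (ν * k) _) (trans (cong (toℕ (f (i , j)) % ν +_) (trans (*-comm ν k) (cong (_* ν) (sym (trans (last j) (toℕ-fromℕ k)))))) (sym (m≡m%n+[m/n]*n (toℕ (f (i , j))) ν))))) (toℕ<n (f (i , j)))) N≤)

  lower-bound : ∀ (T : SimpleGraph (suc ν)) → Connected T → (m : Fin (suc k) → ℕ) → ∀ μ → suc μ ≤ ν → (∀ i → suc μ ≤ m i) →
    ∀ N → Arrows N (Fin (suc ν)) (Adj T) (KVert (suc k) m) (KAdj (suc k) m) → ν * k + suc μ ≤ N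
  lower-bound T conn m μ μ<ν μ<m N arrows = ≮⇒≥ λ lt → case arrows (cliques N) (cliques-sym N) of λ
    { (inj₁ r) → no-red-copy T conn r
    ; (inj₂ b) → no-blue-copy m μ<ν μ<m (≤-pred (≤-trans lt (≤-reflexive (+-suc (ν * k) μ)))) b }

-- Constants and logarithmic estimates

n<2^n : ∀ n → n < 2 ^ n
n<2^n zero = s≤s z≤n
n<2^n (suc n) = ≤-trans (≤-reflexive (+-comm 1 (suc n))) (≤-trans (n<2^n n ⊞ m^n>0 2 n) (≤-reflexive (cong (2 ^ n +_) (sym (+-identityʳ _)))))

dyadic : ∀ m → 1 ≤ m → Σ ℕ λ l → 2 ^ l ≤ m × m < 2 ^ suc l
dyadic (suc zero) _ = 0 , s≤s z≤n , s≤s (s≤s z≤n)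
dyadic (suc (suc m)) _ with dyadic (suc m) (s≤s z≤n)
... | l , lo , hi with suc (suc m) <? 2 ^ suc l
...   | yes lt = l , ≤-trans lo (n≤1+n _) , lt
...   | no ge = suc l , ≮⇒≥ ge , ≤-<-trans hi (≤-trans (≤-reflexive (+-comm 1 (2 ^ suc l))) (+-monoʳ-≤ (2 ^ suc l) (≤-trans (m^n>0 2 (suc l)) (≤-reflexive (sym (+-identityʳ _))))))

depthOf-linear : ∀ w q → depthOf w q ≡ 2 * q * w
depthOf-linear w zero = refl
depthOf-linear w (suc q) = trans (cong (λ z → w + (z + w)) (depthOf-linear w q)) (arith w q)
  where
  arith : ∀ w q → w + (2 * q * w + w) ≡ 2 * suc q * w
  arith = solve-∀

-- `treeSize` counts a full binary tree of depth d without its root.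
treeSize-pow : ∀ d → treeSize d + 2 ≡ 2 * 2 ^ d
treeSize-pow zero = refl
treeSize-pow (suc d) = trans (arith (treeSize d)) (trans (cong (2 *_) (treeSize-pow d)) refl)
  where
  arith : ∀ s → (2 + (s + s)) + 2 ≡ 2 * (s + 2)
  arith = solve-∀

slack-bound : ∀ wb t → slack wb t ≤ (5 + 2 * (wb + 1)) * 2 ^ t
slack-bound wb t = arith (2 ^ t) (treeSize t) wb (treeSize-pow t)
  where
  arith : ∀ M s wb → s + 2 ≡ 2 * M → M + (2 + (s + s) + (wb + 1) * (M + M)) ≤ (5 + 2 * (wb + 1)) * M
  arith M s wb h = lin 2 (2 · ≤-reflexive h) (solve (M List.∷ s List.∷ wb List.∷ List.[]))

-- The number of interior vertices of a long path in the exact embedding, written out in terms of t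
-- and q alone.
interior : ℕ → ℕ → ℕ
interior t q = depthOf (suc ((1 + (t + t)) * (2 + (2 + (t + t))))) q + ((2 + (t + t)) + (3 + (2 + (t + t))))

kin-arith : ∀ q w t L τ θ ω X → q ≤ θ * L → w ≤ ω * (L * L) → t ≤ τ * L → L ≤ X → L * (L * L) ≤ X → 1 ≤ X → suc (2 * q * w + ((2 + (t + t)) + (3 + (2 + (t + t))))) ≤ (2 * θ * ω + 8 + 4 * τ) * X
kin-arith q w t L τ θ ω X h1 h2 h3 h4 h5 h6 = lin (0) ((2 * w) · h1 ⊞ (2 * θ * L) · h2 ⊞ 4 · h3 ⊞ (4 * τ) · h4 ⊞ (2 * θ * ω) · h5 ⊞ 8 · h6) (solve (q List.∷ w List.∷ t List.∷ L List.∷ τ List.∷ θ List.∷ ω List.∷ X List.∷ List.[]))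

wire-arith : ∀ t L τ → t ≤ τ * L → 1 ≤ L → suc ((1 + (t + t)) * (2 + (2 + (t + t)))) ≤ (1 + (1 + 2 * τ) * (4 + 2 * τ)) * (L * L)
wire-arith t L τ h1 h2 = lin (0) ((10 + 4 * t + 4 * τ * L) · h1 ⊞ (5 + 5 * L + 10 * τ * L) · h2) (solve (t List.∷ L List.∷ τ List.∷ List.[]))

-- A wire is quadratic in t, and a route has 2q wires. With t and q linear in L this is cubic in L,
-- which the fourth power absorbs.
interior-bound : ∀ t q L τ θ → 1 ≤ L → t ≤ τ * L → q ≤ θ * L → suc (interior t q) ≤ (2 * θ * (1 + (1 + 2 * τ) * (4 + 2 * τ)) + 8 + 4 * τ) * L ^ 4
interior-bound t q L τ θ 1≤L ht hq = ≤-trans (≤-reflexive (cong (λ z → suc (z + ((2 + (t + t)) + (3 + (2 + (t + t)))))) (depthOf-linear (suc ((1 + (t + t)) * (2 + (2 + (t + t))))) q)))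
    (kin-arith q _ t L τ θ (1 + (1 + 2 * τ) * (4 + 2 * τ)) (L ^ 4) hq (wire-arith t L τ ht 1≤L) ht
      (≤-trans (≤-reflexive (sym (*-identityʳ L))) (*-monoʳ-≤ L (≤-trans 1≤L (≤-trans (≤-reflexive (sym (*-identityʳ L))) (*-monoʳ-≤ L 1≤LL)))))
      (*-monoʳ-≤ L (*-monoʳ-≤ L (≤-trans (≤-reflexive (sym (*-identityʳ L))) (*-monoʳ-≤ L 1≤L1))))
      (≤-trans 1≤L1 (≤-trans (≤-reflexive (sym (*-identityˡ _))) (*-mono-≤ 1≤L (≤-trans (≤-reflexive (sym (*-identityˡ _))) (*-mono-≤ 1≤L (≤-trans (≤-reflexive (sym (*-identityˡ _))) (*-mono-≤ 1≤L ≤-refl))))))))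
  where
  1≤L1 : 1 ≤ L * 1
  1≤L1 = ≤-trans 1≤L (≤-reflexive (sym (*-identityʳ L)))
  1≤LL : 1 ≤ L * (L * 1)
  1≤LL = *-mono-≤ 1≤L 1≤L1

-- Opaque, since conversion checking would otherwise expand numerals such as 2 ^ s₂.

module Constants (Δ k : ℕ) where

  opaque
    w′ : ℕ
    w′ = 4 * Δ

    w′-def : w′ ≡ 4 * Δ
    w′-def = refl

  D κ′ : ℕ
  D = 8 + w′
  κ′ = (D + 1) * 2

  -- `loss` in units of m, when the shortfall is x * m.
  lossCoeff : ℕ → ℕ → ℕ
  lossCoeff zero x = 1
  lossCoeff (suc i) x = 2 + (lossCoeff i (x + 1 + κ′) + lossCoeff i (x + 1 + κ′)) + (x + 1 + κ′)

  -- A sum instead of the last coefficient: it bounds all of them without an argument that they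
  -- increase.
  lossTotal : ℕ → ℕ
  lossTotal zero = lossCoeff zero 0
  lossTotal (suc j) = lossCoeff (suc j) 0 + lossTotal j

  lossCoeff≤total : ∀ {j k} → j ≤ k → lossCoeff j 0 ≤ lossTotal k
  lossCoeff≤total {zero} {zero} h = ≤-refl
  lossCoeff≤total {j} {suc k} h with m≤n⇒m<n∨m≡n h
  ... | inj₂ refl = m≤m+n _ _
  ... | inj₁ (s≤s lt) = ≤-trans (lossCoeff≤total lt) (m≤n+m _ _)

  opaque
    -- In multiples of the largest part: `e` bounds the losses, `cLeaf` the number of leaves in the
    -- case of few leaves, `cMany` and `cFew` are the sizes required in the two cases. `s` makes M
    -- exceed losses plus one part, `s₂` makes Q exceed the slack, and `cInterior` is the factor in
    -- the length of long paths. The first term of `C` pays for the Q long paths and for the leaves,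
    -- the second for the linear requirements; its 2 also makes T larger than every part.
    e s s₂ cLeaf cMany cFew cInterior C : ℕ
    e = lossTotal k
    s = suc (suc e)
    s₂ = 5 + 2 * (D + 1)
    cLeaf = (D + 1) * (2 * (D + 1)) + 1
    cMany = (D + 1) * (2 * (D + 1) + 1) + 1
    cFew = ((k * (D + D) + 1) + 4) * (e + 3) + ((D + D) + 1) * (2 * 2 ^ s + 1)
    cInterior = 2 * (1 + s + s₂) * (1 + (1 + 2 * (1 + s)) * (4 + 2 * (1 + s))) + 8 + 4 * (1 + s)
    C = cInterior * (2 ^ (s + s₂) + 2 * cLeaf) + (cMany + cFew + 2)

    e-def : e ≡ lossTotal k
    e-def = refl
    s-def : s ≡ suc (suc e)
    s-def = refl
    s₂-def : s₂ ≡ 5 + 2 * (D + 1)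
    s₂-def = refl
    cLeaf-def : cLeaf ≡ (D + 1) * (2 * (D + 1)) + 1
    cLeaf-def = refl
    cMany-def : cMany ≡ (D + 1) * (2 * (D + 1) + 1) + 1
    cMany-def = refl
    cFew-def : cFew ≡ ((k * (D + D) + 1) + 4) * (e + 3) + ((D + D) + 1) * (2 * 2 ^ s + 1)
    cFew-def = refl
    cInterior-def : cInterior ≡ 2 * (1 + s + s₂) * (1 + (1 + 2 * (1 + s)) * (4 + 2 * (1 + s))) + 8 + 4 * (1 + s)
    cInterior-def = refl
    C-def : C ≡ cInterior * (2 ^ (s + s₂) + 2 * cLeaf) + (cMany + cFew + 2)
    C-def = refl

-- The upper bound when the largest part has at least two vertices

module Upper {N : ℕ} (c : Coloring N) (c-sym : SymmetricColoring c) (Δ k ν mx : ℕ) (1≤Δ : 1 ≤ Δ) {T : SimpleGraph (suc ν)} (S : TreeShape T Δ)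
             (2≤mx : 2 ≤ mx) (L : ℕ) (log : ∀ l → 2 ^ l ≤ mx → l ≤ L) (large : Constants.C Δ k * mx * L ^ 4 ≤ suc ν) where

  open Red c c-sym
  open Extension red
  open Blue red red-sym
  open Constants Δ k
  open TreeShape S
  open Completion red red-sym T S using (RedCopy)

  1≤mx : 1 ≤ mx
  1≤mx = ≤-trans (s≤s z≤n) 2≤mx

  open Induction red red-sym ν mx 1≤mx

  l : ℕ
  l = proj₁ (dyadic mx 1≤mx)

  2^l≤mx : 2 ^ l ≤ mx
  2^l≤mx = proj₁ (proj₂ (dyadic mx 1≤mx))

  mx<2^l : mx < 2 ^ suc l
  mx<2^l = proj₂ (proj₂ (dyadic mx 1≤mx))

  1≤L : 1 ≤ L
  1≤L = log 1 2≤mx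

  1≤L⁴ : 1 ≤ L ^ 4
  1≤L⁴ = ≤-trans (≤-reflexive (sym (^-zeroˡ 4))) (^-monoˡ-≤ 4 1≤L)

  linear : (cMany + cFew + 2) * mx ≤ suc ν
  linear = ≤-trans (≤-trans (*-monoˡ-≤ mx (≤-trans (m≤n+m _ (cInterior * (2 ^ (s + s₂) + 2 * cLeaf))) (≡⇒≥ C-def))) (≤-trans (≤-reflexive (sym (*-identityʳ (C * mx)))) (*-monoʳ-≤ (C * mx) 1≤L⁴))) large

  -- The remaining multiple `y` pays for the step from |T| to |T| - 1.
  small-const : ∀ x y → x + y ≡ cMany + cFew + 2 → 1 ≤ y → x * mx ≤ ν
  small-const x y e h = ≤-pred (≤-trans (arith x y mx (cMany + cFew + 2) e h 1≤mx) linear)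
    where
    arith : ∀ x y m z → x + y ≡ z → 1 ≤ y → 1 ≤ m → suc (x * m) ≤ z * m
    arith x (suc y) m .(x + suc y) refl h1 h2 = lin (y * m) h2 (solve (x List.∷ y List.∷ m List.∷ List.[]))

  many : ¬ RedCopy → (D + 1) * ((D + 1) * mx + (D + 1) * mx) < #leaves shape ∸ 1 → ∀ j → UB j
  many noT leafy zero = UB-zero
  many noT leafy (suc j) = Many.step-many D
    (λ U ne robust spread → Expanding.embed-with-leaves red (record { irr = red-irr ; adj-sym = red-sym ; U = U ; M = (D + 1) * mx ; w′ = w′ ; n̂ = suc ν ; 1≤M = 1≤M ; robust = robust ; spread = spread }) S 1≤Δ (≡⇒≥ w′-def) ne refl leafy noT)
    (≤-trans (≤-reflexive (trans (arith D mx) (cong (_* mx) (sym cMany-def)))) (small-const cMany (cFew + 2) (sym (+-assoc cMany cFew 2)) (≤-trans (s≤s z≤n) (m≤n+m 2 cFew)))) j (many noT leafy j)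
    where
    1≤M : 1 ≤ (D + 1) * mx
    1≤M = ≤-trans 1≤mx (m≤m+n mx _)
    arith : ∀ D m → (D + 1) * ((D + 1) * m + (D + 1) * m + m) + m ≡ ((D + 1) * (2 * (D + 1) + 1) + 1) * m
    arith = solve-∀

  t q M κ E : ℕ
  t = l + s
  q = t + s₂
  M = 2 ^ t
  κ = (D + 1) * (mx + mx)
  E = e * mx

  M≤ : M ≤ 2 ^ s * mx
  M≤ = ≤-trans (≤-reflexive (^-distribˡ-+-* 2 l s)) (≤-trans (*-monoˡ-≤ (2 ^ s) 2^l≤mx) (≤-reflexive (*-comm mx (2 ^ s))))

  -- Bounding e + 1 by 2^(e + 1) and `mx` by 2^(l + 1) gives the exponent l + e + 2, which is the
  -- reason for the value of `s`.
  fits : E + mx ≤ M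
  fits = ≤-trans (≤-reflexive (+-comm (e * mx) mx)) (≤-trans (*-mono-≤ {suc e} {2 ^ suc e} (<⇒≤ (n<2^n (suc e))) (<⇒≤ mx<2^l)) (≤-reflexive (trans (*-comm (2 ^ suc e) (2 ^ suc l))
           (trans (sym (^-distribˡ-+-* 2 (suc l) (suc e))) (cong (2 ^_) (trans (sym (+-suc l (suc e))) (cong (l +_) (sym s-def))))))))

  large-few : ((k * (D + D) + 1) + 4) * (E + (mx + (mx + mx))) + ((D + D) + 1) * (M + M + mx) ≤ ν
  large-few = ≤-trans (arith (k * (D + D) + 1) e mx D M (2 ^ s) M≤) (≤-trans (*-monoˡ-≤ mx (≡⇒≥ cFew-def)) (small-const cFew (cMany + 2) (swap cFew cMany) (≤-trans (s≤s z≤n) (m≤n+m 2 cMany))))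
    where
    arith : ∀ c e m D M z → M ≤ z * m → (c + 4) * (e * m + (m + (m + m))) + ((D + D) + 1) * (M + M + m) ≤ ((c + 4) * (e + 3) + ((D + D) + 1) * (2 * z + 1)) * m
    arith c e m D M z h = lin 0 ((((D + D) + 1) * 2) · h) (solve (c List.∷ e List.∷ m List.∷ D List.∷ M List.∷ z List.∷ List.[]))
    swap : ∀ a b → a + (b + 2) ≡ b + a + 2
    swap = solve-∀

  -- A long edge takes its interior and one vertex, and each leaf wastes at most twice as many. Both
  -- 2^q and the number of leaves are linear in `mx`, so the fourth power of the logarithm enters
  -- only through the interior.
  enough-long : #leaves shape ∸ 1 ≤ (D + 1) * ((D + 1) * mx + (D + 1) * mx) → suc (interior t q) * 2 ^ q + 2 * suc (interior t q) * #leaves shape ≤ suc ν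
  enough-long few = ≤-trans (≤-reflexive (factor (suc (interior t q)) (2 ^ q) (#leaves shape)))
      (≤-trans (*-mono-≤ (≤-trans (interior-bound t q L (1 + s) (1 + s + s₂) 1≤L t≤ q≤) (*-monoˡ-≤ (L ^ 4) (≡⇒≥ cInterior-def))) (Q≤ ⊞ *-monoʳ-≤ 2 leaves≤))
      (≤-trans (≤-reflexive (regroup cInterior (L ^ 4) (2 ^ (s + s₂)) cLeaf mx)) (≤-trans (*-monoˡ-≤ (L ^ 4) (*-monoˡ-≤ mx (≤-trans (m≤m+n (cInterior * (2 ^ (s + s₂) + 2 * cLeaf)) _) (≡⇒≥ C-def)))) large)))
    where
    factor : ∀ a Q v → a * Q + 2 * a * v ≡ a * (Q + 2 * v)
    factor = solve-∀
    regroup : ∀ c X p l m → c * X * (p * m + 2 * (l * m)) ≡ c * (p + 2 * l) * m * X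
    regroup = solve-∀
    grow : ∀ l x → l ≤ L → l + x ≤ (1 + x) * L
    grow l x h = h ⊞ ≤-trans (≤-reflexive (sym (*-identityʳ x))) (*-monoʳ-≤ x 1≤L)
    t≤ : t ≤ (1 + s) * L
    t≤ = grow l s (log l 2^l≤mx)
    q≤ : q ≤ (1 + s + s₂) * L
    q≤ = ≤-trans (≤-reflexive (+-assoc l s s₂)) (grow l (s + s₂) (log l 2^l≤mx))
    Q≤ : 2 ^ q ≤ 2 ^ (s + s₂) * mx
    Q≤ = ≤-trans (≤-reflexive (trans (cong (2 ^_) (+-assoc l s s₂)) (^-distribˡ-+-* 2 l (s + s₂)))) (≤-trans (*-monoˡ-≤ (2 ^ (s + s₂)) 2^l≤mx) (≤-reflexive (*-comm mx _)))
    leaves≤ : #leaves shape ≤ cLeaf * mx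
    leaves≤ = ≤-trans (m≤n+m∸n (#leaves shape) 1) (≤-trans (1≤mx ⊞ few) (≤-reflexive (trans (arith D mx) (cong (_* mx) (sym cLeaf-def)))))
      where
      arith : ∀ D m → m + (D + 1) * ((D + 1) * m + (D + 1) * m) ≡ ((D + 1) * (2 * (D + 1)) + 1) * m
      arith = solve-∀

  module _ (noT : ¬ RedCopy) (few : #leaves shape ∸ 1 ≤ (D + 1) * ((D + 1) * mx + (D + 1) * mx)) where

    noT-plain : ∀ U → 1 ≤ card U → (∀ X → X ⊆ U → card X ≤ mx + mx → D * card X ≤ card (nb X ∩ U)) →
                (∀ X → X ⊆ U → mx ≤ card X → suc ν + κ ≤ card ((X ∪ nb X) ∩ U)) → ⊥
    noT-plain U ne robust spread = Expanding.embed-plain red (record { irr = red-irr ; adj-sym = red-sym ; U = U ; M = mx ; w′ = w′ ; n̂ = suc ν + κ ; 1≤M = 1≤mx ; robust = robust ; spread = spread }) S 1≤Δ (≡⇒≥ w′-def) ne ≤-refl noT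

    noT-exact : ∀ U → Linking red U M → (∀ X → X ⊆ U → card X ≤ M + M → D * card X ≤ card (nb X ∩ U)) → suc ν ≤ card U → ⊥
    noT-exact U edge robust n≤U = embed (many-longs (interior t q) (2 ^ q) shape plain (≤-trans (enough-long few) (≤-reflexive (sym (shape-length S)))))
      where
      slack<Q : slack D t < 2 ^ q
      slack<Q = ≤-<-trans (≤-trans (slack-bound D t) (*-monoˡ-≤ (2 ^ t) (≡⇒≥ s₂-def))) (<-≤-trans (*-monoˡ-< (2 ^ t) {{>-nonZero (m^n>0 2 t)}} (n<2^n s₂)) (≤-reflexive (trans (*-comm (2 ^ s₂) (2 ^ t)) (sym (^-distribˡ-+-* 2 t s₂)))))
      embed : (Σ Tr λ s → shape ≋ s × Longs (interior t q) s × #long s ≡ 2 ^ q) → ⊥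
      embed (t′ , eq , longs , count) = Exact.exact-embedding red (record { irr = red-irr ; adj-sym = red-sym ; U = U ; t = t ; q = q ; w′ = w′ ; edge = edge ; robust = robust ; large = slack<Q }) S 1≤Δ (≡⇒≥ w′-def) t′ eq longs count n≤U noT

    thin : Thin
    thin = record { D = D ; M = M ; κ = κ ; k̂ = k ; E = E ; noT-plain = noT-plain ; noT-exact = noT-exact ; fits = fits ; large = large-few }

    open Few thin

    loss-scale : ∀ j x → loss j (x * mx) ≡ lossCoeff j x * mx
    loss-scale zero x = sym (+-identityʳ mx)
    loss-scale (suc i) x = trans (cong₂ (λ a b → (mx + mx) + (a + a) + b) (trans (cong (loss i) (step-error x)) (loss-scale i (x + 1 + κ′))) (step-error x))
        (arith (lossCoeff i (x + 1 + κ′)) (x + 1 + κ′) mx)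
      where
      step-error : ∀ x → x * mx + mx + κ ≡ (x + 1 + κ′) * mx
      step-error x = go x mx (D + 1)
        where
        go : ∀ x m d → x * m + m + d * (m + m) ≡ (x + 1 + d * 2) * m
        go = solve-∀
      arith : ∀ a b m → (m + m) + (a * m + a * m) + b * m ≡ (2 + (a + a) + b) * m
      arith = solve-∀

    UB-below : ∀ j → j ≤ suc k → Below j
    UB-below (suc j) h i (s≤s i≤j) with m≤n⇒m<n∨m≡n i≤j
    ... | inj₁ lt = UB-below j (≤-trans (n≤1+n j) h) i lt
    UB-below (suc zero) h .zero _ | inj₂ refl = UB-zero
    UB-below (suc (suc j)) h .(suc j) _ | inj₂ refl = step-few j (≤-pred h) (UB-below (suc j) (≤-trans (n≤1+n _) h))
      (≤-trans (≤-reflexive (loss-scale (suc j) 0)) (*-monoˡ-≤ mx (≤-trans (lossCoeff≤total (≤-pred h)) (≡⇒≥ e-def))))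

  upper : ¬ RedCopy → UB k
  upper noT with (D + 1) * ((D + 1) * mx + (D + 1) * mx) <? #leaves shape ∸ 1
  ... | yes leafy = many noT leafy k
  ... | no few = UB-below noT (≮⇒≥ few) (suc k) ≤-refl k ≤-refl

-- The case in which all parts are single vertices. For a tree with one vertex any vertex is a red
-- copy, and otherwise Chvátal's theorem applies.
unit-family : ∀ {N ν k Δ} (c : Coloring N) (c-sym : SymmetricColoring c) {T : SimpleGraph (suc ν)} (S : TreeShape T Δ) →
  let open Red c c-sym in ¬ Completion.RedCopy red red-sym T S → 1 ≤ N → ν * k + 1 ≤ N → NN (Blue.BK red red-sym 1 full (suc k))
unit-family {suc N} {zero} c c-sym {T} S noT _ _ _ = noT ((λ _ → fzero) , (λ { {fzero} {fzero} _ → refl }) , λ { fzero fzero a → true≢false a (SimpleGraph.irrefl T fzero) })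
unit-family {N} {suc ν} {k} c c-sym S noT _ h = Red.Greedy.chvátal c c-sym (suc ν) (s≤s z≤n) S noT k full (≤-trans h (≤-reflexive (sym card-full)))

theorem2p1 : (Δ k : ℕ) → 1 ≤ Δ →
    Σ ℕ λ C →
    (n : ℕ) (T : SimpleGraph n) → IsTree T → MaxDegreeAtMost T Δ →
    (m : Fin (suc k) → ℕ) → (∀ i → 1 ≤ m i) → (∀ i j → i ≤ᶠ j → m i ≤ m j) →
    C * m (fromℕ k) * ⌊log₂ m (fromℕ k) ⌋ ^ 4 ≤ n →
    IsRamseyNumber (Fin n) (Adj T) (KVert (suc k) m) (KAdj (suc k) m) ((n ∸ 1) * k + m fzero)
theorem2p1 Δ k 1≤Δ = Constants.C Δ k , main
  where
  open Constants Δ k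

  main : (n : ℕ) (T : SimpleGraph n) → IsTree T → MaxDegreeAtMost T Δ →
    (m : Fin (suc k) → ℕ) → (∀ i → 1 ≤ m i) → (∀ i j → i ≤ᶠ j → m i ≤ m j) →
    C * m (fromℕ k) * ⌊log₂ m (fromℕ k) ⌋ ^ 4 ≤ n →
    IsRamseyNumber (Fin n) (Adj T) (KVert (suc k) m) (KAdj (suc k) m) ((n ∸ 1) * k + m fzero)
  main (suc ν) T tree maxdeg m 1≤m mono large = arrows , minimal
    where
    mx : ℕ
    mx = m (fromℕ k)
    m≤mx : ∀ i → m i ≤ mx
    m≤mx i = mono i (fromℕ k) (≤-trans (≤-pred (toℕ<n i)) (≤-reflexive (sym (toℕ-fromℕ k))))
    S : TreeShape T Δ
    S = tree-shape T tree maxdeg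

    2≤C : 2 ≤ C
    2≤C = ≤-trans (m≤n+m 2 (cMany + cFew)) (≤-trans (m≤n+m _ (cInterior * (2 ^ (s + s₂) + 2 * cLeaf))) (≡⇒≥ C-def))

    log : ∀ l → 2 ^ l ≤ mx → l ≤ ⌊log₂ mx ⌋
    log l h = ≤-trans (≤-reflexive (sym (⌊log₂[2^n]⌋≡n l))) (⌊log₂⌋-mono-≤ h)

    linear : 2 ≤ mx → 2 * mx ≤ suc ν
    linear 2≤mx = ≤-trans (≤-trans (*-monoˡ-≤ mx 2≤C) (≤-trans (≤-reflexive (sym (*-identityʳ (C * mx)))) (*-monoʳ-≤ (C * mx) (≤-trans (≤-reflexive (sym (^-zeroˡ 4))) (^-monoˡ-≤ 4 (log 1 2≤mx)))))) large

    arrows : Arrows (ν * k + m fzero) (Fin (suc ν)) (Adj T) (KVert (suc k) m) (KAdj (suc k) m)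
    arrows c c-sym = stable-arrow T (suc k) m c (em (Completion.RedCopy red red-sym T S) >>= λ
        { (inj₁ (f , inj , hom)) → pure (inj₁ (f , (λ {x} {y} → inj {x} {y}) , λ x y a → red⇒c (hom x y a)))
        ; (inj₂ noT) → family noT >>= λ K → pure (inj₂ (blue-copy k m ≤-refl m≤mx K)) })
      where
      open Red c c-sym
      open Blue red red-sym
      family : ¬ Completion.RedCopy red red-sym T S → NN (KK (m fzero) mx full k)
      family noT with 2 ≤? mx
      ... | yes 2≤mx = Upper.upper c c-sym Δ k ν mx 1≤Δ S 2≤mx ⌊log₂ mx ⌋ log large noT (m fzero) (m≤mx fzero) full (≤-reflexive (sym card-full))
      ... | no small = subst (λ a → NN (KK a mx full k)) (sym m₀≡1) (subst (λ b → NN (KK 1 b full k)) (sym mx≡1)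
                         (unit-family c c-sym S noT (≤-trans (1≤m fzero) (m≤n+m _ (ν * k))) (+-monoʳ-≤ (ν * k) (1≤m fzero))))
        where
        mx≡1 : mx ≡ 1
        mx≡1 = ≤-antisym (≤-pred (≰⇒> small)) (1≤m (fromℕ k))
        m₀≡1 : m fzero ≡ 1
        m₀≡1 = ≤-antisym (≤-trans (m≤mx fzero) (≤-reflexive mx≡1)) (1≤m fzero)

    -- The extremal colouring needs its last class to be incomplete. This fails only for the tree
    -- with one vertex and m₀ = 1, where the bound merely says that N is positive.
    fits : m fzero ≤ ν ⊎ ν ≡ 0 × m fzero ≡ 1
    fits with 2 ≤? mx
    ... | yes 2≤mx = inj₁ (≤-trans (m≤mx fzero) (≤-pred (≤-trans (≤-trans (≤-reflexive (+-comm 1 mx)) (+-monoʳ-≤ mx (≤-trans (1≤m (fromℕ k)) (≤-reflexive (sym (+-identityʳ mx)))))) (linear 2≤mx))))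
    ... | no small = tiny ν
      where
      m₀≤1 : m fzero ≤ 1
      m₀≤1 = ≤-trans (m≤mx fzero) (≤-pred (≰⇒> small))
      tiny : ∀ ν → m fzero ≤ ν ⊎ ν ≡ 0 × m fzero ≡ 1
      tiny zero = inj₂ (refl , ≤-antisym m₀≤1 (1≤m fzero))
      tiny (suc _) = inj₁ (≤-trans m₀≤1 (s≤s z≤n))

    nonempty : ∀ N → Arrows N (Fin (suc ν)) (Adj T) (KVert (suc k) m) (KAdj (suc k) m) → 1 ≤ N
    nonempty zero h with h (λ ()) (λ ())
    ... | inj₁ (f , _) = case f fzero of λ ()
    ... | inj₂ (f , _) = case f (fzero , fromℕ< (1≤m fzero)) of λ ()
    nonempty (suc N) h = s≤s z≤n

    minimal : ∀ N → Arrows N (Fin (suc ν)) (Adj T) (KVert (suc k) m) (KAdj (suc k) m) → ν * k + m fzero ≤ N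
    minimal N h with fits
    ... | inj₂ (e , e′) = ≤-trans (≤-reflexive (cong₂ (λ a b → a * k + b) e e′)) (nonempty N h)
    ... | inj₁ m₀≤ν = cliques-bound ν T (proj₁ (proj₂ tree)) h (≤-trans (1≤m fzero) m₀≤ν) m₀≤ν
      where
      cliques-bound : ∀ ν (T : SimpleGraph (suc ν)) → Connected T → Arrows N (Fin (suc ν)) (Adj T) (KVert (suc k) m) (KAdj (suc k) m) → 1 ≤ ν → m fzero ≤ ν → ν * k + m fzero ≤ N
      cliques-bound (suc ν′) T conn h _ m₀≤ = ≤-trans (≤-reflexive (cong (suc ν′ * k +_) (sym m₀))) (LowerBound.lower-bound ν′ k T conn m (m fzero ∸ 1) (≤-trans (≤-reflexive m₀) m₀≤) (λ i → ≤-trans (≤-reflexive m₀) (mono fzero i z≤n)) N h)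
        where
        m₀ : suc (m fzero ∸ 1) ≡ m fzero
        m₀ = trans (+-comm 1 (m fzero ∸ 1)) (m∸n+n≡m (1≤m fzero))
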